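{- For every odd prime $p$, $$S_{2p}\equiv-p\pmod{p^2}.$$ Consequently, $$\chi'(K_{2p})=\chi'_{\ell}(K_{2p})=\chi'_{\mathrm P}(K_{2p})=2p-1.$$ Here $S_n$, $\chi'$, $\chi'_\ell$, $\chi'_{\mathrm P}$ are as defined in the context.
   Context: Signed count. Let $n$ be even and order the vertices of $K_n$ as $0<1<\dots<n-1$. For a perfect matching $M$ let $\operatorname{cr}(M)$ be the number of unordered pairs of edges $\{a,c\},\{b,d\}\in M$ with $a<b<c<d$ (crossing pairs), and put $\varepsilon(M)=(-1)^{\operatorname{cr}(M)}$. A one-factorization of a graph is a partition of its edge set into perfect matchings (an unordered collection, whose members are called factors). For a one-factorization $\mathcal F$ put $\varepsilon(\mathcal F)=\prod_{M\in\mathcal F}\varepsilon(M)$. Define $S_n=\sum_{\mathcal F}\varepsilon(\mathcal F)$, the sum over all one-factorizations of $K_n$. Coloring indices of a graph $G$. $\chi'(G)$ is the ordinary edge chromatic index. $\chi'_\ell(G)$ is the least integer $k$ such that whenever each edge is assigned a list of $k$ colors, the edges can be properly colored from their lists. The edge-paintability index $\chi'_{\mathrm P}(G)$ is the least $k$ for which Painter has a winning strategy in the following game: each edge starts with $k$ tokens; in each round Lister marks a nonempty set of uncolored edges and removes one token from each of them; Painter then colors a matching consisting of marked edges (these edges are then colored permanently). After Painter's move, Lister wins if some uncolored edge has no token left. Painter wins if every edge is eventually colored. -}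

module Defs where

open import Data.Bool.Base using (if_then_else_)
open import Data.Fin.Base as Fin using (Fin)
open import Data.Fin.Properties as Fin using (all?; any?)
open import Data.Fin.Subset using (Subset; inside; outside; _∈_; _⊆_; _∩_; _─_; ⊤; Empty; Nonempty)
open import Data.Fin.Subset.Properties using (_∈?_; nonempty?)
open import Data.Integer.Base as ℤ using (ℤ; 0ℤ; 1ℤ; -1ℤ)
open import Data.List.Base as List using (List; []; _∷_; _++_; map; foldr; length; lookup; filter; allFin; cartesianProduct)
open import Data.List.Membership.Propositional as List using ()
open import Data.List.Relation.Unary.All as All using (All)
open import Data.List.Relation.Unary.AllPairs as AllPairs using (AllPairs)
open import Data.List.Relation.Unary.Any as Any using (Any)
open import Data.List.Relation.Unary.Unique.Propositional using (Unique)
open import Data.Nat.Base as ℕ using (ℕ; zero; suc; pred)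
open import Data.Product.Base using (∃; _×_; _,_; proj₁; proj₂)
open import Data.Sum.Base using (_⊎_)
open import Data.Vec.Base using ([]; _∷_)
open import Level using (0ℓ)
open import Relation.Binary.Core using (Rel)
import Relation.Binary.Definitions as B
open import Relation.Binary.PropositionalEquality using (_≡_; _≢_; ≢-sym)
open import Relation.Nullary.Decidable using (Dec; does; ¬?; _×-dec_; _⊎-dec_; _→-dec_)
open import Relation.Nullary.Negation using (¬_)
open import Relation.Unary using (Decidable)

IsLeast : (ℕ → Set) → ℕ → Set
IsLeast P k = P k × (∀ j → P j → k ℕ.≤ j)

sumℤ productℤ : List ℤ → ℤ
sumℤ     = foldr ℤ._+_ 0ℤ
productℤ = foldr ℤ._*_ 1ℤ

-- All subsets of Fin m, each exactly once.
allSubsets : ∀ m → List (Subset m)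
allSubsets zero    = [] ∷ []
allSubsets (suc m) = map (inside ∷_) (allSubsets m) ++ map (outside ∷_) (allSubsets m)

-- For a list without repetitions these are the subsets of its set of
-- elements, each exactly once: a set of elements is represented by the
-- sublist in which they appear in the order of the given list.
sublists : ∀ {A : Set} → List A → List (List A)
sublists []       = [] ∷ []
sublists (x ∷ xs) = map (x ∷_) (sublists xs) ++ sublists xs

record Graph : Set₁ where
  field
    order  : ℕ
    Adj    : Rel (Fin order) 0ℓ
    adj?   : B.Decidable Adj
    sym    : B.Symmetric Adj
    irrefl : B.Irreflexive _≡_ Adj

K : ℕ → Graph
K n = record
  { order  = n
  ; Adj    = _≢_
  ; adj?   = λ u v → ¬? (u Fin.≟ v)
  ; sym    = ≢-sym
  ; irrefl = λ u≡v u≢v → u≢v u≡v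
  }

module _ (G : Graph) where
  open Graph G

  Vertex : Set
  Vertex = Fin order

  -- An edge {u , v} is listed once, as the pair (u , v) with u < v.
  edgeList : List (Vertex × Vertex)
  edgeList = filter (λ (u , v) → u Fin.<? v ×-dec adj? u v)
                    (cartesianProduct (allFin order) (allFin order))

  -- Edges are referred to by their position in edgeList.
  Edge : Set
  Edge = Fin (length edgeList)

  EdgeSet : Set
  EdgeSet = Subset (length edgeList)

  lo hi : Edge → Vertex
  lo e = proj₁ (lookup edgeList e)
  hi e = proj₂ (lookup edgeList e)

  Incident : Vertex → Edge → Set
  Incident v e = v ≡ lo e ⊎ v ≡ hi e

  incident? : B.Decidable Incident
  incident? v e = (v Fin.≟ lo e) ⊎-dec (v Fin.≟ hi e)

  AdjacentEdges : Rel Edge 0ℓ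
  AdjacentEdges e f = e ≢ f × ∃ λ v → Incident v e × Incident v f

  adjacentEdges? : B.Decidable AdjacentEdges
  adjacentEdges? e f = ¬? (e Fin.≟ f) ×-dec any? λ v → incident? v e ×-dec incident? v f

  Matching : EdgeSet → Set
  Matching M = ∀ e f → e ∈ M → f ∈ M → ¬ AdjacentEdges e f

  matching? : Decidable Matching
  matching? M = all? λ e → all? λ f →
    (e ∈? M) →-dec ((f ∈? M) →-dec ¬? (adjacentEdges? e f))

  PerfectMatching : EdgeSet → Set
  PerfectMatching M = Matching M × (∀ v → ∃ λ e → e ∈ M × Incident v e)

  perfectMatching? : Decidable PerfectMatching
  perfectMatching? M =
    matching? M ×-dec all? λ v → any? λ e → (e ∈? M) ×-dec incident? v e

  perfectMatchings : List EdgeSet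
  perfectMatchings = filter perfectMatching? (allSubsets (length edgeList))

  -- The last three conditions say that 𝓕 is a partition of the edge set; the
  -- members of 𝓕 are then pairwise distinct.
  OneFactorization : List EdgeSet → Set
  OneFactorization 𝓕 =
      All PerfectMatching 𝓕
    × All Nonempty 𝓕
    × AllPairs (λ M N → Empty (M ∩ N)) 𝓕
    × (∀ e → Any (e ∈_) 𝓕)

  oneFactorization? : Decidable OneFactorization
  oneFactorization? 𝓕 =
    All.all? perfectMatching? 𝓕
    ×-dec All.all? nonempty? 𝓕
    ×-dec AllPairs.allPairs? (λ M N → ¬? (nonempty? (M ∩ N))) 𝓕
    ×-dec all? λ e → Any.any? (e ∈?_) 𝓕

  -- One-factorizations are unordered: each appears here once, with its factors
  -- in the order of perfectMatchings.
  oneFactorizations : List (List EdgeSet)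
  oneFactorizations = filter oneFactorization? (sublists perfectMatchings)

  -- e = {a , c} and f = {b , d} with a < b < c < d.  At most one of
  -- Crosses e f and Crosses f e holds, so counting ordered pairs (e , f) with
  -- Crosses e f counts each unordered crossing pair once.
  Crosses : Rel Edge 0ℓ
  Crosses e f = lo e Fin.< lo f × lo f Fin.< hi e × hi e Fin.< hi f

  crosses? : B.Decidable Crosses
  crosses? e f = lo e Fin.<? lo f ×-dec lo f Fin.<? hi e ×-dec hi e Fin.<? hi f

  cr : EdgeSet → ℕ
  cr M = length (filter (λ (e , f) → (e ∈? M) ×-dec (f ∈? M) ×-dec crosses? e f)
                        (cartesianProduct (allFin _) (allFin _)))

  ε : EdgeSet → ℤ
  ε M = -1ℤ ℤ.^ cr M

  εF : List EdgeSet → ℤ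
  εF 𝓕 = productℤ (map ε 𝓕)

  Proper : {C : Set} → (Edge → C) → Set
  Proper c = ∀ e f → AdjacentEdges e f → c e ≢ c f

  EdgeColourable : ℕ → Set
  EdgeColourable k = ∃ λ (c : Edge → Fin k) → Proper c

  -- Lists consist of k distinct colours; colours are natural numbers.
  EdgeChoosable : ℕ → Set
  EdgeChoosable k =
    (L : Edge → List ℕ) → (∀ e → Unique (L e) × length (L e) ≡ k) →
    ∃ λ (c : Edge → ℕ) → (∀ e → c e List.∈ L e) × Proper c

  removeTokens : EdgeSet → (Edge → ℕ) → (Edge → ℕ)
  removeTokens S t e = if does (e ∈? S) then pred (t e) else t e

  -- A winning strategy for Painter when U is the set of uncoloured edges and t
  -- gives the remaining tokens.  Lister has not won at this point, and Painter
  -- has an answer M to every set S that Lister may mark.  Being inductive, a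
  -- strategy is well founded; play ends only when no edge is left to mark, that
  -- is, when every edge is coloured.
  -- Lister winning is tested at the start of a round, which is the same as
  -- testing after Painter's move except that it also covers the initial
  -- position: with no tokens at all Painter loses as soon as there is an edge.
  data PainterWins (U : EdgeSet) (t : Edge → ℕ) : Set where
    strategy :
      (∀ e → e ∈ U → 0 ℕ.< t e) →
      (∀ S → Nonempty S → S ⊆ U →
        ∃ λ M → M ⊆ S × Matching M × PainterWins (U ─ M) (removeTokens S t)) →
      PainterWins U t

  EdgePaintable : ℕ → Set
  EdgePaintable k = PainterWins ⊤ (λ _ → k)

  -- The three indices, as relations "the index of G equals k".
  ChromaticIndex ListChromaticIndex PaintabilityIndex : ℕ → Set
  ChromaticIndex     = IsLeast EdgeColourable
  ListChromaticIndex = IsLeast EdgeChoosable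
  PaintabilityIndex  = IsLeast EdgePaintable

S : ℕ → ℤ
S n = sumℤ (map (εF (K n)) (oneFactorizations (K n)))

{-# OPTIONS --safe #-}
module Submission where

-- Ordering the factors turns (2p-1)! S₂ₚ into the signed number A of proper
-- edge colourings of K₂ₚ with 2p-1 colours.  The crossing sign of a colouring
-- is the product over the vertices of the sign of the order in which the
-- colours appear around the vertex, for a suitable cyclic listing of the edges.
-- Let the vertices be two copies of ℤ/p.  The group (ℤ/p)³ of rotations of the
-- two copies and of p of the colours acts on colourings and preserves signs, as
-- rotations of odd order are even; so the signed numbers of colourings fixed by
-- its elements add up to 0 modulo p³.  The identity contributes A, the elements
-- with some but not all coordinates zero fix no proper colouring, and the other
-- (p-1)³ elements all contribute the same, namely p² (p-1)! W², where W is the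
-- signed number of starters of ℤ/p.  Write p = 2m+1.  As a top coefficient
-- extracted by finite differences, W is modulo p equal to m! times the number
-- obtained when the differences 1, …, m of a starter are all replaced by 1, which
-- is ± m!; so W² ≡ (m!)⁴ ≡ 1.  Dividing by p (p-1)! and using Wilson's theorem,
-- S₂ₚ ≡ -p modulo p².
--
-- In particular A ≠ 0.  A is a multiple of a linear functional of the graph
-- polynomial of the line graph, with only monomials of exponents at least 2p-2,
-- hence exactly 2p-2, surviving; so the online version of the Alon–Tarsi theorem
-- bounds the paintability index by 2p-1.

-- The modulus p³ is what division by (2p-1)! demands: this factorial contains p exactly once, so
-- after cancelling it the congruence still holds modulo p². The sign of a colouring is needed in
-- three forms, as no single one shows everything. The crossing sign depends only on which edges
-- share a colour, so it is blind to permutations of the colours. With the edges at each vertex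
-- listed in the global vertex order, the product of the vertex signs is invariant under
-- permutations of the vertices, because each pair of vertices is compared at the even number 2p-2
-- of other vertices. With the cyclic listing, the rows of an equivariant colouring are rotations of
-- one another, so its sign can be computed. Finite differences enter through their weights (-1)^c
-- binom(p-1,c), all 1 modulo p: a plain sum over ℤ/p agrees modulo p with a difference of order
-- p-1, which sees only leading parts. For paintability, weights of order 2p-2 are used over the
-- integers. Every proper colouring uses each colour exactly p times, so all of them carry the same
-- nonzero product of weights, and A factors out.

open import Defs
open import Algebra.Bundles using (CommutativeRing)
open import Algebra.Structures using (IsCommutativeMonoid; IsCommutativeRing)
import Algebra.Solver.Ring
open import Algebra.Solver.Ring.AlmostCommutativeRing using (AlmostCommutativeRing; fromCommutativeRing; _-Raw-AlmostCommutative⟶_)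
open import Data.Bool.Base using (Bool; true; false; if_then_else_)
import Data.Bool.Properties as Bool
open import Data.Empty using (⊥)
open import Data.Fin.Base as Fin using (Fin; zero; suc; toℕ; fromℕ<; combine; splitAt; _↑ˡ_; _↑ʳ_)
import Data.Fin.Properties as Fin
open import Data.Fin.Subset as Subset using (Subset; inside; outside)
import Data.Fin.Subset.Properties as Subset
open import Data.Integer.Base as ℤ using (ℤ; +_; 0ℤ; 1ℤ; -1ℤ)
import Data.Integer.Divisibility as ℤ
open import Data.Integer.Divisibility.Signed as ℤ∣ using (divides)
import Data.Integer.Properties as ℤ
open import Data.List.Base as List using (List; []; _∷_; _++_; map; length; filter; allFin; cartesianProduct; concatMap; [_])
import Data.List.Properties as List
open import Data.List.Membership.Propositional using (_∈_; _∉_; find; lose)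
import Data.List.Membership.Propositional.Properties as ∈
open import Data.List.Relation.Binary.Permutation.Propositional as ↭ using (_↭_; ↭-refl; ↭-sym; ↭-trans; ↭-prep)
import Data.List.Relation.Binary.Permutation.Propositional.Properties as ↭
open import Data.List.Relation.Unary.All as All using (All; []; _∷_)
import Data.List.Relation.Unary.All.Properties as All
open import Data.List.Relation.Unary.AllPairs as AllPairs using (AllPairs; []; _∷_)
import Data.List.Relation.Unary.AllPairs.Properties as AllPairs
open import Data.List.Relation.Unary.Any as Any using (Any; here; there)
import Data.List.Relation.Unary.Any.Properties as Any
open import Data.List.Relation.Unary.Unique.Propositional using (Unique)
import Data.List.Relation.Unary.Unique.Propositional.Properties as Unique
open import Data.Maybe.Base using (Maybe; just; nothing)
open import Data.Nat.Base as ℕ using (ℕ; zero; suc; _+_; _*_; _∸_; _^_; _≤_; _<_; z≤n; s≤s; NonZero; pred; _!)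
open import Data.Nat.Divisibility as ℕ∣ using (_∣_; _∤_)
open import Data.Nat.DivMod as ℕ% using (_%_; _/_)
open import Data.Nat.ListAction using (sum)
open import Data.Nat.Primality as Prime using (Prime)
import Data.Nat.Properties as ℕ
import Data.Nat.Tactic.RingSolver as ℕSolver
open import Data.Product.Base using (∃; _×_; _,_; proj₁; proj₂; uncurry; swap)
import Data.Product.Properties as Product
open import Data.Sum.Base as Sum using (_⊎_; inj₁; inj₂)
open import Data.Vec.Base as Vec using (Vec; []; _∷_)
import Data.Vec.Properties as Vec
open import Function.Base using (_∘_; id)
open import Level using (0ℓ)
open import Relation.Binary.Consequences using (dec⇒weaklyDec)
open import Data.Unit.Base using (tt) renaming (⊤ to Unit)
open import Relation.Binary.Definitions using (DecidableEquality; tri<; tri≈; tri>)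
open import Relation.Binary.PropositionalEquality using (_≡_; _≢_; refl; sym; trans; cong; cong₂; subst; subst₂; module ≡-Reasoning)
open import Relation.Nullary.Decidable using (Dec; yes; no; does; ¬?; _×-dec_; _⊎-dec_; dec-true; dec-false; map′)
open import Relation.Nullary.Negation using (¬_; contradiction)

-- The ring operations of ℤ, opaque so that unification can see operands.

infixl 6 _⊕_
infixl 7 _·_
infix  8 ⊝_
infixr 8 _↑_

opaque
  _⊕_ _·_ : ℤ → ℤ → ℤ
  _⊕_ = ℤ._+_
  _·_ = ℤ._*_

  ⊝_ : ℤ → ℤ
  ⊝_ = ℤ.-_

  +≡⊕ : ∀ x y → x ℤ.+ y ≡ x ⊕ y
  +≡⊕ _ _ = refl

  *≡· : ∀ x y → x ℤ.* y ≡ x · y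
  *≡· _ _ = refl

  -≡⊝ : ∀ x → ℤ.- x ≡ ⊝ x
  -≡⊝ _ = refl

  ℤ-isCommutativeRing : IsCommutativeRing _≡_ _⊕_ _·_ ⊝_ 0ℤ 1ℤ
  ℤ-isCommutativeRing = ℤ.+-*-isCommutativeRing

  ·-≡0 : ∀ {x y} → x · y ≡ 0ℤ → x ≡ 0ℤ ⊎ y ≡ 0ℤ
  ·-≡0 {x} = ℤ.i*j≡0⇒i≡0∨j≡0 x

  suc-· : ∀ n a → + suc n · a ≡ a ⊕ + n · a
  suc-· n a = ℤ.suc-* (+ n) a

ℤ-commutativeRing : CommutativeRing 0ℓ 0ℓ
ℤ-commutativeRing = record { isCommutativeRing = ℤ-isCommutativeRing }

open CommutativeRing ℤ-commutativeRing public
  using ()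
  renaming (+-isCommutativeMonoid to ⊕-isCommutativeMonoid; *-isCommutativeMonoid to ·-isCommutativeMonoid;
            *-comm to ·-comm; *-assoc to ·-assoc; *-identityˡ to ·-identityˡ; *-identityʳ to ·-identityʳ;
            zeroˡ to ·-zeroˡ; zeroʳ to ·-zeroʳ; distribˡ to ·-distribˡ; distribʳ to ·-distribʳ;
            +-comm to ⊕-comm; +-assoc to ⊕-assoc; +-identityˡ to ⊕-identityˡ; +-identityʳ to ⊕-identityʳ;
            -‿inverseʳ to ⊝-inverseʳ)

private
  ring : AlmostCommutativeRing 0ℓ 0ℓ
  ring = fromCommutativeRing ℤ-commutativeRing

  coefficients : ℤ.+-*-rawRing -Raw-AlmostCommutative⟶ ring
  coefficients = record { ⟦_⟧ = id; +-homo = +≡⊕; *-homo = *≡·; -‿homo = -≡⊝; 0-homo = refl; 1-homo = refl }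

open Algebra.Solver.Ring ℤ.+-*-rawRing ring coefficients (dec⇒weaklyDec ℤ._≟_) public
  using (solve; _:=_; _:+_; _:*_; :-_; con)

_↑_ : ℤ → ℕ → ℤ
a ↑ zero  = 1ℤ
a ↑ suc n = a · a ↑ n

-- Finite sums and products over lists

module Big {M : Set} {_∙_ : M → M → M} {e₀ : M} (isCM : IsCommutativeMonoid _≡_ _∙_ e₀) where
  private module M = IsCommutativeMonoid isCM

  interchange : ∀ a b c d → (a ∙ b) ∙ (c ∙ d) ≡ (a ∙ c) ∙ (b ∙ d)
  interchange a b c d = begin
    (a ∙ b) ∙ (c ∙ d) ≡⟨ M.assoc a b (c ∙ d) ⟩
    a ∙ (b ∙ (c ∙ d)) ≡⟨ cong (a ∙_) (trans (sym (M.assoc b c d)) (trans (cong (_∙ d) (M.comm b c)) (M.assoc c b d))) ⟩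
    a ∙ (c ∙ (b ∙ d)) ≡⟨ M.assoc a c (b ∙ d) ⟨
    (a ∙ c) ∙ (b ∙ d) ∎
    where open ≡-Reasoning

  module _ {X : Set} where

    big : List X → (X → M) → M
    big []       f = e₀
    big (x ∷ xs) f = f x ∙ big xs f

    big-cong∈ : ∀ xs {f g : X → M} → (∀ {x} → x ∈ xs → f x ≡ g x) → big xs f ≡ big xs g
    big-cong∈ []       eq = refl
    big-cong∈ (x ∷ xs) eq = cong₂ _∙_ (eq (here refl)) (big-cong∈ xs (eq ∘ there))

    big-cong : ∀ xs {f g : X → M} → (∀ x → f x ≡ g x) → big xs f ≡ big xs g
    big-cong xs eq = big-cong∈ xs (λ {x} _ → eq x)

    big-unit : ∀ xs {f : X → M} → (∀ {x} → x ∈ xs → f x ≡ e₀) → big xs f ≡ e₀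
    big-unit []       eq = refl
    big-unit (x ∷ xs) eq = trans (cong₂ _∙_ (eq (here refl)) (big-unit xs (eq ∘ there))) (M.identityˡ e₀)

    big-++ : ∀ xs ys (f : X → M) → big (xs ++ ys) f ≡ big xs f ∙ big ys f
    big-++ []       ys f = sym (M.identityˡ _)
    big-++ (x ∷ xs) ys f = trans (cong (f x ∙_) (big-++ xs ys f)) (sym (M.assoc _ _ _))

    big-∙ : ∀ xs (f g : X → M) → big xs (λ x → f x ∙ g x) ≡ big xs f ∙ big xs g
    big-∙ []       f g = sym (M.identityˡ e₀)
    big-∙ (x ∷ xs) f g = trans (cong ((f x ∙ g x) ∙_) (big-∙ xs f g)) (interchange (f x) (g x) (big xs f) (big xs g))

    big-↭ : ∀ {xs ys} (f : X → M) → xs ↭ ys → big xs f ≡ big ys f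
    big-↭ f ↭.refl            = refl
    big-↭ f (↭.prep x p)      = cong (f x ∙_) (big-↭ f p)
    big-↭ {_} {_ ∷ _ ∷ ys} f (↭.swap x y p) =
      trans (cong (λ z → f x ∙ (f y ∙ z)) (big-↭ f p))
        (trans (sym (M.assoc _ _ _)) (trans (cong (_∙ big ys f) (M.comm (f x) (f y))) (M.assoc _ _ _)))
    big-↭ f (↭.trans p q)     = trans (big-↭ f p) (big-↭ f q)

    big-single : ∀ {xs a} {f : X → M} → Unique xs → a ∈ xs → (∀ {x} → x ≢ a → f x ≡ e₀) → big xs f ≡ f a
    big-single {x ∷ xs} {f = f} (x∉ ∷ _) (here refl) z =
      trans (cong (f x ∙_) (big-unit xs (λ y∈ → z (λ { refl → All.lookup x∉ y∈ refl })))) (M.identityʳ _)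
    big-single {x ∷ xs} {a} (x∉ ∷ u) (there a∈) z =
      trans (cong₂ _∙_ (z (λ { refl → All.lookup x∉ a∈ refl })) (big-single u a∈ z)) (M.identityˡ _)

  module _ {X Y : Set} where

    big-map : ∀ (h : X → Y) xs (f : Y → M) → big (map h xs) f ≡ big xs (f ∘ h)
    big-map h []       f = refl
    big-map h (x ∷ xs) f = cong (f (h x) ∙_) (big-map h xs f)

    big-concatMap : ∀ (h : X → List Y) xs (f : Y → M) → big (concatMap h xs) f ≡ big xs (λ x → big (h x) f)
    big-concatMap h []       f = refl
    big-concatMap h (x ∷ xs) f = trans (big-++ (h x) (concatMap h xs) f) (cong (big (h x) f ∙_) (big-concatMap h xs f))

    big-swap : ∀ xs ys (f : X → Y → M) → big xs (λ x → big ys (f x)) ≡ big ys (λ y → big xs (λ x → f x y))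
    big-swap []       ys f = sym (big-unit ys (λ _ → refl))
    big-swap (x ∷ xs) ys f = trans (cong (big ys (f x) ∙_) (big-swap xs ys f)) (sym (big-∙ ys (f x) _))

  module _ {X Y : Set} where

    big-× : ∀ xs ys (f : X × Y → M) → big (cartesianProduct xs ys) f ≡ big xs (λ x → big ys (λ y → f (x , y)))
    big-× []       ys f = refl
    big-× (x ∷ xs) ys f = trans (big-++ (map (x ,_) ys) _ f) (cong₂ _∙_ (big-map (x ,_) ys f) (big-× xs ys f))

open Big ⊕-isCommutativeMonoid public using ()
  renaming (big to ∑; big-cong to ∑-cong; big-cong∈ to ∑-cong∈; big-unit to ∑-zero; big-++ to ∑-++; big-∙ to ∑-+;
            big-↭ to ∑-↭; big-single to ∑-single; big-map to ∑-map; big-concatMap to ∑-concatMap;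
            big-swap to ∑-swap; big-× to ∑-×)
open Big ·-isCommutativeMonoid public using ()
  renaming (big to ∏; big-cong to ∏-cong; big-cong∈ to ∏-cong∈; big-unit to ∏-one; big-++ to ∏-++; big-∙ to ∏-*;
            big-↭ to ∏-↭; big-single to ∏-single; big-map to ∏-map; big-concatMap to ∏-concatMap;
            big-swap to ∏-swap; big-× to ∏-×; interchange to ·-interchange)

module _ {X : Set} where

  ∑-*ˡ : ∀ (xs : List X) a (f : X → ℤ) → ∑ xs (λ x → a · f x) ≡ a · ∑ xs f
  ∑-*ˡ []       a f = sym (·-zeroʳ a)
  ∑-*ˡ (x ∷ xs) a f = trans (cong (λ z → a · f x ⊕ z) (∑-*ˡ xs a f)) (sym (·-distribˡ a _ _))

  ∑-*ʳ : ∀ (xs : List X) a (f : X → ℤ) → ∑ xs (λ x → f x · a) ≡ ∑ xs f · a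
  ∑-*ʳ xs a f = trans (∑-cong xs (λ x → ·-comm (f x) a)) (trans (∑-*ˡ xs a f) (·-comm a _))

  ∑-const : ∀ (xs : List X) a → ∑ xs (λ _ → a) ≡ + length xs · a
  ∑-const []       a = sym (·-zeroˡ a)
  ∑-const (x ∷ xs) a = trans (cong (λ z → a ⊕ z) (∑-const xs a)) (sym (suc-· (length xs) a))

  ∏-const : ∀ (xs : List X) a → ∏ xs (λ _ → a) ≡ a ↑ length xs
  ∏-const []       a = refl
  ∏-const (x ∷ xs) a = cong (a ·_) (∏-const xs a)

  ∏-zero : ∀ {xs : List X} {a} {f : X → ℤ} → a ∈ xs → f a ≡ 0ℤ → ∏ xs f ≡ 0ℤ
  ∏-zero {x ∷ xs} {f = f} (here refl) eq = trans (cong (_· ∏ xs f) eq) (·-zeroˡ (∏ xs f))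
  ∏-zero {x ∷ xs} {f = f} (there a∈) eq  = trans (cong (f x ·_) (∏-zero a∈ eq)) (·-zeroʳ (f x))

  ∏-≢0 : ∀ (xs : List X) {f : X → ℤ} → (∀ {x} → x ∈ xs → f x ≢ 0ℤ) → ∏ xs f ≢ 0ℤ
  ∏-≢0 []       nz ()
  ∏-≢0 (x ∷ xs) {f} nz eq with ·-≡0 eq
  ... | inj₁ e = nz (here refl) e
  ... | inj₂ e = ∏-≢0 xs (nz ∘ there) e

  ∑-≢0 : ∀ (xs : List X) {f : X → ℤ} → ∑ xs f ≢ 0ℤ → ∃ λ x → x ∈ xs × f x ≢ 0ℤ
  ∑-≢0 []       nz = contradiction refl nz
  ∑-≢0 (x ∷ xs) {f} nz with f x ℤ.≟ 0ℤ
  ... | no  fx≢0 = x , here refl , fx≢0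
  ... | yes fx≡0 with ∑-≢0 xs (λ eq → nz (trans (cong₂ _⊕_ fx≡0 eq) (⊕-identityˡ 0ℤ)))
  ...   | y , y∈ , fy≢0 = y , there y∈ , fy≢0

-- Indicators of decidable statements and reindexing of sums

does-true : ∀ {P : Set} (d : Dec P) → does d ≡ true → P
does-true (yes p) _ = p

⟦_⟧ : ∀ {P : Set} → Dec P → ℤ
⟦ d ⟧ = if does d then 1ℤ else 0ℤ

⟦⟧-yes : ∀ {P : Set} (d : Dec P) → P → ⟦ d ⟧ ≡ 1ℤ
⟦⟧-yes (yes _) _ = refl
⟦⟧-yes (no ¬p) p = contradiction p ¬p

⟦⟧-no : ∀ {P : Set} (d : Dec P) → ¬ P → ⟦ d ⟧ ≡ 0ℤ
⟦⟧-no (yes p) ¬p = contradiction p ¬p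
⟦⟧-no (no _)  _  = refl

⟦⟧-cong : ∀ {P Q : Set} (d : Dec P) (d′ : Dec Q) → (P → Q) → (Q → P) → ⟦ d ⟧ ≡ ⟦ d′ ⟧
⟦⟧-cong (yes p) d′ to from = sym (⟦⟧-yes d′ (to p))
⟦⟧-cong (no ¬p) d′ to from = sym (⟦⟧-no d′ (¬p ∘ from))

⟦⟧*-cong : ∀ {P : Set} (d : Dec P) {a b} → (P → a ≡ b) → ⟦ d ⟧ · a ≡ ⟦ d ⟧ · b
⟦⟧*-cong (yes p) eq = cong (1ℤ ·_) (eq p)
⟦⟧*-cong (no _)  eq = trans (·-zeroˡ _) (sym (·-zeroˡ _))

-- Reindexing along an injection that has to hit only the points where the summand is nonzero. Each
-- value is spread over its fibre by indicators, and the two summations are exchanged.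
∑-inj : ∀ {X Y : Set} {xs : List X} {ys : List Y} (_≟_ : DecidableEquality Y) {f : Y → ℤ} {h : X → Y} →
        Unique xs → (∀ x → x ∈ xs) → Unique ys → (∀ {x x′} → h x ≡ h x′ → x ≡ x′) →
        (∀ x → f (h x) ≢ 0ℤ → h x ∈ ys) → (∀ {y} → y ∈ ys → f y ≢ 0ℤ → ∃ λ x → h x ≡ y) →
        ∑ ys f ≡ ∑ xs (f ∘ h)
∑-inj {xs = xs} {ys} _≟_ {f} {h} uxs cxs uys inj into onto = begin
  ∑ ys f                                              ≡⟨ ∑-cong∈ ys fibre ⟩
  ∑ ys (λ y → ∑ xs (λ x → ⟦ h x ≟ y ⟧ · f y))       ≡⟨ ∑-swap ys xs _ ⟩
  ∑ xs (λ x → ∑ ys (λ y → ⟦ h x ≟ y ⟧ · f y))       ≡⟨ ∑-cong xs point ⟩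
  ∑ xs (f ∘ h)                                        ∎
  where
  open ≡-Reasoning
  diag : ∀ x → ⟦ h x ≟ h x ⟧ · f (h x) ≡ f (h x)
  diag x = trans (cong (_· _) (⟦⟧-yes (h x ≟ h x) refl)) (·-identityˡ _)
  off : ∀ {x y} → h x ≢ y → ⟦ h x ≟ y ⟧ · f y ≡ 0ℤ
  off {x} {y} ne = trans (cong (_· f y) (⟦⟧-no (h x ≟ y) ne)) (·-zeroˡ (f y))
  fibre : ∀ {y} → y ∈ ys → f y ≡ ∑ xs (λ x → ⟦ h x ≟ y ⟧ · f y)
  fibre {y} y∈ with f y ℤ.≟ 0ℤ
  ... | yes z = trans z (sym (∑-zero xs (λ {x} _ → trans (cong (⟦ h x ≟ y ⟧ ·_) z) (·-zeroʳ _))))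
  ... | no nz with onto y∈ nz
  ...   | x₀ , refl = sym (trans (∑-single uxs (cxs x₀) (λ x≢ → off (x≢ ∘ inj))) (diag x₀))
  point : ∀ x → ∑ ys (λ y → ⟦ h x ≟ y ⟧ · f y) ≡ f (h x)
  point x with f (h x) ℤ.≟ 0ℤ
  ... | yes z = trans (∑-zero ys (λ {y} _ → trans (⟦⟧*-cong (h x ≟ y) (λ { refl → z })) (·-zeroʳ ⟦ h x ≟ y ⟧))) (sym z)
  ... | no nz = trans (∑-single uys (into x nz) (λ y≢ → off (y≢ ∘ sym))) (diag x)

-- Finite types given by complete lists without repetitions

record Enumeration (X : Set) : Set where
  field
    list     : List X
    complete : ∀ x → x ∈ list
    unique   : Unique list
    _≟_      : DecidableEquality X

module _ {X : Set} where

  ∉-head : ∀ {x} {xs : List X} → All (x ≢_) xs → x ∉ xs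
  ∉-head x≢ x∈ = All.lookup x≢ x∈ refl

  ∈⇒↭ : ∀ {x : X} {ys} → x ∈ ys → ∃ λ zs → ys ↭ x ∷ zs
  ∈⇒↭ x∈ with ∈.∈-∃++ x∈
  ... | as , bs , refl = as ++ bs , ↭.shift _ as bs

  Unique-resp-↭ : ∀ {xs ys : List X} → xs ↭ ys → Unique xs → Unique ys
  Unique-resp-↭ ↭.refl         u = u
  Unique-resp-↭ (↭.prep x p)   (x≢ ∷ u) = ↭.All-resp-↭ p x≢ ∷ Unique-resp-↭ p u
  Unique-resp-↭ (↭.swap x y p) ((x≢y ∷ x≢) ∷ y≢ ∷ u) =
    ((λ { refl → x≢y refl }) ∷ ↭.All-resp-↭ p y≢) ∷ ↭.All-resp-↭ p x≢ ∷ Unique-resp-↭ p u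
  Unique-resp-↭ (↭.trans p q)  u = Unique-resp-↭ q (Unique-resp-↭ p u)

  private
    tail-⊆ : ∀ {x : X} {xs ys zs} → x ∉ xs → (∀ {y} → y ∈ x ∷ xs → y ∈ ys) → ys ↭ x ∷ zs → ∀ {y} → y ∈ xs → y ∈ zs
    tail-⊆ x∉ sub p y∈ with ↭.∈-resp-↭ p (sub (there y∈))
    ... | here refl = contradiction y∈ x∉
    ... | there y∈′ = y∈′

  unique-⊆⇒length≤ : ∀ {xs ys : List X} → Unique xs → (∀ {x} → x ∈ xs → x ∈ ys) → length xs ≤ length ys
  unique-⊆⇒length≤ {[]}     u sub = z≤n
  unique-⊆⇒length≤ {x ∷ xs} (x≢ ∷ u) sub with ∈⇒↭ (sub (here refl))
  ... | zs , p = subst (suc (length xs) ≤_) (sym (↭.↭-length p))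
                   (s≤s (unique-⊆⇒length≤ u (tail-⊆ (∉-head x≢) sub p)))

  unique-⊆⇒↭ : ∀ {xs ys : List X} → Unique xs → (∀ {x} → x ∈ xs → x ∈ ys) → length ys ≤ length xs → xs ↭ ys
  unique-⊆⇒↭ {[]} {[]} u sub len = ↭-refl
  unique-⊆⇒↭ {x ∷ xs} (x≢ ∷ u) sub len with ∈⇒↭ (sub (here refl))
  ... | zs , p = ↭-trans (↭-prep x (unique-⊆⇒↭ u (tail-⊆ (∉-head x≢) sub p)
                   (ℕ.s≤s⁻¹ (subst (_≤ suc (length xs)) (↭.↭-length p) len)))) (↭-sym p)

  unique-set⇒↭ : ∀ {xs ys : List X} → Unique xs → Unique ys →
                 (∀ {x} → x ∈ xs → x ∈ ys) → (∀ {x} → x ∈ ys → x ∈ xs) → xs ↭ ys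
  unique-set⇒↭ u v sub sup = unique-⊆⇒↭ u sub (unique-⊆⇒length≤ v sup)

module _ {X : Set} (E : Enumeration X) where
  open Enumeration E

  -- Pigeonhole. Its standard use is that a row of k distinct colours is a rearrangement of all
  -- colours.
  full⇒↭ : ∀ {xs} → Unique xs → length list ≤ length xs → xs ↭ list
  full⇒↭ u = unique-⊆⇒↭ u (λ {x} _ → complete x)

  map-injective-↭ : ∀ {h : X → X} → (∀ {x y} → h x ≡ h y → x ≡ y) → map h list ↭ list
  map-injective-↭ {h} inj = full⇒↭ (Unique.map⁺ inj unique) (ℕ.≤-reflexive (sym (List.length-map h list)))

  injective⇒surjective : ∀ {h : X → X} → (∀ {x y} → h x ≡ h y → x ≡ y) → ∀ y → ∃ λ x → h x ≡ y
  injective⇒surjective {h} inj y with ∈.∈-map⁻ h (↭.∈-resp-↭ (↭-sym (map-injective-↭ inj)) (complete y))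
  ... | x , _ , eq = x , sym eq

finEnum : ∀ n → Enumeration (Fin n)
finEnum n = record { list = allFin n; complete = ∈.∈-allFin; unique = Unique.allFin⁺ n; _≟_ = Fin._≟_ }

_×-enum_ : ∀ {X Y : Set} → Enumeration X → Enumeration Y → Enumeration (X × Y)
E ×-enum F = record
  { list     = cartesianProduct E.list F.list
  ; complete = λ (x , y) → ∈.∈-cartesianProduct⁺ (E.complete x) (F.complete y)
  ; unique   = Unique.cartesianProduct⁺ E.unique F.unique
  ; _≟_      = Product.≡-dec E._≟_ F._≟_
  } where module E = Enumeration E
          module F = Enumeration F

allVecs : ∀ {X : Set} → List X → ∀ n → List (Vec X n)
allVecs xs zero    = [ [] ]
allVecs xs (suc n) = map (uncurry _∷_) (cartesianProduct xs (allVecs xs n))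

∑-allVecs : ∀ {X : Set} (xs : List X) n (f : Vec X (suc n) → ℤ) →
            ∑ (allVecs xs (suc n)) f ≡ ∑ xs (λ x → ∑ (allVecs xs n) (λ v → f (x ∷ v)))
∑-allVecs xs n f = trans (∑-map (uncurry _∷_) (cartesianProduct xs (allVecs xs n)) f) (∑-× xs (allVecs xs n) _)

∈-allVecs : ∀ {X : Set} {xs : List X} {n} (v : Vec X n) → (∀ i → Vec.lookup v i ∈ xs) → v ∈ allVecs xs n
∈-allVecs []      _  = here refl
∈-allVecs (x ∷ v) v∈ = ∈.∈-map⁺ (uncurry _∷_) (∈.∈-cartesianProduct⁺ (v∈ zero) (∈-allVecs v (v∈ ∘ suc)))

allVecs-unique : ∀ {X : Set} {xs : List X} n → Unique xs → Unique (allVecs xs n)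
allVecs-unique zero    u = [] ∷ []
allVecs-unique (suc n) u = Unique.map⁺ (λ { {_ , _} {_ , _} refl → refl }) (Unique.cartesianProduct⁺ u (allVecs-unique n u))

vecEnum : ∀ {X : Set} → Enumeration X → ∀ n → Enumeration (Vec X n)
vecEnum E n = record
  { list = allVecs list n; complete = λ v → ∈-allVecs v (λ i → complete _)
  ; unique = allVecs-unique n unique; _≟_ = Vec.≡-dec _≟_ }
  where open Enumeration E

vec-ext : ∀ {X : Set} {n} {v w : Vec X n} → (∀ i → Vec.lookup v i ≡ Vec.lookup w i) → v ≡ w
vec-ext {v = v} {w} eq = trans (sym (Vec.tabulate∘lookup v)) (trans (Vec.tabulate-cong eq) (Vec.tabulate∘lookup w))

toList≡map-lookup : ∀ {X : Set} {n} (v : Vec X n) → Vec.toList v ≡ map (Vec.lookup v) (allFin n)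
toList≡map-lookup []      = refl
toList≡map-lookup {n = suc n} (x ∷ v) = cong (x ∷_) (trans (toList≡map-lookup v)
  (trans (List.map-∘ (allFin n)) (cong (map (Vec.lookup (x ∷ v))) (List.map-tabulate {n = n} id suc))))

unique-map⇒injective : ∀ {X Y : Set} (h : X → Y) {xs} → Unique (map h xs) → ∀ {x y} → x ∈ xs → y ∈ xs → h x ≡ h y → x ≡ y
unique-map⇒injective h (x≢ ∷ u) (here refl) (here refl) eq = refl
unique-map⇒injective h (x≢ ∷ u) (here refl) (there y∈)  eq = contradiction eq (All.lookup x≢ (∈.∈-map⁺ h y∈))
unique-map⇒injective h (x≢ ∷ u) (there x∈)  (here refl) eq = contradiction (sym eq) (All.lookup x≢ (∈.∈-map⁺ h x∈))
unique-map⇒injective h (x≢ ∷ u) (there x∈)  (there y∈)  eq = unique-map⇒injective h u x∈ y∈ eq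

-- Products over unordered pairs of positions

module _ {X : Set} where

  pairs : List X → List (X × X)
  pairs []       = []
  pairs (x ∷ xs) = map (x ,_) xs ++ pairs xs

  -- With an antisymmetric factor this depends on the order of the list and is a permutation sign.
  -- With a symmetric factor it depends only on the entries (`pp-↭`).
  pp : (X → X → ℤ) → List X → ℤ
  pp g xs = ∏ (pairs xs) (uncurry g)

  pp-∷ : ∀ g x xs → pp g (x ∷ xs) ≡ ∏ xs (g x) · pp g xs
  pp-∷ g x xs = trans (∏-++ (map (x ,_) xs) (pairs xs) (uncurry g)) (cong (_· pp g xs) (∏-map (x ,_) xs (uncurry g)))

  pp-cong : ∀ {g h} xs → (∀ x y → g x y ≡ h x y) → pp g xs ≡ pp h xs
  pp-cong xs eq = ∏-cong (pairs xs) (uncurry eq)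

  pp-* : ∀ g h xs → pp (λ x y → g x y · h x y) xs ≡ pp g xs · pp h xs
  pp-* g h xs = ∏-* (pairs xs) (uncurry g) (uncurry h)

  AllPairs⇒pairs : ∀ {R : X → X → Set} {xs} → AllPairs R xs → ∀ {x y} → (x , y) ∈ pairs xs → R x y
  AllPairs⇒pairs {xs = x ∷ xs} (rx ∷ r) xy∈ with ∈.∈-++⁻ (map (x ,_) xs) xy∈
  ... | inj₂ xy∈′ = AllPairs⇒pairs r xy∈′
  ... | inj₁ xy∈′ with ∈.∈-map⁻ (x ,_) xy∈′
  ...   | y , y∈ , refl = All.lookup rx y∈

  pp-cong-AllPairs : ∀ {g h xs} → AllPairs (λ x y → g x y ≡ h x y) xs → pp g xs ≡ pp h xs
  pp-cong-AllPairs ap = ∏-cong∈ _ (AllPairs⇒pairs ap)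

  pp-cong-unique : ∀ {g h xs} → Unique xs → (∀ {x y} → x ≢ y → g x y ≡ h x y) → pp g xs ≡ pp h xs
  pp-cong-unique u eq = pp-cong-AllPairs (AllPairs.map eq u)

  pp-one : ∀ {g} {xs} → AllPairs (λ x y → g x y ≡ 1ℤ) xs → pp g xs ≡ 1ℤ
  pp-one ap = ∏-one _ (AllPairs⇒pairs ap)

  pp-++ : ∀ g xs ys → pp g (xs ++ ys) ≡ pp g xs · pp g ys · ∏ xs (λ x → ∏ ys (g x))
  pp-++ g []       ys = lem (pp g ys)
    where lem : ∀ a → a ≡ 1ℤ · a · 1ℤ
          lem = solve 1 (λ a → a := con 1ℤ :* a :* con 1ℤ) refl
  pp-++ g (x ∷ xs) ys = begin
    pp g (x ∷ xs ++ ys)                                    ≡⟨ pp-∷ g x (xs ++ ys) ⟩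
    ∏ (xs ++ ys) (g x) · pp g (xs ++ ys)                 ≡⟨ cong₂ _·_ (∏-++ xs ys (g x)) (pp-++ g xs ys) ⟩
    ∏ xs (g x) · ∏ ys (g x) · (pp g xs · pp g ys · _) ≡⟨ lem (∏ xs (g x)) (∏ ys (g x)) (pp g xs) (pp g ys) _ ⟩
    ∏ xs (g x) · pp g xs · pp g ys · (∏ ys (g x) · _) ≡⟨ cong (λ z → z · pp g ys · (∏ ys (g x) · ∏ xs (λ x → ∏ ys (g x)))) (sym (pp-∷ g x xs)) ⟩
    pp g (x ∷ xs) · pp g ys · (∏ ys (g x) · _)       ∎
    where
    open ≡-Reasoning
    lem : ∀ a b c d e → a · b · (c · d · e) ≡ a · c · d · (b · e)
    lem = solve 5 (λ a b c d e → a :* b :* (c :* d :* e) := a :* c :* d :* (b :* e)) refl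

  pp-↭ : ∀ {g xs ys} → (∀ x y → g x y ≡ g y x) → xs ↭ ys → pp g xs ≡ pp g ys
  pp-↭ s ↭.refl = refl
  pp-↭ {g} s (↭.prep {xs} {ys} x p) =
    trans (pp-∷ g x xs) (trans (cong₂ _·_ (∏-↭ (g x) p) (pp-↭ s p)) (sym (pp-∷ g x ys)))
  pp-↭ {g} s (↭.swap {xs} {ys} x y p) = begin
    pp g (x ∷ y ∷ xs)                                           ≡⟨ two x y xs ⟩
    g x y · ∏ xs (g x) · (∏ xs (g y) · pp g xs)
      ≡⟨ cong₂ _·_ (cong₂ _·_ (s x y) (∏-↭ (g x) p)) (cong₂ _·_ (∏-↭ (g y) p) (pp-↭ s p)) ⟩
    g y x · ∏ ys (g x) · (∏ ys (g y) · pp g ys)           ≡⟨ lem (g y x) (∏ ys (g x)) (∏ ys (g y)) (pp g ys) ⟩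
    g y x · ∏ ys (g y) · (∏ ys (g x) · pp g ys)           ≡⟨ sym (two y x ys) ⟩
    pp g (y ∷ x ∷ ys)                                           ∎
    where
    open ≡-Reasoning
    two : ∀ x y xs → pp g (x ∷ y ∷ xs) ≡ g x y · ∏ xs (g x) · (∏ xs (g y) · pp g xs)
    two x y xs = trans (pp-∷ g x (y ∷ xs)) (cong (∏ (y ∷ xs) (g x) ·_) (pp-∷ g y xs))
    lem : ∀ a b c d → a · b · (c · d) ≡ a · c · (b · d)
    lem = solve 4 (λ a b c d → a :* b :* (c :* d) := a :* c :* (b :* d)) refl
  pp-↭ s (↭.trans p q) = trans (pp-↭ s p) (pp-↭ s q)

  -- Passes from ordered pairs, over which crossings are counted, to the diagonal and unordered
  -- pairs.
  ∏∏≡pp : ∀ (g : X → X → ℤ) xs → ∏ xs (λ x → ∏ xs (g x)) ≡ ∏ xs (λ x → g x x) · pp (λ x y → g x y · g y x) xs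
  ∏∏≡pp g []       = sym (·-identityˡ 1ℤ)
  ∏∏≡pp g (x ∷ xs) = begin
    g x x · ∏ xs (g x) · ∏ xs (λ y → g y x · ∏ xs (g y))
      ≡⟨ cong (g x x · ∏ xs (g x) ·_) (trans (∏-* xs (λ y → g y x) (λ y → ∏ xs (g y))) (cong (∏ xs (λ y → g y x) ·_) (∏∏≡pp g xs))) ⟩
    g x x · ∏ xs (g x) · (∏ xs (λ y → g y x) · (∏ xs (λ y → g y y) · pp G xs))
      ≡⟨ lem (g x x) (∏ xs (g x)) (∏ xs (λ y → g y x)) (∏ xs (λ y → g y y)) (pp G xs) ⟩
    g x x · ∏ xs (λ y → g y y) · (∏ xs (g x) · ∏ xs (λ y → g y x) · pp G xs)
      ≡⟨ cong (g x x · ∏ xs (λ y → g y y) ·_)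
           (trans (cong (_· pp G xs) (sym (∏-* xs (g x) (λ y → g y x)))) (sym (pp-∷ G x xs))) ⟩
    g x x · ∏ xs (λ y → g y y) · pp G (x ∷ xs) ∎
    where
    open ≡-Reasoning
    G : X → X → ℤ
    G x y = g x y · g y x
    lem : ∀ a b c d e → a · b · (c · (d · e)) ≡ a · d · (b · c · e)
    lem = solve 5 (λ a b c d e → a :* b :* (c :* (d :* e)) := a :* d :* (b :* c :* e)) refl

module _ {X Y : Set} where

  pp-map : ∀ g (h : X → Y) xs → pp g (map h xs) ≡ pp (λ x y → g (h x) (h y)) xs
  pp-map g h []       = refl
  pp-map g h (x ∷ xs) = begin
    pp g (h x ∷ map h xs)                            ≡⟨ pp-∷ g (h x) (map h xs) ⟩
    ∏ (map h xs) (g (h x)) · pp g (map h xs)       ≡⟨ cong₂ _·_ (∏-map h xs (g (h x))) (pp-map g h xs) ⟩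
    ∏ xs (λ y → g (h x) (h y)) · pp _ xs           ≡⟨ pp-∷ _ x xs ⟨
    pp (λ x y → g (h x) (h y)) (x ∷ xs)              ∎
    where open ≡-Reasoning

  pp-concatMap : ∀ g (h : X → List Y) xs →
    pp g (concatMap h xs) ≡ ∏ xs (λ x → pp g (h x)) · pp (λ x y → ∏ (h x) (λ a → ∏ (h y) (g a))) xs
  pp-concatMap g h []       = sym (·-identityˡ 1ℤ)
  pp-concatMap g h (x ∷ xs) = begin
    pp g (h x ++ concatMap h xs)
      ≡⟨ pp-++ g (h x) (concatMap h xs) ⟩
    pp g (h x) · pp g (concatMap h xs) · ∏ (h x) (λ a → ∏ (concatMap h xs) (g a))
      ≡⟨ cong₂ (λ u v → pp g (h x) · u · v) (pp-concatMap g h xs)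
           (trans (∏-cong (h x) (λ a → ∏-concatMap h xs (g a))) (∏-swap (h x) xs _)) ⟩
    pp g (h x) · (∏ xs (λ x → pp g (h x)) · pp G xs) · ∏ xs (λ y → ∏ (h x) (λ a → ∏ (h y) (g a)))
      ≡⟨ lem (pp g (h x)) (∏ xs (λ x → pp g (h x))) (pp G xs) _ ⟩
    pp g (h x) · ∏ xs (λ x → pp g (h x)) · (∏ xs (λ y → ∏ (h x) (λ a → ∏ (h y) (g a))) · pp G xs)
      ≡⟨ cong (pp g (h x) · ∏ xs (λ x → pp g (h x)) ·_) (sym (pp-∷ G x xs)) ⟩
    pp g (h x) · ∏ xs (λ x → pp g (h x)) · pp G (x ∷ xs) ∎
    where
    open ≡-Reasoning
    G : X → X → ℤ
    G x y = ∏ (h x) (λ a → ∏ (h y) (g a))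
    lem : ∀ a b c d → a · (b · c) · d ≡ a · b · (d · c)
    lem = solve 4 (λ a b c d → a :* (b :* c) :* d := a :* b :* (d :* c)) refl

·-interchange₃ : ∀ a b c → a · (b · c) ≡ b · (a · c)
·-interchange₃ = solve 3 (λ a b c → a :* (b :* c) := b :* (a :* c)) refl

-- Tuples versus sets

module _ {X : Set} where

  tuples : List X → ℕ → (List X → ℤ) → ℤ
  tuples xs zero    f = f []
  tuples xs (suc k) f = ∑ xs (λ x → tuples xs k (f ∘ (x ∷_)))

  tuples-cong : ∀ xs k {f g : List X → ℤ} → (∀ l → f l ≡ g l) → tuples xs k f ≡ tuples xs k g
  tuples-cong xs zero    eq = eq []
  tuples-cong xs (suc k) eq = ∑-cong xs (λ x → tuples-cong xs k (eq ∘ (x ∷_)))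

  tuples-zero : ∀ xs k {f : List X → ℤ} → (∀ l → f l ≡ 0ℤ) → tuples xs k f ≡ 0ℤ
  tuples-zero xs zero    eq = eq []
  tuples-zero xs (suc k) eq = ∑-zero xs (λ {x} _ → tuples-zero xs k (eq ∘ (x ∷_)))

  tuples≡∑ : ∀ xs k (f : List X → ℤ) → tuples xs k f ≡ ∑ (allVecs xs k) (f ∘ Vec.toList)
  tuples≡∑ xs zero    f = sym (⊕-identityʳ (f []))
  tuples≡∑ xs (suc k) f = trans (∑-cong xs (λ x → tuples≡∑ xs k (f ∘ (x ∷_)))) (sym (∑-allVecs xs k (f ∘ Vec.toList)))

  -- Symmetric without a sign change: the functions meant are weights of sets presented as lists. A
  -- repeat is tested only at the head, since symmetry brings any repeat there.
  record Alternating (f : List X → ℤ) : Set where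
    field
      symmetric : ∀ {l l′} → l ↭ l′ → f l ≡ f l′
      repeated  : ∀ x l → f (x ∷ x ∷ l) ≡ 0ℤ

  open Alternating

  alternating-∷ : ∀ {f} → Alternating f → ∀ x → Alternating (f ∘ (x ∷_))
  alternating-∷ {f} A x .symmetric p  = symmetric A (↭-prep x p)
  alternating-∷ {f} A x .repeated y l =
    trans (symmetric A (↭-trans (↭.swap x y ↭-refl) (↭-prep y (↭.swap x y ↭-refl)))) (repeated A y (x ∷ l))

  -- The new element x stands in at most one of the suc k positions, as a second occurrence makes f
  -- vanish; by symmetry all positions contribute alike.
  tuples-∷ : ∀ {f} → Alternating f → ∀ x xs k →
             tuples (x ∷ xs) (suc k) f ≡ tuples xs (suc k) f ⊕ + suc k · tuples xs k (f ∘ (x ∷_))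
  tuples-∷ {f} A x xs zero = lem (f (x ∷ [])) (∑ xs (λ y → f (y ∷ [])))
    where lem : ∀ a b → a ⊕ b ≡ b ⊕ + 1 · a
          lem = solve 2 (λ a b → a :+ b := b :+ con (+ 1) :* a) refl
  tuples-∷ {f} A x xs (suc k) = begin
    tuples (x ∷ xs) (suc k) fx ⊕ ∑ xs (λ y → tuples (x ∷ xs) (suc k) (f ∘ (y ∷_)))
      ≡⟨ cong₂ _⊕_ (tuples-∷ (alternating-∷ A x) x xs k) (∑-cong xs (λ y → tuples-∷ (alternating-∷ A y) x xs k)) ⟩
    (tuples xs (suc k) fx ⊕ + suc k · tuples xs k (fx ∘ (x ∷_)))
      ⊕ ∑ xs (λ y → tuples xs (suc k) (f ∘ (y ∷_)) ⊕ + suc k · tuples xs k (λ l → f (y ∷ x ∷ l)))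
      ≡⟨ cong₂ _⊕_ (cong (λ z → tuples xs (suc k) fx ⊕ + suc k · z) (tuples-zero xs k (repeated A x)))
           (trans (∑-+ xs _ _) (cong (tuples xs (suc (suc k)) f ⊕_)
             (trans (∑-*ˡ xs (+ suc k) _)
               (cong (+ suc k ·_) (∑-cong xs (λ y → tuples-cong xs k (λ l → symmetric A (↭.swap y x ↭-refl)))))))) ⟩
    (tuples xs (suc k) fx ⊕ + suc k · 0ℤ) ⊕ (tuples xs (suc (suc k)) f ⊕ + suc k · tuples xs (suc k) fx)
      ≡⟨ lem (tuples xs (suc k) fx) (+ suc k) (tuples xs (suc (suc k)) f) ⟩
    tuples xs (suc (suc k)) f ⊕ (tuples xs (suc k) fx ⊕ + suc k · tuples xs (suc k) fx)
      ≡⟨ cong (tuples xs (suc (suc k)) f ⊕_) (sym (suc-· (suc k) (tuples xs (suc k) fx))) ⟩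
    tuples xs (suc (suc k)) f ⊕ + suc (suc k) · tuples xs (suc k) fx ∎
    where
    open ≡-Reasoning
    fx = f ∘ (x ∷_)
    lem : ∀ a k b → (a ⊕ k · 0ℤ) ⊕ (b ⊕ k · a) ≡ b ⊕ (a ⊕ k · a)
    lem = solve 3 (λ a k b → (a :+ k :* con 0ℤ) :+ (b :+ k :* a) := b :+ (a :+ k :* a)) refl

  -- Passes from families numbered by colours to unordered families. The recursion `tuples-∷`
  -- mirrors the division of `sublists` into those with and those without the head.
  tuples≡!·sublists : ∀ {f} → Alternating f → ∀ xs k →
    tuples xs k f ≡ + (k !) · ∑ (sublists xs) (λ F → ⟦ length F ℕ.≟ k ⟧ · f F)
  tuples≡!·sublists {f} A [] zero = lem (f [])
    where lem : ∀ a → a ≡ + 1 · (1ℤ · a ⊕ 0ℤ)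
          lem = solve 1 (λ a → a := con (+ 1) :* (con 1ℤ :* a :+ con 0ℤ)) refl
  tuples≡!·sublists {f} A [] (suc k) = lem (+ (suc k !)) (f [])
    where lem : ∀ a b → 0ℤ ≡ a · (0ℤ · b ⊕ 0ℤ)
          lem = solve 2 (λ a b → con 0ℤ := a :* (con 0ℤ :* b :+ con 0ℤ)) refl
  tuples≡!·sublists {f} A (x ∷ xs) zero = begin
    f []
      ≡⟨ tuples≡!·sublists A xs zero ⟩
    + 1 · ∑ (sublists xs) g
      ≡⟨ cong (+ 1 ·_) (sym (⊕-identityˡ _)) ⟩
    + 1 · (0ℤ ⊕ ∑ (sublists xs) g)
      ≡⟨ cong (λ z → + 1 · (z ⊕ ∑ (sublists xs) g)) (sym (trans (∑-map (x ∷_) (sublists xs) g)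
           (∑-zero (sublists xs) (λ _ → ·-zeroˡ _)))) ⟩
    + 1 · (∑ (map (x ∷_) (sublists xs)) g ⊕ ∑ (sublists xs) g)
      ≡⟨ cong (+ 1 ·_) (sym (∑-++ (map (x ∷_) (sublists xs)) (sublists xs) g)) ⟩
    + 1 · ∑ (sublists (x ∷ xs)) g ∎
    where
    open ≡-Reasoning
    g : List X → ℤ
    g F = ⟦ length F ℕ.≟ 0 ⟧ · f F
  tuples≡!·sublists {f} A (x ∷ xs) (suc k) = begin
    tuples (x ∷ xs) (suc k) f
      ≡⟨ tuples-∷ A x xs k ⟩
    tuples xs (suc k) f ⊕ + suc k · tuples xs k (f ∘ (x ∷_))
      ≡⟨ cong₂ (λ a b → a ⊕ + suc k · b) (tuples≡!·sublists A xs (suc k)) (tuples≡!·sublists (alternating-∷ A x) xs k) ⟩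
    + (suc k !) · ∑ (sublists xs) g ⊕ + suc k · (+ (k !) · ∑ (sublists xs) (λ F → ⟦ length F ℕ.≟ k ⟧ · f (x ∷ F)))
      ≡⟨ cong (λ z → + (suc k !) · ∑ (sublists xs) g ⊕ + suc k · (+ (k !) · z))
           (trans (∑-cong (sublists xs) (λ F → cong (_· f (x ∷ F)) (⟦⟧-cong (length F ℕ.≟ k) (suc (length F) ℕ.≟ suc k) (cong suc) ℕ.suc-injective)))
             (sym (∑-map (x ∷_) (sublists xs) g))) ⟩
    + (suc k !) · ∑ (sublists xs) g ⊕ + suc k · (+ (k !) · ∑ (map (x ∷_) (sublists xs)) g)
      ≡⟨ lem (+ (suc k !)) (+ suc k) (+ (k !)) (trans (ℤ.pos-* (suc k) (k !)) (*≡· _ _)) (∑ (sublists xs) g) (∑ (map (x ∷_) (sublists xs)) g) ⟩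
    + (suc k !) · (∑ (map (x ∷_) (sublists xs)) g ⊕ ∑ (sublists xs) g)
      ≡⟨ cong (+ (suc k !) ·_) (sym (∑-++ (map (x ∷_) (sublists xs)) (sublists xs) g)) ⟩
    + (suc k !) · ∑ (sublists (x ∷ xs)) g ∎
    where
    open ≡-Reasoning
    g : List X → ℤ
    g F = ⟦ length F ℕ.≟ suc k ⟧ · f F
    lem : ∀ c a b → c ≡ a · b → ∀ u v → c · u ⊕ a · (b · v) ≡ c · (v ⊕ u)
    lem _ a b refl u v = solve 4 (λ a b u v → a :* b :* u :+ a :* (b :* v) := a :* b :* (v :+ u)) refl a b u v

-- Burnside's lemma

module _ {X : Set} where

  -- Orbit representatives are chosen as the first enumerated point of the orbit, so that they
  -- depend on the orbit alone. The default `d` is returned only if nothing in the list qualifies.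
  first : {P : X → Set} → (∀ x → Dec (P x)) → List X → X → X
  first P? []       d = d
  first P? (x ∷ xs) d = if does (P? x) then x else first P? xs d

  first-satisfies : ∀ {P : X → Set} (P? : ∀ x → Dec (P x)) xs {d} → P d → P (first P? xs d)
  first-satisfies P? []       pd = pd
  first-satisfies P? (x ∷ xs) pd with P? x
  ... | yes px = px
  ... | no _   = first-satisfies P? xs pd

  first-cong : ∀ {P Q : X → Set} (P? : ∀ x → Dec (P x)) (Q? : ∀ x → Dec (Q x)) {xs d d′} →
               (∀ {x} → P x → Q x) → (∀ {x} → Q x → P x) → Any P xs → first P? xs d ≡ first Q? xs d′
  first-cong P? Q? {x ∷ xs} to from any with P? x | Q? x
  ... | yes _  | yes _  = refl
  ... | yes px | no ¬qx = contradiction (to px) ¬qx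
  ... | no ¬px | yes qx = contradiction (from qx) ¬px
  first-cong P? Q? to from (here px)   | no ¬px | no _ = contradiction px ¬px
  first-cong P? Q? to from (there any) | no _   | no _ = first-cong P? Q? to from any

module Burnside
  {X G : Set} (EX : Enumeration X) (EG : Enumeration G) (_∙_ : G → G → G) (act : G → X → X)
  (act-∙ : ∀ g h x → act (g ∙ h) x ≡ act g (act h x))
  (∙-cancelʳ : ∀ {g g′} h → g ∙ h ≡ g′ ∙ h → g ≡ g′)
  (e : G) (act-e : ∀ x → act e x ≡ x)
  (inverse : ∀ g → ∃ λ h → ∀ x → act h (act g x) ≡ x)
  (w : X → ℤ) (w-invariant : ∀ g x → w (act g x) ≡ w x)
  where
  open Enumeration EX
  private gs = Enumeration.list EG

  private
    _~_ : X → X → Set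
    x ~ y = ∃ λ g → act g x ≡ y

    _~?_ : ∀ x y → Dec (x ~ y)
    x ~? y = map′ (λ any → let g , _ , eq = find any in g , eq) (λ (g , eq) → lose (Enumeration.complete EG g) eq)
                  (Any.any? (λ g → act g x ≟ y) gs)

    ~-sym : ∀ {x y} → x ~ y → y ~ x
    ~-sym (g , refl) with inverse g
    ... | h , hg = h , hg _

    ~-trans : ∀ {x y z} → x ~ y → y ~ z → x ~ z
    ~-trans (g , refl) (h , refl) = h ∙ g , act-∙ h g _

    rep : X → X
    rep x = first (x ~?_) list x

    rep-~ : ∀ x → x ~ rep x
    rep-~ x = first-satisfies (x ~?_) list (e , act-e x)

    rep-cong : ∀ {x y} → x ~ y → rep x ≡ rep y
    rep-cong {x} {y} x~y = first-cong (x ~?_) (y ~?_) (~-trans (~-sym x~y)) (~-trans x~y) (lose (complete y) x~y)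

    count : X → X → ℤ
    count x y = ∑ gs (λ g → ⟦ act g x ≟ y ⟧)

    -- Right translation by an element that carries x to y matches the elements carrying y to x with
    -- the stabiliser of x.
    count-~ : ∀ {x y} → x ~ y → count x x ≡ count y x
    count-~ {x} (h , refl) = begin
      ∑ gs (λ g → ⟦ act g x ≟ x ⟧)          ≡⟨ ∑-↭ _ (↭-sym (map-injective-↭ EG (∙-cancelʳ h))) ⟩
      ∑ (map (_∙ h) gs) (λ g → ⟦ act g x ≟ x ⟧) ≡⟨ ∑-map (_∙ h) gs _ ⟩
      ∑ gs (λ g → ⟦ act (g ∙ h) x ≟ x ⟧)    ≡⟨ ∑-cong gs (λ g → cong (λ z → ⟦ z ≟ x ⟧) (act-∙ g h x)) ⟩
      ∑ gs (λ g → ⟦ act g (act h x) ≟ x ⟧)  ∎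
      where open ≡-Reasoning

    collect : ∀ x y → ⟦ rep x ≟ y ⟧ · (count x x · w x) ≡ ⟦ rep y ≟ y ⟧ · w y · count y x
    collect x y with rep x ≟ y
    ... | yes refl = trans (lem (count x x) (w x)) (cong₂ _·_ (cong₂ _·_ (sym (⟦⟧-yes (rep (rep x) ≟ rep x) (sym (rep-cong (rep-~ x))))) w-eq) (count-~ (rep-~ x)))
      where
      lem : ∀ a b → 1ℤ · (a · b) ≡ 1ℤ · b · a
      lem = solve 2 (λ a b → con 1ℤ :* (a :* b) := con 1ℤ :* b :* a) refl
      w-eq : w x ≡ w (rep x)
      w-eq = let g , eq = rep-~ x in trans (sym (w-invariant g x)) (cong w eq)
    ... | no ne with rep y ≟ y
    ...   | no _   = lem (count x x · w x) (w y) (count y x)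
      where lem : ∀ a b c → 0ℤ · a ≡ 0ℤ · b · c
            lem = solve 3 (λ a b c → con 0ℤ :* a := con 0ℤ :* b :* c) refl
    ...   | yes ry = trans (·-zeroˡ _) (sym (trans (cong (1ℤ · w y ·_) none) (·-zeroʳ _)))
      where
      none : count y x ≡ 0ℤ
      none = ∑-zero gs (λ {g} _ → ⟦⟧-no (act g y ≟ x) (λ eq → ne (trans (sym (rep-cong (g , eq))) ry)))

    ∑-count : ∀ y → ∑ list (count y) ≡ + length gs
    ∑-count y = begin
      ∑ list (λ x → ∑ gs (λ g → ⟦ act g y ≟ x ⟧)) ≡⟨ ∑-swap list gs _ ⟩
      ∑ gs (λ g → ∑ list (λ x → ⟦ act g y ≟ x ⟧)) ≡⟨ ∑-cong gs (λ g → trans (∑-single unique (complete (act g y))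
                                                       (λ ne → ⟦⟧-no (_ ≟ _) (ne ∘ sym))) (⟦⟧-yes (_ ≟ _) refl)) ⟩
      ∑ gs (λ _ → 1ℤ)                             ≡⟨ ∑-const gs 1ℤ ⟩
      + length gs · 1ℤ                            ≡⟨ ·-identityʳ _ ⟩
      + length gs                                 ∎
      where open ≡-Reasoning

  -- The weight is constant on orbits, so the weighted number of pairs (g , x) with x fixed by g is
  -- the order of the group times the sum of w over one representative of each orbit. That sum is
  -- the quotient exhibited.
  burnside : ∃ λ q → ∑ gs (λ g → ∑ list (λ x → ⟦ act g x ≟ x ⟧ · w x)) ≡ q · + length gs
  burnside = ∑ list (λ y → ⟦ rep y ≟ y ⟧ · w y) , (begin
    ∑ gs (λ g → ∑ list (λ x → ⟦ act g x ≟ x ⟧ · w x))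
      ≡⟨ ∑-swap gs list _ ⟩
    ∑ list (λ x → ∑ gs (λ g → ⟦ act g x ≟ x ⟧ · w x))
      ≡⟨ ∑-cong list (λ x → ∑-*ʳ gs (w x) (λ g → ⟦ act g x ≟ x ⟧)) ⟩
    ∑ list (λ x → count x x · w x)
      ≡⟨ ∑-cong list (λ x → sym (trans (∑-single unique (complete (rep x))
           (λ ne → trans (cong (_· (count x x · w x)) (⟦⟧-no (rep x ≟ _) (ne ∘ sym))) (·-zeroˡ _)))
           (trans (cong (_· (count x x · w x)) (⟦⟧-yes (rep x ≟ rep x) refl)) (·-identityˡ _)))) ⟩
    ∑ list (λ x → ∑ list (λ y → ⟦ rep x ≟ y ⟧ · (count x x · w x)))
      ≡⟨ ∑-swap list list _ ⟩
    ∑ list (λ y → ∑ list (λ x → ⟦ rep x ≟ y ⟧ · (count x x · w x)))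
      ≡⟨ ∑-cong list (λ y → trans (∑-cong list (λ x → collect x y)) (trans (∑-*ˡ list _ (count y)) (cong (⟦ rep y ≟ y ⟧ · w y ·_) (∑-count y)))) ⟩
    ∑ list (λ y → ⟦ rep y ≟ y ⟧ · w y · + length gs)
      ≡⟨ ∑-*ʳ list (+ length gs) _ ⟩
    ∑ list (λ y → ⟦ rep y ≟ y ⟧ · w y) · + length gs ∎)
    where open ≡-Reasoning

-- Signs

1≢0 : 1ℤ ≢ 0ℤ
1≢0 ()

opaque
  unfolding _·_
  ⊝1≡-1 : ⊝ 1ℤ ≡ -1ℤ
  ⊝1≡-1 = refl

-- The sign of b - a, so that increasing lists have sign 1.
sg : ℕ → ℕ → ℤ
sg zero    zero    = 0ℤ
sg zero    (suc _) = 1ℤ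
sg (suc _) zero    = -1ℤ
sg (suc a) (suc b) = sg a b

sg-< : ∀ {a b} → a < b → sg a b ≡ 1ℤ
sg-< {zero}  {suc b} _       = refl
sg-< {suc a} {suc b} (s≤s l) = sg-< l

sg-> : ∀ {a b} → b < a → sg a b ≡ -1ℤ
sg-> {suc a} {zero}  _       = refl
sg-> {suc a} {suc b} (s≤s l) = sg-> l

sg-refl : ∀ a → sg a a ≡ 0ℤ
sg-refl zero    = refl
sg-refl (suc a) = sg-refl a

opaque
  unfolding ⊝_
  sg-anti : ∀ a b → sg b a ≡ ⊝ sg a b
  sg-anti zero    zero    = refl
  sg-anti zero    (suc b) = refl
  sg-anti (suc a) zero    = refl
  sg-anti (suc a) (suc b) = sg-anti a b

opaque
  unfolding _·_
  sg-sq : ∀ {a b} → a ≢ b → sg a b · sg a b ≡ 1ℤ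
  sg-sq {zero}  {zero}  ne = contradiction refl ne
  sg-sq {zero}  {suc b} ne = refl
  sg-sq {suc a} {zero}  ne = refl
  sg-sq {suc a} {suc b} ne = sg-sq {a} {b} (ne ∘ cong suc)

square-one⇒≢0 : ∀ {a} → a · a ≡ 1ℤ → a ≢ 0ℤ
square-one⇒≢0 eq refl = 1≢0 (trans (sym eq) (·-zeroˡ _))

-- An orientation of every pair of distinct elements. In this generality the same `sgnL` serves
-- vertices, slots and colours, and also pulled back and lexicographic comparisons.
record Sign (X : Set) : Set where
  field
    s     : X → X → ℤ
    anti  : ∀ x y → s y x ≡ ⊝ s x y
    diag  : ∀ x → s x x ≡ 0ℤ
    sq    : ∀ {x y} → x ≢ y → s x y · s x y ≡ 1ℤ

finSign : ∀ n → Sign (Fin n)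
finSign n = record { s = λ x y → sg (toℕ x) (toℕ y); anti = λ x y → sg-anti (toℕ x) (toℕ y); diag = λ x → sg-refl (toℕ x)
                   ; sq = λ {x} {y} ne → sg-sq (ne ∘ Fin.toℕ-injective) }

⊝·⊝ : ∀ a b → ⊝ a · ⊝ b ≡ a · b
⊝·⊝ = solve 2 (λ a b → :- a :* :- b := a :* b) refl

·-cancel-sign : ∀ {a b} → a · a ≡ 1ℤ → a · b ≡ 1ℤ → a ≡ b
·-cancel-sign {a} {b} aa ab = begin
  a           ≡⟨ ·-identityʳ a ⟨
  a · 1ℤ      ≡⟨ cong (a ·_) ab ⟨
  a · (a · b) ≡⟨ ·-assoc a a b ⟨
  a · a · b   ≡⟨ cong (_· b) aa ⟩
  1ℤ · b      ≡⟨ ·-identityˡ b ⟩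
  b           ∎
  where open ≡-Reasoning

pp-square : ∀ {X : Set} {g : X → X → ℤ} {xs} → Unique xs → (∀ {x y} → x ≢ y → g x y · g x y ≡ 1ℤ) → pp g xs · pp g xs ≡ 1ℤ
pp-square {g = g} {xs} u sq = trans (sym (pp-* g g xs)) (pp-one (AllPairs.map sq u))

module _ {X : Set} (σ : Sign X) where
  open Sign σ

  anti·anti : ∀ x y x′ y′ → s y x · s y′ x′ ≡ s x y · s x′ y′
  anti·anti x y x′ y′ = trans (cong₂ _·_ (anti x y) (anti x′ y′)) (⊝·⊝ _ _)

  sq·sq : ∀ {x y x′ y′} → x ≢ y → x′ ≢ y′ → (s x y · s x′ y′) · (s x y · s x′ y′) ≡ 1ℤ
  sq·sq ne ne′ = trans (·-interchange _ _ _ _) (trans (cong₂ _·_ (sq ne) (sq ne′)) (·-identityˡ 1ℤ))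

  sgnL : List X → ℤ
  sgnL = pp s

  sgnL-repeated : ∀ {xs x} → (x , x) ∈ pairs xs → sgnL xs ≡ 0ℤ
  sgnL-repeated x∈ = ∏-zero x∈ (diag _)

  sgnL-sq : ∀ {xs} → Unique xs → sgnL xs · sgnL xs ≡ 1ℤ
  sgnL-sq u = pp-square u sq

  module _ (_≟_ : DecidableEquality X) where

    sgnL-nonunique : ∀ xs → ¬ Unique xs → sgnL xs ≡ 0ℤ
    sgnL-nonunique []       ¬u = contradiction [] ¬u
    sgnL-nonunique (x ∷ xs) ¬u with Any.any? (x ≟_) xs
    ... | yes x∈ = trans (pp-∷ s x xs) (trans (cong (_· sgnL xs) (∏-zero x∈ (diag x))) (·-zeroˡ _))
    ... | no  x∉ = trans (pp-∷ s x xs) (trans (cong (∏ xs (s x) ·_)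
                     (sgnL-nonunique xs (λ u → ¬u (All.¬Any⇒All¬ xs x∉ ∷ u)))) (·-zeroʳ _))

    unique? : ∀ (xs : List X) → Dec (Unique xs)
    unique? = AllPairs.allPairs? (λ x y → ¬? (x ≟ y))

    sgnL≢0⇒unique : ∀ {xs} → sgnL xs ≢ 0ℤ → Unique xs
    sgnL≢0⇒unique {xs} nz with unique? xs
    ... | yes u = u
    ... | no ¬u = contradiction (sgnL-nonunique xs ¬u) nz

  -- For injective h this is -1 exactly at the inversions of h, and it is symmetric. Its product
  -- over all pairs is therefore the sign of h, whatever listing is used.
  twist : (X → X) → X → X → ℤ
  twist h x y = s x y · s (h x) (h y)

  twist-sym : ∀ h x y → twist h x y ≡ twist h y x
  twist-sym h x y = sym (anti·anti x y (h x) (h y))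

  -- A cyclic group of odd order 2m+1 consists of even permutations.
  module _ {m xs} (h : ℕ → X → X) (h-inj : ∀ a {x y} → h a x ≡ h a y → x ≡ y) (h-+ : ∀ a b x → h (a + b) x ≡ h a (h b x))
           (h-id : ∀ a x → h (a + (a * m + a * m)) x ≡ x) (u : Unique xs) (perm : ∀ a → map (h a) xs ↭ xs) where
    private
      κ : ℕ → ℤ
      κ a = pp (twist (h a)) xs

      κ-+ : ∀ a b → κ (a + b) ≡ κ a · κ b
      κ-+ a b = begin
        pp (twist (h (a + b))) xs
          ≡⟨ pp-cong-unique u (λ {x} {y} ne → sym (trans (lem (s (h b x) (h b y)) _ (s x y))
               (trans (cong (_· (s x y · s (h a (h b x)) (h a (h b y)))) (sq (ne ∘ h-inj b))) (trans (·-identityˡ _)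
                 (cong₂ (λ p q → s x y · s p q) (sym (h-+ a b x)) (sym (h-+ a b y))))))) ⟩
        pp (λ x y → twist (h a) (h b x) (h b y) · twist (h b) x y) xs
          ≡⟨ pp-* _ _ xs ⟩
        pp (λ x y → twist (h a) (h b x) (h b y)) xs · κ b
          ≡⟨ cong (_· κ b) (sym (pp-map (twist (h a)) (h b) xs)) ⟩
        pp (twist (h a)) (map (h b) xs) · κ b
          ≡⟨ cong (_· κ b) (pp-↭ (twist-sym (h a)) (perm b)) ⟩
        κ a · κ b ∎
        where
        open ≡-Reasoning
        lem : ∀ p q r → (p · q) · (r · p) ≡ p · p · (r · q)
        lem = solve 3 (λ p q r → (p :* q) :* (r :* p) := p :* p :* (r :* q)) refl

      κ-sq : ∀ a → κ a · κ a ≡ 1ℤ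
      κ-sq a = pp-square u (λ ne → sq·sq ne (ne ∘ h-inj a))

    -- Signs are multiplicative, so 2am steps have the sign of am steps squared, which is 1; and a +
    -- 2am = a(2m+1) steps are the identity.
    pp-twist-odd : ∀ a → pp (twist (h a)) xs ≡ 1ℤ
    pp-twist-odd a = begin
      κ a                                   ≡⟨ ·-identityʳ _ ⟨
      κ a · 1ℤ                              ≡⟨ cong (κ a ·_) (trans (κ-+ (a * m) (a * m)) (κ-sq (a * m))) ⟨
      κ a · κ (a * m + a * m)               ≡⟨ κ-+ a (a * m + a * m) ⟨
      κ (a + (a * m + a * m))               ≡⟨ pp-one (AllPairs.map (λ {x} {y} ne → trans (cong₂ (λ p q → s x y · s p q) (h-id a x) (h-id a y)) (sq ne)) u) ⟩
      1ℤ                                    ∎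
      where open ≡-Reasoning

  -- A list this long without repetitions is a full listing, on which the sign of h is known. With a
  -- repetition both signs are 0.
  sgnL-map-even : ∀ (E : Enumeration X) {h} → (∀ {x y} → h x ≡ h y → x ≡ y) → pp (twist h) (Enumeration.list E) ≡ 1ℤ →
                  ∀ {xs} → length (Enumeration.list E) ≤ length xs → sgnL (map h xs) ≡ sgnL xs
  sgnL-map-even E {h} inj even {xs} len with unique? (Enumeration._≟_ E) xs
  ... | yes u = sym (·-cancel-sign (sgnL-sq u) (begin
    sgnL xs · sgnL (map h xs)                ≡⟨ cong (sgnL xs ·_) (pp-map s h xs) ⟩
    sgnL xs · pp (λ x y → s (h x) (h y)) xs  ≡⟨ pp-* s _ xs ⟨
    pp (twist h) xs                          ≡⟨ pp-↭ (twist-sym h) (full⇒↭ E u len) ⟩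
    pp (twist h) (Enumeration.list E)        ≡⟨ even ⟩
    1ℤ                                       ∎))
    where open ≡-Reasoning
  ... | no ¬u = trans (sgnL-nonunique (Enumeration._≟_ E) (map h xs) (¬u ∘ Unique.map⁻)) (sym (sgnL-nonunique (Enumeration._≟_ E) xs ¬u))

-- Products of affine forms, evaluated by product functionals

Nsum : ∀ {m} → (Fin m → ℕ) → ℕ
Nsum {zero}  a = 0
Nsum {suc m} a = a zero + Nsum (a ∘ suc)

Nsum-mono : ∀ {m} {a b : Fin m → ℕ} → (∀ e → a e ≤ b e) → Nsum a ≤ Nsum b
Nsum-mono {zero}  le = z≤n
Nsum-mono {suc m} le = ℕ.+-mono-≤ (le zero) (Nsum-mono (le ∘ suc))

Nsum-strict : ∀ {m} {a b : Fin m → ℕ} e → (∀ e → a e ≤ b e) → a e < b e → Nsum a < Nsum b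
Nsum-strict zero    le lt = ℕ.+-mono-<-≤ lt (Nsum-mono (le ∘ suc))
Nsum-strict (suc e) le lt = ℕ.+-mono-≤-< (le zero) (Nsum-strict e (le ∘ suc) lt)

Nsum-step : ∀ {m} {a b : Fin m → ℕ} e → (∀ {e′} → e′ ≢ e → a e′ ≤ b e′) → a e ≤ suc (b e) → Nsum a ≤ suc (Nsum b)
Nsum-step zero    le lt = ℕ.+-mono-≤ lt (Nsum-mono (λ e → le {suc e} (λ ())))
Nsum-step {a = a} {b} (suc e) le lt = ℕ.≤-trans (ℕ.+-mono-≤ (le {zero} (λ ())) (Nsum-step e (λ ne → le (ne ∘ Fin.suc-injective)) lt))
                                        (ℕ.≤-reflexive (ℕ.+-suc (b zero) _))

Nsum-pos : ∀ {m} (a : Fin m → ℕ) → 0 < Nsum a → ∃ λ e → 0 < a e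
Nsum-pos {suc m} a lt with a zero in eq
... | suc k = zero , subst (0 <_) (sym eq) (s≤s z≤n)
... | zero with Nsum-pos (a ∘ suc) lt
...   | e , pos = suc e , pos

Nsum-const : ∀ {m} c → Nsum {m} (λ _ → c) ≡ m * c
Nsum-const {zero}  c = refl
Nsum-const {suc m} c = cong (λ n → c + n) (Nsum-const {m} c)

∏-linear : ∀ {X : Set} {xs : List X} {e} {f f₁ f₂ : X → ℤ} {a b} → Unique xs → e ∈ xs →
           (∀ {x} → x ≢ e → f x ≡ f₁ x) → (∀ {x} → x ≢ e → f x ≡ f₂ x) → f e ≡ a · f₁ e ⊕ b · f₂ e →
           ∏ xs f ≡ a · ∏ xs f₁ ⊕ b · ∏ xs f₂
∏-linear {xs = x ∷ xs} {f = f} {f₁} {f₂} {a} {b} (x≢ ∷ u) (here refl) o₁ o₂ at = begin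
  f x · ∏ xs f                                          ≡⟨ cong (_· ∏ xs f) at ⟩
  (a · f₁ x ⊕ b · f₂ x) · ∏ xs f                        ≡⟨ lem a (f₁ x) b (f₂ x) (∏ xs f) ⟩
  a · (f₁ x · ∏ xs f) ⊕ b · (f₂ x · ∏ xs f)
    ≡⟨ cong₂ (λ p q → a · (f₁ x · p) ⊕ b · (f₂ x · q))
         (∏-cong∈ xs (λ y∈ → o₁ (λ { refl → All.lookup x≢ y∈ refl }))) (∏-cong∈ xs (λ y∈ → o₂ (λ { refl → All.lookup x≢ y∈ refl }))) ⟩
  a · (f₁ x · ∏ xs f₁) ⊕ b · (f₂ x · ∏ xs f₂)           ∎
  where
  open ≡-Reasoning
  lem : ∀ a p b q r → (a · p ⊕ b · q) · r ≡ a · (p · r) ⊕ b · (q · r)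
  lem = solve 5 (λ a p b q r → (a :* p :+ b :* q) :* r := a :* (p :* r) :+ b :* (q :* r)) refl
∏-linear {xs = x ∷ xs} {f = f} {f₁} {f₂} {a} {b} (x≢ ∷ u) (there e∈) o₁ o₂ at = begin
  f x · ∏ xs f                                          ≡⟨ cong (f x ·_) (∏-linear u e∈ o₁ o₂ at) ⟩
  f x · (a · ∏ xs f₁ ⊕ b · ∏ xs f₂)                     ≡⟨ lem (f x) a (∏ xs f₁) b (∏ xs f₂) ⟩
  a · (f x · ∏ xs f₁) ⊕ b · (f x · ∏ xs f₂)             ≡⟨ cong₂ (λ p q → a · (p · ∏ xs f₁) ⊕ b · (q · ∏ xs f₂)) (o₁ x≢e) (o₂ x≢e) ⟩
  a · (f₁ x · ∏ xs f₁) ⊕ b · (f₂ x · ∏ xs f₂)           ∎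
  where
  open ≡-Reasoning
  x≢e : x ≢ _
  x≢e refl = All.lookup x≢ e∈ refl
  lem : ∀ r a p b q → r · (a · p ⊕ b · q) ≡ a · (r · p) ⊕ b · (r · q)
  lem = solve 5 (λ r a p b q → r :* (a :* p :+ b :* q) := a :* (r :* p) :+ b :* (r :* q)) refl

∏-allFin-suc : ∀ m (f : Fin (suc m) → ℤ) → ∏ (allFin (suc m)) f ≡ f zero · ∏ (allFin m) (f ∘ suc)
∏-allFin-suc m f = cong (f zero ·_) (trans (cong (λ l → ∏ l f) (sym (List.map-tabulate id suc))) (∏-map suc (allFin m) f))

∏∑≡∑∏ : ∀ {C : Set} (cs : List C) m (W : Fin m → C → ℤ) →
        ∏ (allFin m) (λ e → ∑ cs (W e)) ≡ ∑ (allVecs cs m) (λ v → ∏ (allFin m) (λ e → W e (Vec.lookup v e)))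
∏∑≡∑∏ cs zero    W = sym (⊕-identityʳ 1ℤ)
∏∑≡∑∏ cs (suc m) W = begin
  ∏ (allFin (suc m)) (λ e → ∑ cs (W e))
    ≡⟨ ∏-allFin-suc m _ ⟩
  ∑ cs (W zero) · ∏ (allFin m) (λ e → ∑ cs (W (suc e)))
    ≡⟨ cong (∑ cs (W zero) ·_) (∏∑≡∑∏ cs m (W ∘ suc)) ⟩
  ∑ cs (W zero) · ∑ (allVecs cs m) (λ v → ∏ (allFin m) (λ e → W (suc e) (Vec.lookup v e)))
    ≡⟨ ∑-*ʳ cs _ (W zero) ⟨
  ∑ cs (λ c → W zero c · ∑ (allVecs cs m) (λ v → ∏ (allFin m) (λ e → W (suc e) (Vec.lookup v e))))
    ≡⟨ ∑-cong cs (λ c → trans (sym (∑-*ˡ (allVecs cs m) (W zero c) _)) (∑-cong (allVecs cs m) (λ v → sym (∏-allFin-suc m _)))) ⟩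
  ∑ cs (λ c → ∑ (allVecs cs m) (λ v → ∏ (allFin (suc m)) (λ e → W e (Vec.lookup (c ∷ v) e))))
    ≡⟨ ∑-allVecs cs m _ ⟨
  ∑ (allVecs cs (suc m)) (λ v → ∏ (allFin (suc m)) (λ e → W e (Vec.lookup v e))) ∎
  where open ≡-Reasoning

module _ {m : ℕ} where

  Form : Set
  Form = List (ℤ × Fin m) × ℤ

  evalForm : Form → (Fin m → ℤ) → ℤ
  evalForm (l , c) x = ∑ l (λ (a , e) → a · x e) ⊕ c

  -- Multiplication of the polynomial by the variable of e, carried over to the functional: every
  -- exponent of that variable rises by one.
  shift : Fin m → (Fin m → ℕ → ℤ) → Fin m → ℕ → ℤ
  shift e φ e′ j = if does (e′ Fin.≟ e) then φ e′ (suc j) else φ e′ j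

  shift-here : ∀ e φ j → shift e φ e j ≡ φ e (suc j)
  shift-here e φ j rewrite dec-true (e Fin.≟ e) refl = refl

  -- Φ L φ is the value on the polynomial ∏ L of the linear functional
  -- that sends the monomial ∏ xₑ ^ jₑ to ∏ φ e jₑ.
  Φ : List Form → (Fin m → ℕ → ℤ) → ℤ
  Φ []            φ = ∏ (allFin m) (λ e → φ e 0)
  Φ ((l , c) ∷ L) φ = ∑ l (λ (a , e) → a · Φ L (shift e φ)) ⊕ c · Φ L φ

  Φ-local : ∀ L {φ ψ} → (∀ e j → j ≤ length L → φ e j ≡ ψ e j) → Φ L φ ≡ Φ L ψ
  Φ-local []            eq = ∏-cong (allFin m) (λ e → eq e 0 z≤n)
  Φ-local ((l , c) ∷ L) {φ} {ψ} eq =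
    cong₂ _⊕_ (∑-cong l (λ (a , e) → cong (a ·_) (Φ-local L (λ e′ j le → lem e e′ j le))))
              (cong (c ·_) (Φ-local L (λ e j le → eq e j (ℕ.m≤n⇒m≤1+n le))))
    where
    lem : ∀ e e′ j → j ≤ length L → shift e φ e′ j ≡ shift e ψ e′ j
    lem e e′ j le with does (e′ Fin.≟ e)
    ... | true  = eq e′ (suc j) (s≤s le)
    ... | false = eq e′ j (ℕ.m≤n⇒m≤1+n le)

  Φ-cong : ∀ L {φ ψ} → (∀ e j → φ e j ≡ ψ e j) → Φ L φ ≡ Φ L ψ
  Φ-cong L eq = Φ-local L (λ e j _ → eq e j)

  Φ-vanish : ∀ l c L {φ} → (∀ {a e} → (a , e) ∈ l → Φ L (shift e φ) ≡ 0ℤ) → c · Φ L φ ≡ 0ℤ → Φ ((l , c) ∷ L) φ ≡ 0ℤ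
  Φ-vanish l c L hs hc = trans (cong₂ _⊕_ (∑-zero l (λ {(a , e)} ∈l → trans (cong (a ·_) (hs ∈l)) (·-zeroʳ a))) hc) (⊕-identityˡ 0ℤ)

  Φ-null : ∀ L {φ} e → (∀ j → φ e j ≡ 0ℤ) → Φ L φ ≡ 0ℤ
  Φ-null []            e z = ∏-zero (∈.∈-allFin e) (z 0)
  Φ-null ((l , c) ∷ L) {φ} e z =
    Φ-vanish l c L (λ {_} {e′} _ → Φ-null L e (λ j → lem e′ j)) (trans (cong (c ·_) (Φ-null L e z)) (·-zeroʳ c))
    where
    lem : ∀ e′ j → shift e′ φ e j ≡ 0ℤ
    lem e′ j with does (e Fin.≟ e′)
    ... | true  = z (suc j)
    ... | false = z j

  private
    lower : (Fin m → ℕ) → Fin m → Fin m → ℕ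
    lower a e e′ = if does (e′ Fin.≟ e) then pred (a e′) else a e′

    lower-there : ∀ a {e e′} → e′ ≢ e → lower a e e′ ≡ a e′
    lower-there a {e} {e′} ne rewrite dec-false (e′ Fin.≟ e) ne = refl

    lower-here : ∀ a e → lower a e e ≡ pred (a e)
    lower-here a e rewrite dec-true (e Fin.≟ e) refl = refl

    lower-≤ : ∀ a e → Nsum a ≤ suc (Nsum (lower a e))
    lower-≤ a e = Nsum-step e (λ ne → ℕ.≤-reflexive (sym (lower-there a ne)))
                    (subst (λ z → a e ≤ suc z) (sym (lower-here a e)) (≤-suc-pred (a e)))
      where
      ≤-suc-pred : ∀ n → n ≤ suc (pred n)
      ≤-suc-pred zero    = z≤n
      ≤-suc-pred (suc n) = ℕ.≤-refl

  Vanishes-below : (Fin m → ℕ) → (Fin m → ℕ → ℤ) → Set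
  Vanishes-below a φ = ∀ e j → j < a e → φ e j ≡ 0ℤ

  private
    below-shift : ∀ {a φ} e → Vanishes-below a φ → Vanishes-below (lower a e) (shift e φ)
    below-shift {a} {φ} e v e′ j lt with does (e′ Fin.≟ e)
    ... | true  = v e′ (suc j) (ℕ.<-≤-trans (s≤s lt) (suc-pred (a e′) lt))
      where suc-pred : ∀ n {j} → j < pred n → suc (pred n) ≤ n
            suc-pred (suc n) _ = ℕ.≤-refl
    ... | false = v e′ j lt

  -- A product of these forms has degree at most `length L`, so in each of its monomials some
  -- exponent stays below the bound in `a`.
  Φ-low : ∀ L {a φ} → Vanishes-below a φ → length L < Nsum a → Φ L φ ≡ 0ℤ
  Φ-low []            {a} v lt with Nsum-pos a lt
  ... | e , pos = ∏-zero (∈.∈-allFin e) (v e 0 pos)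
  Φ-low ((l , c) ∷ L) {a} {φ} v lt = Φ-vanish l c L
    (λ {_} {e} _ → Φ-low L {lower a e} (below-shift e v) (ℕ.s<s⁻¹ (ℕ.<-≤-trans lt (lower-≤ a e))))
    (trans (cong (c ·_) (Φ-low L v (ℕ.<-trans (ℕ.n<1+n _) lt))) (·-zeroʳ c))

  -- Functionals vanishing below a see only the leading forms, and only through φ e (a e).
  Φ-top : ∀ L L′ {a φ ψ} → map proj₁ L ≡ map proj₁ L′ → Vanishes-below a φ → Vanishes-below a ψ →
          (∀ e → φ e (a e) ≡ ψ e (a e)) → length L ≤ Nsum a → Φ L φ ≡ Φ L′ ψ
  Φ-top [] [] {a} {φ} {ψ} _ v w eq le with Nsum a in sum
  ... | suc _ = trans (Φ-low [] v (subst (0 <_) (sym sum) (s≤s z≤n))) (sym (Φ-low [] w (subst (0 <_) (sym sum) (s≤s z≤n))))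
  ... | zero  = ∏-cong (allFin m) at0
    where
    at0 : ∀ e → φ e 0 ≡ ψ e 0
    at0 e with a e | eq e | v e 0 | w e 0
    ... | zero  | p | _ | _ = p
    ... | suc _ | _ | q | r = trans (q (s≤s z≤n)) (sym (r (s≤s z≤n)))
  Φ-top ((l , c) ∷ L) ((l′ , c′) ∷ L′) {a} {φ} {ψ} ls v w eq le with List.∷-injective ls
  ... | refl , ls′ = cong₂ _⊕_ (∑-cong l (λ (b , e) → cong (b ·_) (rec e)))
                       (trans (zero-const c (Φ-low L v le)) (sym (zero-const c′ (Φ-low L′ w (subst (_< Nsum a) len le)))))
    where
    len : length L ≡ length L′
    len = trans (sym (List.length-map proj₁ L)) (trans (cong length ls′) (List.length-map proj₁ L′))
    zero-const : ∀ c {x} → x ≡ 0ℤ → c · x ≡ 0ℤ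
    zero-const c refl = ·-zeroʳ c
    rec : ∀ e → Φ L (shift e φ) ≡ Φ L′ (shift e ψ)
    rec e with a e in ae
    ... | zero = trans (Φ-low L (below-same v) le) (sym (Φ-low L′ (below-same w) (subst (_< Nsum a) len le)))
      where
      below-same : ∀ {χ} → Vanishes-below a χ → Vanishes-below a (shift e χ)
      below-same {χ} v e′ j lt with e′ Fin.≟ e
      ... | no _     = v e′ j lt
      ... | yes refl = contradiction (subst (j <_) ae lt) λ ()
    ... | suc k = Φ-top L L′ {lower a e} ls′ (below-shift e v) (below-shift e w) at (ℕ.s≤s⁻¹ (ℕ.≤-trans le (lower-≤ a e)))
      where
      at : ∀ e′ → shift e φ e′ (lower a e e′) ≡ shift e ψ e′ (lower a e e′)
      at e′ with e′ Fin.≟ e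
      ... | no _     = eq e′
      ... | yes refl = subst (λ z → φ e z ≡ ψ e z) (trans ae (sym (cong (λ z → suc (pred z)) ae))) (eq e)

  -- Homogeneous forms give monomials of degree exactly `length L`. When this exceeds the sum of the
  -- bounds `b`, every monomial exceeds one of them.
  Φ-high : ∀ L {b φ} → All (λ ℓ → proj₂ ℓ ≡ 0ℤ) L → (∀ e j → b e < j → φ e j ≡ 0ℤ) → Nsum b < length L → Φ L φ ≡ 0ℤ
  Φ-high ((l , c) ∷ L) {b} {φ} (refl ∷ hom) v lt = Φ-vanish l 0ℤ L (λ {_} {e} _ → rec e) (·-zeroˡ _)
    where
    rec : ∀ e → Φ L (shift e φ) ≡ 0ℤ
    rec e with b e in be
    ... | zero  = Φ-null L e (λ j → trans (shift-here e φ j) (v e (suc j) (subst (_< suc j) (sym be) (s≤s z≤n))))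
    ... | suc k = Φ-high L {lower b e} hom below (ℕ.<-≤-trans (Nsum-strict e lower≤ lower<) (ℕ.s≤s⁻¹ lt))
      where
      lower≤ : ∀ e′ → lower b e e′ ≤ b e′
      lower≤ e′ with does (e′ Fin.≟ e)
      ... | true  = ℕ.pred[n]≤n
      ... | false = ℕ.≤-refl
      lower< : lower b e e < b e
      lower< = subst (_< b e) (sym (lower-here b e)) (subst (λ z → pred z < z) (sym be) (ℕ.n<1+n k))
      below : ∀ e′ j → lower b e e′ < j → shift e φ e′ j ≡ 0ℤ
      below e′ j lt with e′ Fin.≟ e
      ... | no _     = v e′ j lt
      ... | yes refl = v e (suc j) (subst (_< suc j) (sym be) (s≤s (subst (λ z → pred z < j) be lt)))

  Φ-linear : ∀ L {φ φ₁ φ₂ a b} e → (∀ {e′} → e′ ≢ e → ∀ j → φ e′ j ≡ φ₁ e′ j) → (∀ {e′} → e′ ≢ e → ∀ j → φ e′ j ≡ φ₂ e′ j) →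
             (∀ j → φ e j ≡ a · φ₁ e j ⊕ b · φ₂ e j) → Φ L φ ≡ a · Φ L φ₁ ⊕ b · Φ L φ₂
  Φ-linear [] e o₁ o₂ at = ∏-linear (Unique.allFin⁺ m) (∈.∈-allFin e) (λ ne → o₁ ne 0) (λ ne → o₂ ne 0) (at 0)
  Φ-linear ((l , c) ∷ L) {φ} {φ₁} {φ₂} {a} {b} e o₁ o₂ at = begin
    ∑ l (λ (d , f) → d · Φ L (shift f φ)) ⊕ c · Φ L φ
      ≡⟨ cong₂ _⊕_ (trans (∑-cong l (λ (d , f) → trans (cong (d ·_) (Φ-linear L e (o₁′ f) (o₂′ f) (at′ f))) (lem₁ d a b _ _)))
                     (trans (∑-+ l _ _) (cong₂ _⊕_ (∑-*ˡ l a _) (∑-*ˡ l b _))))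
                   (cong (c ·_) (Φ-linear L e o₁ o₂ at)) ⟩
    (a · ∑ l (λ (d , f) → d · Φ L (shift f φ₁)) ⊕ b · ∑ l (λ (d , f) → d · Φ L (shift f φ₂))) ⊕ c · (a · Φ L φ₁ ⊕ b · Φ L φ₂)
      ≡⟨ lem₂ a b c _ _ _ _ ⟩
    a · (∑ l (λ (d , f) → d · Φ L (shift f φ₁)) ⊕ c · Φ L φ₁) ⊕ b · (∑ l (λ (d , f) → d · Φ L (shift f φ₂)) ⊕ c · Φ L φ₂) ∎
    where
    open ≡-Reasoning
    lem₁ : ∀ d a b x y → d · (a · x ⊕ b · y) ≡ a · (d · x) ⊕ b · (d · y)
    lem₁ = solve 5 (λ d a b x y → d :* (a :* x :+ b :* y) := a :* (d :* x) :+ b :* (d :* y)) refl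
    lem₂ : ∀ a b c x y z w → (a · x ⊕ b · y) ⊕ c · (a · z ⊕ b · w) ≡ a · (x ⊕ c · z) ⊕ b · (y ⊕ c · w)
    lem₂ = solve 7 (λ a b c x y z w → (a :* x :+ b :* y) :+ c :* (a :* z :+ b :* w) := a :* (x :+ c :* z) :+ b :* (y :+ c :* w)) refl
    o₁′ : ∀ f {e′} → e′ ≢ e → ∀ j → shift f φ e′ j ≡ shift f φ₁ e′ j
    o₁′ f {e′} ne j with does (e′ Fin.≟ f)
    ... | true  = o₁ ne (suc j)
    ... | false = o₁ ne j
    o₂′ : ∀ f {e′} → e′ ≢ e → ∀ j → shift f φ e′ j ≡ shift f φ₂ e′ j
    o₂′ f {e′} ne j with does (e′ Fin.≟ f)
    ... | true  = o₂ ne (suc j)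
    ... | false = o₂ ne j
    at′ : ∀ f j → shift f φ e j ≡ a · shift f φ₁ e j ⊕ b · shift f φ₂ e j
    at′ f j with does (e Fin.≟ f)
    ... | true  = at (suc j)
    ... | false = at j

  -- The link between coefficients and counts: if each local functional is a weighted sum of point
  -- evaluations, then Φ is a weighted sum of values of the polynomial over all assignments.
  Φ-eval : ∀ {C : Set} (cs : List C) (val : C → ℤ) L (W : Fin m → C → ℤ) →
    Φ L (λ e j → ∑ cs (λ c → W e c · val c ↑ j)) ≡
    ∑ (allVecs cs m) (λ v → ∏ (allFin m) (λ e → W e (Vec.lookup v e)) · ∏ L (λ ℓ → evalForm ℓ (val ∘ Vec.lookup v)))
  Φ-eval cs val [] W = trans (∏-cong (allFin m) (λ e → ∑-cong cs (λ c → ·-identityʳ (W e c))))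
    (trans (∏∑≡∑∏ cs m W) (∑-cong (allVecs cs m) (λ v → sym (·-identityʳ _))))
  Φ-eval {C} cs val ((l , c₀) ∷ L) W = begin
    ∑ l (λ (a , e) → a · Φ L (shift e φ)) ⊕ c₀ · Φ L φ
      ≡⟨ cong₂ _⊕_ (∑-cong l (λ (a , e) → cong (a ·_) (rec e))) (cong (c₀ ·_) (Φ-eval cs val L W)) ⟩
    ∑ l (λ (a , e) → a · ∑ vs (λ v → w v · x v e · P v)) ⊕ c₀ · ∑ vs (λ v → w v · P v)
      ≡⟨ cong₂ _⊕_ (∑-cong l (λ (a , e) → sym (∑-*ˡ vs a _))) (sym (∑-*ˡ vs c₀ _)) ⟩
    ∑ l (λ (a , e) → ∑ vs (λ v → a · (w v · x v e · P v))) ⊕ ∑ vs (λ v → c₀ · (w v · P v))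
      ≡⟨ cong (_⊕ ∑ vs (λ v → c₀ · (w v · P v))) (∑-swap l vs _) ⟩
    ∑ vs (λ v → ∑ l (λ (a , e) → a · (w v · x v e · P v))) ⊕ ∑ vs (λ v → c₀ · (w v · P v))
      ≡⟨ ∑-+ vs _ _ ⟨
    ∑ vs (λ v → ∑ l (λ (a , e) → a · (w v · x v e · P v)) ⊕ c₀ · (w v · P v))
      ≡⟨ ∑-cong vs (λ v → trans (cong (_⊕ c₀ · (w v · P v)) (trans (∑-cong l (λ (a , e) → lem₁ a (w v) (x v e) (P v))) (∑-*ʳ l (w v · P v) _)))
                            (lem₂ (∑ l (λ (a , e) → a · x v e)) c₀ (w v) (P v))) ⟩
    ∑ vs (λ v → w v · (evalForm (l , c₀) (x v) · P v)) ∎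
    where
    open ≡-Reasoning
    vs = allVecs cs m
    φ : Fin m → ℕ → ℤ
    φ e j = ∑ cs (λ c → W e c · val c ↑ j)
    w : Vec C m → ℤ
    w v = ∏ (allFin m) (λ e → W e (Vec.lookup v e))
    x : Vec C m → Fin m → ℤ
    x v = val ∘ Vec.lookup v
    P : Vec C m → ℤ
    P v = ∏ L (λ ℓ → evalForm ℓ (x v))
    lem₁ : ∀ a w x P → a · (w · x · P) ≡ a · x · (w · P)
    lem₁ = solve 4 (λ a w x P → a :* (w :* x :* P) := a :* x :* (w :* P)) refl
    lem₂ : ∀ s c w P → s · (w · P) ⊕ c · (w · P) ≡ w · ((s ⊕ c) · P)
    lem₂ = solve 4 (λ s c w P → s :* (w :* P) :+ c :* (w :* P) := w :* ((s :+ c) :* P)) refl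
    factor : Fin m → Fin m → C → ℤ
    factor e e′ c = if does (e′ Fin.≟ e) then val c else 1ℤ
    rec : ∀ e → Φ L (shift e φ) ≡ ∑ vs (λ v → w v · x v e · P v)
    rec e = trans (Φ-cong L shifted) (trans (Φ-eval cs val L (λ e′ c → W e′ c · factor e e′ c))
              (∑-cong vs (λ v → cong (_· P v) (trans (∏-* (allFin m) (λ e′ → W e′ (Vec.lookup v e′)) _) (cong (w v ·_)
                (trans (∏-single (Unique.allFin⁺ m) (∈.∈-allFin e) (off v)) (on v)))))))
      where
      shifted : ∀ e′ j → shift e φ e′ j ≡ ∑ cs (λ c → W e′ c · factor e e′ c · val c ↑ j)
      shifted e′ j with does (e′ Fin.≟ e)
      ... | true  = ∑-cong cs (λ c → sym (·-assoc (W e′ c) (val c) (val c ↑ j)))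
      ... | false = ∑-cong cs (λ c → cong (_· val c ↑ j) (sym (·-identityʳ (W e′ c))))
      off : ∀ v {e′} → e′ ≢ e → factor e e′ (Vec.lookup v e′) ≡ 1ℤ
      off v {e′} ne rewrite dec-false (e′ Fin.≟ e) ne = refl
      on : ∀ v → factor e e (Vec.lookup v e) ≡ x v e
      on v rewrite dec-true (e Fin.≟ e) refl = refl

  module _ where
    update : Fin m → (ℕ → ℤ) → (Fin m → ℕ → ℤ) → Fin m → ℕ → ℤ
    update e ψ φ e′ = if does (e′ Fin.≟ e) then ψ else φ e′

    update-here : ∀ e ψ φ → update e ψ φ e ≡ ψ
    update-here e ψ φ rewrite dec-true (e Fin.≟ e) refl = refl

    update-there : ∀ {e e′} ψ φ → e′ ≢ e → update e ψ φ e′ ≡ φ e′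
    update-there {e} {e′} ψ φ ne rewrite dec-false (e′ Fin.≟ e) ne = refl

    -- The local functionals are exchanged one variable at a time, each choice depending on the
    -- earlier ones. A variable still has its original functional when its turn comes, so `P` and
    -- `Q` may refer to the original.
    replace-all : ∀ L (P : Fin m → (ℕ → ℤ) → Set) (Q : Fin m → (ℕ → ℤ) → (ℕ → ℤ) → Set) →
      (∀ φ e → P e (φ e) → Φ L φ ≢ 0ℤ → ∃ λ ψ → Q e (φ e) ψ × Φ L (update e ψ φ) ≢ 0ℤ) →
      ∀ φ → (∀ e → P e (φ e)) → Φ L φ ≢ 0ℤ → ∃ λ φ′ → Φ L φ′ ≢ 0ℤ × (∀ e → Q e (φ e) (φ′ e))
    replace-all L P Q step φ pre nz =
      let φ′ , nz′ , q , _ = go (allFin m) (Unique.allFin⁺ m) in φ′ , nz′ , λ e → q (∈.∈-allFin e)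
      where
      go : ∀ es → Unique es → ∃ λ φ′ → Φ L φ′ ≢ 0ℤ × (∀ {e} → e ∈ es → Q e (φ e) (φ′ e)) × (∀ {e} → e ∉ es → φ′ e ≡ φ e)
      go []       _        = φ , nz , (λ ()) , λ _ → refl
      go (x ∷ es) (x≢ ∷ u) =
        let φ′ , nz′ , q , same = go es u
            same-x = same (∉-head x≢)
            ψ , qx , nz″ = step φ′ x (subst (P x) (sym same-x) (pre x)) nz′
        in update x ψ φ′ , nz″ ,
           (λ { (here refl) → subst₂ (Q x) same-x (sym (update-here x ψ φ′)) qx
              ; (there e∈) → subst (Q _ (φ _)) (sym (update-there ψ φ′ (λ { refl → ∉-head x≢ e∈ }))) (q e∈) }) ,
           (λ e∉ → trans (update-there ψ φ′ (e∉ ∘ here)) (same (e∉ ∘ there)))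

  -- As a product functional this extracts the coefficient of the monomial with exponents β.
  δ : (Fin m → ℕ) → Fin m → ℕ → ℤ
  δ β e j = ⟦ j ℕ.≟ β e ⟧

  private
    -- Exponents above `length L` never matter, so the functional at e can be cut off and is then a
    -- finite combination of coefficient extractions. A nonzero value survives in one of the terms.
    pure-step : ∀ L φ e → Φ L φ ≢ 0ℤ → ∃ λ j → φ e j ≢ 0ℤ × Φ L (update e (λ i → ⟦ i ℕ.≟ j ⟧) φ) ≢ 0ℤ
    pure-step L φ e nz = go (suc (length L)) (λ z → nz (trans (sym (Φ-local L whole)) z))
      where
      cut : ℕ → ℕ → ℤ
      cut N i = ⟦ i ℕ.<? N ⟧ · φ e i
      whole : ∀ e′ j → j ≤ length L → update e (cut (suc (length L))) φ e′ j ≡ φ e′ j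
      whole e′ j le with e′ Fin.≟ e
      ... | no _     = refl
      ... | yes refl = trans (cong (_· φ e j) (⟦⟧-yes (j ℕ.<? suc (length L)) (s≤s le))) (·-identityˡ _)
      single : ℕ → Fin m → ℕ → ℤ
      single N = update e (λ i → ⟦ i ℕ.≟ N ⟧) φ
      cut-suc : ∀ N j → cut (suc N) j ≡ 1ℤ · cut N j ⊕ φ e N · ⟦ j ℕ.≟ N ⟧
      cut-suc N j with ℕ.<-cmp j N
      ... | tri< j<N j≢N _ rewrite ⟦⟧-yes (j ℕ.<? suc N) (ℕ.m<n⇒m<1+n j<N) | ⟦⟧-yes (j ℕ.<? N) j<N | ⟦⟧-no (j ℕ.≟ N) j≢N = lem (φ e j) (φ e N)
        where lem : ∀ a b → 1ℤ · a ≡ 1ℤ · (1ℤ · a) ⊕ b · 0ℤ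
              lem = solve 2 (λ a b → con 1ℤ :* a := con 1ℤ :* (con 1ℤ :* a) :+ b :* con 0ℤ) refl
      ... | tri≈ j≮N refl _ rewrite ⟦⟧-yes (N ℕ.<? suc N) (ℕ.n<1+n N) | ⟦⟧-no (N ℕ.<? N) j≮N | ⟦⟧-yes (N ℕ.≟ N) refl = lem (φ e N)
        where lem : ∀ a → 1ℤ · a ≡ 1ℤ · (0ℤ · a) ⊕ a · 1ℤ
              lem = solve 1 (λ a → con 1ℤ :* a := con 1ℤ :* (con 0ℤ :* a) :+ a :* con 1ℤ) refl
      ... | tri> j≮N j≢N N<j rewrite ⟦⟧-no (j ℕ.<? suc N) (λ lt → ℕ.<⇒≱ N<j (ℕ.s≤s⁻¹ lt)) | ⟦⟧-no (j ℕ.<? N) j≮N | ⟦⟧-no (j ℕ.≟ N) j≢N = lem (φ e j) (φ e N)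
        where lem : ∀ a b → 0ℤ · a ≡ 1ℤ · (0ℤ · a) ⊕ b · 0ℤ
              lem = solve 2 (λ a b → con 0ℤ :* a := con 1ℤ :* (con 0ℤ :* a) :+ b :* con 0ℤ) refl
      split : ∀ N → Φ L (update e (cut (suc N)) φ) ≡ 1ℤ · Φ L (update e (cut N) φ) ⊕ φ e N · Φ L (single N)
      split N = Φ-linear L e
        (λ ne j → cong (λ f → f j) (trans (update-there _ φ ne) (sym (update-there _ φ ne))))
        (λ ne j → cong (λ f → f j) (trans (update-there _ φ ne) (sym (update-there _ φ ne))))
        (λ j → trans (cong (λ f → f j) (update-here e _ φ)) (trans (cut-suc N j)
           (cong₂ (λ p q → 1ℤ · p ⊕ φ e N · q) (cong (λ f → f j) (sym (update-here e (cut N) φ)))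
                                                (cong (λ f → f j) (sym (update-here e (λ i → ⟦ i ℕ.≟ N ⟧) φ))))))
      go : ∀ N → Φ L (update e (cut N) φ) ≢ 0ℤ → ∃ λ j → φ e j ≢ 0ℤ × Φ L (single j) ≢ 0ℤ
      go zero    nz = contradiction (Φ-null L e (λ j → trans (cong (λ f → f j) (update-here e (cut 0) φ))
                        (trans (cong (_· φ e j) (⟦⟧-no (j ℕ.<? 0) λ ())) (·-zeroˡ _)))) nz
      go (suc N) nz with Φ L (update e (cut N) φ) ℤ.≟ 0ℤ | φ e N ℤ.≟ 0ℤ | Φ L (single N) ℤ.≟ 0ℤ
      ... | no nz′ | _      | _      = go N nz′
      ... | yes _  | no a≢0 | no b≢0 = N , a≢0 , b≢0
      ... | yes z  | yes a  | _      = contradiction (trans (split N) (trans (cong₂ (λ p q → 1ℤ · p ⊕ q · Φ L (single N)) z a) (lem _))) nz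
        where lem : ∀ x → 1ℤ · 0ℤ ⊕ 0ℤ · x ≡ 0ℤ
              lem = solve 1 (λ x → con 1ℤ :* con 0ℤ :+ con 0ℤ :* x := con 0ℤ) refl
      ... | yes z  | no _   | yes b  = contradiction (trans (split N) (trans (cong₂ (λ p q → 1ℤ · p ⊕ φ e N · q) z b) (lem _))) nz
        where lem : ∀ x → 1ℤ · 0ℤ ⊕ x · 0ℤ ≡ 0ℤ
              lem = solve 1 (λ x → con 1ℤ :* con 0ℤ :+ x :* con 0ℤ := con 0ℤ) refl

  monomial : ∀ L φ → Φ L φ ≢ 0ℤ → ∃ λ β → Φ L (δ β) ≢ 0ℤ × (∀ e → φ e (β e) ≢ 0ℤ)
  monomial L φ nz with replace-all L (λ _ _ → Unit) (λ _ ψ ψ′ → ∃ λ j → ψ j ≢ 0ℤ × ψ′ ≡ (λ i → ⟦ i ℕ.≟ j ⟧))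
                        (λ φ e _ nz → let j , a , b = pure-step L φ e nz in (λ i → ⟦ i ℕ.≟ j ⟧) , (j , a , refl) , b)
                        φ (λ _ → tt) nz
  ... | φ′ , nz′ , q = (λ e → proj₁ (q e)) , (λ z → nz′ (trans (Φ-cong L (λ e j → cong (λ f → f j) (proj₂ (proj₂ (q e))))) z)) , λ e → proj₁ (proj₂ (q e))

  difference : Fin m → Fin m → Form
  difference e f = (1ℤ , e) ∷ (-1ℤ , f) ∷ [] , 0ℤ

  -- If x_e and x_f are both evaluated at 1, a factor x_e - x_f vanishes.
  Φ-difference : ∀ {L φ e f} → difference e f ∈ L → (∀ j → φ e j ≡ 1ℤ) → (∀ j → φ f j ≡ 1ℤ) → Φ L φ ≡ 0ℤ
  Φ-difference {_ ∷ L} {φ} {e} {f} (here refl) at-e at-f =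
    trans (cong₂ (λ p q → (1ℤ · p ⊕ (-1ℤ · q ⊕ 0ℤ)) ⊕ 0ℤ · Φ L φ) (Φ-cong L (constant e at-e)) (Φ-cong L (constant f at-f))) (lem (Φ L φ))
    where
    lem : ∀ x → (1ℤ · x ⊕ (-1ℤ · x ⊕ 0ℤ)) ⊕ 0ℤ · x ≡ 0ℤ
    lem = solve 1 (λ x → (con 1ℤ :* x :+ (con -1ℤ :* x :+ con 0ℤ)) :+ con 0ℤ :* x := con 0ℤ) refl
    constant : ∀ e → (∀ j → φ e j ≡ 1ℤ) → ∀ e′ j → shift e φ e′ j ≡ φ e′ j
    constant e at e′ j with e′ Fin.≟ e
    ... | yes refl = trans (at (suc j)) (sym (at j))
    ... | no _     = refl
  Φ-difference {(l , c) ∷ L} {φ} {e} {f} (there ∈L) at-e at-f =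
    Φ-vanish l c L (λ {_} {e′} _ → Φ-difference ∈L (still e′ at-e) (still e′ at-f))
                 (trans (cong (c ·_) (Φ-difference ∈L at-e at-f)) (·-zeroʳ c))
    where
    still : ∀ e′ {e} → (∀ j → φ e j ≡ 1ℤ) → ∀ j → shift e′ φ e j ≡ 1ℤ
    still e′ {e} at j with does (e Fin.≟ e′)
    ... | true  = at (suc j)
    ... | false = at j

─-∉ : ∀ {n} (p q : Subset n) {x} → x Subset.∈ p Subset.─ q → x Subset.∉ q
─-∉ (outside ∷ p) (inside ∷ q)  {zero}  ()
─-∉ (inside ∷ p)  (inside ∷ q)  {zero}  ()
─-∉ (_ ∷ p)       (outside ∷ q) {zero}  _            ()
─-∉ (_ ∷ p)       (inside ∷ q)  {suc x} (Vec.there ∈p) (Vec.there ∈q) = ─-∉ p q ∈p ∈q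
─-∉ (_ ∷ p)       (outside ∷ q) {suc x} (Vec.there ∈p) (Vec.there ∈q) = ─-∉ p q ∈p ∈q

-- The online version of the theorem of Alon and Tarsi

module AlonTarsi (G : Graph) (L : List (Form {length (edgeList G)}))
  (homogeneous : All (λ ℓ → proj₂ ℓ ≡ 0ℤ) L)
  (complete : ∀ e f → AdjacentEdges G e f → difference e f ∈ L ⊎ difference f e ∈ L) where

  private
    E = Edge G
    ES = EdgeSet G

    -- The monomial x ^ β occurs in the graph polynomial, with fewer factors
    -- of each uncoloured edge than it has tokens; coloured edges are free.
    Inv : ES → (E → ℕ) → Set
    Inv U t = ∃ λ (β : E → ℕ) → Φ L (δ β) ≢ 0ℤ × (∀ e → e Subset.∈ U → β e < t e)

    degree : ∀ {β} → Φ L (δ β) ≢ 0ℤ → length L ≤ Nsum β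
    degree {β} nz = ℕ.≮⇒≥ (λ lt → nz (Φ-high L homogeneous (λ e j β<j → ⟦⟧-no (j ℕ.≟ β e) (λ { refl → ℕ.<-irrefl refl β<j })) lt))

    -- The outcome of a round for one edge. Evaluation at 1 stands for being coloured. The negative
    -- truncation stands for being marked but not coloured: only exponents below β e remain, which
    -- pays for the lost token. An unmarked edge keeps its exponent.
    data Fate (S : ES) (β : E → ℕ) (e : E) (ψ : ℕ → ℤ) : Set where
      taken : e Subset.∈ S → (∀ j → ψ j ≡ 1ℤ) → Fate S β e ψ
      kept  : e Subset.∈ S → (∀ j → ψ j ≡ ⊝ ⟦ j ℕ.<? β e ⟧) → Fate S β e ψ
      idle  : e Subset.∉ S → (∀ j → ψ j ≡ ⟦ j ℕ.≟ β e ⟧) → Fate S β e ψ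

    isTaken : ∀ {S β e ψ} → Fate S β e ψ → Bool
    isTaken (taken _ _) = inside
    isTaken _           = outside

    taken-∈ : ∀ {S β e ψ} (d : Fate S β e ψ) → isTaken d ≡ inside → e Subset.∈ S × (∀ j → ψ j ≡ 1ℤ)
    taken-∈ (taken e∈S one) _ = e∈S , one

    remaining : ∀ {S β e ψ b} t (d : Fate S β e ψ) → isTaken d ≢ inside → ψ b ≢ 0ℤ → β e < t e → b < removeTokens G S t e
    remaining t (taken _ _) nt _ _ = contradiction refl nt
    remaining {S} {β} {e} {b = b} t (kept e∈S v) _ ψ≢0 lt with b ℕ.<? β e
    ... | yes b<β = subst (λ d → b < (if d then pred (t e) else t e)) (sym (dec-true (e Subset.∈? S) e∈S)) (ℕ.<-≤-trans b<β (ℕ.pred-mono-≤ lt))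
    ... | no b≮β  = contradiction (trans (v b) (trans (cong ⊝_ (⟦⟧-no (b ℕ.<? β e) b≮β)) (solve 0 (:- con 0ℤ := con 0ℤ) refl))) ψ≢0
    remaining {S} {β} {e} {b = b} t (idle e∉S v) _ ψ≢0 lt with b ℕ.≟ β e
    ... | yes refl = subst (λ d → b < (if d then pred (t e) else t e)) (sym (dec-false (e Subset.∈? S) e∉S)) lt
    ... | no ne    = contradiction (trans (v b) (⟦⟧-no (b ℕ.≟ β e) ne)) ψ≢0

    module Round (S : ES) (β : E → ℕ) (nz : Φ L (δ β) ≢ 0ℤ) where

      -- On monomials of degree ∣ β ∣ the truncation [ β e ≤ j ] has the same
      -- effect as [ j ≡ β e ], and it is the evaluation at 1 minus [ j < β e ].
      μ : E → ℕ → ℤ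
      μ e j = if does (e Subset.∈? S) then ⟦ β e ℕ.≤? j ⟧ else ⟦ j ℕ.≟ β e ⟧

      μ-nz : Φ L μ ≢ 0ℤ
      μ-nz z = nz (trans (Φ-top L L {β} refl below-δ below-μ at (degree nz)) z)
        where
        below-δ : Vanishes-below β (δ β)
        below-δ e j lt = ⟦⟧-no (j ℕ.≟ β e) (ℕ.<⇒≢ lt)
        below-μ : Vanishes-below β μ
        below-μ e j lt with does (e Subset.∈? S)
        ... | true  = ⟦⟧-no (β e ℕ.≤? j) (ℕ.<⇒≱ lt)
        ... | false = below-δ e j lt
        at : ∀ e → δ β e (β e) ≡ μ e (β e)
        at e with does (e Subset.∈? S)
        ... | true  = trans (⟦⟧-yes (β e ℕ.≟ β e) refl) (sym (⟦⟧-yes (β e ℕ.≤? β e) ℕ.≤-refl))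
        ... | false = refl

      -- At a marked edge the local functional is the sum of the functionals `taken` and `kept`, so
      -- Φ stays nonzero for one of them.
      decide : ∀ φ e → (∀ j → φ e j ≡ μ e j) → Φ L φ ≢ 0ℤ → ∃ λ ψ → Fate S β e ψ × Φ L (update e ψ φ) ≢ 0ℤ
      decide φ e pre nz with e Subset.∈? S
      ... | no e∉S = φ e , idle e∉S pre ,
                     λ z → nz (trans (Φ-cong L (λ e′ j → cong (λ f → f j) (sym (same e′)))) z)
        where
        same : ∀ e′ → update e (φ e) φ e′ ≡ φ e′
        same e′ with e′ Fin.≟ e
        ... | yes refl = refl
        ... | no _     = refl
      ... | yes e∈S with Φ L (update e (λ _ → 1ℤ) φ) ℤ.≟ 0ℤ | Φ L (update e (λ j → ⊝ ⟦ j ℕ.<? β e ⟧) φ) ℤ.≟ 0ℤ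
      ...   | no nz₁ | _      = _ , taken e∈S (λ _ → refl) , nz₁
      ...   | yes _  | no nz₂ = _ , kept e∈S (λ _ → refl) , nz₂
      ...   | yes z₁ | yes z₂ = contradiction (trans split (trans (cong₂ (λ p q → 1ℤ · p ⊕ 1ℤ · q) z₁ z₂)
                                  (solve 0 (con 1ℤ :* con 0ℤ :+ con 1ℤ :* con 0ℤ := con 0ℤ) refl))) nz
        where
        point : ∀ j → φ e j ≡ 1ℤ · 1ℤ ⊕ 1ℤ · ⊝ ⟦ j ℕ.<? β e ⟧
        point j with j ℕ.<? β e | pre j
        ... | yes lt | p = trans p (trans (⟦⟧-no (β e ℕ.≤? j) (ℕ.<⇒≱ lt)) (trans (solve 0 (con 0ℤ := con 1ℤ :* con 1ℤ :+ con 1ℤ :* :- con 1ℤ) refl)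
                             (cong (λ q → 1ℤ · 1ℤ ⊕ 1ℤ · ⊝ q) (sym (⟦⟧-yes (j ℕ.<? β e) lt)))))
        ... | no ge  | p = trans p (trans (⟦⟧-yes (β e ℕ.≤? j) (ℕ.≮⇒≥ ge)) (trans (solve 0 (con 1ℤ := con 1ℤ :* con 1ℤ :+ con 1ℤ :* :- con 0ℤ) refl)
                             (cong (λ q → 1ℤ · 1ℤ ⊕ 1ℤ · ⊝ q) (sym (⟦⟧-no (j ℕ.<? β e) ge)))))
        split : Φ L φ ≡ 1ℤ · Φ L (update e (λ _ → 1ℤ) φ) ⊕ 1ℤ · Φ L (update e (λ j → ⊝ ⟦ j ℕ.<? β e ⟧) φ)
        split = Φ-linear L e (λ ne j → cong (λ f → f j) (sym (update-there _ φ ne))) (λ ne j → cong (λ f → f j) (sym (update-there _ φ ne)))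
          (λ j → trans (point j) (cong₂ (λ p q → 1ℤ · p ⊕ 1ℤ · q) (cong (λ f → f j) (sym (update-here e (λ _ → 1ℤ) φ)))
                                        (cong (λ f → f j) (sym (update-here e (λ j → ⊝ ⟦ j ℕ.<? β e ⟧) φ)))))

      decided = replace-all L (λ e ψ → ∀ j → ψ j ≡ μ e j) (λ e _ ψ → Fate S β e ψ) decide μ (λ _ _ → refl) μ-nz

      φ : E → ℕ → ℤ
      φ = proj₁ decided

      φ-nz : Φ L φ ≢ 0ℤ
      φ-nz = proj₁ (proj₂ decided)

      fate : ∀ e → Fate S β e (φ e)
      fate = proj₂ (proj₂ decided)

      M : ES
      M = Vec.tabulate (isTaken ∘ fate)

      M-taken : ∀ {e} → e Subset.∈ M → e Subset.∈ S × (∀ j → φ e j ≡ 1ℤ)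
      M-taken {e} e∈M = taken-∈ (fate e) (trans (sym (Vec.lookup∘tabulate (isTaken ∘ fate) e)) (Vec.[]=⇒lookup e∈M))

      -- Two adjacent taken edges would both be evaluated at 1, where their factor in the graph
      -- polynomial vanishes.
      matching : Matching G M
      matching e f e∈M f∈M adj with complete e f adj
      ... | inj₁ ∈L = φ-nz (Φ-difference ∈L (proj₂ (M-taken e∈M)) (proj₂ (M-taken f∈M)))
      ... | inj₂ ∈L = φ-nz (Φ-difference ∈L (proj₂ (M-taken f∈M)) (proj₂ (M-taken e∈M)))

      β′ : E → ℕ
      β′ = proj₁ (monomial L φ φ-nz)

      bound : ∀ t e → e Subset.∉ M → β e < t e → β′ e < removeTokens G S t e
      bound t e e∉M = remaining t (fate e)
        (λ eq → e∉M (Vec.lookup⇒[]= e M (trans (Vec.lookup∘tabulate (isTaken ∘ fate) e) eq)))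
        (proj₂ (proj₂ (monomial L φ φ-nz)) e)

    tokens-decrease : ∀ S t e → e Subset.∈ S → 0 < t e → Nsum (removeTokens G S t) < Nsum t
    tokens-decrease S t e e∈S pos = Nsum-strict e le (subst (λ d → (if d then pred (t e) else t e) < t e) (sym (dec-true (e Subset.∈? S) e∈S)) (pred< pos))
      where
      pred< : ∀ {n} → 0 < n → pred n < n
      pred< {suc n} _ = ℕ.n<1+n n
      le : ∀ e → removeTokens G S t e ≤ t e
      le e with does (e Subset.∈? S)
      ... | true  = ℕ.pred[n]≤n
      ... | false = ℕ.≤-refl

    -- The fuel N exceeds the total number of tokens. A round removes at least one, since a nonempty
    -- set is marked and β e < t e leaves every uncoloured edge a token to lose.
    wins : ∀ N U t → Nsum t < N → Inv U t → PainterWins G U t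
    wins (suc N) U t fuel (β , nz , lt) = strategy (λ e e∈U → ℕ.≤-<-trans z≤n (lt e e∈U)) λ S (e , e∈S) S⊆U →
      let open Round S β nz in
      M , (λ e∈M → proj₁ (M-taken e∈M)) , matching ,
      wins N (U Subset.─ M) (removeTokens G S t)
        (ℕ.<-≤-trans (tokens-decrease S t e e∈S (ℕ.≤-<-trans z≤n (lt e (S⊆U e∈S)))) (ℕ.s≤s⁻¹ fuel))
        (β′ , proj₁ (proj₂ (monomial L φ φ-nz)) ,
         λ f f∈ → bound t f (─-∉ U M f∈) (lt f (Subset.p─q⊆p U M f∈)))

  alonTarsi : ∀ k β → Φ L (δ β) ≢ 0ℤ → (∀ e → β e < k) → EdgePaintable G k
  alonTarsi k β nz lt = wins (suc (Nsum (λ (_ : E) → k))) Subset.⊤ (λ _ → k) ℕ.≤-refl (β , nz , λ e _ → lt e)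

-- Paintability, choosability and colourability

module _ where
  private
    -- The colours of a list that are still to be offered once the rounds before i are over; this is
    -- the number of tokens left to an uncoloured edge.
    count≥ : ℕ → List ℕ → ℕ
    count≥ i l = length (filter (i ℕ.≤?_) l)

    count≥-∉ : ∀ {i} l → i ∉ l → count≥ i l ≡ count≥ (suc i) l
    count≥-∉ []      _  = refl
    count≥-∉ {i} (c ∷ l) i∉ with ℕ.<-cmp i c
    ... | tri≈ _ refl _ = contradiction (here refl) i∉
    ... | tri< i<c _ _ = trans (cong length (List.filter-accept (i ℕ.≤?_) (ℕ.<⇒≤ i<c)))
                           (trans (cong suc (count≥-∉ l (i∉ ∘ there))) (sym (cong length (List.filter-accept (suc i ℕ.≤?_) i<c))))
    ... | tri> _ _ c<i = trans (cong length (List.filter-reject (i ℕ.≤?_) (ℕ.<⇒≱ c<i)))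
                           (trans (count≥-∉ l (i∉ ∘ there)) (sym (cong length (List.filter-reject (suc i ℕ.≤?_) (ℕ.<⇒≱ (ℕ.m<n⇒m<1+n c<i))))))

    count≥-∈ : ∀ {i} {l} → Unique l → i ∈ l → count≥ i l ≡ suc (count≥ (suc i) l)
    count≥-∈ {i} {_ ∷ l} (c≢ ∷ u) (here refl) =
      trans (cong length (List.filter-accept (i ℕ.≤?_) ℕ.≤-refl))
        (cong suc (trans (count≥-∉ l (∉-head c≢)) (sym (cong length (List.filter-reject (suc i ℕ.≤?_) (ℕ.<-irrefl refl))))))
    count≥-∈ {i} {c ∷ l} (c≢ ∷ u) (there i∈) with ℕ.<-cmp i c
    ... | tri≈ _ refl _ = contradiction i∈ (∉-head c≢)
    ... | tri< i<c _ _ = trans (cong length (List.filter-accept (i ℕ.≤?_) (ℕ.<⇒≤ i<c)))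
                           (cong suc (trans (count≥-∈ u i∈) (sym (cong length (List.filter-accept (suc i ℕ.≤?_) i<c)))))
    ... | tri> _ _ c<i = trans (cong length (List.filter-reject (i ℕ.≤?_) (ℕ.<⇒≱ c<i)))
                           (trans (count≥-∈ u i∈) (cong suc (sym (cong length (List.filter-reject (suc i ℕ.≤?_) (ℕ.<⇒≱ (ℕ.m<n⇒m<1+n c<i)))))))

    count≥-all : ∀ {i} l → (∀ {c} → c ∈ l → i ≤ c) → count≥ i l ≡ length l
    count≥-all {i} l all = cong length (List.filter-all (i ℕ.≤?_) (All.tabulate all))

    count≥-none : ∀ {i} l → (∀ {c} → c ∈ l → c < i) → count≥ i l ≡ 0
    count≥-none {i} l none = cong length (List.filter-none (i ℕ.≤?_) (All.tabulate (ℕ.<⇒≱ ∘ none)))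

    ≤-sum : ∀ {c} {l : List ℕ} → c ∈ l → c ≤ sum l
    ≤-sum (here refl)         = ℕ.m≤m+n _ _
    ≤-sum {l = d ∷ _} (there c∈) = ℕ.≤-trans (≤-sum c∈) (ℕ.m≤n+m _ d)

    ≤-Nsum : ∀ {m} (a : Fin m → ℕ) e → a e ≤ Nsum a
    ≤-Nsum a zero    = ℕ.m≤m+n _ _
    ≤-Nsum a (suc e) = ℕ.≤-trans (≤-Nsum (a ∘ suc) e) (ℕ.m≤n+m _ (a zero))

  module _ (G : Graph) (L : Edge G → List ℕ) (unique : ∀ e → Unique (L e)) where
    private
      Chosen : ℕ → EdgeSet G → Set
      Chosen i U = ∃ λ (c : Edge G → ℕ) → (∀ e → e Subset.∈ U → c e ∈ L e × i ≤ c e) ×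
                                           (∀ e f → e Subset.∈ U → f Subset.∈ U → AdjacentEdges G e f → c e ≢ c f)

      extend : ∀ {i U} M → (∀ {e} → e Subset.∈ M → i ∈ L e) → Matching G M → Chosen (suc i) (U Subset.─ M) → Chosen i U
      extend {i} {U} M i∈ matching (c′ , member′ , proper′) = c , member , proper
        where
        c : Edge G → ℕ
        c e = if does (e Subset.∈? M) then i else c′ e
        member : ∀ e → e Subset.∈ U → c e ∈ L e × i ≤ c e
        member e e∈ with e Subset.∈? M
        ... | yes e∈M = i∈ e∈M , ℕ.≤-refl
        ... | no e∉M  = let c∈ , le = member′ e (Subset.x∈p∧x∉q⇒x∈p─q e∈ e∉M) in c∈ , ℕ.<⇒≤ le
        proper : ∀ e f → e Subset.∈ U → f Subset.∈ U → AdjacentEdges G e f → c e ≢ c f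
        proper e f e∈ f∈ adj eq with e Subset.∈? M | f Subset.∈? M
        ... | yes e∈M | yes f∈M = matching e f e∈M f∈M adj
        ... | yes e∈M | no f∉M  = ℕ.<⇒≢ (proj₂ (member′ f (Subset.x∈p∧x∉q⇒x∈p─q f∈ f∉M))) eq
        ... | no e∉M  | yes f∈M = ℕ.<⇒≢ (proj₂ (member′ e (Subset.x∈p∧x∉q⇒x∈p─q e∈ e∉M))) (sym eq)
        ... | no e∉M  | no f∉M  = proper′ e f (Subset.x∈p∧x∉q⇒x∈p─q e∈ e∉M) (Subset.x∈p∧x∉q⇒x∈p─q f∈ f∉M) adj eq

      tokens : ∀ (S : EdgeSet G) (t : Edge G → ℕ) e → (e Subset.∈ S × removeTokens G S t e ≡ pred (t e)) ⊎ (e Subset.∉ S × removeTokens G S t e ≡ t e)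
      tokens S t e with e Subset.∈? S
      ... | yes e∈ = inj₁ (e∈ , refl)
      ... | no e∉  = inj₂ (e∉ , refl)

      -- Colour i is offered in round i, to the uncoloured edges whose list contains it.
      play : ∀ N i → (∀ e {c} → c ∈ L e → c < i + N) → ∀ U t → PainterWins G U t →
             (∀ e → e Subset.∈ U → t e ≡ count≥ i (L e)) → Chosen i U
      play zero i bound U t (strategy pos _) tok = (λ _ → 0) , (λ e e∈ → contradiction e∈ (empty e)) , λ e f e∈ → contradiction e∈ (empty e)
        where
        empty : ∀ e → e Subset.∉ U
        empty e e∈ = ℕ.<-irrefl (sym (trans (tok e e∈) (count≥-none (L e) (λ {c} c∈ → subst (c <_) (ℕ.+-identityʳ i) (bound e c∈))))) (pos e e∈)
      play (suc N) i bound U t win@(strategy pos answer) tok = round (Subset.nonempty? Sᵢ)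
        where
        open import Data.List.Membership.DecPropositional ℕ._≟_ using (_∈?_)
        marked? : ∀ e → Dec (e Subset.∈ U × i ∈ L e)
        marked? e = (e Subset.∈? U) ×-dec (i ∈? L e)
        Sᵢ : EdgeSet G
        Sᵢ = Vec.tabulate (λ e → does (marked? e))
        ∈Sᵢ⁻ : ∀ {e} → e Subset.∈ Sᵢ → e Subset.∈ U × i ∈ L e
        ∈Sᵢ⁻ {e} e∈ = does-true (marked? e) (trans (sym (Vec.lookup∘tabulate (λ e → does (marked? e)) e)) (Vec.[]=⇒lookup e∈))
        ∈Sᵢ⁺ : ∀ {e} → e Subset.∈ U → i ∈ L e → e Subset.∈ Sᵢ
        ∈Sᵢ⁺ {e} e∈ i∈ = Vec.lookup⇒[]= e Sᵢ (trans (Vec.lookup∘tabulate (λ e → does (marked? e)) e) (dec-true (marked? e) (e∈ , i∈)))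
        bound′ : ∀ e {c} → c ∈ L e → c < suc i + N
        bound′ e {c} c∈ = subst (c <_) (ℕ.+-suc i N) (bound e c∈)
        round : Dec (Subset.Nonempty Sᵢ) → Chosen i U
        -- Lister may not mark the empty set: a colour in no list of an uncoloured edge is skipped
        -- without a round.
        round (no empty) =
          let c , member , proper = play N (suc i) bound′ U t win
                (λ e e∈ → trans (tok e e∈) (count≥-∉ (L e) (λ i∈ → empty (e , ∈Sᵢ⁺ e∈ i∈))))
          in c , (λ e e∈ → let c∈ , le = member e e∈ in c∈ , ℕ.<⇒≤ le) , proper
        round (yes nonempty) with answer Sᵢ nonempty (proj₁ ∘ ∈Sᵢ⁻)
        ... | M , M⊆Sᵢ , matching , win′ =
          extend M (λ e∈M → proj₂ (∈Sᵢ⁻ (M⊆Sᵢ e∈M))) matching (play N (suc i) bound′ (U Subset.─ M) (removeTokens G Sᵢ t) win′ tok′)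
          where
          tok′ : ∀ e → e Subset.∈ U Subset.─ M → removeTokens G Sᵢ t e ≡ count≥ (suc i) (L e)
          tok′ e e∈ with Subset.p─q⊆p U M e∈ | tokens Sᵢ t e
          ... | e∈U | inj₁ (e∈Sᵢ , eq) = trans eq (trans (cong pred (tok e e∈U)) (cong pred (count≥-∈ (unique e) (proj₂ (∈Sᵢ⁻ e∈Sᵢ)))))
          ... | e∈U | inj₂ (e∉Sᵢᵢ , eq) = trans eq (trans (tok e e∈U) (count≥-∉ (L e) (λ i∈ → e∉Sᵢᵢ (∈Sᵢ⁺ e∈U i∈))))

    choose : ∀ {k} → (∀ e → length (L e) ≡ k) → EdgePaintable G k → ∃ λ (c : Edge G → ℕ) → (∀ e → c e ∈ L e) × Proper G c
    choose {k} len win =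
      -- No colour exceeds the sum of all entries of all lists, so this number of rounds exhausts
      -- the lists.
      let c , member , proper = play (suc (Nsum (sum ∘ L))) 0 (λ e c∈ → s≤s (ℕ.≤-trans (≤-sum c∈) (≤-Nsum (sum ∘ L) e)))
                                     Subset.⊤ (λ _ → k) win (λ e _ → sym (trans (count≥-all (L e) (λ _ → z≤n)) (len e)))
      in c , (λ e → proj₁ (member e Subset.∈⊤)) , λ e f → proper e f Subset.∈⊤ Subset.∈⊤

paintable⇒choosable : ∀ G k → EdgePaintable G k → EdgeChoosable G k
paintable⇒choosable G k win L good = choose G L (proj₁ ∘ good) (proj₂ ∘ good) win

choosable⇒colourable : ∀ G k → EdgeChoosable G k → EdgeColourable G k
choosable⇒colourable G k ch =
  let c , member , proper = ch (λ _ → List.upTo k) (λ _ → Unique.upTo⁺ k , List.length-upTo k)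
  in (λ e → fromℕ< (∈.∈-upTo⁻ (member e))) , λ e f adj eq → proper e f adj (Fin.fromℕ<-injective _ _ _ _ eq)

-- Congruences

opaque
  unfolding _⊕_
  pos-⊕ : ∀ a b → + (a + b) ≡ + a ⊕ + b
  pos-⊕ = ℤ.pos-+

  pos-· : ∀ a b → + (a * b) ≡ + a · + b
  pos-· = ℤ.pos-*

  -suc : ∀ k → ℤ.-[1+ k ] ≡ ⊝ + suc k
  -suc k = refl

  abs-· : ∀ a b → ℤ.∣ a · b ∣ ≡ ℤ.∣ a ∣ * ℤ.∣ b ∣
  abs-· = ℤ.abs-*

pos-^ : ∀ a n → + (a ^ n) ≡ (+ a) ↑ n
pos-^ a zero    = refl
pos-^ a (suc n) = trans (pos-· a (a ^ n)) (cong (+ a ·_) (pos-^ a n))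

infix 4 _≡_⟨mod_⟩

record _≡_⟨mod_⟩ (a b n : ℤ) : Set where
  constructor by
  field
    quotient : ℤ
    equation : a ≡ b ⊕ quotient · n

module _ {n : ℤ} where

  ≡⇒mod : ∀ {a b} → a ≡ b → a ≡ b ⟨mod n ⟩
  ≡⇒mod {a} refl = by 0ℤ (solve 2 (λ a n → a := a :+ con 0ℤ :* n) refl a n)

  mod-refl : ∀ {a} → a ≡ a ⟨mod n ⟩
  mod-refl = ≡⇒mod refl

  mod-sym : ∀ {a b} → a ≡ b ⟨mod n ⟩ → b ≡ a ⟨mod n ⟩
  mod-sym {b = b} (by q refl) = by (⊝ q) (solve 3 (λ b q n → b := b :+ q :* n :+ :- q :* n) refl b q n)

  mod-trans : ∀ {a b c} → a ≡ b ⟨mod n ⟩ → b ≡ c ⟨mod n ⟩ → a ≡ c ⟨mod n ⟩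
  mod-trans {c = c} (by q refl) (by r refl) = by (q ⊕ r) (solve 4 (λ c q r n → c :+ r :* n :+ q :* n := c :+ (q :+ r) :* n) refl c q r n)

  mod-⊕ : ∀ {a b c d} → a ≡ b ⟨mod n ⟩ → c ≡ d ⟨mod n ⟩ → a ⊕ c ≡ b ⊕ d ⟨mod n ⟩
  mod-⊕ {b = b} {d = d} (by q refl) (by r refl) =
    by (q ⊕ r) (solve 5 (λ b d q r n → b :+ q :* n :+ (d :+ r :* n) := b :+ d :+ (q :+ r) :* n) refl b d q r n)

  mod-· : ∀ {a b c d} → a ≡ b ⟨mod n ⟩ → c ≡ d ⟨mod n ⟩ → a · c ≡ b · d ⟨mod n ⟩
  mod-· {b = b} {d = d} (by q refl) (by r refl) = by (b · r ⊕ q · d ⊕ q · r · n)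
    (solve 5 (λ b d q r n → (b :+ q :* n) :* (d :+ r :* n) := b :* d :+ (b :* r :+ q :* d :+ q :* r :* n) :* n) refl b d q r n)

  mod-⊝ : ∀ {a b} → a ≡ b ⟨mod n ⟩ → ⊝ a ≡ ⊝ b ⟨mod n ⟩
  mod-⊝ {b = b} (by q refl) = by (⊝ q) (solve 3 (λ b q n → :- (b :+ q :* n) := :- b :+ :- q :* n) refl b q n)

  module _ {X : Set} where

    mod-∑ : ∀ (xs : List X) {f g : X → ℤ} → (∀ {x} → x ∈ xs → f x ≡ g x ⟨mod n ⟩) → ∑ xs f ≡ ∑ xs g ⟨mod n ⟩
    mod-∑ []       eq = mod-refl
    mod-∑ (x ∷ xs) eq = mod-⊕ (eq (here refl)) (mod-∑ xs (eq ∘ there))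

    mod-∏ : ∀ (xs : List X) {f g : X → ℤ} → (∀ {x} → x ∈ xs → f x ≡ g x ⟨mod n ⟩) → ∏ xs f ≡ ∏ xs g ⟨mod n ⟩
    mod-∏ []       eq = mod-refl
    mod-∏ (x ∷ xs) eq = mod-· (eq (here refl)) (mod-∏ xs (eq ∘ there))

infixr 2 _mod⟨_⟩_
infix  3 _mod∎

_mod⟨_⟩_ : ∀ a {b c n} → a ≡ b ⟨mod n ⟩ → b ≡ c ⟨mod n ⟩ → a ≡ c ⟨mod n ⟩
a mod⟨ p ⟩ q = mod-trans p q

_mod∎ : ∀ a {n} → a ≡ a ⟨mod n ⟩
a mod∎ = mod-refl

∣⇒mod : ∀ {n a} → n ∣ ℤ.∣ a ∣ → a ≡ 0ℤ ⟨mod + n ⟩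
∣⇒mod {n} {a} n∣a with ℤ∣.∣ᵤ⇒∣ {+ n} {a} n∣a
... | divides q eq = by q (trans eq (trans (*≡· q (+ n)) (sym (⊕-identityˡ _))))

mod⇒∣ : ∀ {n a} → a ≡ 0ℤ ⟨mod + n ⟩ → n ∣ ℤ.∣ a ∣
mod⇒∣ {n} {a} (by q eq) = ℤ∣.∣⇒∣ᵤ {+ n} {a} (divides q (trans eq (trans (⊕-identityˡ _) (sym (*≡· q (+ n))))))

mod-difference : ∀ {a b n} → a ≡ b ⟨mod n ⟩ → a ⊕ ⊝ b ≡ 0ℤ ⟨mod n ⟩
mod-difference {b = b} {n} (by q refl) = by q (solve 3 (λ b q n → b :+ q :* n :+ :- b := con 0ℤ :+ q :* n) refl b q n)

difference-mod : ∀ {a b n} → a ⊕ ⊝ b ≡ 0ℤ ⟨mod n ⟩ → a ≡ b ⟨mod n ⟩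
difference-mod {a} {b} (by q eq) = by q (trans (solve 2 (λ a b → a := b :+ (a :+ :- b)) refl a b) (cong (b ⊕_) (trans eq (⊕-identityˡ _))))

module _ {p : ℕ} (prime : Prime p) where

  mod-euclid : ∀ {a b} → a · b ≡ 0ℤ ⟨mod + p ⟩ → a ≡ 0ℤ ⟨mod + p ⟩ ⊎ b ≡ 0ℤ ⟨mod + p ⟩
  mod-euclid {a} {b} eq = Sum.map ∣⇒mod ∣⇒mod (Prime.euclidsLemma ℤ.∣ a ∣ ℤ.∣ b ∣ prime (subst (p ∣_) (abs-· a b) (mod⇒∣ eq)))

  mod-cancelˡ : ∀ {a b} c → ¬ (c ≡ 0ℤ ⟨mod + p ⟩) → c · a ≡ c · b ⟨mod + p ⟩ → a ≡ b ⟨mod + p ⟩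
  mod-cancelˡ {a} {b} c c≢0 eq = difference-mod (Sum.[ (λ c≡0 → contradiction c≡0 c≢0) , id ]
    (mod-euclid (mod-trans (≡⇒mod (solve 3 (λ a b c → c :* (a :+ :- b) := c :* a :+ :- (c :* b)) refl a b c)) (mod-difference eq))))

  mod-∏≢0 : ∀ {X : Set} (xs : List X) {f : X → ℤ} → (∀ {x} → x ∈ xs → ¬ (f x ≡ 0ℤ ⟨mod + p ⟩)) → ¬ (∏ xs f ≡ 0ℤ ⟨mod + p ⟩)
  mod-∏≢0 []       nz eq = ℕ.<⇒≱ (ℕ.nonTrivial⇒n>1 p {{Prime.prime⇒nonTrivial prime}}) (ℕ∣.∣⇒≤ (mod⇒∣ eq))
  mod-∏≢0 (x ∷ xs) {f} nz eq with mod-euclid {f x} {∏ xs f} eq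
  ... | inj₁ e = nz (here refl) e
  ... | inj₂ e = mod-∏≢0 xs (nz ∘ there) e

small-mod : ∀ {p a} → 0 < a → a < p → ¬ (+ a ≡ 0ℤ ⟨mod + p ⟩)
small-mod {p} {suc a} pos lt eq = ℕ.<⇒≱ lt (ℕ∣.∣⇒≤ (mod⇒∣ eq))

-- Residues

module _ (p : ℕ) .{{_ : NonZero p}} where

  opaque
    residue : ℕ → Fin p
    residue a = fromℕ< (ℕ%.m%n<n a p)

    toℕ-residue : ∀ a → toℕ (residue a) ≡ a % p
    toℕ-residue a = Fin.toℕ-fromℕ< _

  rot : ℕ → Fin p → Fin p
  rot a x = residue (a + toℕ x)

  val : Fin p → ℤ
  val x = + toℕ x

  %-mod : ∀ a → + (a % p) ≡ + a ⟨mod + p ⟩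
  %-mod a = mod-sym (by (+ (a / p)) (trans (cong +_ (ℕ%.m≡m%n+[m/n]*n a p)) (trans (pos-⊕ (a % p) _) (cong (+ (a % p) ⊕_) (pos-· (a / p) p)))))

  val-residue : ∀ a → val (residue a) ≡ + a ⟨mod + p ⟩
  val-residue a = subst (λ z → + z ≡ + a ⟨mod + p ⟩) (sym (toℕ-residue a)) (%-mod a)

  val-rot : ∀ a x → val (rot a x) ≡ + a ⊕ val x ⟨mod + p ⟩
  val-rot a x = mod-trans (val-residue (a + toℕ x)) (≡⇒mod (pos-⊕ a (toℕ x)))

  mod⇒%≡ : ∀ {a b} → + a ≡ + b ⟨mod + p ⟩ → a % p ≡ b % p
  mod⇒%≡ {a} {b} (by (+ k) eq) =
    trans (cong (_% p) (ℤ.+-injective (trans eq (trans (cong (+ b ⊕_) (sym (pos-· k p))) (sym (pos-⊕ b (k * p))))))) (ℕ%.[m+kn]%n≡m%n b k p)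
  mod⇒%≡ {a} {b} (by ℤ.-[1+ k ] eq) = sym (trans (cong (_% p) (ℤ.+-injective
    (trans (trans (solve 3 (λ b q p → b := b :+ :- q :* p :+ q :* p) refl (+ b) (+ suc k) (+ p)) (cong₂ _⊕_ (trans (cong (λ z → + b ⊕ z · + p) (sym (-suc k))) (sym eq)) (sym (pos-· (suc k) p))))
           (sym (pos-⊕ a (suc k * p)))))) (ℕ%.[m+kn]%n≡m%n a (suc k) p))

  residue-cong : ∀ {a b} → + a ≡ + b ⟨mod + p ⟩ → residue a ≡ residue b
  residue-cong {a} {b} eq = Fin.toℕ-injective (trans (toℕ-residue a) (trans (mod⇒%≡ eq) (sym (toℕ-residue b))))

  residue-toℕ : ∀ x → residue (toℕ x) ≡ x
  residue-toℕ x = Fin.toℕ-injective (trans (toℕ-residue (toℕ x)) (ℕ%.m<n⇒m%n≡m (Fin.toℕ<n x)))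

  val-injective : ∀ {x y} → val x ≡ val y ⟨mod + p ⟩ → x ≡ y
  val-injective {x} {y} eq = trans (sym (residue-toℕ x)) (trans (residue-cong eq) (residue-toℕ y))

  rot-cong : ∀ {a b} → + a ≡ + b ⟨mod + p ⟩ → ∀ x → rot a x ≡ rot b x
  rot-cong {a} {b} eq x = val-injective (mod-trans (val-rot a x) (mod-trans (mod-⊕ eq mod-refl) (mod-sym (val-rot b x))))

  rot-+ : ∀ a b x → rot (a + b) x ≡ rot a (rot b x)
  rot-+ a b x = val-injective
    (val (rot (a + b) x)         mod⟨ val-rot (a + b) x ⟩
     + (a + b) ⊕ val x           mod⟨ ≡⇒mod (trans (cong (_⊕ val x) (pos-⊕ a b)) (⊕-assoc (+ a) (+ b) (val x))) ⟩
     + a ⊕ (+ b ⊕ val x)         mod⟨ mod-⊕ mod-refl (mod-sym (val-rot b x)) ⟩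
     + a ⊕ val (rot b x)         mod⟨ mod-sym (val-rot a (rot b x)) ⟩
     val (rot a (rot b x))       mod∎)

  rot-0 : ∀ {a} → + a ≡ 0ℤ ⟨mod + p ⟩ → ∀ x → rot a x ≡ x
  rot-0 {a} eq x = val-injective (mod-trans (val-rot a x) (mod-trans (mod-⊕ eq mod-refl) (≡⇒mod (⊕-identityˡ _))))

  multiple-mod : ∀ a → + (a * p) ≡ 0ℤ ⟨mod + p ⟩
  multiple-mod a = by (+ a) (trans (pos-· a p) (sym (⊕-identityˡ _)))

  -- (p ∸ 1) * a represents - a.
  neg : ℕ → ℕ
  neg a = a * (p ∸ 1)

  neg-mod : ∀ a → + (neg a + a) ≡ 0ℤ ⟨mod + p ⟩
  neg-mod a = subst (λ z → + z ≡ 0ℤ ⟨mod + p ⟩) (sym (lem p)) (multiple-mod a)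
    where lem : ∀ p .{{_ : NonZero p}} → a * (p ∸ 1) + a ≡ a * p
          lem (suc q) = trans (ℕ.+-comm _ a) (sym (ℕ.*-suc a q))

  val-neg : ∀ a → + neg a ≡ ⊝ + a ⟨mod + p ⟩
  val-neg a = mod-trans (≡⇒mod (trans (solve 2 (λ x y → x := (x :+ y) :+ :- y) refl (+ neg a) (+ a)) (cong (_⊕ ⊝ + a) (sym (pos-⊕ (neg a) a)))))
                        (mod-trans (mod-⊕ (neg-mod a) mod-refl) (≡⇒mod (⊕-identityˡ _)))

  rot-neg : ∀ a x → rot (neg a) (rot a x) ≡ x
  rot-neg a x = trans (sym (rot-+ (neg a) a x)) (rot-0 (neg-mod a) x)

  rot-neg′ : ∀ a x → rot a (rot (neg a) x) ≡ x
  rot-neg′ a x = trans (sym (rot-+ a (neg a) x)) (trans (cong (λ z → rot z x) (ℕ.+-comm a (neg a))) (rot-0 (neg-mod a) x))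

  rot-injective : ∀ a {x y} → rot a x ≡ rot a y → x ≡ y
  rot-injective a {x} {y} eq = trans (sym (rot-neg a x)) (trans (cong (rot (neg a)) eq) (rot-neg a y))

  rot-fixed : ∀ a {x} → rot a x ≡ x → + a ≡ 0ℤ ⟨mod + p ⟩
  rot-fixed a {x} eq = mod-trans (≡⇒mod (solve 2 (λ a x → a := (a :+ x) :+ :- x) refl (+ a) (val x)))
    (mod-difference (mod-trans (mod-sym (val-rot a x)) (≡⇒mod (cong val eq))))

  0′ : Fin p
  0′ = residue 0

  val-0′ : val 0′ ≡ 0ℤ
  val-0′ = cong +_ (trans (toℕ-residue 0) (ℕ%.m<n⇒m%n≡m (ℕ.>-nonZero⁻¹ p)))

  rot-toℕ-0′ : ∀ x → rot (toℕ x) 0′ ≡ x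
  rot-toℕ-0′ x = val-injective (mod-trans (val-rot (toℕ x) 0′) (≡⇒mod (trans (cong (val x ⊕_) val-0′) (⊕-identityʳ _))))

  mul : ℕ → Fin p → Fin p
  mul a x = residue (a * toℕ x)

  val-mul : ∀ a x → val (mul a x) ≡ + a · val x ⟨mod + p ⟩
  val-mul a x = mod-trans (val-residue (a * toℕ x)) (≡⇒mod (pos-· a (toℕ x)))

  mul-rot : ∀ a b x → mul a (rot b x) ≡ rot (a * b) (mul a x)
  mul-rot a b x = val-injective
    (val (mul a (rot b x))          mod⟨ val-mul a (rot b x) ⟩
     + a · val (rot b x)            mod⟨ mod-· mod-refl (val-rot b x) ⟩
     + a · (+ b ⊕ val x)            mod⟨ ≡⇒mod (trans (·-distribˡ (+ a) (+ b) (val x)) (cong (_⊕ + a · val x) (sym (pos-· a b)))) ⟩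
     + (a * b) ⊕ + a · val x        mod⟨ mod-⊕ mod-refl (mod-sym (val-mul a x)) ⟩
     + (a * b) ⊕ val (mul a x)      mod⟨ mod-sym (val-rot (a * b) (mul a x)) ⟩
     val (rot (a * b) (mul a x))    mod∎)

  module _ (prime : Prime p) where

    mul-injective : ∀ {a} → ¬ (+ a ≡ 0ℤ ⟨mod + p ⟩) → ∀ {x y} → mul a x ≡ mul a y → x ≡ y
    mul-injective {a} a≢0 {x} {y} eq = val-injective (mod-cancelˡ prime (+ a) a≢0
      (mod-trans (mod-sym (val-mul a x)) (mod-trans (≡⇒mod (cong val eq)) (val-mul a y))))

    -- Multiplication by a is injective on the finite set of residues, hence onto; the inverse is
    -- the preimage of 1.
    mod-inverse : ∀ {a} → ¬ (+ a ≡ 0ℤ ⟨mod + p ⟩) → ∃ λ b → + (b * a) ≡ 1ℤ ⟨mod + p ⟩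
    mod-inverse {a} a≢0 =
      let x , eq = injective⇒surjective (finEnum p) (mul-injective a≢0) (residue 1)
      in toℕ x , mod-trans (≡⇒mod (trans (pos-· (toℕ x) a) (·-comm (val x) (+ a)))) (mod-trans (mod-sym (val-mul a x))
                   (mod-trans (≡⇒mod (cong val eq)) (val-residue 1)))

    -- Multiplication by x permutes the nonzero residues, and their product Π is invertible.
    fermat : ∀ x → x ≢ 0′ → val x ↑ (p ∸ 1) ≡ 1ℤ ⟨mod + p ⟩
    fermat x x≢0 = mod-cancelˡ prime Π Π≢0
      (Π · val x ↑ (p ∸ 1)                  mod⟨ ≡⇒mod (·-comm Π _) ⟩
       val x ↑ (p ∸ 1) · Π                  mod⟨ ≡⇒mod (trans (cong (λ n → val x ↑ n · Π) (sym len)) (trans (cong (_· Π) (sym (∏-const nz (val x)))) (sym (∏-* nz (λ _ → val x) val)))) ⟩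
       ∏ nz (λ y → val x · val y)           mod⟨ mod-∏ nz (λ {y} _ → mod-sym (val-mul (toℕ x) y)) ⟩
       ∏ nz (λ y → val (mul (toℕ x) y))     mod⟨ ≡⇒mod (trans (sym (∏-map (mul (toℕ x)) nz val)) (∏-↭ val perm)) ⟩
       Π                                    mod⟨ ≡⇒mod (sym (·-identityʳ Π)) ⟩
       Π · 1ℤ                               mod∎)
      where
      nz = proj₁ (∈⇒↭ (∈.∈-allFin {p} 0′))
      all↭ : allFin p ↭ 0′ ∷ nz
      all↭ = proj₂ (∈⇒↭ (∈.∈-allFin {p} 0′))
      len : length nz ≡ p ∸ 1
      len = cong pred {x = suc (length nz)} {y = p} (trans (sym (↭.↭-length all↭)) (List.length-tabulate id))
      val≢0 : ∀ {y} → y ≢ 0′ → ¬ (val y ≡ 0ℤ ⟨mod + p ⟩)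
      val≢0 y≢ e = y≢ (val-injective (mod-trans e (≡⇒mod (sym val-0′))))
      mul-0 : mul (toℕ x) 0′ ≡ 0′
      mul-0 = val-injective (mod-trans (val-mul (toℕ x) 0′) (≡⇒mod (trans (cong (val x ·_) val-0′) (trans (·-zeroʳ _) (sym val-0′)))))
      perm : map (mul (toℕ x)) nz ↭ nz
      perm = ↭.drop-∷ (↭-trans (subst (λ z → z ∷ map (mul (toℕ x)) nz ↭ map (mul (toℕ x)) (0′ ∷ nz)) mul-0 ↭-refl)
               (↭-trans (↭.map⁺ _ (↭-sym all↭)) (↭-trans (map-injective-↭ (finEnum p) (mul-injective (val≢0 x≢0))) all↭)))
      Π = ∏ nz val
      nz≢0 : ∀ {y} → y ∈ nz → y ≢ 0′
      nz≢0 y∈ refl = ∉-head (AllPairs.head (Unique-resp-↭ all↭ (Unique.allFin⁺ p))) y∈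
      Π≢0 : ¬ (Π ≡ 0ℤ ⟨mod + p ⟩)
      Π≢0 = mod-∏≢0 prime nz (val≢0 ∘ nz≢0)

-- Finite differences

rsum : ℕ → (ℕ → ℤ) → ℤ
rsum zero    g = 0ℤ
rsum (suc n) g = g 0 ⊕ rsum n (g ∘ suc)

rsum≡∑ : ∀ n g → rsum n g ≡ ∑ (allFin n) (g ∘ toℕ)
rsum≡∑ zero    g = refl
rsum≡∑ (suc n) g = cong (g 0 ⊕_) (trans (rsum≡∑ n (g ∘ suc)) (trans (sym (∑-map suc (allFin n) (g ∘ toℕ)))
                     (cong (λ l → ∑ l (g ∘ toℕ)) (List.map-tabulate {n = n} id suc))))

rsum-cong : ∀ n {g h} → (∀ c → g c ≡ h c) → rsum n g ≡ rsum n h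
rsum-cong zero    eq = refl
rsum-cong (suc n) eq = cong₂ _⊕_ (eq 0) (rsum-cong n (eq ∘ suc))

rsum-last : ∀ n g → rsum (suc n) g ≡ rsum n g ⊕ g n
rsum-last zero    g = ⊕-comm (g 0) 0ℤ
rsum-last (suc n) g = trans (cong (g 0 ⊕_) (rsum-last n (g ∘ suc))) (sym (⊕-assoc _ _ _))

rsum-difference : ∀ n g h → rsum n g ⊕ ⊝ rsum n h ≡ rsum n (λ c → g c ⊕ ⊝ h c)
rsum-difference zero    g h = solve 0 (con 0ℤ :+ :- con 0ℤ := con 0ℤ) refl
rsum-difference (suc n) g h = trans (solve 4 (λ a b c d → (a :+ b) :+ :- (c :+ d) := (a :+ :- c) :+ (b :+ :- d)) refl _ _ _ _)
                                (cong (g 0 ⊕ ⊝ h 0 ⊕_) (rsum-difference n (g ∘ suc) (h ∘ suc)))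

-- The coefficients (-1)^c binom(k,c) of the k-th difference, generated by Pascal's rule in step
-- with `fd`.
weight : ℕ → ℕ → ℤ
weight zero    zero    = 1ℤ
weight zero    (suc c) = 0ℤ
weight (suc k) zero    = weight k zero
weight (suc k) (suc c) = weight k (suc c) ⊕ ⊝ weight k c

weight-top : ∀ k c → k < c → weight k c ≡ 0ℤ
weight-top zero    (suc c) _        = refl
weight-top (suc k) (suc c) (s≤s lt) = trans (cong₂ (λ a b → a ⊕ ⊝ b) (weight-top k (suc c) (ℕ.m<n⇒m<1+n lt)) (weight-top k c lt))
                                        (solve 0 (con 0ℤ :+ :- con 0ℤ := con 0ℤ) refl)

fd : ℕ → (ℕ → ℤ) → ℕ → ℤ
fd zero    f x = f x
fd (suc k) f x = fd k f x ⊕ ⊝ fd k f (suc x)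

fd≡rsum : ∀ k f x → fd k f x ≡ rsum (suc k) (λ c → weight k c · f (x + c))
fd≡rsum zero    f x = trans (cong f (sym (ℕ.+-identityʳ x))) (solve 1 (λ a → a := con 1ℤ :* a :+ con 0ℤ) refl _)
fd≡rsum (suc k) f x = begin
  fd k f x ⊕ ⊝ fd k f (suc x)
    ≡⟨ cong₂ (λ a b → a ⊕ ⊝ b) (trans (fd≡rsum k f x) extend) (trans (fd≡rsum k f (suc x))
         (rsum-cong (suc k) (λ c → cong (λ z → weight k c · f z) (sym (ℕ.+-suc x c))))) ⟩
  (weight k 0 · f (x + 0) ⊕ rsum (suc k) (λ c → weight k (suc c) · f (x + suc c))) ⊕ ⊝ rsum (suc k) (λ c → weight k c · f (x + suc c))
    ≡⟨ trans (solve 3 (λ a b c → (a :+ b) :+ :- c := a :+ (b :+ :- c)) refl _ _ _)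
         (cong (weight k 0 · f (x + 0) ⊕_) (rsum-difference (suc k) (λ c → weight k (suc c) · f (x + suc c)) (λ c → weight k c · f (x + suc c)))) ⟩
  weight k 0 · f (x + 0) ⊕ rsum (suc k) (λ c → weight k (suc c) · f (x + suc c) ⊕ ⊝ (weight k c · f (x + suc c)))
    ≡⟨ cong (weight k 0 · f (x + 0) ⊕_) (rsum-cong (suc k) (λ c → solve 3 (λ a b f → a :* f :+ :- (b :* f) := (a :+ :- b) :* f) refl (weight k (suc c)) (weight k c) (f (x + suc c)))) ⟩
  rsum (suc (suc k)) (λ c → weight (suc k) c · f (x + c)) ∎
  where
  open ≡-Reasoning
  extend : rsum (suc k) (λ c → weight k c · f (x + c)) ≡ rsum (suc (suc k)) (λ c → weight k c · f (x + c))
  extend = sym (trans (rsum-last (suc k) (λ c → weight k c · f (x + c)))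
    (trans (cong (λ z → rsum (suc k) (λ c → weight k c · f (x + c)) ⊕ z · f (x + suc k)) (weight-top k (suc k) (ℕ.n<1+n k)))
      (solve 2 (λ a b → a :+ con 0ℤ :* b := a) refl _ _)))

power : ℕ → ℕ → ℤ
power j x = (+ x) ↑ j

-- Leibniz rule for the operator f(x) - f(x+1). It evaluates differences of powers by induction on
-- the exponent.
fd-· : ∀ k g x → fd (suc k) (λ x → + x · g x) x ≡ + x · fd (suc k) g x ⊕ ⊝ (+ suc k · fd k g (suc x))
fd-· zero    g x = trans (cong (λ z → + x · g x ⊕ ⊝ (z · g (suc x))) (pos-⊕ 1 x))
  (solve 3 (λ x a b → x :* a :+ :- ((con (+ 1) :+ x) :* b) := x :* (a :+ :- b) :+ :- (con (+ 1) :* b)) refl (+ x) (g x) (g (suc x)))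
fd-· (suc k) g x = begin
  fd (suc k) xg x ⊕ ⊝ fd (suc k) xg (suc x)
    ≡⟨ cong₂ (λ a b → a ⊕ ⊝ b) (fd-· k g x) (trans (fd-· k g (suc x)) (cong (λ z → z · fd (suc k) g (suc x) ⊕ ⊝ (+ suc k · fd k g (suc (suc x)))) (pos-⊕ 1 x))) ⟩
  (+ x · fd (suc k) g x ⊕ ⊝ (+ suc k · fd k g (suc x))) ⊕ ⊝ ((+ 1 ⊕ + x) · fd (suc k) g (suc x) ⊕ ⊝ (+ suc k · fd k g (suc (suc x))))
    ≡⟨ solve 5 (λ x A n B C → (x :* A :+ :- (n :* B)) :+ :- ((con (+ 1) :+ x) :* (B :+ :- C) :+ :- (n :* C))
                              := x :* (A :+ :- (B :+ :- C)) :+ :- ((con (+ 1) :+ n) :* (B :+ :- C)))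
         refl (+ x) (fd (suc k) g x) (+ suc k) (fd k g (suc x)) (fd k g (suc (suc x))) ⟩
  + x · fd (suc (suc k)) g x ⊕ ⊝ ((+ 1 ⊕ + suc k) · fd (suc k) g (suc x))
    ≡⟨ cong (λ z → + x · fd (suc (suc k)) g x ⊕ ⊝ (z · fd (suc k) g (suc x))) (sym (pos-⊕ 1 (suc k))) ⟩
  + x · fd (suc (suc k)) g x ⊕ ⊝ (+ suc (suc k) · fd (suc k) g (suc x)) ∎
  where
  open ≡-Reasoning
  xg : ℕ → ℤ
  xg x = + x · g x

fd-const : ∀ k x → fd (suc k) (power 0) x ≡ 0ℤ
fd-const zero    x = solve 0 (con 1ℤ :+ :- con 1ℤ := con 0ℤ) refl
fd-const (suc k) x = trans (cong₂ (λ a b → a ⊕ ⊝ b) (fd-const k x) (fd-const k (suc x))) (solve 0 (con 0ℤ :+ :- con 0ℤ := con 0ℤ) refl)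

fd-power-low : ∀ k j x → j < k → fd k (power j) x ≡ 0ℤ
fd-power-low (suc k) zero    x _        = fd-const k x
fd-power-low (suc k) (suc j) x (s≤s lt) = trans (fd-· k (power j) x)
  (trans (cong₂ (λ a b → + x · a ⊕ ⊝ (+ suc k · b)) (fd-power-low (suc k) j x (ℕ.m<n⇒m<1+n lt)) (fd-power-low k j (suc x) lt))
    (solve 2 (λ x k → x :* con 0ℤ :+ :- (k :* con 0ℤ) := con 0ℤ) refl (+ x) (+ suc k)))

fd-power-top : ∀ k x → fd k (power k) x ≡ (⊝ 1ℤ) ↑ k · + (k !)
fd-power-top zero    x = solve 0 (con 1ℤ := con 1ℤ :* con 1ℤ) refl
fd-power-top (suc k) x = trans (fd-· k (power k) x)
  (trans (cong₂ (λ a b → + x · a ⊕ ⊝ (+ suc k · b)) (fd-power-low (suc k) k x (ℕ.n<1+n k)) (fd-power-top k (suc x)))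
    (trans (solve 4 (λ x k a b → x :* con 0ℤ :+ :- (k :* (a :* b)) := (:- con 1ℤ :* a) :* (k :* b)) refl (+ x) (+ suc k) ((⊝ 1ℤ) ↑ k) (+ (k !)))
      (cong ((⊝ 1ℤ) ↑ suc k ·_) (sym (pos-· (suc k) (k !))))))

∑-weight : ∀ {p k} → p ≡ suc k → ∀ j → ∑ (allFin p) (λ x → weight k (toℕ x) · (+ toℕ x) ↑ j) ≡ fd k (power j) 0
∑-weight {k = k} refl j = trans (sym (rsum≡∑ (suc k) (λ c → weight k c · power j c))) (sym (fd≡rsum k (power j) 0))

-- Binomial weights modulo a prime, and Wilson's theorem

binom : ℕ → ℕ → ℕ
binom _       zero    = 1
binom zero    (suc c) = 0
binom (suc k) (suc c) = binom k c + binom k (suc c)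

binom-pos : ∀ k c → c ≤ k → 0 < binom k c
binom-pos k       zero    _        = s≤s z≤n
binom-pos (suc k) (suc c) (s≤s le) = ℕ.<-≤-trans (binom-pos k c le) (ℕ.m≤m+n _ _)

weight≡binom : ∀ k c → weight k c ≡ (⊝ 1ℤ) ↑ c · + binom k c
weight≡binom zero    zero    = solve 0 (con 1ℤ := con 1ℤ :* con 1ℤ) refl
weight≡binom zero    (suc c) = sym (·-zeroʳ _)
weight≡binom (suc k) zero    = weight≡binom k zero
weight≡binom (suc k) (suc c) = trans (cong₂ (λ a b → a ⊕ ⊝ b) (weight≡binom k (suc c)) (weight≡binom k c))
  (trans (solve 3 (λ s a b → :- con 1ℤ :* s :* a :+ :- (s :* b) := :- con 1ℤ :* s :* (b :+ a)) refl ((⊝ 1ℤ) ↑ c) (+ binom k (suc c)) (+ binom k c))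
    (cong ((⊝ 1ℤ) ↑ suc c ·_) (sym (pos-⊕ (binom k c) (binom k (suc c))))))

binom-absorb : ∀ k c → suc c * binom (suc k) (suc c) ≡ suc k * binom k c
binom-absorb zero    zero    = refl
binom-absorb zero    (suc c) = ℕ.*-zeroʳ (suc (suc c))
binom-absorb (suc k) zero    = trans (ℕ.*-identityˡ _) (cong suc (trans (sym (ℕ.*-identityˡ _)) (binom-absorb k 0)))
binom-absorb (suc k) (suc c) = begin
  suc (suc c) * (binom (suc k) (suc c) + binom (suc k) (suc (suc c)))
    ≡⟨ ℕ.*-distribˡ-+ (suc (suc c)) (binom (suc k) (suc c)) _ ⟩
  binom (suc k) (suc c) + suc c * binom (suc k) (suc c) + suc (suc c) * binom (suc k) (suc (suc c))
    ≡⟨ cong₂ (λ a b → binom (suc k) (suc c) + a + b) (binom-absorb k c) (binom-absorb k (suc c)) ⟩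
  binom (suc k) (suc c) + suc k * binom k c + suc k * binom k (suc c)
    ≡⟨ trans (ℕ.+-assoc (binom (suc k) (suc c)) _ _) (cong (λ z → binom (suc k) (suc c) + z) (sym (ℕ.*-distribˡ-+ (suc k) (binom k c) _))) ⟩
  suc (suc k) * binom (suc k) (suc c) ∎
  where open ≡-Reasoning

↑-+ : ∀ a i j → a ↑ (i + j) ≡ a ↑ i · a ↑ j
↑-+ a zero    j = sym (·-identityˡ _)
↑-+ a (suc i) j = trans (cong (a ·_) (↑-+ a i j)) (sym (·-assoc a _ _))

↑-even : ∀ {a} → a · a ≡ 1ℤ → ∀ m → a ↑ (m * 2) ≡ 1ℤ
↑-even sq zero    = refl
↑-even {a} sq (suc m) = trans (cong (λ z → a · (a · z)) (↑-even sq m)) (trans (cong (a ·_) (·-identityʳ a)) sq)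

⊝1-sq : ⊝ 1ℤ · ⊝ 1ℤ ≡ 1ℤ
⊝1-sq = solve 0 (:- con 1ℤ :* :- con 1ℤ := con 1ℤ) refl

module _ {p k : ℕ} (prime : Prime p) (p≡ : p ≡ suc k) where

  -- Consecutive weights differ by a weight of order p, which is up to sign a binomial coefficient
  -- binom(p,c+1) with 0 < c+1 < p, divisible by p.
  weight-mod : ∀ c → c ≤ k → weight k c ≡ 1ℤ ⟨mod + p ⟩
  weight-mod zero    _  = ≡⇒mod (trans (weight≡binom k 0) (·-identityˡ 1ℤ))
  weight-mod (suc c) le = mod-trans (mod-trans (≡⇒mod (solve 2 (λ a b → a := (a :+ :- b) :+ b) refl (weight k (suc c)) (weight k c)))
      (mod-trans (mod-⊕ vanish mod-refl) (≡⇒mod (⊕-identityˡ _)))) (weight-mod c (ℕ.<⇒≤ le))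
    where
    vanish : weight (suc k) (suc c) ≡ 0ℤ ⟨mod + p ⟩
    vanish = mod-cancelˡ prime (+ suc c) (small-mod (s≤s z≤n) (subst (suc c <_) (sym p≡) (s≤s le)))
      (+ suc c · weight (suc k) (suc c)                                  mod⟨ ≡⇒mod (trans (cong (+ suc c ·_) (weight≡binom (suc k) (suc c))) (·-interchange₃ (+ suc c) _ _)) ⟩
       (⊝ 1ℤ) ↑ suc c · (+ suc c · + binom (suc k) (suc c))              mod⟨ ≡⇒mod (cong ((⊝ 1ℤ) ↑ suc c ·_) (trans (sym (pos-· (suc c) _)) (trans (cong +_ (trans (binom-absorb k c) (cong (_* binom k c) (sym p≡)))) (pos-· p (binom k c))))) ⟩
       (⊝ 1ℤ) ↑ suc c · (+ p · + binom k c)                        mod⟨ by ((⊝ 1ℤ) ↑ suc c · + binom k c) (solve 4 (λ s p b c → s :* (p :* b) := c :* con 0ℤ :+ s :* b :* p) refl _ (+ p) _ (+ suc c)) ⟩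
       + suc c · 0ℤ                                                mod∎)

module _ {p m : ℕ} .{{_ : NonZero p}} (prime : Prime p) (p≡ : p ≡ suc (m * 2)) where

  private
    k>0 : 0 < m * 2
    k>0 = ℕ.s<s⁻¹ (subst (1 <_) p≡ (ℕ.nonTrivial⇒n>1 p {{Prime.prime⇒nonTrivial prime}}))

    0↑ : ∀ {n} → 0 < n → 0ℤ ↑ n ≡ 0ℤ
    0↑ (s≤s _) = ·-zeroˡ _

    xs = allFin p

    w pw δ₀ : Fin p → ℤ
    w x  = weight (m * 2) (toℕ x)
    pw x = val p x ↑ (m * 2)
    δ₀ x = ⟦ x Fin.≟ 0′ p ⟧

    ∑δ₀ : ∑ xs δ₀ ≡ 1ℤ
    ∑δ₀ = trans (∑-single {xs = xs} {0′ p} {δ₀} (Unique.allFin⁺ p) (∈.∈-allFin (0′ p)) (λ {x} ne → ⟦⟧-no (x Fin.≟ 0′ p) ne)) (⟦⟧-yes (0′ p Fin.≟ 0′ p) refl)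

    nonzero : ∑ xs (λ x → 1ℤ ⊕ ⊝ 1ℤ · δ₀ x) ≡ + p ⊕ ⊝ 1ℤ
    nonzero = trans (∑-+ xs (λ _ → 1ℤ) (λ x → ⊝ 1ℤ · δ₀ x)) (cong₂ _⊕_
      (trans (∑-const xs 1ℤ) (trans (·-identityʳ _) (cong +_ (List.length-tabulate id))))
      (trans (∑-*ˡ xs (⊝ 1ℤ) δ₀) (trans (cong (⊝ 1ℤ ·_) ∑δ₀) (·-identityʳ _))))

    term : ∀ x → w x · pw x ≡ 1ℤ ⊕ ⊝ 1ℤ · δ₀ x ⟨mod + p ⟩
    term x = by-cases (x Fin.≟ 0′ p)
      where
      by-cases : Dec (x ≡ 0′ p) → w x · pw x ≡ 1ℤ ⊕ ⊝ 1ℤ · δ₀ x ⟨mod + p ⟩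
      by-cases (yes x≡0) = ≡⇒mod (trans (cong (w x ·_) (trans (cong (_↑ (m * 2)) (trans (cong (val p) x≡0) (val-0′ p))) (0↑ k>0)))
        (trans (·-zeroʳ _) (trans (solve 0 (con 0ℤ := con 1ℤ :+ :- con 1ℤ :* con 1ℤ) refl) (cong (λ z → 1ℤ ⊕ ⊝ 1ℤ · z) (sym (⟦⟧-yes (x Fin.≟ 0′ p) x≡0))))))
      by-cases (no x≢0)  = mod-trans
        (mod-· (weight-mod prime p≡ (toℕ x) (ℕ.s≤s⁻¹ (subst (toℕ x <_) p≡ (Fin.toℕ<n x))))
               (subst (λ k → val p x ↑ k ≡ 1ℤ ⟨mod + p ⟩) (cong (_∸ 1) p≡) (fermat p prime x x≢0)))
        (≡⇒mod (trans (solve 0 (con 1ℤ :* con 1ℤ := con 1ℤ :+ :- con 1ℤ :* con 0ℤ) refl) (cong (λ z → 1ℤ ⊕ ⊝ 1ℤ · z) (sym (⟦⟧-no (x Fin.≟ 0′ p) x≢0)))))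

    top : + ((m * 2) !) ≡ ∑ xs (λ x → w x · pw x)
    top = sym (trans (∑-weight p≡ (m * 2)) (trans (fd-power-top (m * 2) 0) (trans (cong (_· + ((m * 2) !)) (↑-even ⊝1-sq m)) (·-identityˡ _))))

  -- The difference of order p-1 of the power x^(p-1) is (p-1)!. Modulo p its weights are 1, and by
  -- Fermat the powers are 1 except at 0, which leaves p - 1.
  wilson : + ((m * 2) !) ≡ ⊝ 1ℤ ⟨mod + p ⟩
  wilson = mod-trans (≡⇒mod top) (mod-trans (mod-∑ xs (λ {x} _ → term x)) (mod-trans (≡⇒mod nonzero)
    (by 1ℤ (solve 1 (λ p → p :+ :- con 1ℤ := :- con 1ℤ :+ con 1ℤ :* p) refl (+ p)))))

  private
    -- Moving one factor from i! to j! replaces i+1 by j+1, which is its negative modulo p as the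
    -- two add up to p. Squaring removes the sign, and Wilson's theorem is the start.
    factorials : ∀ i j → i + j ≡ m * 2 → (+ (i !) · + (j !)) · (+ (i !) · + (j !)) ≡ 1ℤ ⟨mod + p ⟩
    factorials zero    j refl = mod-trans (mod-· start start) (≡⇒mod ⊝1-sq)
      where start = mod-trans (≡⇒mod (·-identityˡ (+ (j !)))) wilson
    factorials (suc i) j eq = mod-trans (mod-· step step) (mod-trans (≡⇒mod (⊝·⊝ _ _)) (factorials i (suc j) (trans (ℕ.+-suc i j) eq)))
      where
      step : + (suc i !) · + (j !) ≡ ⊝ (+ (i !) · + (suc j !)) ⟨mod + p ⟩
      step = by (+ (i !) · + (j !)) (begin
        + (suc i !) · + (j !)                       ≡⟨ cong (_· + (j !)) (pos-· (suc i) (i !)) ⟩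
        + suc i · + (i !) · + (j !)                 ≡⟨ solve 4 (λ a b c d → a :* b :* c := :- (b :* (d :* c)) :+ b :* c :* (a :+ d)) refl (+ suc i) (+ (i !)) (+ (j !)) (+ suc j) ⟩
        ⊝ (+ (i !) · (+ suc j · + (j !))) ⊕ + (i !) · + (j !) · (+ suc i ⊕ + suc j)
          ≡⟨ cong₂ (λ a b → ⊝ (+ (i !) · a) ⊕ + (i !) · + (j !) · b) (sym (pos-· (suc j) (j !)))
               (trans (sym (pos-⊕ (suc i) (suc j))) (cong +_ (trans (ℕ.+-suc (suc i) j) (trans (cong suc eq) (sym p≡))))) ⟩
        ⊝ (+ (i !) · + (suc j !)) ⊕ + (i !) · + (j !) · + p ∎)
        where open ≡-Reasoning

  factorial⁴ : (+ (m !) · + (m !)) · (+ (m !) · + (m !)) ≡ 1ℤ ⟨mod + p ⟩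
  factorial⁴ = factorials m m (trans (cong (λ z → m + z) (sym (ℕ.+-identityʳ m))) (ℕ.*-comm 2 m))

-- Vandermonde products of integer labels

opaque
  unfolding _⊕_
  sg-difference : ∀ a b → + b ⊕ ⊝ + a ≡ sg a b · + ℕ.∣ a - b ∣
  sg-difference zero    zero    = refl
  sg-difference zero    (suc b) = trans (ℤ.+-identityʳ (+ suc b)) (sym (ℤ.*-identityˡ (+ suc b)))
  sg-difference (suc a) zero    = trans (ℤ.+-identityˡ ℤ.-[1+ a ]) (sym (ℤ.-1*i≡-i (+ suc a)))
  sg-difference (suc a) (suc b) = trans (ℤ.m-n≡m⊖n (suc b) (suc a)) (trans (ℤ.[1+m]⊖[1+n]≡m⊖n b a) (trans (sym (ℤ.m-n≡m⊖n b a)) (sg-difference a b)))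

module _ (n : ℕ) where
  private
    σ = finSign n

    gap : Fin n → Fin n → ℤ
    gap a b = + ℕ.∣ toℕ a - toℕ b ∣

    gap-sym : ∀ a b → gap a b ≡ gap b a
    gap-sym a b = cong +_ (ℕ.∣-∣-comm (toℕ a) (toℕ b))

  dif : Fin n → Fin n → ℤ
  dif a b = + toℕ b ⊕ ⊝ + toℕ a

  V : ℤ
  V = pp gap (allFin n)

  -- The bridge from signs to polynomials: up to the constant `V`, the Vandermonde product of 0,
  -- ..., n-1 in absolute value, the sign of a full list of labels is its own Vandermonde product.
  -- With a repetition both sides are 0.
  pp-dif : ∀ xs → n ≤ length xs → pp dif xs ≡ sgnL σ xs · V
  pp-dif xs len with unique? σ Fin._≟_ xs
  ... | yes u = trans (pp-cong xs (λ a b → sg-difference (toℕ a) (toℕ b))) (trans (pp-* (Sign.s σ) gap xs)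
                  (cong (sgnL σ xs ·_) (pp-↭ gap-sym (full⇒↭ (finEnum n) u (subst (_≤ length xs) (sym (List.length-tabulate id)) len)))))
  ... | no ¬u = trans (pp-cong xs (λ a b → sg-difference (toℕ a) (toℕ b))) (trans (pp-* (Sign.s σ) gap xs)
                  (trans (cong (_· pp gap xs) (sgnL-nonunique σ Fin._≟_ xs ¬u))
                    (trans (trans (·-zeroˡ _) (sym (·-zeroˡ V))) (cong (_· V) (sym (sgnL-nonunique σ Fin._≟_ xs ¬u))))))

  private
    gap-pos : ∀ {a b : Fin n} → a ≢ b → 0 < ℕ.∣ toℕ a - toℕ b ∣
    gap-pos {a} {b} ne = ℕ.n≢0⇒n>0 (λ e → ne (Fin.toℕ-injective (ℕ.∣m-n∣≡0⇒m≡n e)))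

    gap-lt : ∀ (a b : Fin n) → ℕ.∣ toℕ a - toℕ b ∣ < n
    gap-lt a b = ℕ.≤-<-trans (ℕ.∣m-n∣≤m⊔n (toℕ a) (toℕ b)) (ℕ.⊔-pres-<m (Fin.toℕ<n a) (Fin.toℕ<n b))

  V≢0 : V ≢ 0ℤ
  V≢0 = ∏-≢0 (pairs (allFin n)) (λ {ab} ∈ps e → ℕ.<⇒≢ (gap-pos (AllPairs⇒pairs (Unique.allFin⁺ n) ∈ps)) (sym (ℤ.+-injective e)))

  V-unit : Prime n → ¬ (V ≡ 0ℤ ⟨mod + n ⟩)
  V-unit pr = mod-∏≢0 pr (pairs (allFin n)) (λ { {a , b} ∈ps → small-mod (gap-pos (AllPairs⇒pairs (Unique.allFin⁺ n) ∈ps)) (gap-lt a b) })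

-- Sublists of full length, tuples with restricted entries

module _ {X : Set} where

  sublist-length : ∀ (xs : List X) {F} → F ∈ sublists xs → length F ≤ length xs
  sublist-length []       (here refl) = z≤n
  sublist-length (x ∷ xs) F∈ with ∈.∈-++⁻ (map (x ∷_) (sublists xs)) F∈
  ... | inj₂ F∈′ = ℕ.m≤n⇒m≤1+n (sublist-length xs F∈′)
  ... | inj₁ F∈′ with ∈.∈-map⁻ (x ∷_) F∈′
  ...   | F′ , F′∈ , refl = s≤s (sublist-length xs F′∈)

  ∑-full-sublist : ∀ (xs : List X) k (g : List X → ℤ) → length xs ≡ k → ∑ (sublists xs) (λ F → ⟦ length F ℕ.≟ k ⟧ · g F) ≡ g xs
  ∑-full-sublist []       zero    g _   = solve 1 (λ a → con 1ℤ :* a :+ con 0ℤ := a) refl (g [])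
  ∑-full-sublist (x ∷ xs) (suc k) g len = begin
    ∑ (map (x ∷_) (sublists xs) ++ sublists xs) h
      ≡⟨ ∑-++ (map (x ∷_) (sublists xs)) (sublists xs) h ⟩
    ∑ (map (x ∷_) (sublists xs)) h ⊕ ∑ (sublists xs) h
      ≡⟨ cong₂ _⊕_ (∑-map (x ∷_) (sublists xs) h) (∑-zero (sublists xs) (λ {F} F∈ → trans (cong (_· g F) (⟦⟧-no (length F ℕ.≟ suc k)
           (λ e → ℕ.<-irrefl refl (ℕ.≤-trans (ℕ.≤-reflexive (trans (cong suc (ℕ.suc-injective len)) (sym e))) (sublist-length xs F∈))))) (·-zeroˡ _))) ⟩
    ∑ (sublists xs) (h ∘ (x ∷_)) ⊕ 0ℤ
      ≡⟨ ⊕-identityʳ _ ⟩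
    ∑ (sublists xs) (h ∘ (x ∷_))
      ≡⟨ ∑-cong (sublists xs) (λ F → cong (_· g (x ∷ F)) (⟦⟧-cong (suc (length F) ℕ.≟ suc k) (length F ℕ.≟ k) ℕ.suc-injective (cong suc))) ⟩
    ∑ (sublists xs) (λ F → ⟦ length F ℕ.≟ k ⟧ · g (x ∷ F))
      ≡⟨ ∑-full-sublist xs k (g ∘ (x ∷_)) (ℕ.suc-injective len) ⟩
    g (x ∷ xs) ∎
    where
    open ≡-Reasoning
    h : List X → ℤ
    h F = ⟦ length F ℕ.≟ suc k ⟧ · g F

  tuples-↭ : ∀ {xs ys : List X} k f → xs ↭ ys → tuples xs k f ≡ tuples ys k f
  tuples-↭ zero    f p = refl
  tuples-↭ {xs} {ys} (suc k) f p = trans (∑-cong xs (λ x → tuples-↭ k (f ∘ (x ∷_)) p)) (∑-↭ _ p)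

  tuples-vanish : ∀ (xs : List X) k {f} → (∀ l → length l ≡ k → f l ≡ 0ℤ) → tuples xs k f ≡ 0ℤ
  tuples-vanish xs zero    z = z [] refl
  tuples-vanish xs (suc k) z = ∑-zero xs (λ {x} _ → tuples-vanish xs k (λ l len → z (x ∷ l) (cong suc len)))

  ∑-filter : ∀ {P : X → Set} (P? : ∀ x → Dec (P x)) xs g → (∀ x → ¬ P x → g x ≡ 0ℤ) → ∑ xs g ≡ ∑ (filter P? xs) g
  ∑-filter P? []       g z = refl
  ∑-filter P? (x ∷ xs) g z with P? x
  ... | yes _  = cong (g x ⊕_) (∑-filter P? xs g z)
  ... | no ¬px = trans (cong₂ _⊕_ (z x ¬px) (∑-filter P? xs g z)) (⊕-identityˡ _)

  tuples-filter : ∀ {P : X → Set} (P? : ∀ x → Dec (P x)) xs k f →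
                  (∀ l → length l ≡ k → Any (λ x → ¬ P x) l → f l ≡ 0ℤ) → tuples xs k f ≡ tuples (filter P? xs) k f
  tuples-filter P? xs zero    f z = refl
  tuples-filter P? xs (suc k) f z =
    trans (∑-filter P? xs _ (λ x ¬px → tuples-vanish xs k (λ l len → z (x ∷ l) (cong suc len) (here ¬px))))
          (∑-cong (filter P? xs) (λ x → tuples-filter P? xs k (f ∘ (x ∷_)) (λ l len any → z (x ∷ l) (cong suc len) (there any))))

  length-concatMap : ∀ {Y : Set} (h : X → List Y) c xs → (∀ x → length (h x) ≡ c) → length (concatMap h xs) ≡ length xs * c
  length-concatMap h c []       _   = refl
  length-concatMap h c (x ∷ xs) len = trans (List.length-++ (h x)) (cong₂ _+_ (len x) (length-concatMap h c xs len))

  length-pairs : ∀ (xs : List X) → length (pairs xs) * 2 + length xs ≡ length xs * length xs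
  length-pairs []       = refl
  length-pairs (x ∷ xs) = begin
    length (map (x ,_) xs ++ pairs xs) * 2 + suc n
      ≡⟨ cong (λ z → z * 2 + suc n) (trans (List.length-++ (map (x ,_) xs)) (cong (_+ length (pairs xs)) (List.length-map (x ,_) xs))) ⟩
    (n + length (pairs xs)) * 2 + suc n
      ≡⟨ lem₁ n (length (pairs xs)) ⟩
    (length (pairs xs) * 2 + n) + (n + suc n)
      ≡⟨ cong (_+ (n + suc n)) (length-pairs xs) ⟩
    n * n + (n + suc n)
      ≡⟨ lem₂ n ⟩
    suc n * suc n ∎
    where
    open ≡-Reasoning
    n = length xs
    lem₁ : ∀ n q → (n + q) * 2 + suc n ≡ (q * 2 + n) + (n + suc n)
    lem₁ = ℕSolver.solve-∀
    lem₂ : ∀ n → n * n + (n + suc n) ≡ suc n * suc n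
    lem₂ = ℕSolver.solve-∀

∏-rising : ∀ m i → ∏ (allFin m) (λ d → + suc (i + toℕ d)) · + (i !) ≡ + ((m + i) !)
∏-rising zero    i = ·-identityˡ _
∏-rising (suc m) i = begin
  ∏ (allFin (suc m)) (λ d → + suc (i + toℕ d)) · + (i !)
    ≡⟨ cong (_· + (i !)) (∏-allFin-suc m _) ⟩
  + suc (i + 0) · ∏ (allFin m) (λ d → + suc (i + suc (toℕ d))) · + (i !)
    ≡⟨ cong₂ (λ a b → a · b · + (i !)) (cong (+_ ∘ suc) (ℕ.+-identityʳ i)) (∏-cong (allFin m) (λ d → cong (+_ ∘ suc) (ℕ.+-suc i (toℕ d)))) ⟩
  + suc i · ∏ (allFin m) (λ d → + suc (suc i + toℕ d)) · + (i !)
    ≡⟨ trans (solve 3 (λ a b c → a :* b :* c := b :* (a :* c)) refl _ _ _) (cong (∏ (allFin m) (λ d → + suc (suc i + toℕ d)) ·_) (sym (pos-· (suc i) (i !)))) ⟩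
  ∏ (allFin m) (λ d → + suc (suc i + toℕ d)) · + (suc i !)
    ≡⟨ ∏-rising m (suc i) ⟩
  + ((m + suc i) !)
    ≡⟨ cong (λ n → + (n !)) (ℕ.+-suc m i) ⟩
  + ((suc m + i) !) ∎
  where open ≡-Reasoning

∏-factorial : ∀ m → ∏ (allFin m) (λ d → + suc (toℕ d)) ≡ + (m !)
∏-factorial m = trans (sym (·-identityʳ _)) (trans (∏-rising m 0) (cong (λ n → + (n !)) (ℕ.+-identityʳ m)))

-- The signed number of starters

module Starters (p m : ℕ) .{{_ : NonZero p}} (prime : Prime p) (p≡ : p ≡ suc (m * 2)) where

  private
    σ = finSign p
    open Sign σ
    ds = allFin m
    xs = allFin p

  -- The two ends of the d-th pair of a starter, and `nothing` for the residue left over by the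
  -- pairs.
  Position : Set
  Position = Maybe (Fin m × Bool)

  block : Fin m → List Position
  block d = just (d , false) ∷ just (d , true) ∷ []

  positions : List Position
  positions = concatMap block ds ++ [ nothing ]

  length-ds : length ds ≡ m
  length-ds = List.length-tabulate id

  length-positions : length positions ≡ p
  length-positions = trans (List.length-++ (concatMap block ds)) (trans (cong (_+ 1) (trans (length-concatMap block 2 ds (λ _ → refl)) (cong (_* 2) length-ds)))
                       (trans (ℕ.+-comm (m * 2) 1) (sym p≡)))

  private
    -- All pairs of positions other than the two ends of one pair. Those have the constant
    -- difference c d and contribute no variable to the Vandermonde product.
    crossPairs : List (Position × Position)
    crossPairs = concatMap (λ (d , d′) → cartesianProduct (block d) (block d′)) (pairs ds) ++ map (_, nothing) (concatMap block ds)

    pp-positions : ∀ (g : Position → Position → ℤ) →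
                   pp g positions ≡ ∏ ds (λ d → g (just (d , false)) (just (d , true))) · ∏ crossPairs (uncurry g)
    pp-positions g = begin
      pp g (bs ++ [ nothing ])
        ≡⟨ pp-++ g bs [ nothing ] ⟩
      pp g bs · 1ℤ · ∏ bs (λ a → g a nothing · 1ℤ)
        ≡⟨ cong₂ _·_ (·-identityʳ _) (trans (∏-cong bs (λ a → ·-identityʳ _)) (sym (∏-map (_, nothing) bs (uncurry g)))) ⟩
      pp g bs · T
        ≡⟨ cong (_· T) (pp-concatMap g block ds) ⟩
      ∏ ds (λ d → pp g (block d)) · ∏ (pairs ds) (λ (d , d′) → ∏ (block d) (λ a → ∏ (block d′) (g a))) · T
        ≡⟨ cong₂ (λ a b → a · b · T) (∏-cong ds (λ d → trans (·-identityʳ _) refl))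
             (trans (∏-cong (pairs ds) (λ (d , d′) → sym (∏-× (block d) (block d′) (uncurry g)))) (sym (∏-concatMap _ (pairs ds) (uncurry g)))) ⟩
      ∏ ds (λ d → g (just (d , false)) (just (d , true))) · B · T
        ≡⟨ trans (·-assoc _ B T) (cong (∏ ds (λ d → g (just (d , false)) (just (d , true))) ·_) (sym (∏-++ (concatMap _ (pairs ds)) _ (uncurry g)))) ⟩
      ∏ ds (λ d → g (just (d , false)) (just (d , true))) · ∏ crossPairs (uncurry g) ∎
      where
      open ≡-Reasoning
      bs = concatMap block ds
      T = ∏ (map (_, nothing) bs) (uncurry g)
      B = ∏ (concatMap (λ (d , d′) → cartesianProduct (block d) (block d′)) (pairs ds)) (uncurry g)

    length-crossPairs : length crossPairs ≡ m * (m * 2)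
    length-crossPairs = begin
      length crossPairs
        ≡⟨ trans (List.length-++ (concatMap _ (pairs ds))) (cong₂ _+_ (length-concatMap _ 4 (pairs ds) (λ _ → refl))
             (trans (List.length-map (_, nothing) (concatMap block ds)) (length-concatMap block 2 ds (λ _ → refl)))) ⟩
      length (pairs ds) * 4 + length ds * 2
        ≡⟨ lem₁ (length (pairs ds)) (length ds) ⟩
      (length (pairs ds) * 2 + length ds) * 2
        ≡⟨ cong (_* 2) (trans (length-pairs ds) (cong₂ _*_ length-ds length-ds)) ⟩
      m * m * 2
        ≡⟨ ℕ.*-assoc m m 2 ⟩
      m * (m * 2) ∎
      where
      open ≡-Reasoning
      lem₁ : ∀ q n → q * 4 + n * 2 ≡ (q * 2 + n) * 2
      lem₁ = ℕSolver.solve-∀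

  place : (Fin m → ℕ) → Vec (Fin p) m → Fin p → Position → Fin p
  place c γ z (just (d , false)) = Vec.lookup γ d
  place c γ z (just (d , true))  = rot p (c d) (Vec.lookup γ d)
  place c γ z nothing            = z

  -- The sign is nonzero only if z and the m pairs formed by an entry γ d and its translate by c d
  -- exhaust ℤ/p, so this is the signed number of starters with prescribed differences.
  starters : (Fin m → ℕ) → Fin p → ℤ
  starters c z = ∑ (allVecs xs m) (λ γ → sgnL σ (map (place c γ z) positions))

  private
    linear : Position → List (ℤ × Fin m)
    linear (just (d , _)) = [ (1ℤ , d) ]
    linear nothing        = []

    offset : (Fin m → ℕ) → Position → ℤ
    offset c (just (d , true)) = + c d
    offset c _                 = 0ℤ

    form : (Fin m → ℕ) → Position × Position → Form
    form c (a , b) = (linear b ++ map (λ (k , e) → (⊝ k , e)) (linear a)) , offset c b ⊕ ⊝ offset c a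

    coordinate : (Fin m → ℤ) → Position → ℤ
    coordinate x (just (d , _)) = x d
    coordinate x nothing        = 0ℤ

    ∑-linear : ∀ x a → ∑ (linear a) (λ (k , e) → k · x e) ≡ coordinate x a
    ∑-linear x (just (d , _)) = solve 1 (λ a → con 1ℤ :* a :+ con 0ℤ := a) refl (x d)
    ∑-linear x nothing        = refl

    ∑-negated : ∀ x a → ∑ (map (λ (k , e) → (⊝ k , e)) (linear a)) (λ (k , e) → k · x e) ≡ ⊝ coordinate x a
    ∑-negated x (just (d , _)) = solve 1 (λ a → :- con 1ℤ :* a :+ con 0ℤ := :- a) refl (x d)
    ∑-negated x nothing        = solve 0 (con 0ℤ := :- con 0ℤ) refl

    eval-form : ∀ c x a b → evalForm (form c (a , b)) x ≡ (coordinate x b ⊕ offset c b) ⊕ ⊝ (coordinate x a ⊕ offset c a)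
    eval-form c x a b = trans (cong (_⊕ (offset c b ⊕ ⊝ offset c a)) (trans (∑-++ (linear b) _ _) (cong₂ _⊕_ (∑-linear x b) (∑-negated x a))))
      (solve 4 (λ p q r s → (p :+ :- q) :+ (r :+ :- s) := (p :+ r) :+ :- (q :+ s)) refl _ _ _ _)

    val-place : ∀ c γ a → val p (place c γ (0′ p) a) ≡ coordinate (val p ∘ Vec.lookup γ) a ⊕ offset c a ⟨mod + p ⟩
    val-place c γ (just (d , false)) = ≡⇒mod (sym (⊕-identityʳ _))
    val-place c γ (just (d , true))  = mod-trans (val-rot p (c d) (Vec.lookup γ d)) (≡⇒mod (⊕-comm _ _))
    val-place c γ nothing            = ≡⇒mod (trans (val-0′ p) (sym (⊕-identityˡ 0ℤ)))

    forms : (Fin m → ℕ) → List Form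
    forms c = map (form c) crossPairs

    point : Vec (Fin p) m → Fin m → ℤ
    point γ = val p ∘ Vec.lookup γ

    -- The Vandermonde product of the placed residues: modulo p the ends of a pair give the factor c
    -- d, and any other two positions give an affine form in γ.
    one-term : ∀ c γ → sgnL σ (map (place c γ (0′ p)) positions) · V p ≡
                       ∏ ds (λ d → + c d) · ∏ (forms c) (λ ℓ → evalForm ℓ (point γ)) ⟨mod + p ⟩
    one-term c γ =
      sgnL σ (map f positions) · V p
        mod⟨ ≡⇒mod (sym (pp-dif p (map f positions) (ℕ.≤-reflexive (sym (trans (List.length-map f positions) length-positions))))) ⟩
      pp (dif p) (map f positions)
        mod⟨ ≡⇒mod (trans (pp-map (dif p) f positions) (pp-positions (λ a b → dif p (f a) (f b)))) ⟩
      ∏ ds (λ d → dif p (f (just (d , false))) (f (just (d , true)))) · ∏ crossPairs (λ (a , b) → dif p (f a) (f b))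
        mod⟨ mod-· (mod-∏ ds (λ {d} _ → mod-trans (mod-⊕ (val-place c γ (just (d , true))) (mod-⊝ (val-place c γ (just (d , false)))))
                              (≡⇒mod (solve 2 (λ x c → (x :+ c) :+ :- (x :+ con 0ℤ) := c) refl (point γ d) (+ c d)))))
                   (mod-trans (mod-∏ crossPairs (λ { {a , b} _ → mod-trans (mod-⊕ (val-place c γ b) (mod-⊝ (val-place c γ a))) (≡⇒mod (sym (eval-form c (point γ) a b))) }))
                              (≡⇒mod (sym (∏-map (form c) crossPairs (λ ℓ → evalForm ℓ (point γ)))))) ⟩
      ∏ ds (λ d → + c d) · ∏ (forms c) (λ ℓ → evalForm ℓ (point γ)) mod∎
      where f = place c γ (0′ p)

    w : Fin p → ℤ
    w x = weight (m * 2) (toℕ x)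

    φ : Fin m → ℕ → ℤ
    φ e j = ∑ xs (λ x → w x · val p x ↑ j)

    φ-low : Vanishes-below (λ _ → m * 2) φ
    φ-low e j lt = trans (∑-weight p≡ j) (fd-power-low (m * 2) j 0 lt)

    -- The forms for different shifts c have the same leading parts.
    leading : ℤ
    leading = Φ (forms (λ _ → 0)) φ

    -- Inserting the weights changes nothing modulo p, as they are all 1. The m · 2m forms have
    -- exactly the degree at which a functional vanishing below exponent 2m in each of m variables
    -- can be nonzero, so the constants of the forms drop out.
    ∑-forms : ∀ c → ∑ (allVecs xs m) (λ γ → ∏ (forms c) (λ ℓ → evalForm ℓ (point γ))) ≡ leading ⟨mod + p ⟩
    ∑-forms c = mod-trans (mod-∑ (allVecs xs m) (λ {γ} _ → mod-trans (≡⇒mod (sym (·-identityˡ _))) (mod-· (mod-sym (w-one γ)) mod-refl)))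
      (≡⇒mod (trans (sym (Φ-eval xs (val p) (forms c) (λ _ → w)))
        (Φ-top (forms c) (forms (λ _ → 0)) same-linear φ-low φ-low (λ _ → refl)
          (ℕ.≤-reflexive (trans (List.length-map (form c) crossPairs) (trans length-crossPairs (sym (Nsum-const {m} (m * 2)))))))))
      where
      w-one : ∀ γ → ∏ (allFin m) (λ e → w (Vec.lookup γ e)) ≡ 1ℤ ⟨mod + p ⟩
      w-one γ = mod-trans (mod-∏ (allFin m) (λ {e} _ → weight-mod prime p≡ (toℕ (Vec.lookup γ e))
                  (ℕ.s≤s⁻¹ (subst (toℕ (Vec.lookup γ e) <_) p≡ (Fin.toℕ<n (Vec.lookup γ e)))))) (≡⇒mod (∏-one (allFin m) (λ _ → refl)))
      same-linear : map proj₁ (forms c) ≡ map proj₁ (forms (λ _ → 0))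
      same-linear = trans (sym (List.map-∘ crossPairs)) (List.map-∘ crossPairs)

    starters-leading : ∀ c → starters c (0′ p) · V p ≡ ∏ ds (λ d → + c d) · leading ⟨mod + p ⟩
    starters-leading c = mod-trans (≡⇒mod (sym (∑-*ʳ (allVecs xs m) (V p) _)))
      (mod-trans (mod-∑ (allVecs xs m) (λ {γ} _ → one-term c γ)) (mod-trans (≡⇒mod (∑-*ˡ (allVecs xs m) _ _)) (mod-· mod-refl (∑-forms c))))

  starters-shift : starters (suc ∘ toℕ) (0′ p) ≡ + (m !) · starters (λ _ → 1) (0′ p) ⟨mod + p ⟩
  starters-shift = mod-cancelˡ prime (V p) (V-unit p prime)
    (V p · starters (suc ∘ toℕ) (0′ p)              mod⟨ ≡⇒mod (·-comm _ _) ⟩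
     starters (suc ∘ toℕ) (0′ p) · V p              mod⟨ starters-leading (suc ∘ toℕ) ⟩
     ∏ ds (λ d → + suc (toℕ d)) · leading           mod⟨ mod-· (≡⇒mod (∏-factorial m)) (≡⇒mod (sym (·-identityˡ leading))) ⟩
     + (m !) · (1ℤ · leading)                       mod⟨ mod-· (mod-refl {a = + (m !)}) (mod-· (≡⇒mod (sym (∏-one ds (λ _ → refl)))) mod-refl) ⟩
     + (m !) · (∏ ds (λ _ → + 1) · leading)         mod⟨ mod-· mod-refl (mod-sym (starters-leading (λ _ → 1))) ⟩
     + (m !) · (starters (λ _ → 1) (0′ p) · V p)    mod⟨ ≡⇒mod (solve 3 (λ a b c → a :* (b :* c) := c :* (a :* b)) refl _ _ _) ⟩
     V p · (+ (m !) · starters (λ _ → 1) (0′ p))    mod∎)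

-- With all differences equal to 1 there is, up to order, just one starter: {1,2}, {3,4}, ….
module UnitStarters (p m : ℕ) .{{_ : NonZero p}} (prime : Prime p) (p≡ : p ≡ suc (m * 2)) where
  open Starters p m prime p≡

  private
    σ = finSign p
    open Sign σ
    xs = allFin p
    z₀ = 0′ p
    r₁ = rot p 1

    dominoes : List (Fin p) → List (Fin p)
    dominoes l = concatMap (λ x → x ∷ r₁ x ∷ []) l ++ [ z₀ ]

    f : List (Fin p) → ℤ
    f l = sgnL σ (dominoes l)

    places≡dominoes : ∀ γ → map (place (λ _ → 1) γ z₀) positions ≡ dominoes (Vec.toList γ)
    places≡dominoes γ = trans (List.map-++ _ (concatMap block (allFin m)) [ nothing ]) (cong (_++ [ z₀ ])
      (trans (List.map-concatMap _ block (allFin m)) (trans (sym (List.concatMap-map (λ x → x ∷ r₁ x ∷ []) (Vec.lookup γ) (allFin m)))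
        (cong (concatMap (λ x → x ∷ r₁ x ∷ [])) (sym (toList≡map-lookup γ))))))

    starters≡tuples : starters (λ _ → 1) z₀ ≡ tuples xs m f
    starters≡tuples = trans (∑-cong (allVecs xs m) (λ γ → cong (sgnL σ) (places≡dominoes γ))) (sym (tuples≡∑ xs m f))

    G : Fin p → Fin p → ℤ
    G x y = ∏ (x ∷ r₁ x ∷ []) (λ a → ∏ (y ∷ r₁ y ∷ []) (s a))

    f≡ : ∀ l → f l ≡ ∏ l (λ x → pp s (x ∷ r₁ x ∷ [])) · pp G l · pp s [ z₀ ] · ∏ l (λ x → ∏ (x ∷ r₁ x ∷ []) (λ a → ∏ [ z₀ ] (s a)))
    f≡ l = trans (pp-++ s (concatMap _ l) [ z₀ ]) (cong₂ (λ a b → a · pp s [ z₀ ] · b) (pp-concatMap s _ l) (∏-concatMap _ l _))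

    -- Exchanging two dominoes reverses four comparisons, so the signs cancel. This makes `f`
    -- independent of the order of the dominoes.
    G-sym : ∀ x y → G x y ≡ G y x
    G-sym x y = trans (lem (s x y) (s x (r₁ y)) (s (r₁ x) y) (s (r₁ x) (r₁ y)))
      (cong₂ (λ a b → a · (b · 1ℤ))
        (trans (cong₂ (λ a b → a · (b · 1ℤ)) (sym (anti x y)) (sym (anti (r₁ x) y))) refl)
        (trans (cong₂ (λ a b → a · (b · 1ℤ)) (sym (anti x (r₁ y))) (sym (anti (r₁ x) (r₁ y)))) refl))
      where
      lem : ∀ a b c d → (a · (b · 1ℤ)) · ((c · (d · 1ℤ)) · 1ℤ) ≡ (⊝ a · (⊝ c · 1ℤ)) · ((⊝ b · (⊝ d · 1ℤ)) · 1ℤ)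
      lem = solve 4 (λ a b c d → (a :* (b :* con 1ℤ)) :* ((c :* (d :* con 1ℤ)) :* con 1ℤ)
                               := (:- a :* (:- c :* con 1ℤ)) :* ((:- b :* (:- d :* con 1ℤ)) :* con 1ℤ)) refl

    alternating : Alternating f
    alternating .Alternating.symmetric {l} {l′} q = trans (f≡ l) (trans
      (cong₂ _·_ (cong (_· pp s [ z₀ ]) (cong₂ _·_ (∏-↭ _ q) (pp-↭ G-sym q))) (∏-↭ _ q)) (sym (f≡ l′)))
    alternating .Alternating.repeated x l = ∏-zero {xs = pairs (dominoes (x ∷ x ∷ l))} (there (here refl)) (diag x)

    odd : ℕ → Fin p
    odd i = residue p (suc (i * 2))

    odds : List (Fin p)
    odds = map (odd ∘ toℕ) (allFin m)

    bound : ∀ {i} → i < m → suc (suc (i * 2)) < p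
    bound {i} lt = subst (suc (suc (i * 2)) <_) (sym p≡) (s≤s (ℕ.*-monoˡ-≤ 2 lt))

    small : ∀ {a} → a < p → toℕ (residue p a) ≡ a
    small {a} lt = trans (toℕ-residue p a) (ℕ%.m<n⇒m%n≡m lt)

    toℕ-odd : ∀ {i} → i < m → toℕ (odd i) ≡ suc (i * 2)
    toℕ-odd lt = small (ℕ.<-trans (ℕ.n<1+n _) (bound lt))

    odds-unique : Unique odds
    odds-unique = Unique.map⁺ (λ {i} {j} eq → Fin.toℕ-injective (ℕ.*-cancelʳ-≡ _ _ 2 (ℕ.suc-injective
      (trans (sym (toℕ-odd (Fin.toℕ<n i))) (trans (cong toℕ eq) (toℕ-odd (Fin.toℕ<n j))))))) (Unique.allFin⁺ m)

    length-odds : length odds ≡ m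
    length-odds = trans (List.length-map _ (allFin m)) (List.length-tabulate id)

    length-dominoes : ∀ l → length l ≡ m → length (dominoes l) ≡ p
    length-dominoes l len = trans (List.length-++ (concatMap _ l)) (trans (cong (_+ 1) (trans (length-concatMap _ 2 l (λ _ → refl)) (cong (_* 2) len)))
                                (trans (ℕ.+-comm (m * 2) 1) (sym p≡)))

    ∈-domino₁ : ∀ {x l} → x ∈ l → x ∈ concatMap (λ x → x ∷ r₁ x ∷ []) l
    ∈-domino₁ (here refl) = here refl
    ∈-domino₁ (there x∈)  = there (there (∈-domino₁ x∈))

    ∈-domino₂ : ∀ {x l} → x ∈ l → r₁ x ∈ concatMap (λ x → x ∷ r₁ x ∷ []) l
    ∈-domino₂ (here refl) = there (here refl)
    ∈-domino₂ (there x∈)  = there (there (∈-domino₂ x∈))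

    domino-∈ : ∀ {a} l → a ∈ dominoes l → (a ∈ l ⊎ ∃ λ x → x ∈ l × r₁ x ≡ a) ⊎ a ≡ z₀
    domino-∈ []      (here refl)         = inj₂ refl
    domino-∈ (x ∷ l) (here refl)         = inj₁ (inj₁ (here refl))
    domino-∈ (x ∷ l) (there (here refl)) = inj₁ (inj₂ (x , here refl , refl))
    domino-∈ (x ∷ l) (there (there a∈))  = Sum.map₁ (Sum.map there (λ (y , y∈ , eq) → y , there y∈ , eq)) (domino-∈ l a∈)

    disjoint : ∀ {l x y} → Unique (dominoes l) → x ∈ l → y ∈ l → r₁ x ≢ y
    disjoint {h ∷ l} ((h≢ ∷ _) ∷ _ ∷ _)    (here refl) (here refl) eq = h≢ (sym eq)
    disjoint {h ∷ l} (_ ∷ r≢ ∷ _)          (here refl) (there y∈)  eq = All.lookup r≢ (∈.∈-++⁺ˡ (∈-domino₁ y∈)) eq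
    disjoint {h ∷ l} ((_ ∷ h≢) ∷ _ ∷ _)    (there x∈)  (here refl) eq = All.lookup h≢ (∈.∈-++⁺ˡ (∈-domino₂ x∈)) (sym eq)
    disjoint {h ∷ l} (_ ∷ _ ∷ u)           (there x∈)  (there y∈)  eq = disjoint u x∈ y∈ eq

    z₀∉ : ∀ {l} → Unique (dominoes l) → z₀ ∉ l
    z₀∉ {h ∷ l} ((_ ∷ h≢) ∷ _ ∷ _) (here refl) = All.lookup h≢ (∈.∈-++⁺ʳ (concatMap _ l) (here refl)) refl
    z₀∉ {h ∷ l} (_ ∷ _ ∷ u)        (there z∈)  = z₀∉ u z∈

    r₁-residue : ∀ a → r₁ (residue p a) ≡ residue p (suc a)
    r₁-residue a = val-injective p (mod-trans (val-rot p 1 (residue p a)) (mod-trans (mod-⊕ mod-refl (val-residue p a))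
                     (mod-trans (≡⇒mod (sym (pos-⊕ 1 a))) (mod-sym (val-residue p (suc a))))))

    residue≢z₀ : ∀ {a} → 0 < a → a < p → residue p a ≢ z₀
    residue≢z₀ {a} pos lt eq = ℕ.<⇒≢ pos (sym (trans (sym (small lt)) (trans (cong toℕ eq) (ℤ.+-injective (val-0′ p)))))

    module _ {l : List (Fin p)} (len : length l ≡ m) (u : Unique (dominoes l)) where

      covered : ∀ a → a ∈ dominoes l
      covered a = ↭.∈-resp-↭ (↭-sym (full⇒↭ (finEnum p) u
        (ℕ.≤-reflexive (trans (List.length-tabulate id) (sym (length-dominoes l len)))))) (∈.∈-allFin a)

      -- Going up through 1, 3, 5, ...: if 2i+1 were the second half of its domino, the first half
      -- would be 2i. But that residue is the left over 0, or it is already the second half of the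
      -- domino at 2i-1.
      odd∈ : ∀ i → i < m → odd i ∈ l
      odd∈ i lt with domino-∈ l (covered (odd i))
      ... | inj₁ (inj₁ o∈) = o∈
      ... | inj₂ eq        = contradiction eq (residue≢z₀ (s≤s z≤n) (ℕ.<-trans (ℕ.n<1+n _) (bound lt)))
      odd∈ zero    lt | inj₁ (inj₂ (x , x∈ , eq)) =
        contradiction (subst (_∈ l) (rot-injective p 1 (trans eq (sym (r₁-residue 0)))) x∈) (z₀∉ u)
      odd∈ (suc i) lt | inj₁ (inj₂ (x , x∈ , eq)) =
        contradiction (sym (rot-injective p 1 (trans eq (sym (trans (cong r₁ (r₁-residue (suc (i * 2)))) (r₁-residue (suc (suc (i * 2)))))))))
                      (disjoint u (odd∈ i (ℕ.<-trans (ℕ.n<1+n i) lt)) x∈)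

      ⊆odds : ∀ {x} → x ∈ l → x ∈ odds
      ⊆odds x∈ = ↭.∈-resp-↭ (↭-sym (unique-⊆⇒↭ odds-unique odds⊆ (ℕ.≤-reflexive (trans len (sym length-odds))))) x∈
        where
        odds⊆ : ∀ {x} → x ∈ odds → x ∈ l
        odds⊆ x∈ with ∈.∈-map⁻ (odd ∘ toℕ) x∈
        ... | i , _ , refl = odd∈ (toℕ i) (Fin.toℕ<n i)

    open import Data.List.Membership.DecPropositional {A = Fin p} Fin._≟_ using (_∈?_)

    odds-filter : filter (_∈? odds) xs ↭ odds
    odds-filter = unique-set⇒↭ (Unique.filter⁺ (_∈? odds) (Unique.allFin⁺ p)) odds-unique
      (λ x∈ → proj₂ (∈.∈-filter⁻ (_∈? odds) {xs = xs} x∈)) (λ x∈ → ∈.∈-filter⁺ (_∈? odds) (∈.∈-allFin _) x∈)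

    outside-odds : ∀ l → length l ≡ m → Any (λ x → x ∉ odds) l → f l ≡ 0ℤ
    outside-odds l len any with unique? σ Fin._≟_ (dominoes l)
    ... | no ¬u = sgnL-nonunique σ Fin._≟_ (dominoes l) ¬u
    ... | yes u with find any
    ...   | x , x∈ , x∉ = contradiction (⊆odds len u x∈) x∉

    parity : ∀ n → (∃ λ i → n ≡ i * 2) ⊎ (∃ λ i → n ≡ suc (i * 2))
    parity zero    = inj₁ (0 , refl)
    parity (suc n) = Sum.[ (λ (i , eq) → inj₂ (i , cong suc eq)) , (λ (i , eq) → inj₁ (suc i , cong suc eq)) ] (parity n)

    all∈ : ∀ a → a ∈ dominoes odds
    all∈ a = subst (_∈ dominoes odds) (residue-toℕ p a) (go (toℕ a) (Fin.toℕ<n a) (parity (toℕ a)))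
      where
      odd∈odds : ∀ {i} → i < m → odd i ∈ odds
      odd∈odds {i} lt = subst (λ j → odd j ∈ odds) (Fin.toℕ-fromℕ< lt) (∈.∈-map⁺ (odd ∘ toℕ) (∈.∈-allFin (fromℕ< lt)))
      half : ∀ {i} → i * 2 < m * 2 → i < m
      half lt = ℕ.*-cancelʳ-< _ _ _ lt
      go : ∀ n → n < p → (∃ λ i → n ≡ i * 2) ⊎ (∃ λ i → n ≡ suc (i * 2)) → residue p n ∈ dominoes odds
      go _ lt (inj₁ (zero , refl))  = ∈.∈-++⁺ʳ (concatMap _ odds) (here refl)
      go _ lt (inj₁ (suc i , refl)) = ∈.∈-++⁺ˡ (subst (_∈ concatMap _ odds) (r₁-residue (suc (i * 2)))
        (∈-domino₂ (odd∈odds (half {i} (ℕ.<-trans (ℕ.n<1+n _) (ℕ.s<s⁻¹ (subst (suc (suc (i * 2)) <_) p≡ lt)))))))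
      go _ lt (inj₂ (i , refl))     = ∈.∈-++⁺ˡ (∈-domino₁ (odd∈odds (half {i} (ℕ.s<s⁻¹ (subst (suc (i * 2) <_) p≡ lt)))))

    f-odds-sq : f odds · f odds ≡ 1ℤ
    f-odds-sq = sgnL-sq σ (Unique-resp-↭ (unique-⊆⇒↭ (Unique.allFin⁺ p) (λ {a} _ → all∈ a)
      (ℕ.≤-reflexive (trans (length-dominoes odds length-odds) (sym (List.length-tabulate id))))) (Unique.allFin⁺ p))

  unit-starters : ∃ λ ε₁ → starters (λ _ → 1) z₀ ≡ + (m !) · ε₁ × ε₁ · ε₁ ≡ 1ℤ
  unit-starters = f odds , (begin
    starters (λ _ → 1) z₀
      ≡⟨ starters≡tuples ⟩
    tuples xs m f
      ≡⟨ tuples-filter (_∈? odds) xs m f outside-odds ⟩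
    tuples (filter (_∈? odds) xs) m f
      ≡⟨ tuples-↭ m f odds-filter ⟩
    tuples odds m f
      ≡⟨ tuples≡!·sublists alternating odds m ⟩
    + (m !) · ∑ (sublists odds) (λ F → ⟦ length F ℕ.≟ m ⟧ · f F)
      ≡⟨ cong (+ (m !) ·_) (∑-full-sublist odds m f length-odds) ⟩
    + (m !) · f odds ∎) , f-odds-sq
    where open ≡-Reasoning

  starters-sq : starters (suc ∘ toℕ) z₀ · starters (suc ∘ toℕ) z₀ ≡ 1ℤ ⟨mod + p ⟩
  starters-sq = mod-trans (mod-· once once) (mod-trans (≡⇒mod (trans (lem (+ (m !)) ε₁) (trans (cong ((+ (m !) · + (m !)) · (+ (m !) · + (m !)) ·_) (proj₂ (proj₂ unit-starters))) (·-identityʳ _))))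
                  (factorial⁴ {m = m} prime p≡))
    where
    ε₁ = proj₁ unit-starters
    once : starters (suc ∘ toℕ) z₀ ≡ + (m !) · (+ (m !) · ε₁) ⟨mod + p ⟩
    once = mod-trans starters-shift (≡⇒mod (cong (+ (m !) ·_) (proj₁ (proj₂ unit-starters))))
    lem : ∀ a b → a · (a · b) · (a · (a · b)) ≡ (a · a) · (a · a) · (b · b)
    lem = solve 2 (λ a b → a :* (a :* b) :* (a :* (a :* b)) := (a :* a) :* (a :* a) :* (b :* b)) refl

-- The edges of a complete graph

lookup-unique : ∀ {X : Set} {xs : List X} → Unique xs → ∀ {i j} → List.lookup xs i ≡ List.lookup xs j → i ≡ j
lookup-unique {xs = x ∷ xs} (x≢ ∷ u) {zero}  {zero}  eq = refl
lookup-unique {xs = x ∷ xs} (x≢ ∷ u) {zero}  {suc j} eq = contradiction eq (All.lookup x≢ (∈.∈-lookup j))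
lookup-unique {xs = x ∷ xs} (x≢ ∷ u) {suc i} {zero}  eq = contradiction (sym eq) (All.lookup x≢ (∈.∈-lookup i))
lookup-unique {xs = x ∷ xs} (x≢ ∷ u) {suc i} {suc j} eq = cong suc (lookup-unique u eq)

module _ (n : ℕ) where
  private
    edges = edgeList (K n)
    joined? : ∀ (uv : Fin n × Fin n) → Dec (proj₁ uv Fin.< proj₂ uv × proj₁ uv ≢ proj₂ uv)
    joined? (u , v) = (u Fin.<? v) ×-dec (¬? (u Fin.≟ v))

  lo<hi : ∀ e → lo (K n) e Fin.< hi (K n) e
  lo<hi e = proj₁ (proj₂ (∈.∈-filter⁻ joined? {xs = cartesianProduct (allFin n) (allFin n)} (∈.∈-lookup {xs = edges} e)))

  edge-ext : ∀ {e f} → lo (K n) e ≡ lo (K n) f → hi (K n) e ≡ hi (K n) f → e ≡ f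
  edge-ext eq eq′ = lookup-unique (Unique.filter⁺ joined? (Unique.cartesianProduct⁺ (Unique.allFin⁺ n) (Unique.allFin⁺ n))) (cong₂ _,_ eq eq′)

  private
    edge∈ : ∀ {u v : Fin n} → u Fin.< v → (u , v) ∈ edges
    edge∈ {u} {v} lt = ∈.∈-filter⁺ joined? (∈.∈-cartesianProduct⁺ (∈.∈-allFin u) (∈.∈-allFin v)) (lt , Fin.<⇒≢ lt)

    edge< : ∀ {u v : Fin n} → u Fin.< v → Edge (K n)
    edge< lt = Any.index (edge∈ lt)

    edge<-ends : ∀ {u v : Fin n} (lt : u Fin.< v) → (lo (K n) (edge< lt) , hi (K n) (edge< lt)) ≡ (u , v)
    edge<-ends lt = sym (Any.lookup-index (edge∈ lt))

  -- Edges are stored with the smaller end first; the view addresses an edge by its two ends in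
  -- either order.
  data Edge-view (u v : Fin n) (e : Edge (K n)) : Set where
    upward   : lo (K n) e ≡ u → hi (K n) e ≡ v → Edge-view u v e
    downward : lo (K n) e ≡ v → hi (K n) e ≡ u → Edge-view u v e

  view-swap : ∀ {u v e} → Edge-view u v e → Edge-view v u e
  view-swap (upward l h)   = downward l h
  view-swap (downward l h) = upward l h

  view-unique : ∀ {u v e f} → Edge-view u v e → Edge-view u v f → e ≡ f
  view-unique (upward l h)   (upward l′ h′)   = edge-ext (trans l (sym l′)) (trans h (sym h′))
  view-unique (downward l h) (downward l′ h′) = edge-ext (trans l (sym l′)) (trans h (sym h′))
  view-unique {e = e} {f} (upward l h) (downward l′ h′) = contradiction (lo<hi f) (Fin.<-asym (subst₂ Fin._<_ (trans l (sym h′)) (trans h (sym l′)) (lo<hi e)))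
  view-unique {e = e} {f} (downward l h) (upward l′ h′) = contradiction (lo<hi f) (Fin.<-asym (subst₂ Fin._<_ (trans l (sym h′)) (trans h (sym l′)) (lo<hi e)))

  incident-view : ∀ {u v e} → Edge-view u v e → Incident (K n) u e
  incident-view (upward l h)   = inj₁ (sym l)
  incident-view (downward l h) = inj₂ (sym h)

  view-inj : ∀ {u v u′ v′ e} → Edge-view u v e → Edge-view u′ v′ e → (u ≡ u′ × v ≡ v′) ⊎ (u ≡ v′ × v ≡ u′)
  view-inj (upward l h)   (upward l′ h′)   = inj₁ (trans (sym l) l′ , trans (sym h) h′)
  view-inj (downward l h) (downward l′ h′) = inj₁ (trans (sym h) h′ , trans (sym l) l′)
  view-inj (upward l h)   (downward l′ h′) = inj₂ (trans (sym l) l′ , trans (sym h) h′)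
  view-inj (downward l h) (upward l′ h′)   = inj₂ (trans (sym h) h′ , trans (sym l) l′)

  other-end : ∀ {v e} → Incident (K n) v e → ∃ λ u → v ≢ u × Edge-view v u e
  other-end {v} {e} (inj₁ eq) = hi (K n) e , (λ { refl → ℕ.<-irrefl (cong toℕ (sym eq)) (lo<hi e) }) , upward (sym eq) refl
  other-end {v} {e} (inj₂ eq) = lo (K n) e , (λ { refl → ℕ.<-irrefl (cong toℕ eq) (lo<hi e) }) , downward refl (sym eq)

  opaque
    -- edge e₀ u u is the junk value e₀.
    edge : Edge (K n) → Fin n → Fin n → Edge (K n)
    edge e₀ u v with Fin.<-cmp u v
    ... | tri< lt _ _ = edge< lt
    ... | tri≈ _ _ _  = e₀
    ... | tri> _ _ gt = edge< gt

    edge-view : ∀ e₀ {u v} → u ≢ v → Edge-view u v (edge e₀ u v)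
    edge-view e₀ {u} {v} ne with Fin.<-cmp u v
    ... | tri< lt _ _ = upward (cong proj₁ (edge<-ends lt)) (cong proj₂ (edge<-ends lt))
    ... | tri≈ _ eq _ = contradiction eq ne
    ... | tri> _ _ gt = downward (cong proj₁ (edge<-ends gt)) (cong proj₂ (edge<-ends gt))

  some-edge : ∀ {u v : Fin n} → u Fin.< v → Edge (K n)
  some-edge = edge<

  adjacent : ∀ {u v w e f} → Edge-view u v e → Edge-view u w f → v ≢ w → u ≢ v → AdjacentEdges (K n) e f
  adjacent {u} {v} {w} ve vf v≢w u≢v = ne , u , incident-view ve , incident-view vf
    where
    ne : _ ≢ _
    ne refl with view-inj ve vf
    ... | inj₁ (_ , eq) = v≢w eq
    ... | inj₂ (_ , eq) = u≢v (sym eq)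

-- The vertices and edges of K 2p under the rotations of its two halves

combine-mono : ∀ {a b} (i : Fin a) {x y : Fin b} → x Fin.< y → combine i x Fin.< combine i y
combine-mono {b = b} i {x} {y} lt = subst₂ _<_ (sym (Fin.toℕ-combine i x)) (sym (Fin.toℕ-combine i y)) (ℕ.+-monoʳ-< (b * toℕ i) lt)

pullback : ∀ {X Y : Set} (h : X → Y) → (∀ {x y} → h x ≡ h y → x ≡ y) → Sign Y → Sign X
pullback h inj σ = record { s = λ x y → s (h x) (h y); anti = λ x y → anti (h x) (h y); diag = λ x → diag (h x); sq = λ ne → sq (ne ∘ inj) }
  where open Sign σ

module Model (p m : ℕ) .{{_ : NonZero p}} (p≡ : p ≡ suc (m * 2)) (m>0 : 0 < m) where

  n k : ℕ
  n = 2 * p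
  k = m * 2 + p

  VP : Set
  VP = Fin 2 × Fin p

  vtx : VP → Fin n
  vtx (a , x) = combine a x

  vtx-injective : ∀ {u v} → vtx u ≡ vtx v → u ≡ v
  vtx-injective {a , x} {b , y} eq = let i , j = Fin.combine-injective a x b y eq in cong₂ _,_ i j

  vtx-surjective : ∀ v → ∃ λ u → vtx u ≡ v
  vtx-surjective v = let a , x , eq = Fin.combine-surjective {2} {p} v in (a , x) , eq

  VPs : List VP
  VPs = cartesianProduct (allFin 2) (allFin p)

  VP-enum : Enumeration VP
  VP-enum = finEnum 2 ×-enum finEnum p

  σV : Sign VP
  σV = pullback vtx vtx-injective (finSign n)

  sV : VP → VP → ℤ
  sV = Sign.s σV

  sP : Fin p → Fin p → ℤ
  sP = Sign.s (finSign p)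

  sV-side : ∀ a x y → sV (a , x) (a , y) ≡ sP x y
  sV-side a x y with Fin.<-cmp x y
  ... | tri< lt _ _   = trans (sg-< (combine-mono a lt)) (sym (sg-< lt))
  ... | tri> _ _ gt   = trans (sg-> (combine-mono a gt)) (sym (sg-> gt))
  ... | tri≈ _ refl _ = trans (sg-refl (toℕ (combine a x))) (sym (sg-refl (toℕ x)))

  private
    halves : ∀ (x y : Fin p) → combine {2} zero x Fin.< combine {2} (suc zero) y
    halves x y = Fin.combine-monoˡ-< {i = zero {1}} {suc {1} zero} x y (s≤s z≤n)

  sV-across : ∀ x y → sV (zero , x) (suc zero , y) ≡ 1ℤ
  sV-across x y = sg-< (halves x y)

  sV-back : ∀ x y → sV (suc zero , x) (zero , y) ≡ -1ℤ
  sV-back x y = sg-> (halves y x)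

  -- Names for the 2p - 1 edges at a vertex, which constitute the cyclic listing: d + 1 steps
  -- forward (`false`) or backward (`true`) within the half, or a crossing with offset y. A common
  -- rotation of both halves respects the slots.
  Slot : Set
  Slot = (Fin m × Bool) ⊎ Fin p

  bit : Bool → Fin 2
  bit false = zero
  bit true  = suc zero

  ι : Slot → Fin k
  ι (inj₁ (d , b)) = combine d (bit b) ↑ˡ p
  ι (inj₂ y)       = (m * 2) ↑ʳ y

  ι-injective : ∀ {o o′} → ι o ≡ ι o′ → o ≡ o′
  ι-injective {inj₁ (d , b)} {inj₁ (d′ , b′)} eq with Fin.combine-injective d (bit b) d′ (bit b′) (Fin.↑ˡ-injective p _ _ eq)
  ... | refl , eq′ = cong (λ b → inj₁ (d , b)) (bit-injective b b′ eq′)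
    where bit-injective : ∀ b b′ → bit b ≡ bit b′ → b ≡ b′
          bit-injective false false _ = refl
          bit-injective true  true  _ = refl
  ι-injective {inj₂ y} {inj₂ y′} eq = cong inj₂ (Fin.↑ʳ-injective (m * 2) y y′ eq)
  ι-injective {inj₁ (d , b)} {inj₂ y} eq with trans (sym (Fin.splitAt-↑ˡ (m * 2) (combine d (bit b)) p)) (trans (cong (splitAt (m * 2)) eq) (Fin.splitAt-↑ʳ (m * 2) p y))
  ... | ()
  ι-injective {inj₂ y} {inj₁ (d , b)} eq with trans (sym (Fin.splitAt-↑ˡ (m * 2) (combine d (bit b)) p)) (trans (cong (splitAt (m * 2)) (sym eq)) (Fin.splitAt-↑ʳ (m * 2) p y))
  ... | ()

  σO : Sign Slot
  σO = pullback ι ι-injective (finSign k)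

  sO : Slot → Slot → ℤ
  sO = Sign.s σO

  private
    ↑ˡ-mono : ∀ {a} {x y : Fin a} b → x Fin.< y → (x ↑ˡ b) Fin.< (y ↑ˡ b)
    ↑ˡ-mono {x = x} {y} b lt rewrite Fin.toℕ-↑ˡ x b | Fin.toℕ-↑ˡ y b = lt

  sO-within : ∀ d → sO (inj₁ (d , false)) (inj₁ (d , true)) ≡ 1ℤ
  sO-within d = sg-< (↑ˡ-mono p (combine-mono d {zero} {suc zero} (s≤s z≤n)))

  sO-groups : ∀ {d d′} b b′ → d Fin.< d′ → sO (inj₁ (d , b)) (inj₁ (d′ , b′)) ≡ 1ℤ
  sO-groups b b′ lt = sg-< (↑ˡ-mono p (Fin.combine-monoˡ-< (bit b) (bit b′) lt))

  sO-mixed : ∀ db y → sO (inj₁ db) (inj₂ y) ≡ 1ℤ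
  sO-mixed (d , b) y = sg-< lem
    where
    lem : (combine d (bit b) ↑ˡ p) Fin.< ((m * 2) ↑ʳ y)
    lem rewrite Fin.toℕ-↑ˡ (combine d (bit b)) p | Fin.toℕ-↑ʳ (m * 2) y = ℕ.<-≤-trans (Fin.toℕ<n (combine d (bit b))) (ℕ.m≤m+n (m * 2) (toℕ y))

  sO-cross : ∀ {y y′} → y Fin.< y′ → sO (inj₂ y) (inj₂ y′) ≡ 1ℤ
  sO-cross {y} {y′} lt = sg-< lem
    where
    lem : ((m * 2) ↑ʳ y) Fin.< ((m * 2) ↑ʳ y′)
    lem rewrite Fin.toℕ-↑ʳ (m * 2) y | Fin.toℕ-↑ʳ (m * 2) y′ = ℕ.+-monoʳ-< (m * 2) lt

  slotBlock : Fin m → List Slot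
  slotBlock d = inj₁ (d , false) ∷ inj₁ (d , true) ∷ []

  Os : List Slot
  Os = concatMap slotBlock (allFin m) ++ map inj₂ (allFin p)

  allFin-sorted : ∀ a → AllPairs Fin._<_ (allFin a)
  allFin-sorted a = AllPairs.tabulate⁺-< id

  Os-sorted : AllPairs (λ o o′ → sO o o′ ≡ 1ℤ) Os
  Os-sorted = AllPairs.++⁺ (blocks (allFin-sorted m)) (AllPairs.map⁺ (AllPairs.map sO-cross (allFin-sorted p))) (mixed (allFin m))
    where
    later : ∀ {d ds} b → All (d Fin.<_) ds → All (λ o′ → sO (inj₁ (d , b)) o′ ≡ 1ℤ) (concatMap slotBlock ds)
    later b []         = []
    later b (lt ∷ lts) = sO-groups b false lt ∷ sO-groups b true lt ∷ later b lts
    blocks : ∀ {ds} → AllPairs Fin._<_ ds → AllPairs (λ o o′ → sO o o′ ≡ 1ℤ) (concatMap slotBlock ds)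
    blocks []                   = []
    blocks {d ∷ ds} (lts ∷ aps) = (sO-within d ∷ later false lts) ∷ later true lts ∷ blocks aps
    mixed : ∀ ds → All (λ o → All (λ o′ → sO o o′ ≡ 1ℤ) (map inj₂ (allFin p))) (concatMap slotBlock ds)
    mixed []       = []
    mixed (d ∷ ds) = All.map⁺ (All.tabulate (λ {y} _ → sO-mixed (d , false) y)) ∷ All.map⁺ (All.tabulate (λ {y} _ → sO-mixed (d , true) y)) ∷ mixed ds

  Os-unique : Unique Os
  Os-unique = AllPairs.map (λ { {o} eq refl → 1≢0 (trans (sym eq) (Sign.diag σO o)) }) Os-sorted

  length-Os : length Os ≡ k
  length-Os = trans (List.length-++ (concatMap slotBlock (allFin m))) (cong₂ _+_
    (trans (length-concatMap slotBlock 2 (allFin m) (λ _ → refl)) (cong (_* 2) (List.length-tabulate {n = m} id)))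
    (trans (List.length-map inj₂ (allFin p)) (List.length-tabulate {n = p} id)))

  ∈Os : ∀ o → o ∈ Os
  ∈Os (inj₂ y)       = ∈.∈-++⁺ʳ (concatMap slotBlock (allFin m)) (∈.∈-map⁺ inj₂ (∈.∈-allFin y))
  ∈Os (inj₁ (d , b)) = ∈.∈-++⁺ˡ (go b (∈.∈-allFin d))
    where
    go : ∀ b {ds} → d ∈ ds → inj₁ (d , b) ∈ concatMap slotBlock ds
    go false (here refl) = here refl
    go true  (here refl) = there (here refl)
    go b     (there d∈)  = there (there (go b d∈))

  ι-↭ : map ι Os ↭ allFin k
  ι-↭ = full⇒↭ (finEnum k) (Unique.map⁺ ι-injective Os-unique)
    (ℕ.≤-reflexive (trans (List.length-tabulate id) (sym (trans (List.length-map ι Os) length-Os))))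

  amount : Fin m × Bool → ℕ
  amount (d , false) = suc (toℕ d)
  amount (d , true)  = neg p (suc (toℕ d))

  turn : ℕ → VP → VP
  turn a (b , x) = b , rot p a x

  infixl 5 _▷_
  -- Crossings add y one way and subtract it the other way, so that a crossing edge has the same
  -- slot at both ends.
  _▷_ : VP → Slot → VP
  v              ▷ inj₁ db = turn (amount db) v
  (zero , x)     ▷ inj₂ y  = suc zero , rot p (toℕ y) x
  (suc zero , x) ▷ inj₂ y  = zero , rot p (neg p (toℕ y)) x

  private
    d<p : ∀ (d : Fin m) → suc (toℕ d) < p
    d<p d = subst (suc (toℕ d) <_) (sym p≡) (s≤s (ℕ.≤-trans (Fin.toℕ<n d) (ℕ.m≤m*n m 2)))

    sum<p : ∀ (d d′ : Fin m) → suc (toℕ d) + suc (toℕ d′) < p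
    sum<p d d′ = subst (suc (toℕ d) + suc (toℕ d′) <_) (sym p≡) (s≤s (subst (suc (toℕ d) + suc (toℕ d′) ≤_)
                   (trans (cong (λ z → m + z) (sym (ℕ.+-identityʳ m))) (ℕ.*-comm 2 m)) (ℕ.+-mono-≤ (Fin.toℕ<n d) (Fin.toℕ<n d′))))

    opposite : ∀ d d′ → ¬ (+ suc (toℕ d) ≡ + neg p (suc (toℕ d′)) ⟨mod + p ⟩)
    opposite d d′ eq = small-mod (s≤s z≤n) (sum<p d d′) (mod-trans (≡⇒mod (pos-⊕ (suc (toℕ d)) (suc (toℕ d′))))
      (mod-trans (mod-⊕ (mod-trans eq (val-neg p (suc (toℕ d′)))) mod-refl) (≡⇒mod (solve 1 (λ a → :- a :+ a := con 0ℤ) refl (+ suc (toℕ d′))))))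

    ⊝-injective : ∀ {a b} → ⊝ a ≡ ⊝ b ⟨mod + p ⟩ → a ≡ b ⟨mod + p ⟩
    ⊝-injective {a} {b} eq = mod-trans (≡⇒mod (solve 1 (λ a → a := :- (:- a)) refl a)) (mod-trans (mod-⊝ eq) (≡⇒mod (solve 1 (λ a → :- (:- a) := a) refl b)))

    positive : ∀ (d d′ : Fin m) → + suc (toℕ d) ≡ + suc (toℕ d′) ⟨mod + p ⟩ → d ≡ d′
    positive d d′ eq = Fin.toℕ-injective (ℕ.suc-injective (trans (sym (ℕ%.m<n⇒m%n≡m (d<p d))) (trans (mod⇒%≡ p eq) (ℕ%.m<n⇒m%n≡m (d<p d′)))))

  amount-injective : ∀ {db db′} → + amount db ≡ + amount db′ ⟨mod + p ⟩ → db ≡ db′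
  amount-injective {d , false} {d′ , false} eq = cong (_, false) (positive d d′ eq)
  amount-injective {d , true}  {d′ , true}  eq = cong (_, true) (positive d d′ (⊝-injective (mod-trans (mod-sym (val-neg p (suc (toℕ d)))) (mod-trans eq (val-neg p (suc (toℕ d′)))))))
  amount-injective {d , false} {d′ , true}  eq = contradiction eq (opposite d d′)
  amount-injective {d , true}  {d′ , false} eq = contradiction (mod-sym eq) (opposite d′ d)

  amount≢0 : ∀ db → ¬ (+ amount db ≡ 0ℤ ⟨mod + p ⟩)
  amount≢0 (d , false) eq = small-mod (s≤s z≤n) (d<p d) eq
  amount≢0 (d , true)  eq = small-mod (s≤s z≤n) (d<p d) (⊝-injective (mod-trans (mod-sym (val-neg p (suc (toℕ d)))) (mod-trans eq (≡⇒mod (solve 0 (con 0ℤ := :- con 0ℤ) refl)))))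

  private
    rot-amount : ∀ {a b} x → rot p a x ≡ rot p b x → + a ≡ + b ⟨mod + p ⟩
    rot-amount {a} {b} x eq = mod-trans (≡⇒mod (solve 2 (λ a x → a := (a :+ x) :+ :- x) refl (+ a) (val p x)))
      (mod-trans (mod-⊕ (mod-trans (mod-sym (val-rot p a x)) (mod-trans (≡⇒mod (cong (val p) eq)) (val-rot p b x))) mod-refl)
        (≡⇒mod (solve 2 (λ b x → (b :+ x) :+ :- x := b) refl (+ b) (val p x))))

  ▷-≢ : ∀ v o → v ≢ v ▷ o
  ▷-≢ (a , x)        (inj₁ db) eq = amount≢0 db (rot-fixed p (amount db) (sym (cong proj₂ eq)))
  ▷-≢ (zero , x)     (inj₂ y) ()
  ▷-≢ (suc zero , x) (inj₂ y) ()

  ▷-injective : ∀ v {o o′} → v ▷ o ≡ v ▷ o′ → o ≡ o′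
  ▷-injective (a , x) {inj₁ db} {inj₁ db′} eq = cong inj₁ (amount-injective (rot-amount x (cong proj₂ eq)))
  ▷-injective (zero , x) {inj₁ _} {inj₂ _} ()
  ▷-injective (suc zero , x) {inj₁ _} {inj₂ _} ()
  ▷-injective (zero , x) {inj₂ _} {inj₁ _} ()
  ▷-injective (suc zero , x) {inj₂ _} {inj₁ _} ()
  ▷-injective (zero , x) {inj₂ y} {inj₂ y′} eq = cong inj₂ (val-injective p (rot-amount x (cong proj₂ eq)))
  ▷-injective (suc zero , x) {inj₂ y} {inj₂ y′} eq = cong inj₂ (val-injective p (⊝-injective
    (mod-trans (mod-sym (val-neg p (toℕ y))) (mod-trans (rot-amount x (cong proj₂ eq)) (val-neg p (toℕ y′))))))

  ▷-back : ∀ v d → v ▷ inj₁ (d , false) ▷ inj₁ (d , true) ≡ v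
  ▷-back (a , x) d = cong (a ,_) (rot-neg p (suc (toℕ d)) x)

  ▷-forth : ∀ v d → v ▷ inj₁ (d , true) ▷ inj₁ (d , false) ≡ v
  ▷-forth (a , x) d = cong (a ,_) (rot-neg′ p (suc (toℕ d)) x)

  ▷-across : ∀ x y → (zero , x) ▷ inj₂ y ▷ inj₂ y ≡ (zero , x)
  ▷-across x y = cong (zero ,_) (rot-neg p (toℕ y) x)

  ▷-across′ : ∀ x y → (suc zero , x) ▷ inj₂ y ▷ inj₂ y ≡ (suc zero , x)
  ▷-across′ x y = cong (suc zero ,_) (rot-neg′ p (toℕ y) x)

  private
    shift-to : ∀ x y → rot p (toℕ (rot p (neg p (toℕ x)) y)) x ≡ y
    shift-to x y = val-injective p (mod-trans (val-rot p _ x) (mod-trans (mod-⊕ (val-rot p (neg p (toℕ x)) y) mod-refl)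
      (mod-trans (mod-⊕ (mod-⊕ (val-neg p (toℕ x)) mod-refl) mod-refl) (≡⇒mod (solve 2 (λ x y → (:- x :+ y) :+ x := y) refl (val p x) (val p y))))))

    -- A gap e + 1 up to m is a forward step. A larger one is the backward step of length d + 1 = p
    -- - (e + 1), which is then at most m.
    same-side : ∀ x y → x ≢ y → ∃ λ db → rot p (amount db) x ≡ y
    same-side x y ne = by-size gap₀ refl (Fin.toℕ<n (rot p (neg p (toℕ x)) y))
      where
      gap₀ = toℕ (rot p (neg p (toℕ x)) y)
      by-size : ∀ e → gap₀ ≡ e → e < p → ∃ λ db → rot p (amount db) x ≡ y
      by-size zero eq _ = contradiction (trans (sym (rot-0 p (≡⇒mod refl) x)) (trans (cong (λ e → rot p e x) (sym eq)) (shift-to x y))) ne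
      by-size (suc e) eq lt with e ℕ.<? m
      ... | yes e<m = (fromℕ< e<m , false) , trans (cong (λ e → rot p (suc e) x) (Fin.toℕ-fromℕ< e<m)) (trans (cong (λ e → rot p e x) (sym eq)) (shift-to x y))
      ... | no e≮m  = (fromℕ< lt′ , true) , trans (rot-cong p neg-ok x) (trans (cong (λ e → rot p e x) (sym eq)) (shift-to x y))
        where
        e<2m : e < m * 2
        e<2m = ℕ.s<s⁻¹ (subst (suc e <_) p≡ lt)
        d = m * 2 ∸ suc e
        d+e : suc d + suc e ≡ p
        d+e = trans (cong suc (ℕ.m∸n+n≡m e<2m)) (sym p≡)
        lt′ : d < m
        lt′ = ℕ.+-cancelʳ-< _ _ _ (subst (_< m + suc e) (sym (ℕ.m∸n+n≡m e<2m))
                (subst (_< m + suc e) (trans (cong (λ z → m + z) (sym (ℕ.+-identityʳ m))) (ℕ.*-comm 2 m) ) (ℕ.+-monoʳ-< m (s≤s (ℕ.≮⇒≥ e≮m)))))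
        neg-ok : + neg p (suc (toℕ (fromℕ< lt′))) ≡ + suc e ⟨mod + p ⟩
        neg-ok = subst (λ z → + neg p (suc z) ≡ + suc e ⟨mod + p ⟩) (sym (Fin.toℕ-fromℕ< lt′))
          (mod-trans (val-neg p (suc d)) (by (⊝ 1ℤ) (trans (solve 2 (λ d e → :- d := e :+ :- con 1ℤ :* (d :+ e)) refl (+ suc d) (+ suc e))
            (cong (λ z → + suc e ⊕ ⊝ 1ℤ · z) (trans (sym (pos-⊕ (suc d) (suc e))) (cong +_ d+e))))))

  ▷-complete : ∀ v u → v ≢ u → ∃ λ o → v ▷ o ≡ u
  ▷-complete (zero , x) (zero , y) ne = let db , eq = same-side x y (ne ∘ cong (zero ,_)) in inj₁ db , cong (zero ,_) eq
  ▷-complete (suc zero , x) (suc zero , y) ne = let db , eq = same-side x y (ne ∘ cong (suc zero ,_)) in inj₁ db , cong (suc zero ,_) eq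
  ▷-complete (zero , x) (suc zero , y) ne = inj₂ (rot p (neg p (toℕ x)) y) , cong (suc zero ,_) (shift-to x y)
  ▷-complete (suc zero , x) (zero , y) ne = inj₂ w , cong (zero ,_) (trans (cong (rot p (neg p (toℕ w))) (sym (shift-to y x))) (rot-neg p (toℕ w) y))
    where w = rot p (neg p (toℕ y)) x

-- Lexicographic signs and cartesian products

if-yes : ∀ {P X : Set} (d : Dec P) {a b : X} → P → (if does d then a else b) ≡ a
if-yes d p rewrite dec-true d p = refl

if-no : ∀ {P X : Set} (d : Dec P) {a b : X} → ¬ P → (if does d then a else b) ≡ b
if-no d ¬p rewrite dec-false d ¬p = refl

module _ {A B : Set} (σ : Sign A) (τ : Sign B) (_≟_ : DecidableEquality A) where
  private
    module σ = Sign σ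
    module τ = Sign τ

  lexSign : Sign (A × B)
  lexSign = record { s = λ (a , b) (a′ , b′) → lex a b a′ b′; anti = λ (a , b) (a′ , b′) → anti a b a′ b′
                   ; diag = λ (a , b) → trans (if-yes (a ≟ a) refl) (τ.diag b); sq = λ { {a , b} {a′ , b′} ne → sq a b a′ b′ ne } }
    where
    lex : A → B → A → B → ℤ
    lex a b a′ b′ = if does (a ≟ a′) then τ.s b b′ else σ.s a a′
    anti : ∀ a b a′ b′ → lex a′ b′ a b ≡ ⊝ lex a b a′ b′
    anti a b a′ b′ with a ≟ a′
    ... | yes refl = trans (if-yes (a ≟ a) refl) (τ.anti b b′)
    ... | no ne    = trans (if-no (a′ ≟ a) (ne ∘ sym)) (σ.anti a a′)
    sq : ∀ a b a′ b′ → (a , b) ≢ (a′ , b′) → lex a b a′ b′ · lex a b a′ b′ ≡ 1ℤ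
    sq a b a′ b′ ne with a ≟ a′
    ... | yes refl = τ.sq (ne ∘ cong (a ,_))
    ... | no a≢    = σ.sq a≢

module _ {A B : Set} where

  length-× : ∀ (as : List A) (bs : List B) → length (cartesianProduct as bs) ≡ length as * length bs
  length-× []       bs = refl
  length-× (a ∷ as) bs = trans (List.length-++ (map (a ,_) bs)) (cong₂ _+_ (List.length-map (a ,_) bs) (length-× as bs))

  pp-× : ∀ (g : A × B → A × B → ℤ) {as} bs → Unique as → (∀ {a a′} b b′ → a ≢ a′ → g (a , b) (a′ , b′) ≡ 1ℤ) →
         pp g (cartesianProduct as bs) ≡ ∏ as (λ a → pp (λ b b′ → g (a , b) (a , b′)) bs)
  pp-× g {[]}     bs _        cross = refl
  pp-× g {a ∷ as} bs (a≢ ∷ u) cross = trans (pp-++ g (map (a ,_) bs) (cartesianProduct as bs)) (trans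
    (cong₂ _·_ (cong₂ _·_ (pp-map g (a ,_) bs) (pp-× g bs u cross))
       (trans (∏-map (a ,_) bs _) (∏-one bs (λ {b} _ → trans (∏-× as bs (g (a , b))) (∏-one as (λ a′∈ → ∏-one bs (λ {b′} _ → cross b b′ (All.lookup a≢ a′∈))))))))
    (·-identityʳ _))

  map-×-↭ : ∀ {C : Set} (h : A → B → C) {bs cs} as → (∀ a → map (h a) bs ↭ cs) →
            map (λ (a , b) → (a , h a b)) (cartesianProduct as bs) ↭ cartesianProduct as cs
  map-×-↭ h []       perm = ↭-refl
  map-×-↭ h {bs} {cs} (a ∷ as) perm = subst (_↭ cartesianProduct (a ∷ as) cs)
    (sym (trans (List.map-++ _ (map (a ,_) bs) (cartesianProduct as bs)) (cong (_++ map _ (cartesianProduct as bs)) (trans (sym (List.map-∘ bs)) (List.map-∘ bs)))))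
    (↭.++⁺ (↭.map⁺ (a ,_) (perm a)) (map-×-↭ h as perm))

-- The number of pairs is j(2j-1) or j(2j+1), which has the parity of j.
pp-const-even : ∀ {X : Set} j (l : List X) → length l ≡ j * 2 ⊎ length l ≡ suc (j * 2) → pp (λ _ _ → ⊝ 1ℤ) l ≡ (⊝ 1ℤ) ↑ j
pp-const-even zero    []          _         = refl
pp-const-even zero    (x ∷ [])    _         = refl
pp-const-even zero    (_ ∷ _ ∷ _) (inj₁ ())
pp-const-even zero    (_ ∷ _ ∷ _) (inj₂ ())
pp-const-even (suc j) []          (inj₁ ())
pp-const-even (suc j) []          (inj₂ ())
pp-const-even (suc j) (_ ∷ [])    (inj₁ ())
pp-const-even (suc j) (_ ∷ [])    (inj₂ ())
pp-const-even (suc j) (x ∷ y ∷ l) len = trans (pp-∷ _ x (y ∷ l)) (trans (cong (∏ (y ∷ l) (λ _ → ⊝ 1ℤ) ·_) (pp-∷ _ y l))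
  (trans (solve 2 (λ a b → (:- con 1ℤ :* a) :* (a :* b) := :- con 1ℤ :* b :* (a :* a)) refl (∏ l (λ _ → ⊝ 1ℤ)) (pp (λ _ _ → ⊝ 1ℤ) l))
    (trans (cong₂ (λ a b → ⊝ 1ℤ · a · b) (pp-const-even j l (Sum.map (ℕ.suc-injective ∘ ℕ.suc-injective) (ℕ.suc-injective ∘ ℕ.suc-injective) len))
        (trans (sym (∏-* l _ _)) (∏-one l (λ _ → ⊝1-sq)))) (·-identityʳ _))))

-- Edge colourings of K 2p

module Colouring (p m : ℕ) .{{_ : NonZero p}} (p≡ : p ≡ suc (m * 2)) (m>0 : 0 < m) where
  open Model p m p≡ m>0 public

  E : Set
  E = Edge (K n)

  private
    e₀ : E
    e₀ = some-edge n {vtx (zero , 0′ p)} {vtx (suc zero , 0′ p)} (Fin.combine-monoˡ-< {i = zero {1}} {suc {1} zero} (0′ p) (0′ p) (s≤s z≤n))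

  ed : VP → VP → E
  ed u v = edge n e₀ (vtx u) (vtx v)

  ed-view : ∀ {u v} → u ≢ v → Edge-view n (vtx u) (vtx v) (ed u v)
  ed-view ne = edge-view n e₀ (ne ∘ vtx-injective)

  ed-sym : ∀ {u v} → u ≢ v → ed u v ≡ ed v u
  ed-sym ne = view-unique n (ed-view ne) (view-swap n (ed-view (ne ∘ sym)))

  Dart : Set
  Dart = VP × Slot

  de : VP → Slot → E
  de v o = ed v (v ▷ o)

  de-view : ∀ v o → Edge-view n (vtx v) (vtx (v ▷ o)) (de v o)
  de-view v o = ed-view (▷-≢ v o)

  de-injective : ∀ v {o o′} → de v o ≡ de v o′ → o ≡ o′
  de-injective v {o} {o′} eq with view-inj n (de-view v o) (subst (Edge-view n _ _) (sym eq) (de-view v o′))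
  ... | inj₁ (_ , t) = ▷-injective v (vtx-injective t)
  ... | inj₂ (t , _) = contradiction (vtx-injective t) (▷-≢ v o′)

  incident-slot : ∀ v {e} → Incident (K n) (vtx v) e → ∃ λ o → de v o ≡ e
  incident-slot v {e} inc =
    let w , v≢w , view = other-end n inc
        u , u≡w = vtx-surjective w
        o , eq = ▷-complete v u (λ v≡u → v≢w (trans (cong vtx v≡u) u≡w))
    in o , view-unique n (subst (λ x → Edge-view n (vtx v) x (de v o)) (trans (cong vtx eq) u≡w) (de-view v o)) view

  -- One name for each edge: an inner edge by the end from which it goes forward, a crossing edge by
  -- its end in the first half.
  Block : Set
  Block = (Fin m × VP) ⊎ (Fin p × Fin p)

  d₁ d₂ : Block → Dart
  d₁ (inj₁ (d , v)) = v , inj₁ (d , false)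
  d₁ (inj₂ (y , x)) = (zero , x) , inj₂ y
  d₂ (inj₁ (d , v)) = v ▷ inj₁ (d , false) , inj₁ (d , true)
  d₂ (inj₂ (y , x)) = (zero , x) ▷ inj₂ y , inj₂ y

  eb : Block → E
  eb b = uncurry de (d₁ b)

  d₂-back : ∀ b → uncurry _▷_ (d₂ b) ≡ proj₁ (d₁ b)
  d₂-back (inj₁ (d , v)) = ▷-back v d
  d₂-back (inj₂ (y , x)) = ▷-across x y

  d₂-start : ∀ b → proj₁ (d₂ b) ≡ uncurry _▷_ (d₁ b)
  d₂-start (inj₁ (d , v)) = refl
  d₂-start (inj₂ (y , x)) = refl

  de-d₂ : ∀ b → uncurry de (d₂ b) ≡ eb b
  de-d₂ b = trans (cong₂ ed (d₂-start b) (d₂-back b)) (sym (ed-sym (uncurry ▷-≢ (d₁ b))))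

  d₁-injective : ∀ {b b′} → d₁ b ≡ d₁ b′ → b ≡ b′
  d₁-injective {inj₁ _} {inj₁ _} refl = refl
  d₁-injective {inj₂ _} {inj₂ _} refl = refl

  private
    -- No edge is named from both ends: for an inner edge a forward step would also be a backward
    -- one, and crossing edges are named from the first half only.
    not-reversed : ∀ b b′ → proj₁ (d₁ b) ≡ uncurry _▷_ (d₁ b′) → uncurry _▷_ (d₁ b) ≢ proj₁ (d₁ b′)
    not-reversed (inj₁ (d , v)) (inj₁ (d′ , v′)) refl eq =
      distinct (▷-injective (v′ ▷ inj₁ (d′ , false)) {inj₁ (d , false)} {inj₁ (d′ , true)} (trans eq (sym (▷-back v′ d′))))
      where distinct : ∀ {d d′ : Fin m} → inj₁ {B = Fin p} (d , false) ≢ inj₁ (d′ , true)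
            distinct ()
    not-reversed (inj₁ _) (inj₂ _) eq eq′ = Fin.0≢1+n (trans (sym (cong proj₁ eq′)) (cong proj₁ eq))
    not-reversed (inj₂ _) (inj₁ _) eq eq′ = Fin.0≢1+n (trans (cong proj₁ eq) (sym (cong proj₁ eq′)))
    not-reversed (inj₂ _) (inj₂ _) eq eq′ = Fin.0≢1+n (cong proj₁ eq)

  eb-injective : ∀ {b b′} → eb b ≡ eb b′ → b ≡ b′
  eb-injective {b} {b′} eq with view-inj n (uncurry de-view (d₁ b)) (subst (Edge-view n _ _) (sym eq) (uncurry de-view (d₁ b′)))
  ... | inj₂ (t , t′) = contradiction (vtx-injective t′) (not-reversed b b′ (vtx-injective t))
  ... | inj₁ (t , t′) = d₁-injective (dart-ext (vtx-injective t) (vtx-injective t′))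
    where
    dart-ext : ∀ {v o v′ o′} → v ≡ v′ → v ▷ o ≡ v′ ▷ o′ → (v , o) ≡ (v′ , o′)
    dart-ext {v} refl eq = cong (v ,_) (▷-injective v eq)

  blockDarts : Block → List Dart
  blockDarts b = d₁ b ∷ d₂ b ∷ []

  dart-block : ∀ x → ∃ λ b → x ∈ blockDarts b
  dart-block (v , inj₁ (d , false)) = inj₁ (d , v) , here refl
  dart-block (v , inj₁ (d , true))  = inj₁ (d , v ▷ inj₁ (d , true)) , there (here (cong (_, inj₁ (d , true)) (sym (▷-forth v d))))
  dart-block ((zero , x) , inj₂ y)  = inj₂ (y , x) , here refl
  dart-block ((suc zero , x) , inj₂ y) = inj₂ (y , proj₂ ((suc zero , x) ▷ inj₂ y)) , there (here (cong (_, inj₂ y) (sym (▷-across′ x y))))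

  eb-surjective : ∀ e → ∃ λ b → eb b ≡ e
  eb-surjective e =
    let u , eq = vtx-surjective (lo (K n) e)
        o , de≡ = incident-slot u {e} (inj₁ eq)
        b , x∈ = dart-block (u , o)
    in b , trans (sym (on-block x∈)) de≡
    where
    on-block : ∀ {b x} → x ∈ blockDarts b → uncurry de x ≡ eb b
    on-block {b} (here refl)         = refl
    on-block {b} (there (here refl)) = de-d₂ b

  B₁ B₂ Bs : List Block
  B₁ = concatMap (λ d → map (λ v → inj₁ (d , v)) VPs) (allFin m)
  B₂ = concatMap (λ y → map (λ x → inj₂ (y , x)) (allFin p)) (allFin p)
  Bs = B₁ ++ B₂

  private
    ∈-concatMap-map : ∀ {X Y Z : Set} (h : X → Y → Z) {x y xs ys} → x ∈ xs → y ∈ ys → h x y ∈ concatMap (λ x → map (h x) ys) xs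
    ∈-concatMap-map h {ys = ys} (here refl) y∈ = ∈.∈-++⁺ˡ (∈.∈-map⁺ (h _) y∈)
    ∈-concatMap-map h {ys = ys} (there {x = z} x∈)  y∈ = ∈.∈-++⁺ʳ (map (h z) ys) (∈-concatMap-map h x∈ y∈)

    concatMap-map-unique : ∀ {X Y Z : Set} (h : X → Y → Z) → (∀ {x y x′ y′} → h x y ≡ h x′ y′ → x ≡ x′ × y ≡ y′) →
                           ∀ {xs ys} → Unique xs → Unique ys → Unique (concatMap (λ x → map (h x) ys) xs)
    concatMap-map-unique h inj {[]} u v = []
    concatMap-map-unique h inj {x ∷ xs} {ys} (x≢ ∷ u) v = Unique.++⁺ (Unique.map⁺ (λ eq → proj₂ (inj eq)) v) (concatMap-map-unique h inj u v)
      (λ (z∈ , z∈′) → let y , _ , eq = ∈.∈-map⁻ (h x) z∈ in disjoint {xs} (All.lookup x≢) (subst (_∈ _) eq z∈′))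
      where
      disjoint : ∀ {zs y} → (∀ {z} → z ∈ zs → x ≢ z) → h x y ∉ concatMap (λ x → map (h x) ys) zs
      disjoint {z ∷ zs} ne q with ∈.∈-++⁻ (map (h z) ys) q
      ... | inj₂ q′ = disjoint (ne ∘ there) q′
      ... | inj₁ q′ with ∈.∈-map⁻ (h z) q′
      ...   | _ , _ , eq = ne (here refl) (proj₁ (inj eq))

  ∈Bs : ∀ b → b ∈ Bs
  ∈Bs (inj₁ (d , v)) = ∈.∈-++⁺ˡ (∈-concatMap-map (λ d v → inj₁ (d , v)) (∈.∈-allFin d) (Enumeration.complete VP-enum v))
  ∈Bs (inj₂ (y , x)) = ∈.∈-++⁺ʳ B₁ (∈-concatMap-map (λ y x → inj₂ (y , x)) (∈.∈-allFin y) (∈.∈-allFin x))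

  Bs-unique : Unique Bs
  Bs-unique = Unique.++⁺ (concatMap-map-unique (λ d v → inj₁ (d , v)) (λ { refl → refl , refl }) (Unique.allFin⁺ m) (Enumeration.unique VP-enum))
    (concatMap-map-unique (λ y x → inj₂ (y , x)) (λ { refl → refl , refl }) (Unique.allFin⁺ p) (Unique.allFin⁺ p))
    (λ (b∈ , b∈′) → is₁ (allFin m) b∈ (is₂ (allFin p) b∈′))
    where
    data Second : Block → Set where
      second : ∀ {yx} → Second (inj₂ yx)
    is₂ : ∀ ys {b} → b ∈ concatMap (λ y → map (λ x → inj₂ (y , x)) (allFin p)) ys → Second b
    is₂ (y ∷ ys) b∈ with ∈.∈-++⁻ (map (λ x → inj₂ (y , x)) (allFin p)) b∈
    ... | inj₂ b∈′ = is₂ ys b∈′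
    ... | inj₁ b∈′ with ∈.∈-map⁻ (λ x → inj₂ (y , x)) b∈′
    ...   | _ , _ , refl = second
    is₁ : ∀ ds {b} → b ∈ concatMap (λ d → map (λ v → inj₁ (d , v)) VPs) ds → ¬ Second b
    is₁ (d ∷ ds) b∈ sec with ∈.∈-++⁻ (map (λ v → inj₁ (d , v)) VPs) b∈
    ... | inj₂ b∈′ = is₁ ds b∈′ sec
    ... | inj₁ b∈′ with ∈.∈-map⁻ (λ v → inj₁ (d , v)) b∈′ | sec
    ...   | _ , _ , refl | ()

  allE : List E
  allE = allFin (length (edgeList (K n)))

  eb-↭ : map eb Bs ↭ allE
  eb-↭ = unique-set⇒↭ (Unique.map⁺ eb-injective Bs-unique) (Unique.allFin⁺ _) (λ {e} _ → ∈.∈-allFin e)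
    (λ {e} _ → let b , eq = eb-surjective e in subst (_∈ map eb Bs) eq (∈.∈-map⁺ eb (∈Bs b)))

  XV : List Dart
  XV = cartesianProduct VPs Os

  X₅ : List Dart
  X₅ = concatMap blockDarts Bs

  length-VPs : length VPs ≡ p * 2
  length-VPs = trans (length-× (allFin 2) (allFin p)) (trans (cong (2 *_) (List.length-tabulate {n = p} id)) (ℕ.*-comm 2 p))

  length-Bs : length Bs ≡ p * k
  length-Bs = begin
    length Bs                                 ≡⟨ List.length-++ B₁ ⟩
    length B₁ + length B₂                     ≡⟨ cong₂ _+_ (length-concatMap _ (p * 2) (allFin m) (λ d → trans (List.length-map _ VPs) length-VPs))
                                                           (length-concatMap _ p (allFin p) (λ y → trans (List.length-map _ (allFin p)) (List.length-tabulate {n = p} id))) ⟩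
    length (allFin m) * (p * 2) + length (allFin p) * p ≡⟨ cong₂ (λ a b → a * (p * 2) + b * p) (List.length-tabulate {n = m} id) (List.length-tabulate {n = p} id) ⟩
    m * (p * 2) + p * p                       ≡⟨ lem p m ⟩
    p * (m * 2 + p)                           ∎
    where
    open ≡-Reasoning
    lem : ∀ p m → m * (p * 2) + p * p ≡ p * (m * 2 + p)
    lem = ℕSolver.solve-∀

  length-allE : length (edgeList (K n)) ≡ p * k
  length-allE = trans (sym (List.length-tabulate id)) (trans (sym (↭.↭-length eb-↭)) (trans (List.length-map eb Bs) length-Bs))

  X₅-↭ : XV ↭ X₅
  X₅-↭ = unique-⊆⇒↭ (Unique.cartesianProduct⁺ (Enumeration.unique VP-enum) Os-unique)
    (λ {x} _ → let b , x∈ = dart-block x in in-block (∈Bs b) x∈) (ℕ.≤-reflexive (begin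
      length X₅              ≡⟨ length-concatMap blockDarts 2 Bs (λ _ → refl) ⟩
      length Bs * 2          ≡⟨ cong (_* 2) length-Bs ⟩
      p * k * 2              ≡⟨ lem p k ⟩
      p * 2 * k              ≡⟨ cong₂ _*_ length-VPs length-Os ⟨
      length VPs * length Os ≡⟨ length-× VPs Os ⟨
      length XV              ∎))
    where
    open ≡-Reasoning
    lem : ∀ p k → p * k * 2 ≡ p * 2 * k
    lem = ℕSolver.solve-∀
    in-block : ∀ {b x bs} → b ∈ bs → x ∈ blockDarts b → x ∈ concatMap blockDarts bs
    in-block (here refl)     x∈ = ∈.∈-++⁺ˡ x∈
    in-block {bs = a ∷ _} (there b∈) x∈ = ∈.∈-++⁺ʳ (blockDarts a) (in-block b∈ x∈)

  C : Set
  C = Fin k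

  σC : Sign C
  σC = finSign k

  ColVec : Set
  ColVec = Vec C (length (edgeList (K n)))

  χ : ColVec → VP → Slot → C
  χ c v o = Vec.lookup c (de v o)

  row : ColVec → VP → List C
  row c v = map (χ c v) Os

  ProperVec : ColVec → Set
  ProperVec c = Proper (K n) (Vec.lookup c)

  length-row : ∀ c v → length (row c v) ≡ k
  length-row c v = trans (List.length-map (χ c v) Os) length-Os

  de-adjacent : ∀ v {o o′} → o ≢ o′ → AdjacentEdges (K n) (de v o) (de v o′)
  de-adjacent v {o} {o′} ne = (ne ∘ de-injective v) , vtx v , incident-view n (de-view v o) , incident-view n (de-view v o′)

  proper⇒unique : ∀ c → ProperVec c → ∀ v → Unique (row c v)
  proper⇒unique c pr v = AllPairs.map⁺ (AllPairs.map (λ ne → pr _ _ (de-adjacent v ne)) Os-unique)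

  unique⇒proper : ∀ c → (∀ v → Unique (row c v)) → ProperVec c
  unique⇒proper c us e f (e≢f , w , we , wf) eq =
    let v , v≡w = vtx-surjective w
        o , o≡ = incident-slot v {e} (subst (λ w → Incident (K n) w e) (sym v≡w) we)
        o′ , o′≡ = incident-slot v {f} (subst (λ w → Incident (K n) w f) (sym v≡w) wf)
        o≡o′ = unique-map⇒injective (χ c v) (us v) (∈Os o) (∈Os o′) (trans (cong (Vec.lookup c) o≡) (trans eq (cong (Vec.lookup c) (sym o′≡))))
    in e≢f (trans (sym o≡) (trans (cong (de v) o≡o′) o′≡))

  -- The signed weight of a colouring, with the edges of each vertex in slot order: ±1 if the
  -- colouring is proper and 0 otherwise.
  D′ : ColVec → ℤ
  D′ c = ∏ VPs (λ v → sgnL σC (row c v))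

  D′≢0⇒proper : ∀ c → D′ c ≢ 0ℤ → ProperVec c
  D′≢0⇒proper c nz = unique⇒proper c (λ v → sgnL≢0⇒unique σC Fin._≟_ (λ z → nz (∏-zero (Enumeration.complete VP-enum v) z)))

  D′-sq : ∀ c → ProperVec c → D′ c · D′ c ≡ 1ℤ
  D′-sq c pr = trans (sym (∏-* VPs _ _)) (∏-one VPs (λ {v} _ → sgnL-sq σC (proper⇒unique c pr v)))

  sgnL-row : ∀ c v → sgnL σC (row c v) ≡ pp (λ o o′ → sO o o′ · Sign.s σC (χ c v o) (χ c v o′)) Os
  sgnL-row c v = trans (pp-map (Sign.s σC) (χ c v) Os) (pp-cong-AllPairs (AllPairs.map (λ {o} {o′} eq → sym (trans (cong (_· Sign.s σC (χ c v o) (χ c v o′)) eq) (·-identityˡ _))) Os-sorted))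

-- The crossing sign of a proper colouring is the product of its row signs

module Signs (p m : ℕ) .{{_ : NonZero p}} (p≡ : p ≡ suc (m * 2)) (m>0 : 0 < m) where
  open Colouring p m p≡ m>0 public

  private
    module V = Sign σV
    module O = Sign σO
    module C′ = Sign σC
    module P = Sign (finSign p)
    module N = Sign (finSign n)

    _≟V_ : DecidableEquality VP
    _≟V_ = Enumeration._≟_ VP-enum

    swap-injective : ∀ {X Y : Set} {a b : X × Y} → swap a ≡ swap b → a ≡ b
    swap-injective refl = refl

    -- Lexicographic orders on VP × C, with the vertex and the colour first.
    L₁ L₂ : Sign (VP × C)
    L₁ = lexSign σV σC _≟V_
    L₂ = pullback swap swap-injective (lexSign σC σV Fin._≟_)

    l₁ l₂ : VP × C → VP × C → ℤ
    l₁ = Sign.s L₁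
    l₂ = Sign.s L₂

    l₂-same : ∀ v v′ c → l₂ (v , c) (v′ , c) ≡ sV v v′
    l₂-same v v′ c = if-yes (c Fin.≟ c) refl

    l₂-diff : ∀ v v′ {c c′} → c ≢ c′ → l₂ (v , c) (v′ , c′) ≡ C′.s c c′
    l₂-diff v v′ {c} {c′} ne = if-no (c Fin.≟ c′) ne

    l₁-same : ∀ v c c′ → l₁ (v , c) (v , c′) ≡ C′.s c c′
    l₁-same v c c′ = if-yes (v ≟V v) refl

    l₁-diff : ∀ {v v′} c c′ → v ≢ v′ → l₁ (v , c) (v′ , c′) ≡ sV v v′
    l₁-diff {v} {v′} c c′ ne = if-no (v ≟V v′) ne

    labels : (VP → Slot → C) → Dart → VP × C
    labels h (v , o) = v , h v o

    both : (VP → Slot → C) → Dart → Dart → ℤ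
    both h x y = l₁ (labels h x) (labels h y) · l₂ (labels h x) (labels h y)

    module _ (h : VP → Slot → C) (perm : ∀ v → map (h v) Os ↭ allFin k) where

      -- A labelling that is a permutation at each vertex maps the darts bijectively onto `VP × C`,
      -- and the factor is symmetric. The product is thus the same for all proper colourings and for
      -- the slots in the role of colours.
      pp-both : pp (both h) XV ≡ pp (λ x y → l₁ x y · l₂ x y) (cartesianProduct VPs (allFin k))
      pp-both = trans (sym (pp-map (λ x y → l₁ x y · l₂ x y) (labels h) XV))
                  (pp-↭ (λ (a , b) (c , d) → sym (trans (cong₂ _·_ (Sign.anti L₁ (a , b) (c , d)) (Sign.anti L₂ (a , b) (c , d))) (⊝·⊝ _ _)))
                        (map-×-↭ h VPs perm))

    K² : pp (λ x y → l₁ x y · l₂ x y) (cartesianProduct VPs (allFin k)) · pp (λ x y → l₁ x y · l₂ x y) (cartesianProduct VPs (allFin k)) ≡ 1ℤ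
    K² = pp-square (Unique.cartesianProduct⁺ (Enumeration.unique VP-enum) (Unique.allFin⁺ k))
           (λ ne → trans (·-interchange _ _ _ _) (trans (cong₂ _·_ (Sign.sq L₁ ne) (Sign.sq L₂ ne)) (·-identityˡ 1ℤ)))

    ω : Dart → VP × C
    ω = labels (λ _ → ι)

    minus-pairs : ∀ {X : Set} (g : X → X → ℤ) xs → pp g xs ≡ 1ℤ → ∀ j → length xs ≡ j * 2 ⊎ length xs ≡ suc (j * 2) →
                  pp (λ x y → ⊝ 1ℤ · g x y) xs ≡ (⊝ 1ℤ) ↑ j
    minus-pairs g xs one j len = trans (pp-* (λ _ _ → ⊝ 1ℤ) g xs) (trans (cong₂ _·_ (pp-const-even j xs len) one) (·-identityʳ _))

    ids : ∀ a → + (a + (a * m + a * m)) ≡ 0ℤ ⟨mod + p ⟩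
    ids a = subst (λ z → + z ≡ 0ℤ ⟨mod + p ⟩) (trans (cong (a *_) p≡) (lem a m)) (multiple-mod p a)
      where lem : ∀ a m → a * suc (m * 2) ≡ a + (a * m + a * m)
            lem = ℕSolver.solve-∀

  rot-even : ∀ a → pp (twist (finSign p) (rot p a)) (allFin p) ≡ 1ℤ
  rot-even = pp-twist-odd (finSign p) {m} {allFin p} (rot p) (rot-injective p) (rot-+ p) (λ a → rot-0 p (ids a)) (Unique.allFin⁺ p)
               (λ a → map-injective-↭ (finEnum p) (rot-injective p a))

  turn-injective : ∀ a {u v} → turn a u ≡ turn a v → u ≡ v
  turn-injective a {b , x} {c , y} eq = cong₂ _,_ (cong proj₁ eq) (rot-injective p a (cong proj₂ eq))

  turn-even : ∀ a → pp (twist σV (turn a)) VPs ≡ 1ℤ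
  turn-even = pp-twist-odd σV {m} {VPs} turn turn-injective (λ a b (c , x) → cong (c ,_) (rot-+ p a b x)) (λ a (c , x) → cong (c ,_) (rot-0 p (ids a) x))
                (Enumeration.unique VP-enum) (λ a → map-injective-↭ VP-enum (turn-injective a))

  private
    four : (Dart → Dart → ℤ) → Block → Block → ℤ
    four g b b′ = ∏ (blockDarts b) (λ x → ∏ (blockDarts b′) (g x))

    pp-X₅ : ∀ g → pp g X₅ ≡ ∏ Bs (λ b → g (d₁ b) (d₂ b)) · pp (four g) Bs
    pp-X₅ g = trans (pp-concatMap g blockDarts Bs) (cong (_· pp (four g) Bs) (∏-cong Bs (λ b → ·-identityʳ _)))

    lω : Dart → Dart → ℤ
    lω x y = l₂ (ω x) (ω y)

    lω-same : ∀ v v′ o → lω (v , o) (v′ , o) ≡ sV v v′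
    lω-same v v′ o = l₂-same v v′ (ι o)

    lω-diff : ∀ v v′ {o o′} → o ≢ o′ → lω (v , o) (v′ , o′) ≡ sO o o′
    lω-diff v v′ ne = l₂-diff v v′ (ne ∘ ι-injective)

    lω-later : ∀ v v′ o o′ → sO o o′ ≡ 1ℤ → lω (v , o) (v′ , o′) ≡ 1ℤ
    lω-later v v′ o o′ eq = trans (lω-diff v v′ {o} {o′} (λ { refl → 1≢0 (trans (sym eq) (O.diag o)) })) eq

    four-one : ∀ {g b b′} → (∀ {x y} → x ∈ blockDarts b → y ∈ blockDarts b′ → g x y ≡ 1ℤ) → four g b b′ ≡ 1ℤ
    four-one {b = b} {b′} eq = ∏-one (blockDarts b) (λ x∈ → ∏-one (blockDarts b′) (λ y∈ → eq x∈ y∈))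

    groups : ∀ d {d′} v v′ → d Fin.< d′ → four lω (inj₁ (d , v)) (inj₁ (d′ , v′)) ≡ 1ℤ
    groups d {d′} v v′ lt = four-one {g = lω} {b = inj₁ (d , v)} {inj₁ (d′ , v′)} λ
      { (here refl)         (here refl)         → lω-later v v′ (inj₁ (d , false)) (inj₁ (d′ , false)) (sO-groups false false lt)
      ; (here refl)         (there (here refl)) → lω-later v (v′ ▷ inj₁ (d′ , false)) (inj₁ (d , false)) (inj₁ (d′ , true)) (sO-groups false true lt)
      ; (there (here refl)) (here refl)         → lω-later (v ▷ inj₁ (d , false)) v′ (inj₁ (d , true)) (inj₁ (d′ , false)) (sO-groups true false lt)
      ; (there (here refl)) (there (here refl)) → lω-later (v ▷ inj₁ (d , false)) (v′ ▷ inj₁ (d′ , false)) (inj₁ (d , true)) (inj₁ (d′ , true)) (sO-groups true true lt) }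

    crosses : ∀ y {y′} x x′ → y Fin.< y′ → four lω (inj₂ (y , x)) (inj₂ (y′ , x′)) ≡ 1ℤ
    crosses y {y′} x x′ lt = four-one {g = lω} {b = inj₂ (y , x)} {inj₂ (y′ , x′)} λ
      { (here refl)         (here refl)         → lω-later (zero , x) (zero , x′) (inj₂ y) (inj₂ y′) (sO-cross lt)
      ; (here refl)         (there (here refl)) → lω-later (zero , x) ((zero , x′) ▷ inj₂ y′) (inj₂ y) (inj₂ y′) (sO-cross lt)
      ; (there (here refl)) (here refl)         → lω-later ((zero , x) ▷ inj₂ y) (zero , x′) (inj₂ y) (inj₂ y′) (sO-cross lt)
      ; (there (here refl)) (there (here refl)) → lω-later ((zero , x) ▷ inj₂ y) ((zero , x′) ▷ inj₂ y′) (inj₂ y) (inj₂ y′) (sO-cross lt) }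

    mixed : ∀ dv yx → four lω (inj₁ dv) (inj₂ yx) ≡ 1ℤ
    mixed (d , v) (y , x) = four-one {g = lω} {b = inj₁ (d , v)} {inj₂ (y , x)} λ
      { (here refl)         (here refl)         → lω-later v (zero , x) (inj₁ (d , false)) (inj₂ y) (sO-mixed (d , false) y)
      ; (here refl)         (there (here refl)) → lω-later v ((zero , x) ▷ inj₂ y) (inj₁ (d , false)) (inj₂ y) (sO-mixed (d , false) y)
      ; (there (here refl)) (here refl)         → lω-later (v ▷ inj₁ (d , false)) (zero , x) (inj₁ (d , true)) (inj₂ y) (sO-mixed (d , true) y)
      ; (there (here refl)) (there (here refl)) → lω-later (v ▷ inj₁ (d , false)) ((zero , x) ▷ inj₂ y) (inj₁ (d , true)) (inj₂ y) (sO-mixed (d , true) y) }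

    -- Of the four comparisons, start with start and end with end give the inversion factor of the
    -- rotation. The two mixed ones are decided by the slots, one with their order and one against
    -- it, hence the -1.
    parallel : ∀ d v v′ → four lω (inj₁ (d , v)) (inj₁ (d , v′)) ≡ ⊝ 1ℤ · twist σV (turn (suc (toℕ d))) v v′
    parallel d v v′ = trans
      (cong₂ _·_ (cong₂ (λ a b → a · (b · 1ℤ)) (lω-same v v′ (inj₁ (d , false))) (lω-later v (turn (suc (toℕ d)) v′) (inj₁ (d , false)) (inj₁ (d , true)) (sO-within d)))
                 (cong (_· 1ℤ) (cong₂ (λ a b → a · (b · 1ℤ)) (trans (lω-diff (turn (suc (toℕ d)) v) v′ {inj₁ (d , true)} {inj₁ (d , false)} (λ ())) (trans (O.anti (inj₁ (d , false)) (inj₁ (d , true))) (cong ⊝_ (sO-within d))))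
                                                             (lω-same (turn (suc (toℕ d)) v) (turn (suc (toℕ d)) v′) (inj₁ (d , true))))))
      (solve 2 (λ a b → (a :* (con 1ℤ :* con 1ℤ)) :* ((:- con 1ℤ :* (b :* con 1ℤ)) :* con 1ℤ) := :- con 1ℤ :* (a :* b)) refl (sV v v′) (sV (turn (suc (toℕ d)) v) (turn (suc (toℕ d)) v′)))

    through : ∀ y x x′ → four lω (inj₂ (y , x)) (inj₂ (y , x′)) ≡ ⊝ 1ℤ · twist (finSign p) (rot p (toℕ y)) x x′
    through y x x′ = trans
      (cong₂ _·_ (cong₂ (λ a b → a · (b · 1ℤ)) (trans (lω-same (zero , x) (zero , x′) (inj₂ y)) (sV-side zero x x′)) (trans (lω-same (zero , x) (suc zero , rot p (toℕ y) x′) (inj₂ y)) (sV-across x (rot p (toℕ y) x′))))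
                 (cong (_· 1ℤ) (cong₂ (λ a b → a · (b · 1ℤ)) (trans (lω-same (suc zero , rot p (toℕ y) x) (zero , x′) (inj₂ y)) (trans (sV-back (rot p (toℕ y) x) x′) (sym ⊝1≡-1)))
                                                             (trans (lω-same (suc zero , rot p (toℕ y) x) (suc zero , rot p (toℕ y) x′) (inj₂ y)) (sV-side (suc zero) (rot p (toℕ y) x) (rot p (toℕ y) x′))))))
      (solve 2 (λ a b → (a :* (con 1ℤ :* con 1ℤ)) :* ((:- con 1ℤ :* (b :* con 1ℤ)) :* con 1ℤ) := :- con 1ℤ :* (a :* b)) refl (sP x x′) (sP (rot p (toℕ y) x) (rot p (toℕ y) x′)))

    pp-groups : ∀ {X Y : Set} (h : X → Y → Block) {xs} ys → AllPairs (λ x x′ → ∀ y y′ → four lω (h x y) (h x′ y′) ≡ 1ℤ) xs →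
                pp (four lω) (concatMap (λ x → map (h x) ys) xs) ≡ ∏ xs (λ x → pp (λ y y′ → four lω (h x y) (h x y′)) ys)
    pp-groups h {xs} ys ap = trans (pp-concatMap (four lω) (λ x → map (h x) ys) xs) (trans
      (cong₂ _·_ (∏-cong xs (λ x → pp-map (four lω) (h x) ys))
        (pp-one (AllPairs.map (λ {x} {x′} one → trans (∏-map (h x) ys _) (∏-one ys (λ {y} _ → trans (∏-map (h x′) ys _) (∏-one ys (λ {y′} _ → one y y′))))) ap)))
      (·-identityʳ _))

    ↑p : (⊝ 1ℤ) ↑ p ≡ ⊝ 1ℤ
    ↑p = trans (cong ((⊝ 1ℤ) ↑_) p≡) (trans (cong (⊝ 1ℤ ·_) (↑-even ⊝1-sq m)) (·-identityʳ _))

    pp-B₁ : pp (four lω) B₁ ≡ (⊝ 1ℤ) ↑ m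
    pp-B₁ = trans (pp-groups (λ d v → inj₁ (d , v)) VPs (AllPairs.map (λ {d} lt v v′ → groups d v v′ lt) (allFin-sorted m)))
      (trans (∏-cong (allFin m) (λ d → trans (pp-cong VPs (parallel d)) (trans (minus-pairs (twist σV (turn (suc (toℕ d)))) VPs (turn-even (suc (toℕ d))) p (inj₁ length-VPs)) ↑p)))
        (trans (∏-const (allFin m) (⊝ 1ℤ)) (cong ((⊝ 1ℤ) ↑_) (List.length-tabulate {n = m} id))))

    ↑-sq : ∀ {a} → a · a ≡ 1ℤ → ∀ j → a ↑ j · a ↑ j ≡ 1ℤ
    ↑-sq sq zero    = ·-identityˡ 1ℤ
    ↑-sq {a} sq (suc j) = trans (·-interchange a (a ↑ j) a (a ↑ j)) (trans (cong₂ _·_ sq (↑-sq sq j)) (·-identityˡ 1ℤ))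

  odd-power : ∀ {a} → a · a ≡ 1ℤ → a ↑ p ≡ a
  odd-power {a} sq = trans (cong (a ↑_) p≡) (trans (cong (a ·_) (↑-even sq m)) (·-identityʳ _))

  private
    pp-B₂ : pp (four lω) B₂ ≡ (⊝ 1ℤ) ↑ m
    pp-B₂ = trans (pp-groups (λ y x → inj₂ (y , x)) (allFin p) (AllPairs.map (λ {y} lt x x′ → crosses y x x′ lt) (allFin-sorted p)))
      (trans (∏-cong (allFin p) (λ y → trans (pp-cong (allFin p) (through y)) (minus-pairs (twist (finSign p) (rot p (toℕ y))) (allFin p) (rot-even (toℕ y)) m (inj₂ (trans (List.length-tabulate id) p≡)))))
        (trans (∏-const (allFin p) ((⊝ 1ℤ) ↑ m)) (trans (cong (((⊝ 1ℤ) ↑ m) ↑_) (List.length-tabulate {n = p} id)) (odd-power (↑-sq ⊝1-sq m)))))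

    -- The reference labelling by slots has no sign of its own: rotations are even, and the
    -- remaining (-1)^m of the inner edges cancels against (-1)^m of the crossing edges.
    κ : pp lω X₅ ≡ 1ℤ
    κ = begin
      pp lω X₅
        ≡⟨ pp-X₅ lω ⟩
      ∏ Bs (λ b → lω (d₁ b) (d₂ b)) · pp (four lω) (B₁ ++ B₂)
        ≡⟨ cong₂ _·_ (∏-one Bs (λ {b} _ → inner b)) (pp-++ (four lω) B₁ B₂) ⟩
      1ℤ · (pp (four lω) B₁ · pp (four lω) B₂ · ∏ B₁ (λ b → ∏ B₂ (four lω b)))
        ≡⟨ cong (1ℤ ·_) (cong₂ _·_ (trans (cong₂ _·_ pp-B₁ pp-B₂) (↑-sq ⊝1-sq m)) across) ⟩
      1ℤ · (1ℤ · 1ℤ)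
        ≡⟨ solve 0 (con 1ℤ :* (con 1ℤ :* con 1ℤ) := con 1ℤ) refl ⟩
      1ℤ ∎
      where
      open ≡-Reasoning
      inner : ∀ b → lω (d₁ b) (d₂ b) ≡ 1ℤ
      inner (inj₁ (d , v)) = lω-later v (turn (suc (toℕ d)) v) (inj₁ (d , false)) (inj₁ (d , true)) (sO-within d)
      inner (inj₂ (y , x)) = trans (lω-same (zero , x) (suc zero , rot p (toℕ y) x) (inj₂ y)) (sV-across x (rot p (toℕ y) x))
      across : ∏ B₁ (λ b → ∏ B₂ (four lω b)) ≡ 1ℤ
      across = trans (∏-concatMap _ (allFin m) _) (∏-one (allFin m) (λ {d} _ → trans (∏-map _ VPs _) (∏-one VPs (λ {v} _ →
                 trans (∏-concatMap _ (allFin p) _) (∏-one (allFin p) (λ {y} _ → trans (∏-map _ (allFin p) _) (∏-one (allFin p) (λ {x} _ → mixed (d , v) (y , x)))))))))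

  -- For two edges without a common end this is -1 exactly when they cross. Unlike `Crosses`, it
  -- treats the two edges, and the two ends of each, alike.
  s₄ : E → E → ℤ
  s₄ e f = N.s (lo (K n) e) (lo (K n) f) · N.s (lo (K n) e) (hi (K n) f) · N.s (hi (K n) e) (lo (K n) f) · N.s (hi (K n) e) (hi (K n) f)

  private
    s₄-view : ∀ {u v u′ v′ e f} → Edge-view n u v e → Edge-view n u′ v′ f → s₄ e f ≡ N.s u u′ · N.s u v′ · N.s v u′ · N.s v v′
    s₄-view (upward refl refl)   (upward refl refl)   = refl
    s₄-view {u} {v} {u′} {v′} (upward refl refl)   (downward refl refl) =
      solve 4 (λ a b c d → b :* a :* d :* c := a :* b :* c :* d) refl (N.s u u′) (N.s u v′) (N.s v u′) (N.s v v′)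
    s₄-view {u} {v} {u′} {v′} (downward refl refl) (upward refl refl)   =
      solve 4 (λ a b c d → c :* d :* a :* b := a :* b :* c :* d) refl (N.s u u′) (N.s u v′) (N.s v u′) (N.s v v′)
    s₄-view {u} {v} {u′} {v′} (downward refl refl) (downward refl refl) =
      solve 4 (λ a b c d → d :* c :* b :* a := a :* b :* c :* d) refl (N.s u u′) (N.s u v′) (N.s v u′) (N.s v v′)

    s₄-sym : ∀ e f → s₄ e f ≡ s₄ f e
    s₄-sym e f = sym (trans (cong₂ _·_ (cong₂ _·_ (cong₂ _·_ (N.anti le lf) (N.anti he lf)) (N.anti le hf)) (N.anti he hf))
      (solve 4 (λ a b c d → :- a :* :- c :* :- b :* :- d := a :* b :* c :* d) refl (N.s le lf) (N.s le hf) (N.s he lf) (N.s he hf)))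
      where
      le = lo (K n) e
      he = hi (K n) e
      lf = lo (K n) f
      hf = hi (K n) f

  q : ColVec → E → E → ℤ
  q c e f = if does (Vec.lookup c e Fin.≟ Vec.lookup c f) then s₄ e f else 1ℤ

  q-sym : ∀ c e f → q c e f ≡ q c f e
  q-sym c e f = by-cases (Vec.lookup c e Fin.≟ Vec.lookup c f)
    where
    by-cases : Dec (Vec.lookup c e ≡ Vec.lookup c f) → q c e f ≡ q c f e
    by-cases (yes eq) = trans (if-yes (Vec.lookup c e Fin.≟ Vec.lookup c f) eq) (trans (s₄-sym e f) (sym (if-yes (Vec.lookup c f Fin.≟ Vec.lookup c e) (sym eq))))
    by-cases (no ne)  = trans (if-no (Vec.lookup c e Fin.≟ Vec.lookup c f) ne) (sym (if-no (Vec.lookup c f Fin.≟ Vec.lookup c e) (ne ∘ sym)))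

  Q : ColVec → ℤ
  Q c = pp (q c) allE

  private
    module _ (c : ColVec) where
      ψ : Dart → VP × C
      ψ = labels (χ c)

      lψ : Dart → Dart → ℤ
      lψ x y = l₂ (ψ x) (ψ y)

      cb : Block → C
      cb b = Vec.lookup c (eb b)

      ψ₂ : ∀ b → ψ (d₂ b) ≡ (proj₁ (d₂ b) , cb b)
      ψ₂ b = cong (proj₁ (d₂ b) ,_) (cong (Vec.lookup c) (de-d₂ b))

      four-lψ : ∀ b b′ → four lψ b b′ ≡ q c (eb b) (eb b′)
      four-lψ b b′ = trans (cong₂ _·_ (cong₂ (λ x y → x · (y · 1ℤ)) refl (cong (l₂ (ψ (d₁ b))) (ψ₂ b′)))
          (cong (_· 1ℤ) (cong₂ (λ x y → x · (y · 1ℤ)) (cong (λ z → l₂ z (ψ (d₁ b′))) (ψ₂ b)) (cong₂ l₂ (ψ₂ b) (ψ₂ b′)))))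
        (by-cases (cb b Fin.≟ cb b′))
        where
        u = proj₁ (d₁ b)
        v = proj₁ (d₂ b)
        u′ = proj₁ (d₁ b′)
        v′ = proj₁ (d₂ b′)
        prod : (VP → VP → ℤ) → ℤ
        prod g = (g u u′ · (g u v′ · 1ℤ)) · ((g v u′ · (g v v′ · 1ℤ)) · 1ℤ)
        prod-cong : ∀ {g h : VP → VP → ℤ} → (∀ x y → g x y ≡ h x y) → prod g ≡ prod h
        prod-cong {g} {h} eq = cong₂ _·_ (cong₂ (λ x y → x · (y · 1ℤ)) (eq u u′) (eq u v′)) (cong (_· 1ℤ) (cong₂ (λ x y → x · (y · 1ℤ)) (eq v u′) (eq v v′)))
        view : ∀ b → Edge-view n (vtx (proj₁ (d₁ b))) (vtx (proj₁ (d₂ b))) (eb b)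
        view b = subst (λ w → Edge-view n (vtx (proj₁ (d₁ b))) (vtx w) (eb b)) (sym (d₂-start b)) (uncurry de-view (d₁ b))
        by-cases : Dec (cb b ≡ cb b′) → prod (λ x y → l₂ (x , cb b) (y , cb b′)) ≡ q c (eb b) (eb b′)
        by-cases (yes eq) = trans (prod-cong {λ x y → l₂ (x , cb b) (y , cb b′)} {sV} (λ _ _ → if-yes (cb b Fin.≟ cb b′) eq))
          (trans (solve 4 (λ a b c d → (a :* (b :* con 1ℤ)) :* ((c :* (d :* con 1ℤ)) :* con 1ℤ) := a :* b :* c :* d) refl (sV u u′) (sV u v′) (sV v u′) (sV v v′))
            (trans (sym (s₄-view (view b) (view b′))) (sym (if-yes (cb b Fin.≟ cb b′) eq))))
        by-cases (no ne)  = trans (prod-cong {λ x y → l₂ (x , cb b) (y , cb b′)} {λ _ _ → C′.s (cb b) (cb b′)} (λ x y → l₂-diff x y ne))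
          (trans (solve 1 (λ a → (a :* (a :* con 1ℤ)) :* ((a :* (a :* con 1ℤ)) :* con 1ℤ) := (a :* a) :* (a :* a)) refl (C′.s (cb b) (cb b′)))
            (trans (cong₂ _·_ (C′.sq ne) (C′.sq ne)) (trans (·-identityˡ 1ℤ) (sym (if-no (cb b Fin.≟ cb b′) ne)))))

      -- These are the comparisons between the two ends of one edge. Inner edges occur in both
      -- halves with the same sign, and crossing edges always go from the lower half to the upper.
      block-signs : ∏ Bs (λ b → lψ (d₁ b) (d₂ b)) ≡ 1ℤ
      block-signs = trans (∏-cong Bs (λ b → trans (cong (l₂ (ψ (d₁ b))) (ψ₂ b)) (l₂-same (proj₁ (d₁ b)) (proj₁ (d₂ b)) (cb b)))) (trans (∏-++ B₁ B₂ g) (trans (cong₂ _·_ ones₁ ones₂) (·-identityˡ 1ℤ)))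
        where
        g : Block → ℤ
        g b = sV (proj₁ (d₁ b)) (proj₁ (d₂ b))
        half : Fin m → Fin p → ℤ
        half d x = sP x (rot p (suc (toℕ d)) x)
        half-sq : ∀ d x → half d x · half d x ≡ 1ℤ
        half-sq d x = P.sq {x} {rot p (suc (toℕ d)) x} (λ eq → amount≢0 (d , false) (rot-fixed p (suc (toℕ d)) (sym eq)))
        ones₁ : ∏ B₁ g ≡ 1ℤ
        ones₁ = trans (∏-concatMap _ (allFin m) g) (∏-one (allFin m) (λ {d} _ → trans (∏-map _ VPs g) (trans (∏-× (allFin 2) (allFin p) _)
          (trans (cong₂ (λ a b → a · (b · 1ℤ)) (∏-cong (allFin p) (λ x → sV-side zero x (rot p (suc (toℕ d)) x))) (∏-cong (allFin p) (λ x → sV-side (suc zero) x (rot p (suc (toℕ d)) x))))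
            (trans (solve 1 (λ a → a :* (a :* con 1ℤ) := a :* a) refl (∏ (allFin p) (half d))) (trans (sym (∏-* (allFin p) (half d) (half d))) (∏-one (allFin p) (λ {x} _ → half-sq d x))))))))
        ones₂ : ∏ B₂ g ≡ 1ℤ
        ones₂ = trans (∏-concatMap _ (allFin p) g) (∏-one (allFin p) (λ {y} _ → trans (∏-map _ (allFin p) g) (∏-one (allFin p) (λ {x} _ → sV-across x (rot p (toℕ y) x)))))

      Q≡pp : Q c ≡ pp lψ X₅
      Q≡pp = sym (trans (pp-X₅ lψ) (trans (cong₂ _·_ block-signs (pp-cong Bs four-lψ)) (trans (·-identityˡ _) (trans (sym (pp-map (q c) eb Bs)) (pp-↭ (q-sym c) eb-↭)))))

      D′≡pp : D′ c ≡ pp (λ x y → l₁ (ω x) (ω y) · l₁ (ψ x) (ψ y)) XV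
      D′≡pp = sym (trans (pp-× _ Os (Enumeration.unique VP-enum) (λ {a} {a′} b b′ ne → trans (cong₂ _·_ (l₁-diff (ι b) (ι b′) ne) (l₁-diff (χ c a b) (χ c a′ b′) ne)) (V.sq ne)))
        (∏-cong VPs (λ v → trans (pp-cong Os (λ o o′ → cong₂ _·_ (l₁-same v (ι o) (ι o′)) (l₁-same v (χ c v o) (χ c v o′)))) (sym (sgnL-row c v)))))

  -- The darts are compared in vertex-first and in colour-first order. By `pp-both` the joint sign
  -- is the same constant for colours and for slots, so the product of both is 1; its vertex-first
  -- part is `D′`, and its colour-first part is `Q` times the slot sign `κ`, which is 1.
  D′≡Q : ∀ c → ProperVec c → D′ c ≡ Q c
  D′≡Q c pr = ·-cancel-sign (D′-sq c pr) (begin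
    D′ c · Q c
      ≡⟨ cong (D′ c ·_) (trans (sym (·-identityʳ _)) (cong₂ _·_ (Q≡pp c) (sym κ))) ⟩
    D′ c · (pp (lψ c) X₅ · pp lω X₅)
      ≡⟨ cong (D′ c ·_) (trans (sym (pp-* (lψ c) lω X₅)) (sym (pp-↭ lsym X₅-↭))) ⟩
    D′ c · pp (λ x y → lψ c x y · lω x y) XV
      ≡⟨ trans (cong (_· pp (λ x y → lψ c x y · lω x y) XV) (D′≡pp c)) (sym (pp-* _ _ XV)) ⟩
    pp (λ x y → (l₁ (ω x) (ω y) · l₁ (ψ c x) (ψ c y)) · (lψ c x y · lω x y)) XV
      ≡⟨ pp-cong XV (λ x y → solve 4 (λ a b c d → (a :* b) :* (c :* d) := (b :* c) :* (a :* d)) refl (l₁ (ω x) (ω y)) (l₁ (ψ c x) (ψ c y)) (lψ c x y) (lω x y)) ⟩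
    pp (λ x y → both (χ c) x y · both (λ _ → ι) x y) XV
      ≡⟨ pp-* (both (χ c)) (both (λ _ → ι)) XV ⟩
    pp (both (χ c)) XV · pp (both (λ _ → ι)) XV
      ≡⟨ cong₂ _·_ (pp-both (χ c) (λ v → full⇒↭ (finEnum k) (proper⇒unique c pr v) (ℕ.≤-reflexive (trans (List.length-tabulate id) (sym (length-row c v))))))
                   (pp-both (λ _ → ι) (λ _ → ι-↭)) ⟩
    _
      ≡⟨ K² ⟩
    1ℤ ∎)
    where
    open ≡-Reasoning
    lsym : ∀ x y → lψ c x y · lω x y ≡ lψ c y x · lω y x
    lsym x y = sym (trans (cong₂ _·_ (Sign.anti L₂ (ψ c x) (ψ c y)) (Sign.anti L₂ (ω x) (ω y))) (⊝·⊝ _ _))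

-- Invariance of the signed count under permutations of vertices and colours

module Invariance (p m : ℕ) .{{_ : NonZero p}} (p≡ : p ≡ suc (m * 2)) (m>0 : 0 < m) where
  open Signs p m p≡ m>0 public

  infix 4 _≟ⱽ_
  _≟ⱽ_ : DecidableEquality VP
  _≟ⱽ_ = Enumeration._≟_ VP-enum

  VPs-unique : Unique VPs
  VPs-unique = Enumeration.unique VP-enum

  ∈VPs : ∀ v → v ∈ VPs
  ∈VPs = Enumeration.complete VP-enum

  col : ColVec → VP → VP → C
  col c u v = Vec.lookup c (ed u v)

  private
    meets? : ∀ v u w → Dec (u ≡ v ⊎ w ≡ v)
    meets? v u w = (u ≟ⱽ v) ⊎-dec (w ≟ⱽ v)

    -- The comparison at v of the colours towards u and w, taken relative to the global vertex order
    -- in place of the slots. Pairs that contain v itself get the neutral factor.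
    g : ColVec → VP → VP → VP → ℤ
    g c v u w = if does (meets? v u w) then 1ℤ else sV u w · Sign.s σC (col c v u) (col c v w)

    g-sym : ∀ c v u w → g c v u w ≡ g c v w u
    g-sym c v u w = by-cases (meets? v u w)
      where
      by-cases : Dec (u ≡ v ⊎ w ≡ v) → g c v u w ≡ g c v w u
      by-cases (yes y) = trans (if-yes (meets? v u w) y) (sym (if-yes (meets? v w u) (Sum.swap y)))
      by-cases (no n)  = trans (if-no (meets? v u w) n) (trans (sym (trans (cong₂ _·_ (Sign.anti σV u w) (Sign.anti σC (col c v u) (col c v w))) (⊝·⊝ _ _)))
                           (sym (if-no (meets? v w u) (n ∘ Sum.swap))))

    D : ColVec → ℤ
    D c = ∏ VPs (λ v → pp (g c v) VPs)

    neighbours : ∀ v → VPs ↭ v ∷ map (v ▷_) Os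
    neighbours v = ↭-sym (full⇒↭ VP-enum (All.map⁺ (All.tabulate (λ {o} _ → ▷-≢ v o)) ∷ Unique.map⁺ (▷-injective v) Os-unique)
      (ℕ.≤-reflexive (trans length-VPs (sym (trans (cong suc (trans (List.length-map (v ▷_) Os) length-Os)) (trans (cong (_+ p) (sym p≡)) (trans (cong (λ z → p + z) (sym (ℕ.+-identityʳ p))) (ℕ.*-comm 2 p))))))))

    D-slots : ∀ c → D c ≡ ∏ VPs (λ v → pp (λ o o′ → sV (v ▷ o) (v ▷ o′) · Sign.s σC (χ c v o) (χ c v o′)) Os)
    D-slots c = ∏-cong VPs (λ v → trans (pp-↭ (g-sym c v) (neighbours v)) (trans (pp-∷ (g c v) v (map (v ▷_) Os))
      (trans (cong₂ _·_ (∏-one (map (v ▷_) Os) (λ {w} _ → if-yes (meets? v v w) (inj₁ refl)))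
               (trans (pp-map (g c v) (v ▷_) Os) (pp-cong Os (λ o o′ → if-no (meets? v (v ▷ o) (v ▷ o′)) Sum.[ ▷-≢ v o ∘ sym , ▷-≢ v o′ ∘ sym ]))))
             (·-identityˡ _))))

    κ : ℤ
    κ = ∏ VPs (λ v → pp (λ o o′ → sO o o′ · sV (v ▷ o) (v ▷ o′)) Os)

    -- Replacing the slot order by the vertex order changes each row sign by a factor that does not
    -- depend on the colouring.
    D′≡κD : ∀ c → D′ c ≡ κ · D c
    D′≡κD c = sym (trans (cong (κ ·_) (D-slots c)) (trans (sym (∏-* VPs _ _)) (∏-cong VPs (λ v → trans (sym (pp-* _ _ Os)) (trans
      (pp-cong-unique Os-unique (λ {o} {o′} ne → trans (solve 3 (λ a b c → (a :* b) :* (b :* c) := (b :* b) :* (a :* c)) refl (sO o o′) (sV (v ▷ o) (v ▷ o′)) (Sign.s σC (χ c v o) (χ c v o′)))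
        (trans (cong (_· (sO o o′ · Sign.s σC (χ c v o) (χ c v o′))) (Sign.sq σV (ne ∘ ▷-injective v))) (·-identityˡ _))))
      (sym (sgnL-row c v)))))))

    unvtx : Fin n → VP
    unvtx v = proj₁ (vtx-surjective v)

    unvtx-vtx : ∀ u → unvtx (vtx u) ≡ u
    unvtx-vtx u = vtx-injective (proj₂ (vtx-surjective (vtx u)))

  recolour : (VP → VP) → (C → C) → ColVec → ColVec
  recolour f π c = Vec.tabulate (λ e → π (col c (f (unvtx (lo (K n) e))) (f (unvtx (hi (K n) e)))))

  col-recolour : ∀ f π c {u v} → (∀ {x y} → f x ≡ f y → x ≡ y) → u ≢ v → col (recolour f π c) u v ≡ π (col c (f u) (f v))
  col-recolour f π c {u} {v} inj ne = trans (Vec.lookup∘tabulate _ (ed u v)) (cong π (by-view (ed-view ne)))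
    where
    by-view : Edge-view n (vtx u) (vtx v) (ed u v) → col c (f (unvtx (lo (K n) (ed u v)))) (f (unvtx (hi (K n) (ed u v)))) ≡ col c (f u) (f v)
    by-view (upward l h)   = cong₂ (λ x y → col c (f x) (f y)) (trans (cong unvtx l) (unvtx-vtx u)) (trans (cong unvtx h) (unvtx-vtx v))
    by-view (downward l h) = trans (cong₂ (λ x y → col c (f x) (f y)) (trans (cong unvtx l) (unvtx-vtx v)) (trans (cong unvtx h) (unvtx-vtx u)))
                                   (cong (Vec.lookup c) (ed-sym (λ eq → ne (sym (inj eq)))))

  col-ext : ∀ {c c′} → (∀ {u v} → u ≢ v → col c u v ≡ col c′ u v) → c ≡ c′
  col-ext {c} {c′} eq = vec-ext (λ e → let b , b≡ = eb-surjective e in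
    trans (cong (Vec.lookup c) (sym b≡)) (trans (eq (uncurry ▷-≢ (d₁ b))) (cong (Vec.lookup c′) b≡)))

  module _ {f : VP → VP} (f-inj : ∀ {x y} → f x ≡ f y → x ≡ y) where

    private
      t : VP → VP → ℤ
      t u w = sV u w · sV (f u) (f w)

      inversions : VP → VP → VP → ℤ
      inversions v u w = if does (meets? v u w) then 1ℤ else t u w

      -- A pair {u , w} is compared at the n - 2 other vertices, an even number of times.
      cancel : ∀ {u w} → u ≢ w → ∏ VPs (λ v → inversions v u w) ≡ 1ℤ
      cancel {u} {w} u≢w = begin
        X                         ≡⟨ trans (sym (·-identityʳ X)) (cong (X ·_) (sym tt≡1)) ⟩
        X · (t u w · t u w)       ≡⟨ cong (X ·_) (cong₂ _·_ (sym (at u)) (sym (at w))) ⟩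
        X · (∏ VPs (only u) · ∏ VPs (only w)) ≡⟨ trans (cong (X ·_) (sym (∏-* VPs (only u) (only w)))) (sym (∏-* VPs _ _)) ⟩
        ∏ VPs (λ v → inversions v u w · (only u v · only w v)) ≡⟨ ∏-cong VPs pointwise ⟩
        ∏ VPs (λ _ → t u w)       ≡⟨ ∏-const VPs (t u w) ⟩
        t u w ↑ length VPs        ≡⟨ trans (cong (t u w ↑_) length-VPs) (↑-even tt≡1 p) ⟩
        1ℤ                        ∎
        where
        open ≡-Reasoning
        X = ∏ VPs (λ v → inversions v u w)
        tt≡1 : t u w · t u w ≡ 1ℤ
        tt≡1 = sq·sq σV u≢w (u≢w ∘ f-inj)
        only : VP → VP → ℤ
        only x v = if does (x ≟ⱽ v) then t u w else 1ℤ
        at : ∀ x → ∏ VPs (only x) ≡ t u w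
        at x = trans (∏-single VPs-unique (∈VPs x) (λ {v} ne → if-no (x ≟ⱽ v) (ne ∘ sym))) (if-yes (x ≟ⱽ x) refl)
        pointwise : ∀ v → inversions v u w · (only u v · only w v) ≡ t u w
        pointwise v = by-cases (u ≟ⱽ v) (w ≟ⱽ v)
          where
          by-cases : Dec (u ≡ v) → Dec (w ≡ v) → inversions v u w · (only u v · only w v) ≡ t u w
          by-cases (yes a) (yes b) = contradiction (trans a (sym b)) u≢w
          by-cases (yes a) (no b)  = trans (cong₂ _·_ (if-yes (meets? v u w) (inj₁ a)) (cong₂ _·_ (if-yes (u ≟ⱽ v) a) (if-no (w ≟ⱽ v) b)))
                                       (solve 1 (λ a → con 1ℤ :* (a :* con 1ℤ) := a) refl (t u w))
          by-cases (no a)  (yes b) = trans (cong₂ _·_ (if-yes (meets? v u w) (inj₂ b)) (cong₂ _·_ (if-no (u ≟ⱽ v) a) (if-yes (w ≟ⱽ v) b)))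
                                       (solve 1 (λ a → con 1ℤ :* (con 1ℤ :* a) := a) refl (t u w))
          by-cases (no a)  (no b)  = trans (cong₂ _·_ (if-no (meets? v u w) Sum.[ a , b ]) (cong₂ _·_ (if-no (u ≟ⱽ v) a) (if-no (w ≟ⱽ v) b)))
                                       (solve 1 (λ a → a :* (con 1ℤ :* con 1ℤ) := a) refl (t u w))

      D-permute : ∀ c → D (recolour f id c) ≡ D c
      D-permute c = begin
        ∏ VPs (λ v → pp (g c′ v) VPs)
          ≡⟨ ∏-cong VPs (λ v → trans (pp-cong-unique VPs-unique (split v)) (pp-* (inversions v) (λ u w → g c (f v) (f u) (f w)) VPs)) ⟩
        ∏ VPs (λ v → pp (inversions v) VPs · pp (λ u w → g c (f v) (f u) (f w)) VPs)
          ≡⟨ ∏-* VPs _ _ ⟩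
        ∏ VPs (λ v → pp (inversions v) VPs) · ∏ VPs (λ v → pp (λ u w → g c (f v) (f u) (f w)) VPs)
          ≡⟨ cong₂ _·_ (trans (∏-swap VPs (pairs VPs) _) (∏-one (pairs VPs) (λ uw∈ → cancel (AllPairs⇒pairs VPs-unique uw∈))))
               (trans (∏-cong VPs (λ v → trans (sym (pp-map (g c (f v)) f VPs)) (pp-↭ (g-sym c (f v)) (map-injective-↭ VP-enum f-inj))))
                 (trans (sym (∏-map f VPs (λ v → pp (g c v) VPs))) (∏-↭ _ (map-injective-↭ VP-enum f-inj)))) ⟩
        1ℤ · D c
          ≡⟨ ·-identityˡ _ ⟩
        D c ∎
        where
        open ≡-Reasoning
        c′ = recolour f id c
        split : ∀ v {u w} → u ≢ w → g c′ v u w ≡ inversions v u w · g c (f v) (f u) (f w)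
        split v {u} {w} u≢w = by-cases (meets? v u w)
          where
          by-cases : Dec (u ≡ v ⊎ w ≡ v) → g c′ v u w ≡ inversions v u w · g c (f v) (f u) (f w)
          by-cases (yes y) = trans (if-yes (meets? v u w) y) (sym (trans (cong₂ _·_ (if-yes (meets? v u w) y)
            (if-yes (meets? (f v) (f u) (f w)) (Sum.map (cong f) (cong f) y))) (·-identityˡ 1ℤ)))
          by-cases (no ne) = trans (if-no (meets? v u w) ne) (trans
            (cong (sV u w ·_) (cong₂ (Sign.s σC) (col-recolour f id c f-inj (λ eq → ne (inj₁ (sym eq)))) (col-recolour f id c f-inj (λ eq → ne (inj₂ (sym eq))))))
            (sym (trans (cong₂ _·_ (if-no (meets? v u w) ne) (if-no (meets? (f v) (f u) (f w)) (ne ∘ Sum.map f-inj f-inj)))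
              (trans (solve 3 (λ a b c → (a :* b) :* (b :* c) := (b :* b) :* (a :* c)) refl (sV u w) (sV (f u) (f w)) (Sign.s σC (col c (f v) (f u)) (col c (f v) (f w))))
                (trans (cong (_· (sV u w · Sign.s σC (col c (f v) (f u)) (col c (f v) (f w)))) (Sign.sq σV (u≢w ∘ f-inj))) (·-identityˡ _))))))

    module _ {π : C → C} (π-inj : ∀ {x y} → π x ≡ π y → x ≡ y) where

      private
        paint : ColVec → ColVec
        paint = Vec.map π

        lookup-paint : ∀ c e → Vec.lookup (paint c) e ≡ π (Vec.lookup c e)
        lookup-paint c e = Vec.lookup-map e π c

        paint-proper : ∀ c → ProperVec c → ProperVec (paint c)
        paint-proper c pr e f adj eq = pr e f adj (π-inj (trans (sym (lookup-paint c e)) (trans eq (lookup-paint c f))))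

        unpaint-proper : ∀ c → ProperVec (paint c) → ProperVec c
        unpaint-proper c pr e f adj eq = pr e f adj (trans (lookup-paint c e) (trans (cong π eq) (sym (lookup-paint c f))))

        q-paint : ∀ c e f → q (paint c) e f ≡ q c e f
        q-paint c e f = by-cases (Vec.lookup c e Fin.≟ Vec.lookup c f)
          where
          by-cases : Dec (Vec.lookup c e ≡ Vec.lookup c f) → q (paint c) e f ≡ q c e f
          by-cases (yes eq) = trans (if-yes (Vec.lookup (paint c) e Fin.≟ Vec.lookup (paint c) f) (trans (lookup-paint c e) (trans (cong π eq) (sym (lookup-paint c f)))))
                                    (sym (if-yes (Vec.lookup c e Fin.≟ Vec.lookup c f) eq))
          by-cases (no ne)  = trans (if-no (Vec.lookup (paint c) e Fin.≟ Vec.lookup (paint c) f) (λ eq → ne (π-inj (trans (sym (lookup-paint c e)) (trans eq (lookup-paint c f))))))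
                                    (sym (if-no (Vec.lookup c e Fin.≟ Vec.lookup c f) ne))

        -- The crossing sign only asks which edges share a colour, so a permutation of the colours
        -- preserves it. Improper colourings have weight 0 before and after.
        D′-paint : ∀ c → D′ (paint c) ≡ D′ c
        D′-paint c = by-cases (D′ c ℤ.≟ 0ℤ) (D′ (paint c) ℤ.≟ 0ℤ)
          where
          same : ProperVec c → D′ (paint c) ≡ D′ c
          same pr = trans (D′≡Q (paint c) (paint-proper c pr)) (trans (pp-cong allE (q-paint c)) (sym (D′≡Q c pr)))
          by-cases : Dec (D′ c ≡ 0ℤ) → Dec (D′ (paint c) ≡ 0ℤ) → D′ (paint c) ≡ D′ c
          by-cases (no nz) _       = same (D′≢0⇒proper c nz)
          by-cases _       (no nz) = same (unpaint-proper c (D′≢0⇒proper (paint c) nz))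
          by-cases (yes z) (yes z′) = trans z′ (sym z)

      D′-recolour : ∀ c → D′ (recolour f π c) ≡ D′ c
      D′-recolour c = trans (cong D′ {x = recolour f π c} {y = paint (recolour f id c)} (Vec.tabulate-∘ π _))
        (trans (D′-paint (recolour f id c)) (trans (D′≡κD (recolour f id c)) (trans (cong (κ ·_) (D-permute c)) (sym (D′≡κD c)))))

-- Burnside's lemma for ℤ/p × ℤ/p × ℤ/p acting on the two halves and on p of the colours

module Orbits (p m : ℕ) .{{_ : NonZero p}} (prime : Prime p) (p≡ : p ≡ suc (m * 2)) (m>0 : 0 < m) where
  open Invariance p m p≡ m>0 public

  fixedC : Fin (m * 2) → C
  fixedC φ = φ ↑ˡ p

  cyc : Fin p → C
  cyc z = (m * 2) ↑ʳ z

  onColours : (Fin p → Fin p) → C → C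
  onColours f c = Sum.[ fixedC , cyc ∘ f ] (splitAt (m * 2) c)

  data Colour : C → Set where
    isFixed : ∀ φ → Colour (fixedC φ)
    isCyc   : ∀ z → Colour (cyc z)

  colour : ∀ c → Colour c
  colour c = subst Colour (Fin.join-splitAt (m * 2) p c) (go (splitAt (m * 2) c))
    where
    go : ∀ x → Colour (Fin.join (m * 2) p x)
    go (inj₁ φ) = isFixed φ
    go (inj₂ z) = isCyc z

  onColours-fixed : ∀ f φ → onColours f (fixedC φ) ≡ fixedC φ
  onColours-fixed f φ = cong Sum.[ fixedC , cyc ∘ f ] (Fin.splitAt-↑ˡ (m * 2) φ p)

  onColours-cyc : ∀ f z → onColours f (cyc z) ≡ cyc (f z)
  onColours-cyc f z = cong Sum.[ fixedC , cyc ∘ f ] (Fin.splitAt-↑ʳ (m * 2) p z)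

  cyc-injective : ∀ {z z′} → cyc z ≡ cyc z′ → z ≡ z′
  cyc-injective {z} {z′} = Fin.↑ʳ-injective (m * 2) z z′

  fixedC-injective : ∀ {φ φ′} → fixedC φ ≡ fixedC φ′ → φ ≡ φ′
  fixedC-injective {φ} {φ′} = Fin.↑ˡ-injective p φ φ′

  fixed≢cyc : ∀ {φ z} → fixedC φ ≢ cyc z
  fixed≢cyc {φ} {z} eq = inj₁≢inj₂ (trans (sym (Fin.splitAt-↑ˡ (m * 2) φ p)) (trans (cong (splitAt (m * 2)) eq) (Fin.splitAt-↑ʳ (m * 2) p z)))
    where
    inj₁≢inj₂ : inj₁ φ ≢ inj₂ z
    inj₁≢inj₂ ()

  onColours-injective : ∀ f → (∀ {x y} → f x ≡ f y → x ≡ y) → ∀ {c c′} → onColours f c ≡ onColours f c′ → c ≡ c′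
  onColours-injective f inj {c} {c′} eq = go (colour c) (colour c′) eq
    where
    go : ∀ {c c′} → Colour c → Colour c′ → onColours f c ≡ onColours f c′ → c ≡ c′
    go (isFixed φ) (isFixed φ′) eq = trans (sym (onColours-fixed f φ)) (trans eq (onColours-fixed f φ′))
    go (isFixed φ) (isCyc z)    eq = contradiction (trans (sym (onColours-fixed f φ)) (trans eq (onColours-cyc f z))) fixed≢cyc
    go (isCyc z)   (isFixed φ)  eq = contradiction (trans (sym (onColours-fixed f φ)) (trans (sym eq) (onColours-cyc f z))) fixed≢cyc
    go (isCyc z)   (isCyc z′)   eq = cong cyc (inj (cyc-injective (trans (sym (onColours-cyc f z)) (trans eq (onColours-cyc f z′)))))

  onColours-∘ : ∀ {f g h : Fin p → Fin p} → (∀ z → f z ≡ g (h z)) → ∀ c → onColours f c ≡ onColours g (onColours h c)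
  onColours-∘ {f} {g} {h} eq c = go (colour c)
    where
    go : ∀ {c} → Colour c → onColours f c ≡ onColours g (onColours h c)
    go (isFixed φ) = trans (onColours-fixed f φ) (sym (trans (cong (onColours g) (onColours-fixed h φ)) (onColours-fixed g φ)))
    go (isCyc z)   = trans (onColours-cyc f z) (trans (cong cyc (eq z)) (sym (trans (cong (onColours g) (onColours-cyc h z)) (onColours-cyc g (h z)))))

  onColours-id : ∀ {f : Fin p → Fin p} → (∀ z → f z ≡ z) → ∀ c → onColours f c ≡ c
  onColours-id {f} eq c = go (colour c)
    where
    go : ∀ {c} → Colour c → onColours f c ≡ c
    go (isFixed φ) = onColours-fixed f φ
    go (isCyc z)   = trans (onColours-cyc f z) (cong cyc (eq z))

  spin : ℕ → C → C
  spin l = onColours (rot p l)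

  spin-injective : ∀ l {c c′} → spin l c ≡ spin l c′ → c ≡ c′
  spin-injective l = onColours-injective (rot p l) (rot-injective p l)

  onSides : (Fin 2 → Fin p → Fin p) → VP → VP
  onSides f (a , x) = a , f a x

  onSides-injective : ∀ {f} → (∀ a {x y} → f a x ≡ f a y → x ≡ y) → ∀ {u v} → onSides f u ≡ onSides f v → u ≡ v
  onSides-injective {f} inj {a , x} {b , y} eq with cong proj₁ eq
  ... | refl = cong (a ,_) (inj a (cong proj₂ eq))

  turns : (Fin 2 → ℕ) → VP → VP
  turns f = onSides (λ a → rot p (f a))

  turns-injective : ∀ f {u v} → turns f u ≡ turns f v → u ≡ v
  turns-injective f = onSides-injective (λ a → rot-injective p (f a))

  colAct : (Fin 2 → ℕ) → ℕ → ColVec → ColVec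
  colAct f l = recolour (turns f) (spin l)

  col-colAct : ∀ f l c {u v} → u ≢ v → col (colAct f l c) u v ≡ spin l (col c (turns f u) (turns f v))
  col-colAct f l c = col-recolour (turns f) (spin l) c (turns-injective f)

  Gr : Set
  Gr = Fin p × Fin p × Fin p

  Gr-enum : Enumeration Gr
  Gr-enum = finEnum p ×-enum (finEnum p ×-enum finEnum p)

  sides : Gr → Fin 2 → ℕ
  sides (i , j , l) zero       = toℕ i
  sides (i , j , l) (suc zero) = toℕ j

  act : Gr → ColVec → ColVec
  act g = colAct (sides g) (toℕ (proj₂ (proj₂ g)))

  private
    infixl 6 _⊞_
    _⊞_ : Fin p → Fin p → Fin p
    i ⊞ j = rot p (toℕ j) i

    rot-⊞ : ∀ i j x → rot p (toℕ (i ⊞ j)) x ≡ rot p (toℕ j) (rot p (toℕ i) x)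
    rot-⊞ i j x = trans (rot-cong p (mod-trans (val-rot p (toℕ j) i) (≡⇒mod (sym (pos-⊕ (toℕ j) (toℕ i))))) x) (rot-+ p (toℕ j) (toℕ i) x)

    rot-comm : ∀ a b x → rot p a (rot p b x) ≡ rot p b (rot p a x)
    rot-comm a b x = trans (sym (rot-+ p a b x)) (trans (cong (λ z → rot p z x) (ℕ.+-comm a b)) (rot-+ p b a x))

    _∙_ : Gr → Gr → Gr
    (i , j , l) ∙ (i′ , j′ , l′) = i ⊞ i′ , j ⊞ j′ , l ⊞ l′

    turns-∙ : ∀ g h u → turns (sides (g ∙ h)) u ≡ turns (sides h) (turns (sides g) u)
    turns-∙ (i , j , l) (i′ , j′ , l′) (zero , x)     = cong (zero ,_) (rot-⊞ i i′ x)
    turns-∙ (i , j , l) (i′ , j′ , l′) (suc zero , x) = cong (suc zero ,_) (rot-⊞ j j′ x)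

    act-∙ : ∀ g h c → act (g ∙ h) c ≡ act g (act h c)
    act-∙ g@(i , j , l) h@(i′ , j′ , l′) c = col-ext (λ {u} {v} ne → trans (col-colAct (sides (g ∙ h)) (toℕ (l ⊞ l′)) c ne)
      (trans (onColours-∘ (λ z → trans (rot-⊞ l l′ z) (rot-comm (toℕ l′) (toℕ l) z)) _)
        (trans (cong₂ (λ x y → spin (toℕ l) (spin (toℕ l′) (col c x y))) (turns-∙ g h u) (turns-∙ g h v))
          (sym (trans (col-colAct (sides g) (toℕ l) (act h c) ne) (cong (spin (toℕ l)) (col-colAct (sides h) (toℕ l′) c (ne ∘ turns-injective (sides g)))))))))

    e₁ : Gr
    e₁ = 0′ p , 0′ p , 0′ p

    act-zero : ∀ g → (∀ a → + sides g a ≡ 0ℤ ⟨mod + p ⟩) → + toℕ (proj₂ (proj₂ g)) ≡ 0ℤ ⟨mod + p ⟩ → ∀ c → act g c ≡ c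
    act-zero g z zl c = col-ext (λ {u} {v} ne → trans (col-colAct (sides g) _ c ne)
      (trans (onColours-id (rot-0 p zl) _) (cong₂ (col c) (still u) (still v))))
      where
      still : ∀ u → turns (sides g) u ≡ u
      still (a , x) = cong (a ,_) (rot-0 p (z a) x)

    sides-mod : ∀ (g : Gr) → (∀ x → (x ≡ proj₁ g ⊎ x ≡ proj₁ (proj₂ g)) → val p x ≡ 0ℤ ⟨mod + p ⟩) → ∀ a → + sides g a ≡ 0ℤ ⟨mod + p ⟩
    sides-mod g z zero       = z _ (inj₁ refl)
    sides-mod g z (suc zero) = z _ (inj₂ refl)

    opp : Fin p → Fin p
    opp i = residue p (neg p (toℕ i))

    opp-mod : ∀ i → val p (opp i ⊞ i) ≡ 0ℤ ⟨mod + p ⟩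
    opp-mod i = mod-trans (val-rot p (toℕ i) (opp i)) (mod-trans (mod-⊕ mod-refl (mod-trans (val-residue p (neg p (toℕ i))) (val-neg p (toℕ i)))) (≡⇒mod (⊝-inverseʳ _)))

    inverse : ∀ g → ∃ λ h → ∀ c → act h (act g c) ≡ c
    inverse g@(i , j , l) = h , λ c → trans (sym (act-∙ h g c)) (act-zero (h ∙ g) (sides-mod (h ∙ g) (λ { _ (inj₁ refl) → opp-mod i ; _ (inj₂ refl) → opp-mod j })) (opp-mod l) c)
      where h = opp i , opp j , opp l

    cancelʳ : ∀ {g g′} h → g ∙ h ≡ g′ ∙ h → g ≡ g′
    cancelʳ {i , j , l} {i′ , j′ , l′} (a , b , c) eq = cong₂ _,_ (rot-injective p (toℕ a) (cong proj₁ eq))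
      (cong₂ _,_ (rot-injective p (toℕ b) (cong (proj₁ ∘ proj₂) eq)) (rot-injective p (toℕ c) (cong (proj₂ ∘ proj₂) eq)))

  ColVec-enum : Enumeration ColVec
  ColVec-enum = vecEnum (finEnum k) (length (edgeList (K n)))

  colourings : List ColVec
  colourings = Enumeration.list ColVec-enum

  _≟ᶜ_ : DecidableEquality ColVec
  _≟ᶜ_ = Enumeration._≟_ ColVec-enum

  A : ℤ
  A = ∑ colourings D′

  fixedCount : Gr → ℤ
  fixedCount g = ∑ colourings (λ c → ⟦ act g c ≟ᶜ c ⟧ · D′ c)

  length-Gr : length (Enumeration.list Gr-enum) ≡ p * (p * p)
  length-Gr = trans (length-× (allFin p) _) (cong₂ _*_ (List.length-tabulate {n = p} id) (trans (length-× (allFin p) (allFin p)) (cong₂ _*_ (List.length-tabulate {n = p} id) (List.length-tabulate {n = p} id))))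

  ∑-fixedCount : ∑ (Enumeration.list Gr-enum) fixedCount ≡ 0ℤ ⟨mod + (p * (p * p)) ⟩
  ∑-fixedCount =
    let z₀ = ≡⇒mod (val-0′ p)
        r , eq = Burnside.burnside ColVec-enum Gr-enum _∙_ act act-∙ cancelʳ e₁ (act-zero e₁ (sides-mod e₁ (λ { _ (inj₁ refl) → z₀ ; _ (inj₂ refl) → z₀ })) z₀) inverse D′
                   (λ g c → D′-recolour (turns-injective (sides g)) (spin-injective (toℕ (proj₂ (proj₂ g)))) c)
    in by r (trans eq (trans (cong (λ z → r · + z) length-Gr) (sym (⊕-identityˡ _))))

  private
    col-sym : ∀ c {u v} → u ≢ v → col c u v ≡ col c v u
    col-sym c ne = cong (Vec.lookup c) (ed-sym ne)

    module _ {c : ColVec} (pr : ProperVec c) where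

      clash : ∀ {u v w} → u ≢ v → u ≢ w → v ≢ w → col c u v ≢ col c u w
      clash u≢v u≢w v≢w = pr _ _ (adjacent n (ed-view u≢v) (ed-view u≢w) (v≢w ∘ vtx-injective) (u≢v ∘ vtx-injective))

      with-colour : ∀ u φ → ∃ λ w → u ≢ w × col c u w ≡ φ
      with-colour u φ =
        let o , _ , eq = ∈.∈-map⁻ (χ c u) (↭.∈-resp-↭ (↭-sym (full⇒↭ (finEnum k) (proper⇒unique c pr u)
                           (ℕ.≤-reflexive (trans (List.length-tabulate id) (sym (length-row c u)))))) (∈.∈-allFin φ))
        in u ▷ o , ▷-≢ u o , sym eq

      module _ (f : Fin 2 → ℕ) (l : ℕ) (fix : colAct f l c ≡ c) where

        fix-col : ∀ {u v} → u ≢ v → spin l (col c (turns f u) (turns f v)) ≡ col c u v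
        fix-col {u} {v} ne = trans (sym (col-colAct f l c ne)) (cong (λ c → col c u v) fix)

        double : ∀ a → + (a + a) ≡ 0ℤ ⟨mod + p ⟩ → + a ≡ 0ℤ ⟨mod + p ⟩
        double a eq = Sum.[ (λ two → contradiction two (small-mod (s≤s z≤n) (subst (2 <_) (sym p≡) (s≤s (ℕ.*-monoˡ-≤ 2 m>0))))) , id ]
          (mod-euclid prime (mod-trans (≡⇒mod (trans (sym (pos-· 2 a)) (cong (λ z → + (a + z)) (ℕ.+-identityʳ a)))) eq))

        rotated : ∀ a x → ¬ (+ f a ≡ 0ℤ ⟨mod + p ⟩) → (a , x) ≢ turns f (a , x)
        rotated a x nz eq = nz (rot-fixed p (f a) (sym (cong proj₂ eq)))

        -- With the colours at rest, the edges from u to u + f a and from there to u + 2 f a have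
        -- the same colour at their common end. They are different edges because p is odd.
        no-turn : + l ≡ 0ℤ ⟨mod + p ⟩ → ∀ a → + f a ≡ 0ℤ ⟨mod + p ⟩
        no-turn lz a = by-cases (p ℕ∣.∣? f a)
          where
          u v w : VP
          u = a , 0′ p
          v = turns f u
          w = turns f v
          by-cases : Dec (p ∣ f a) → + f a ≡ 0ℤ ⟨mod + p ⟩
          by-cases (yes d) = ∣⇒mod d
          by-cases (no nd) = contradiction (trans (trans (sym (onColours-id (rot-0 p lz) (col c v w))) (fix-col u≢v)) (col-sym c u≢v))
              (clash v≢w (u≢v ∘ sym) (λ w≡u → nz (double (f a) (rot-fixed p (f a + f a) (trans (rot-+ p (f a) (f a) (0′ p)) (cong proj₂ w≡u))))))
            where
            nz : ¬ (+ f a ≡ 0ℤ ⟨mod + p ⟩)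
            nz = nd ∘ mod⇒∣
            u≢v : u ≢ v
            u≢v = rotated a (0′ p) nz
            v≢w : v ≢ w
            v≢w = rotated a _ nz

        -- With the vertices at rest, an edge of cyclic colour stays in place while its colour
        -- advances by l.
        some-turn : (∀ a → + f a ≡ 0ℤ ⟨mod + p ⟩) → + l ≡ 0ℤ ⟨mod + p ⟩
        some-turn z =
          let u = zero , 0′ p
              w , ne , eq = with-colour u (cyc (0′ p))
              still : ∀ v → turns f v ≡ v
              still (a , x) = cong (a ,_) (rot-0 p (z a) x)
              spun = trans (cong (spin l) (trans (sym eq) (sym (cong₂ (col c) (still u) (still w))))) (trans (fix-col ne) eq)
          in rot-fixed p l (cyc-injective (trans (sym (onColours-cyc (rot p l) (0′ p))) spun))

        fixed-iterate : ∀ φ t {u v} → u ≢ v → col c u v ≡ fixedC φ → col c (turns (λ a → t * f a) u) (turns (λ a → t * f a) v) ≡ fixedC φ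
        fixed-iterate φ zero    {u} {v} ne eq = trans (cong₂ (col c) (still u) (still v)) eq
          where
          still : ∀ v → turns (λ a → 0) v ≡ v
          still (a , x) = cong (a ,_) (rot-0 p (≡⇒mod refl) x)
        fixed-iterate φ (suc t) {u} {v} ne eq = trans (cong₂ (col c) (step u) (step v))
          (spin-injective l (trans (fix-col (ne ∘ turns-injective (λ a → t * f a))) (trans (fixed-iterate φ t ne eq) (sym (onColours-fixed (rot p l) φ)))))
          where
          step : ∀ v → turns (λ a → suc t * f a) v ≡ turns f (turns (λ a → t * f a) v)
          step (a , x) = cong (a ,_) (rot-+ p (f a) (t * f a) x)

        -- Take the edge of a fixed colour at the vertex 0 of half a. If it crosses, its far end w
        -- is at rest while 0 moves, so w sees this colour twice. If it stays in the half, a power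
        -- of the rotation takes 0 to w and w to a third vertex, with the same effect.
        both-turn : ∀ a → (∀ b → b ≢ a → + f b ≡ 0ℤ ⟨mod + p ⟩) → + f a ≡ 0ℤ ⟨mod + p ⟩
        both-turn a other = by-cases (p ℕ∣.∣? f a)
          where
          φ : Fin (m * 2)
          φ = fromℕ< (ℕ.*-mono-≤ m>0 (s≤s {n = 1} z≤n))
          u = a , 0′ p
          by-cases : Dec (p ∣ f a) → + f a ≡ 0ℤ ⟨mod + p ⟩
          by-cases (yes d) = ∣⇒mod d
          by-cases (no nd) = let w , ne , eq = with-colour u (fixedC φ) in contradiction refl (at w ne eq (proj₁ w Fin.≟ a))
            where
            nz : ¬ (+ f a ≡ 0ℤ ⟨mod + p ⟩)
            nz = nd ∘ mod⇒∣
            at : ∀ w → u ≢ w → col c u w ≡ fixedC φ → Dec (proj₁ w ≡ a) → _≢_ {A = ℕ} 0 0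
            at w@(b , y) ne eq (no b≢a) = contradiction
              (trans (sym (col-sym c ne)) (trans eq (sym (trans (sym (col-sym c σu≢w)) moved))))
              (clash (ne ∘ sym) (σu≢w ∘ sym) (rotated a (0′ p) nz))
              where
              σu≢w : turns f u ≢ w
              σu≢w e = b≢a (sym (cong proj₁ e))
              still : turns f w ≡ w
              still = cong (b ,_) (rot-0 p (other b b≢a) y)
              moved : col c (turns f u) w ≡ fixedC φ
              moved = spin-injective l (trans (cong (λ w → spin l (col c (turns f u) w)) (sym still)) (trans (fix-col ne) (trans eq (sym (onColours-fixed (rot p l) φ)))))
            at (b , y) ne eq (yes refl) = contradiction
              (trans (trans (sym (col-sym c ne)) eq) (sym (trans (cong (λ v → col c v w′) (sym hop)) (fixed-iterate φ t ne eq))))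
              (clash (ne ∘ sym) w≢w′ u≢w′)
              where
              w : VP
              w = a , y
              i′ = proj₁ (mod-inverse p prime nz)
              -- This many rotations by f a carry the vertex 0 of the half to y.
              t = toℕ y * i′
              g : Fin 2 → ℕ
              g = λ a → t * f a
              w′ = turns g w
              tf : + (t * f a) ≡ + toℕ y ⟨mod + p ⟩
              tf = mod-trans (≡⇒mod (trans (cong +_ (ℕ.*-assoc (toℕ y) i′ (f a))) (pos-· (toℕ y) (i′ * f a))))
                     (mod-trans (mod-· mod-refl (proj₂ (mod-inverse p prime nz))) (≡⇒mod (·-identityʳ _)))
              hop : turns g u ≡ w
              hop = cong (a ,_) (trans (rot-cong p tf (0′ p)) (rot-toℕ-0′ p y))
              y≢0 : ¬ (+ toℕ y ≡ 0ℤ ⟨mod + p ⟩)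
              y≢0 z = ne (cong (a ,_) (val-injective p (mod-trans (≡⇒mod (val-0′ p)) (mod-sym z))))
              w≢w′ : w ≢ w′
              w≢w′ e = y≢0 (mod-trans (mod-sym tf) (rot-fixed p (t * f a) (sym (cong proj₂ e))))
              u≢w′ : u ≢ w′
              u≢w′ e = y≢0 (double (toℕ y) (mod-trans (≡⇒mod (pos-⊕ (toℕ y) (toℕ y))) (mod-trans (mod-⊕ (mod-sym tf) mod-refl)
                (mod-trans (mod-sym (val-rot p (t * f a) y)) (≡⇒mod (trans (cong (val p) (sym (cong proj₂ e))) (val-0′ p)))))))

  private
    units : Fin p → Fin p → Fin p → Set
    units i j l = i ≢ 0′ p × j ≢ 0′ p × l ≢ 0′ p

    val≡0 : ∀ {x} → x ≡ 0′ p → val p x ≡ 0ℤ ⟨mod + p ⟩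
    val≡0 refl = ≡⇒mod (val-0′ p)

    ≡0′ : ∀ {x} → val p x ≡ 0ℤ ⟨mod + p ⟩ → x ≡ 0′ p
    ≡0′ eq = val-injective p (mod-trans eq (≡⇒mod (sym (val-0′ p))))

    -- If one of the three coordinates vanishes on a proper fixed colouring, all do.
    all-or-none : ∀ i j l c → ProperVec c → act (i , j , l) c ≡ c → (i ≡ 0′ p ⊎ j ≡ 0′ p ⊎ l ≡ 0′ p) → i ≡ 0′ p × j ≡ 0′ p × l ≡ 0′ p
    all-or-none i j l c pr fix = Sum.[ from-i , Sum.[ from-j , from-l ] ]
      where
      f = sides (i , j , l)
      conclude : (∀ a → + f a ≡ 0ℤ ⟨mod + p ⟩) → i ≡ 0′ p × j ≡ 0′ p × l ≡ 0′ p
      conclude z = ≡0′ (z zero) , ≡0′ (z (suc zero)) , ≡0′ (some-turn pr f (toℕ l) fix z)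
      from-l : l ≡ 0′ p → _
      from-l l0 = conclude (no-turn pr f (toℕ l) fix (val≡0 l0))
      from-i : i ≡ 0′ p → _
      from-i i0 = conclude λ { zero → val≡0 i0 ; (suc zero) → both-turn pr f (toℕ l) fix (suc zero) (λ { zero _ → val≡0 i0 ; (suc zero) ne → contradiction refl ne }) }
      from-j : j ≡ 0′ p → _
      from-j j0 = conclude λ { (suc zero) → val≡0 j0 ; zero → both-turn pr f (toℕ l) fix zero (λ { (suc zero) _ → val≡0 j0 ; zero ne → contradiction refl ne }) }

  g₁ : Gr
  g₁ = residue p 1 , residue p 1 , residue p 1

  private
    mixed-count : ∀ i j l → (i ≡ 0′ p ⊎ j ≡ 0′ p ⊎ l ≡ 0′ p) → ¬ (i ≡ 0′ p × j ≡ 0′ p × l ≡ 0′ p) → fixedCount (i , j , l) ≡ 0ℤ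
    mixed-count i j l some notall = ∑-zero colourings (λ {c} _ → term c (act (i , j , l) c ≟ᶜ c) (D′ c ℤ.≟ 0ℤ))
      where
      term : ∀ c → Dec (act (i , j , l) c ≡ c) → Dec (D′ c ≡ 0ℤ) → ⟦ act (i , j , l) c ≟ᶜ c ⟧ · D′ c ≡ 0ℤ
      term c (no ne)   _       = trans (cong (_· D′ c) (⟦⟧-no (act (i , j , l) c ≟ᶜ c) ne)) (·-zeroˡ _)
      term c _         (yes z) = trans (cong (⟦ act (i , j , l) c ≟ᶜ c ⟧ ·_) z) (·-zeroʳ _)
      term c (yes fix) (no nz) = contradiction (all-or-none i j l c (D′≢0⇒proper c nz) fix some) notall

    zero-count : fixedCount (0′ p , 0′ p , 0′ p) ≡ A
    zero-count = ∑-cong colourings (λ c → trans (cong (_· D′ c) (⟦⟧-yes (act e₁ c ≟ᶜ c) (act-zero e₁ (sides-mod e₁ (λ { _ (inj₁ refl) → val≡0 refl ; _ (inj₂ refl) → val≡0 refl })) (val≡0 refl) c))) (·-identityˡ _))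

    -- Multiplying each half by its own rotation amount and the cyclic colours by the inverse of l
    -- turns colourings fixed by (i , j , l) into colourings fixed by `g₁`, and as a relabelling of
    -- vertices and colours it preserves the sign.
    unit-count : ∀ i j l → units i j l → fixedCount (i , j , l) ≡ fixedCount g₁
    unit-count i j l (i≢0 , j≢0 , l≢0) = sym (trans (∑-↭ _ (↭-sym (map-injective-↭ ColVec-enum h-injective))) (trans (∑-map h colourings _)
      (∑-cong colourings (λ c → cong₂ _·_ (⟦⟧-cong (act g₁ (h c) ≟ᶜ h c) (act g c ≟ᶜ c) (backward c) (forward c)) (D′-recolour μ-injective λ′-injective c)))))
      where
      g = i , j , l
      f = sides g
      f≢0 : ∀ a → ¬ (+ f a ≡ 0ℤ ⟨mod + p ⟩)
      f≢0 zero       = i≢0 ∘ ≡0′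
      f≢0 (suc zero) = j≢0 ∘ ≡0′
      l-inv = mod-inverse p prime (l≢0 ∘ ≡0′)
      l′ = proj₁ l-inv
      l′≢0 : ¬ (+ l′ ≡ 0ℤ ⟨mod + p ⟩)
      l′≢0 z = small-mod (s≤s z≤n) (ℕ.nonTrivial⇒n>1 p {{Prime.prime⇒nonTrivial prime}}) (mod-trans (mod-sym (proj₂ l-inv)) (mod-trans (≡⇒mod (pos-· l′ (toℕ l))) (mod-trans (mod-· z mod-refl) (≡⇒mod (·-zeroˡ _)))))
      μ : VP → VP
      μ = onSides (λ a → mul p (f a))
      μ-injective : ∀ {u v} → μ u ≡ μ v → u ≡ v
      μ-injective = onSides-injective (λ a → mul-injective p prime (f≢0 a))
      λ′ : C → C
      λ′ = onColours (mul p l′)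
      λ′-injective : ∀ {c c′} → λ′ c ≡ λ′ c′ → c ≡ c′
      λ′-injective = onColours-injective (mul p l′) (mul-injective p prime l′≢0)
      h : ColVec → ColVec
      h = recolour μ λ′
      col-h : ∀ c {u v} → u ≢ v → col (h c) u v ≡ λ′ (col c (μ u) (μ v))
      col-h c = col-recolour μ λ′ c μ-injective
      sides-1 : ∀ a → + sides g₁ a ≡ + 1 ⟨mod + p ⟩
      sides-1 zero       = val-residue p 1
      sides-1 (suc zero) = val-residue p 1
      μ-turn : ∀ u → μ (turns (sides g₁) u) ≡ turns f (μ u)
      μ-turn (a , x) = cong (a ,_) (trans (cong (mul p (f a)) (rot-cong p (sides-1 a) x)) (trans (mul-rot p (f a) 1 x) (cong (λ z → rot p z (mul p (f a) x)) (ℕ.*-identityʳ (f a)))))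
      λ′-spin : ∀ c → spin (toℕ (residue p 1)) (λ′ c) ≡ λ′ (spin (toℕ l) c)
      λ′-spin c = trans (sym (onColours-∘ (λ z → refl) c)) (onColours-∘ (λ z → sym (trans (mul-rot p l′ (toℕ l) z)
        (rot-cong p (mod-trans (proj₂ l-inv) (mod-sym (val-residue p 1))) (mul p l′ z)))) c)
      col-act-h : ∀ c {u v} → u ≢ v → col (act g₁ (h c)) u v ≡ λ′ (spin (toℕ l) (col c (turns f (μ u)) (turns f (μ v))))
      col-act-h c {u} {v} ne = trans (col-colAct (sides g₁) (toℕ (residue p 1)) (h c) ne) (trans (cong (spin (toℕ (residue p 1))) (col-h c (ne ∘ turns-injective (sides g₁))))
        (trans (λ′-spin _) (cong₂ (λ x y → λ′ (spin (toℕ l) (col c x y))) (μ-turn u) (μ-turn v))))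
      forward : ∀ c → act g c ≡ c → act g₁ (h c) ≡ h c
      forward c fix = col-ext (λ {u} {v} ne → trans (col-act-h c ne) (trans
        (cong λ′ (trans (sym (col-colAct f (toℕ l) c (ne ∘ μ-injective))) (cong (λ c → col c (μ u) (μ v)) fix))) (sym (col-h c ne))))
      through-μ : ∀ {c c′} → (∀ {u v} → u ≢ v → col c (μ u) (μ v) ≡ col c′ (μ u) (μ v)) → c ≡ c′
      through-μ {c} {c′} eq = col-ext (λ {u} {v} ne →
        let u′ , u≡ = injective⇒surjective VP-enum μ-injective u
            v′ , v≡ = injective⇒surjective VP-enum μ-injective v
        in trans (sym (cong₂ (col c) u≡ v≡)) (trans (eq (λ e → ne (trans (sym u≡) (trans (cong μ e) v≡)))) (cong₂ (col c′) u≡ v≡)))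
      backward : ∀ c → act g₁ (h c) ≡ h c → act g c ≡ c
      backward c fix = through-μ (λ {u} {v} ne → trans (col-colAct f (toℕ l) c (ne ∘ μ-injective))
        (λ′-injective (trans (sym (col-act-h c ne)) (trans (cong (λ c → col c u v) fix) (col-h c ne)))))
      h-injective : ∀ {c c′} → h c ≡ h c′ → c ≡ c′
      h-injective {c} {c′} eq = through-μ (λ {u} {v} ne → λ′-injective (trans (sym (col-h c ne)) (trans (cong (λ c → col c u v) eq) (col-h c′ ne))))

    z nz : Fin p → ℤ
    z i = ⟦ i Fin.≟ 0′ p ⟧
    nz i = 1ℤ ⊕ ⊝ 1ℤ · z i

    z-yes : ∀ {i} → i ≡ 0′ p → z i ≡ 1ℤ
    z-yes {i} = ⟦⟧-yes (i Fin.≟ 0′ p)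

    z-no : ∀ {i} → i ≢ 0′ p → z i ≡ 0ℤ
    z-no {i} = ⟦⟧-no (i Fin.≟ 0′ p)

    nz-yes : ∀ {i} → i ≡ 0′ p → nz i ≡ 0ℤ
    nz-yes eq = trans (cong (λ a → 1ℤ ⊕ ⊝ 1ℤ · a) (z-yes eq)) (solve 0 (con 1ℤ :+ :- con 1ℤ :* con 1ℤ := con 0ℤ) refl)

    nz-no : ∀ {i} → i ≢ 0′ p → nz i ≡ 1ℤ
    nz-no ne = trans (cong (λ a → 1ℤ ⊕ ⊝ 1ℤ · a) (z-no ne)) (solve 0 (con 1ℤ :+ :- con 1ℤ :* con 0ℤ := con 1ℤ) refl)

    N₁ = fixedCount g₁

    combined : (Fin p → ℤ) → (Fin p → ℤ) → (Fin p → ℤ) → ℤ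
    combined a b c = ∑ (allFin p) (λ i → ∑ (allFin p) (λ j → ∑ (allFin p) (λ l → a i · (b j · c l))))

    combined≡ : ∀ a b c → combined a b c ≡ ∑ (allFin p) a · (∑ (allFin p) b · ∑ (allFin p) c)
    combined≡ a b c = trans (∑-cong (allFin p) (λ i → trans (∑-cong (allFin p) (λ j → trans (∑-*ˡ (allFin p) (a i) _) (cong (a i ·_) (∑-*ˡ (allFin p) (b j) c))))
      (trans (∑-*ˡ (allFin p) (a i) _) (cong (a i ·_) (∑-*ʳ (allFin p) _ b))))) (∑-*ʳ (allFin p) _ a)

    -- In this form, as a combination of products of indicators, the triple sum over the group
    -- factors into single sums.
    count-formula : ∀ i j l → fixedCount (i , j , l) ≡ z i · (z j · (z l · A)) ⊕ nz i · (nz j · (nz l · N₁))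
    count-formula i j l = by-cases (i Fin.≟ 0′ p) (j Fin.≟ 0′ p) (l Fin.≟ 0′ p)
      where
      rhs : ∀ {a b c a′ b′ c′} → z i ≡ a → z j ≡ b → z l ≡ c → nz i ≡ a′ → nz j ≡ b′ → nz l ≡ c′ →
            z i · (z j · (z l · A)) ⊕ nz i · (nz j · (nz l · N₁)) ≡ a · (b · (c · A)) ⊕ a′ · (b′ · (c′ · N₁))
      rhs ea eb ec ea′ eb′ ec′ = cong₂ _⊕_ (cong₂ _·_ ea (cong₂ _·_ eb (cong (_· A) ec))) (cong₂ _·_ ea′ (cong₂ _·_ eb′ (cong (_· N₁) ec′)))
      by-cases : Dec (i ≡ 0′ p) → Dec (j ≡ 0′ p) → Dec (l ≡ 0′ p) → fixedCount (i , j , l) ≡ z i · (z j · (z l · A)) ⊕ nz i · (nz j · (nz l · N₁))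
      by-cases (yes refl) (yes refl) (yes refl) = trans zero-count (sym (trans (rhs (z-yes refl) (z-yes refl) (z-yes refl) (nz-yes refl) (nz-yes refl) (nz-yes refl))
        (solve 2 (λ a n → con 1ℤ :* (con 1ℤ :* (con 1ℤ :* a)) :+ con 0ℤ :* (con 0ℤ :* (con 0ℤ :* n)) := a) refl A N₁)))
      by-cases (no a) (no b) (no c) = trans (unit-count i j l (a , b , c)) (sym (trans (rhs (z-no a) (z-no b) (z-no c) (nz-no a) (nz-no b) (nz-no c))
        (solve 2 (λ a n → con 0ℤ :* (con 0ℤ :* (con 0ℤ :* a)) :+ con 1ℤ :* (con 1ℤ :* (con 1ℤ :* n)) := n) refl A N₁)))
      by-cases (yes a) (yes b) (no c) = trans (mixed-count i j l (inj₁ a) (λ (_ , _ , e) → c e)) (sym (trans (rhs (z-yes a) (z-yes b) (z-no c) (nz-yes a) (nz-yes b) (nz-no c))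
        (solve 2 (λ a n → con 1ℤ :* (con 1ℤ :* (con 0ℤ :* a)) :+ con 0ℤ :* (con 0ℤ :* (con 1ℤ :* n)) := con 0ℤ) refl A N₁)))
      by-cases (yes a) (no b) (yes c) = trans (mixed-count i j l (inj₁ a) (λ (_ , e , _) → b e)) (sym (trans (rhs (z-yes a) (z-no b) (z-yes c) (nz-yes a) (nz-no b) (nz-yes c))
        (solve 2 (λ a n → con 1ℤ :* (con 0ℤ :* (con 1ℤ :* a)) :+ con 0ℤ :* (con 1ℤ :* (con 0ℤ :* n)) := con 0ℤ) refl A N₁)))
      by-cases (yes a) (no b) (no c) = trans (mixed-count i j l (inj₁ a) (λ (_ , e , _) → b e)) (sym (trans (rhs (z-yes a) (z-no b) (z-no c) (nz-yes a) (nz-no b) (nz-no c))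
        (solve 2 (λ a n → con 1ℤ :* (con 0ℤ :* (con 0ℤ :* a)) :+ con 0ℤ :* (con 1ℤ :* (con 1ℤ :* n)) := con 0ℤ) refl A N₁)))
      by-cases (no a) (yes b) (yes c) = trans (mixed-count i j l (inj₂ (inj₁ b)) (λ (e , _ , _) → a e)) (sym (trans (rhs (z-no a) (z-yes b) (z-yes c) (nz-no a) (nz-yes b) (nz-yes c))
        (solve 2 (λ a n → con 0ℤ :* (con 1ℤ :* (con 1ℤ :* a)) :+ con 1ℤ :* (con 0ℤ :* (con 0ℤ :* n)) := con 0ℤ) refl A N₁)))
      by-cases (no a) (yes b) (no c) = trans (mixed-count i j l (inj₂ (inj₁ b)) (λ (e , _ , _) → a e)) (sym (trans (rhs (z-no a) (z-yes b) (z-no c) (nz-no a) (nz-yes b) (nz-no c))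
        (solve 2 (λ a n → con 0ℤ :* (con 1ℤ :* (con 0ℤ :* a)) :+ con 1ℤ :* (con 0ℤ :* (con 1ℤ :* n)) := con 0ℤ) refl A N₁)))
      by-cases (no a) (no b) (yes c) = trans (mixed-count i j l (inj₂ (inj₂ c)) (λ (e , _ , _) → a e)) (sym (trans (rhs (z-no a) (z-no b) (z-yes c) (nz-no a) (nz-no b) (nz-yes c))
        (solve 2 (λ a n → con 0ℤ :* (con 0ℤ :* (con 1ℤ :* a)) :+ con 1ℤ :* (con 1ℤ :* (con 0ℤ :* n)) := con 0ℤ) refl A N₁)))

    ∑z : ∑ (allFin p) z ≡ 1ℤ
    ∑z = trans (∑-single {xs = allFin p} {0′ p} {z} (Unique.allFin⁺ p) (∈.∈-allFin (0′ p)) z-no) (z-yes refl)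

    ∑nz : ∑ (allFin p) nz ≡ + p ⊕ ⊝ 1ℤ
    ∑nz = trans (∑-+ (allFin p) (λ _ → 1ℤ) (λ i → ⊝ 1ℤ · z i)) (cong₂ _⊕_
      (trans (∑-const (allFin p) 1ℤ) (trans (·-identityʳ _) (cong +_ (List.length-tabulate {n = p} id))))
      (trans (∑-*ˡ (allFin p) (⊝ 1ℤ) z) (trans (cong (⊝ 1ℤ ·_) ∑z) (·-identityʳ _))))

  A-mod : A ⊕ (+ p ⊕ ⊝ 1ℤ) · ((+ p ⊕ ⊝ 1ℤ) · (+ p ⊕ ⊝ 1ℤ)) · fixedCount g₁ ≡ 0ℤ ⟨mod + (p * (p * p)) ⟩
  A-mod = mod-trans (≡⇒mod (sym (begin
    ∑ (Enumeration.list Gr-enum) fixedCount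
      ≡⟨ trans (∑-× (allFin p) _ fixedCount) (∑-cong (allFin p) (λ i → ∑-× (allFin p) (allFin p) (λ jl → fixedCount (i , jl)))) ⟩
    ∑ (allFin p) (λ i → ∑ (allFin p) (λ j → ∑ (allFin p) (λ l → fixedCount (i , j , l))))
      ≡⟨ ∑-cong (allFin p) (λ i → ∑-cong (allFin p) (λ j → trans (∑-cong (allFin p) (λ l → count-formula i j l)) (∑-+ (allFin p) _ _))) ⟩
    ∑ (allFin p) (λ i → ∑ (allFin p) (λ j → ∑ (allFin p) (λ l → z i · (z j · (z l · A))) ⊕ ∑ (allFin p) (λ l → nz i · (nz j · (nz l · N₁)))))
      ≡⟨ trans (∑-cong (allFin p) (λ i → ∑-+ (allFin p) _ _)) (∑-+ (allFin p) _ _) ⟩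
    combined z z (λ l → z l · A) ⊕ combined nz nz (λ l → nz l · N₁)
      ≡⟨ cong₂ _⊕_ (combined≡ z z (λ l → z l · A)) (combined≡ nz nz (λ l → nz l · N₁)) ⟩
    ∑ (allFin p) z · (∑ (allFin p) z · ∑ (allFin p) (λ l → z l · A)) ⊕ ∑ (allFin p) nz · (∑ (allFin p) nz · ∑ (allFin p) (λ l → nz l · N₁))
      ≡⟨ cong₂ _⊕_ (cong₂ _·_ ∑z (cong₂ _·_ ∑z (trans (∑-*ʳ (allFin p) A z) (cong (_· A) ∑z)))) (cong₂ _·_ ∑nz (cong₂ _·_ ∑nz (trans (∑-*ʳ (allFin p) N₁ nz) (cong (_· N₁) ∑nz)))) ⟩
    1ℤ · (1ℤ · (1ℤ · A)) ⊕ (+ p ⊕ ⊝ 1ℤ) · ((+ p ⊕ ⊝ 1ℤ) · ((+ p ⊕ ⊝ 1ℤ) · N₁))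
      ≡⟨ solve 3 (λ a q n → con 1ℤ :* (con 1ℤ :* (con 1ℤ :* a)) :+ q :* (q :* (q :* n)) := a :+ q :* (q :* q) :* n) refl A (+ p ⊕ ⊝ 1ℤ) N₁ ⟩
    A ⊕ (+ p ⊕ ⊝ 1ℤ) · ((+ p ⊕ ⊝ 1ℤ) · (+ p ⊕ ⊝ 1ℤ)) · N₁ ∎))) ∑-fixedCount
    where open ≡-Reasoning

-- A signed sum over vectors with exactly one entry of a special kind

module OneSpecial {C X Y : Set} (fx : X → C) (fy : Y → C) where

  place-at : ∀ {q p} → p ≡ suc q → Fin p → X → Vec Y q → Vec C p
  place-at refl y x β = Vec.insertAt (Vec.map fy β) y (fx x)

  pre post : ∀ {q p} → p ≡ suc q → Fin p → Vec Y q → List Y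
  pre  refl y β = List.take (toℕ y) (Vec.toList β)
  post refl y β = List.drop (toℕ y) (Vec.toList β)

  pre++post : ∀ {q p} (e : p ≡ suc q) y β → pre e y β ++ post e y β ≡ Vec.toList β
  pre++post refl y β = List.take++drop≡id (toℕ y) (Vec.toList β)

  toList-place : ∀ {q p} (e : p ≡ suc q) y x β → Vec.toList (place-at e y x β) ≡ map fy (pre e y β) ++ fx x ∷ map fy (post e y β)
  toList-place refl zero    x β       = cong (fx x ∷_) (Vec.toList-map fy β)
  toList-place refl (suc y) x (b ∷ β) = cong (fy b ∷_) (toList-place refl y x β)

  lookup-here : ∀ {q p} (e : p ≡ suc q) y x β → Vec.lookup (place-at e y x β) y ≡ fx x
  lookup-here refl y x β = Vec.insertAt-lookup (Vec.map fy β) y (fx x)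

  lookup-there : ∀ {q p} (e : p ≡ suc q) y β {y′} → y ≢ y′ → ∃ λ b → ∀ x → Vec.lookup (place-at e y x β) y′ ≡ fy b
  lookup-there refl y β {y′} ne = Vec.lookup β (Fin.punchOut ne) , λ x →
    trans (cong (Vec.lookup (Vec.insertAt (Vec.map fy β) y (fx x))) (sym (Fin.punchIn-punchOut ne)))
      (trans (Vec.insertAt-punchIn (Vec.map fy β) y (fx x) (Fin.punchOut ne)) (Vec.lookup-map (Fin.punchOut ne) fy β))

  from-lookup : ∀ {q p} (e : p ≡ suc q) y x (ζ : Vec C p) → Vec.lookup ζ y ≡ fx x →
                (∀ y′ → y ≢ y′ → ∃ λ b → Vec.lookup ζ y′ ≡ fy b) → ∃ λ β → place-at e y x β ≡ ζ
  from-lookup refl y x ζ at off = β , vec-ext λ y′ → by-cases y′ (y Fin.≟ y′)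
    where
    β = Vec.tabulate (λ i → proj₁ (off (Fin.punchIn y i) (Fin.punchInᵢ≢i y i ∘ sym)))
    by-cases : ∀ y′ → Dec (y ≡ y′) → Vec.lookup (place-at refl y x β) y′ ≡ Vec.lookup ζ y′
    by-cases y′ (yes refl) = trans (lookup-here refl y x β) (sym at)
    by-cases y′ (no ne)    = subst (λ i → Vec.lookup (place-at refl y x β) i ≡ Vec.lookup ζ i) (Fin.punchIn-punchOut ne)
      (trans (Vec.insertAt-punchIn (Vec.map fy β) y (fx x) i) (trans (Vec.lookup-map i fy β) (trans (cong fy (Vec.lookup∘tabulate _ i))
        (sym (proj₂ (off (Fin.punchIn y i) (Fin.punchInᵢ≢i y i ∘ sym)))))))
      where i = Fin.punchOut ne

  place-injective : (∀ {x x′} → fx x ≡ fx x′ → x ≡ x′) → (∀ {y y′} → fy y ≡ fy y′ → y ≡ y′) → (∀ {x y} → fy y ≢ fx x) →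
                    ∀ {q p} (e : p ≡ suc q) {y x β y′ x′ β′} → place-at e y x β ≡ place-at e y′ x′ β′ → y ≡ y′ × x ≡ x′ × β ≡ β′
  place-injective fx-inj fy-inj disjoint e {y} {x} {β} {y′} {x′} {β′} eq = by-cases (y Fin.≟ y′)
    where
    same : ∀ {q p} (e : p ≡ suc q) y {x x′ β β′} → place-at e y x β ≡ place-at e y x′ β′ → y ≡ y × x ≡ x′ × β ≡ β′
    same refl y {x} {x′} {β} {β′} eq = refl , fx-inj (trans (sym (lookup-here refl y x β)) (trans (cong (λ v → Vec.lookup v y) eq) (lookup-here refl y x′ β′))) ,
      vec-ext λ i → fy-inj (trans (sym (at i β x)) (trans (cong (λ v → Vec.lookup v (Fin.punchIn y i)) eq) (at i β′ x′)))
      where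
      at : ∀ i β x → Vec.lookup (place-at refl y x β) (Fin.punchIn y i) ≡ fy (Vec.lookup β i)
      at i β x = trans (Vec.insertAt-punchIn (Vec.map fy β) y (fx x) i) (Vec.lookup-map i fy β)
    by-cases : Dec (y ≡ y′) → y ≡ y′ × x ≡ x′ × β ≡ β′
    by-cases (yes refl) = same e y eq
    by-cases (no ne) = contradiction (trans (sym (proj₂ (lookup-there e y β ne) x)) (trans (cong (λ v → Vec.lookup v y′) eq) (lookup-here e y′ x′ β′))) disjoint

-- Colourings equivariant under all three rotations at once

module Equivariant (p m : ℕ) .{{_ : NonZero p}} (prime : Prime p) (p≡ : p ≡ suc (m * 2)) (m>0 : 0 < m) where
  open Orbits p m prime p≡ m>0 public
  open Starters p m prime p≡ using (positions; block; place; starters)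

  private
    ps = allFin p

    spin-+ : ∀ a b c → spin (a + b) c ≡ spin a (spin b c)
    spin-+ a b = onColours-∘ (rot-+ p a b)

    spin-cong : ∀ {a b} → + a ≡ + b ⟨mod + p ⟩ → ∀ c → spin a c ≡ spin b c
    spin-cong {a} {b} eq c = trans (onColours-∘ {h = id} (rot-cong p eq) c) (cong (spin b) (onColours-id (λ _ → refl) c))

    back : Fin p → ℕ
    back x = neg p (toℕ x)

    back-rot : ∀ a x → + back (rot p a x) ≡ + back x ⊕ ⊝ + a ⟨mod + p ⟩
    back-rot a x = mod-trans (val-neg p _) (mod-trans (mod-⊝ (val-rot p a x)) (mod-trans (≡⇒mod (solve 2 (λ a x → :- (a :+ x) := :- x :+ :- a) refl (+ a) (val p x)))
                     (mod-⊕ (mod-sym (val-neg p (toℕ x))) mod-refl)))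

    spin-back-neg : ∀ s x c → spin (back (rot p (neg p s) x)) c ≡ spin (back x) (spin s c)
    spin-back-neg s x c = trans (spin-cong (mod-trans (back-rot (neg p s) x) (mod-trans (mod-⊕ mod-refl (mod-⊝ (val-neg p s)))
      (≡⇒mod (trans (solve 2 (λ a b → a :+ :- (:- b) := a :+ b) refl (+ back x) (+ s)) (sym (pos-⊕ (back x) s)))))) c) (spin-+ (back x) s c)

    spin-back-rot : ∀ a x c → spin a (spin (back (rot p a x)) c) ≡ spin (back x) c
    spin-back-rot a x c = trans (sym (spin-+ a (back (rot p a x)) c)) (spin-cong (mod-trans (≡⇒mod (pos-⊕ a _)) (mod-trans (mod-⊕ mod-refl (back-rot a x))
      (≡⇒mod (solve 2 (λ a b → a :+ (b :+ :- a) := b) refl (+ a) (+ back x))))) c)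

    spin-0 : ∀ {a} → + a ≡ 0ℤ ⟨mod + p ⟩ → ∀ c → spin a c ≡ c
    spin-0 eq = onColours-id (rot-0 p eq)

  -- The colours of the edges {0 , d} in both halves and of the edges from 0 to y across.
  Γ : Set
  Γ = Vec C m × Vec C m × Vec C p

  Γ-enum : Enumeration Γ
  Γ-enum = vecEnum (finEnum k) m ×-enum (vecEnum (finEnum k) m ×-enum vecEnum (finEnum k) p)

  private
    inner : Γ → Fin 2 → Vec C m
    inner (γ₀ , γ₁ , ζ) zero       = γ₀
    inner (γ₀ , γ₁ , ζ) (suc zero) = γ₁

    cross : Γ → Vec C p
    cross (_ , _ , ζ) = ζ

    -- Equivariance determines everything from the edges at the two vertices 0: advancing an edge by
    -- x turns its colour by -x.
    paintBlock : Γ → Block → C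
    paintBlock γ (inj₁ (d , a , x)) = spin (back x) (Vec.lookup (inner γ a) d)
    paintBlock γ (inj₂ (y , x))     = spin (back x) (Vec.lookup (cross γ) y)

    extend : Γ → ColVec
    extend γ = Vec.tabulate (λ e → paintBlock γ (proj₁ (eb-surjective e)))

    extend-eb : ∀ γ b → Vec.lookup (extend γ) (eb b) ≡ paintBlock γ b
    extend-eb γ b = trans (Vec.lookup∘tabulate _ (eb b)) (cong (paintBlock γ) (eb-injective {proj₁ (eb-surjective (eb b))} {b} (proj₂ (eb-surjective (eb b)))))

    block-ext : ∀ {c c′ : ColVec} → (∀ b → Vec.lookup c (eb b) ≡ Vec.lookup c′ (eb b)) → c ≡ c′
    block-ext {c} {c′} eq = vec-ext (λ e → let b , b≡ = eb-surjective e in trans (cong (Vec.lookup c) (sym b≡)) (trans (eq b) (cong (Vec.lookup c′) b≡)))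

    shiftBlock : ℕ → Block → Block
    shiftBlock a (inj₁ (d , v)) = inj₁ (d , turn a v)
    shiftBlock a (inj₂ (y , x)) = inj₂ (y , rot p a x)

    turn₁ : ∀ u → turns (sides g₁) u ≡ turn 1 u
    turn₁ (zero , x)     = cong (zero ,_) (rot-cong p (val-residue p 1) x)
    turn₁ (suc zero , x) = cong (suc zero ,_) (rot-cong p (val-residue p 1) x)

    rot-swap : ∀ a b x → rot p a (rot p b x) ≡ rot p b (rot p a x)
    rot-swap a b x = trans (sym (rot-+ p a b x)) (trans (cong (λ z → rot p z x) (ℕ.+-comm a b)) (rot-+ p b a x))

    turn-▷ : ∀ a b → turn a (uncurry _▷_ (d₁ b)) ≡ uncurry _▷_ (d₁ (shiftBlock a b))
    turn-▷ a (inj₁ (d , c , x)) = cong (c ,_) (rot-swap a (suc (toℕ d)) x)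
    turn-▷ a (inj₂ (y , x))     = cong (suc zero ,_) (rot-swap a (toℕ y) x)

    turn-start : ∀ a b → turn a (proj₁ (d₁ b)) ≡ proj₁ (d₁ (shiftBlock a b))
    turn-start a (inj₁ (d , v)) = refl
    turn-start a (inj₂ (y , x)) = refl

    act₁-eb : ∀ c b → Vec.lookup (act g₁ c) (eb b) ≡ spin 1 (Vec.lookup c (eb (shiftBlock 1 b)))
    act₁-eb c b = trans (col-colAct (sides g₁) (toℕ (residue p 1)) c (uncurry ▷-≢ (d₁ b))) (trans (spin-cong (val-residue p 1) _)
      (cong (spin 1) (cong₂ (col c) (trans (turn₁ _) (turn-start 1 b)) (trans (turn₁ _) (turn-▷ 1 b)))))

    extend-fixed : ∀ γ → act g₁ (extend γ) ≡ extend γ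
    extend-fixed γ = block-ext (λ b → trans (act₁-eb (extend γ) b) (trans (cong (spin 1) (extend-eb γ (shiftBlock 1 b))) (trans (shifted b) (sym (extend-eb γ b)))))
      where
      shifted : ∀ b → spin 1 (paintBlock γ (shiftBlock 1 b)) ≡ paintBlock γ b
      shifted (inj₁ (d , a , x)) = spin-back-rot 1 x _
      shifted (inj₂ (y , x))     = spin-back-rot 1 x _

    module _ {c : ColVec} (fix : act g₁ c ≡ c) where
      iterate : ∀ t b → spin t (Vec.lookup c (eb (shiftBlock t b))) ≡ Vec.lookup c (eb b)
      iterate zero    b = trans (spin-0 (≡⇒mod refl) _) (cong (Vec.lookup c ∘ eb) (shift-0 b))
        where
        shift-0 : ∀ b → shiftBlock 0 b ≡ b
        shift-0 (inj₁ (d , a , x)) = cong (λ x → inj₁ (d , a , x)) (rot-0 p (≡⇒mod refl) x)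
        shift-0 (inj₂ (y , x))     = cong (λ x → inj₂ (y , x)) (rot-0 p (≡⇒mod refl) x)
      iterate (suc t) b = trans (trans (cong (λ z → spin z (Vec.lookup c (eb (shiftBlock (suc t) b)))) (ℕ.+-comm 1 t)) (spin-+ t 1 _))
        (trans (cong (spin t) (trans (cong (spin 1 ∘ Vec.lookup c ∘ eb) (shift-suc b)) (trans (sym (act₁-eb c (shiftBlock t b))) (cong (λ c → Vec.lookup c (eb (shiftBlock t b))) fix))))
          (iterate t b))
        where
        shift-suc : ∀ b → shiftBlock (suc t) b ≡ shiftBlock 1 (shiftBlock t b)
        shift-suc (inj₁ (d , a , x)) = cong (λ x → inj₁ (d , a , x)) (rot-+ p 1 t x)
        shift-suc (inj₂ (y , x))     = cong (λ x → inj₂ (y , x)) (rot-+ p 1 t x)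

      restrict : Γ
      restrict = Vec.tabulate (λ d → Vec.lookup c (eb (inj₁ (d , zero , 0′ p)))) , Vec.tabulate (λ d → Vec.lookup c (eb (inj₁ (d , suc zero , 0′ p)))) ,
                 Vec.tabulate (λ y → Vec.lookup c (eb (inj₂ (y , 0′ p))))

      solve-spin : ∀ x {c c′} → spin (toℕ x) c ≡ c′ → spin (back x) c′ ≡ c
      solve-spin x {c} refl = trans (sym (spin-+ (back x) (toℕ x) c)) (spin-0 (neg-mod p (toℕ x)) c)

      extend-restrict : extend restrict ≡ c
      extend-restrict = block-ext (λ b → trans (extend-eb restrict b) (at b))
        where
        inner-at : ∀ a d → Vec.lookup (inner restrict a) d ≡ Vec.lookup c (eb (inj₁ (d , a , 0′ p)))
        inner-at zero       d = Vec.lookup∘tabulate _ d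
        inner-at (suc zero) d = Vec.lookup∘tabulate _ d
        at : ∀ b → paintBlock restrict b ≡ Vec.lookup c (eb b)
        at (inj₁ (d , a , x)) = trans (cong (spin (back x)) (inner-at a d)) (solve-spin x (trans (cong (λ y → spin (toℕ x) (Vec.lookup c (eb (inj₁ (d , a , y))))) (sym (rot-toℕ-0′ p x)))
                                  (iterate (toℕ x) (inj₁ (d , a , 0′ p)))))
        at (inj₂ (y , x))     = trans (cong (spin (back x)) (Vec.lookup∘tabulate _ y)) (solve-spin x (trans (cong (λ z → spin (toℕ x) (Vec.lookup c (eb (inj₂ (y , z))))) (sym (rot-toℕ-0′ p x)))
                                  (iterate (toℕ x) (inj₂ (y , 0′ p)))))

    extend-injective : ∀ {γ γ′} → extend γ ≡ extend γ′ → γ ≡ γ′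
    extend-injective {γ} {γ′} eq = cong₂ _,_ (vec-ext (at zero)) (cong₂ _,_ (vec-ext (at (suc zero))) (vec-ext (λ y → spin-injective (back (0′ p)) (on (inj₂ (y , 0′ p))))))
      where
      on : ∀ b → paintBlock γ b ≡ paintBlock γ′ b
      on b = trans (sym (extend-eb γ b)) (trans (cong (λ c → Vec.lookup c (eb b)) eq) (extend-eb γ′ b))
      at : ∀ a d → Vec.lookup (inner γ a) d ≡ Vec.lookup (inner γ′ a) d
      at a d = spin-injective (back (0′ p)) (on (inj₁ (d , a , 0′ p)))

    fixedCount≡∑Γ : fixedCount g₁ ≡ ∑ (Enumeration.list Γ-enum) (D′ ∘ extend)
    fixedCount≡∑Γ = trans (∑-inj _≟ᶜ_ (Enumeration.unique Γ-enum) (Enumeration.complete Γ-enum) (Enumeration.unique ColVec-enum) extend-injective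
        (λ γ _ → Enumeration.complete ColVec-enum (extend γ)) (λ {c} _ nz → onto c (act g₁ c ≟ᶜ c) nz))
      (∑-cong (Enumeration.list Γ-enum) (λ γ → trans (cong (_· D′ (extend γ)) (⟦⟧-yes (act g₁ (extend γ) ≟ᶜ extend γ) (extend-fixed γ))) (·-identityˡ _)))
      where
      onto : ∀ c → Dec (act g₁ c ≡ c) → ⟦ act g₁ c ≟ᶜ c ⟧ · D′ c ≢ 0ℤ → ∃ λ γ → extend γ ≡ c
      onto c (yes fix) _  = restrict fix , extend-restrict fix
      onto c (no ne)   nz = contradiction (trans (cong (_· D′ c) (⟦⟧-no (act g₁ c ≟ᶜ c) ne)) (·-zeroˡ _)) nz

  slotColour : Vec C m → Vec C p → Slot → C
  slotColour γ ζ (inj₁ (d , false)) = Vec.lookup γ d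
  slotColour γ ζ (inj₁ (d , true))  = spin (suc (toℕ d)) (Vec.lookup γ d)
  slotColour γ ζ (inj₂ y)           = Vec.lookup ζ y

  -- The crossing colours as seen from 0 in the second half: slot y leads there to -y in the first
  -- half, where the colour of this slot is turned by y.
  spun : Vec C p → Vec C p
  spun ζ = Vec.tabulate (λ y → spin (toℕ y) (Vec.lookup ζ y))

  private
    cross-at : Γ → Fin 2 → Vec C p
    cross-at γ zero       = cross γ
    cross-at γ (suc zero) = spun (cross γ)

    χ-extend : ∀ γ a x o → χ (extend γ) (a , x) o ≡ spin (back x) (slotColour (inner γ a) (cross-at γ a) o)
    χ-extend γ a x (inj₁ (d , false)) = extend-eb γ (inj₁ (d , a , x))
    χ-extend γ a x (inj₁ (d , true))  = trans (cong (Vec.lookup (extend γ)) (trans (cong (λ v → de v (inj₁ (d , true))) (sym (▷-forth (a , x) d))) (de-d₂ (inj₁ (d , (a , x) ▷ inj₁ (d , true))))))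
      (trans (extend-eb γ (inj₁ (d , (a , x) ▷ inj₁ (d , true)))) (spin-back-neg (suc (toℕ d)) x _))
    χ-extend γ zero x (inj₂ y)        = extend-eb γ (inj₂ (y , x))
    χ-extend γ (suc zero) x (inj₂ y)  = trans (cong (Vec.lookup (extend γ)) (trans (cong (λ v → de v (inj₂ y)) (sym (▷-across′ x y))) (de-d₂ (inj₂ (y , rot p (neg p (toℕ y)) x)))))
      (trans (extend-eb γ (inj₂ (y , rot p (neg p (toℕ y)) x))) (trans (spin-back-neg (toℕ y) x _) (cong (spin (back x)) (sym (Vec.lookup∘tabulate _ y)))))

  rowSign : Vec C m → Vec C p → ℤ
  rowSign γ ζ = sgnL σC (map (slotColour γ ζ) Os)

  private
    spin-even : ∀ l → pp (twist σC (spin l)) (allFin k) ≡ 1ℤ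
    spin-even = pp-twist-odd σC {m} {allFin k} spin spin-injective spin-+ (λ a → spin-0 (ids a)) (Unique.allFin⁺ k) (λ a → map-injective-↭ (finEnum k) (spin-injective a))
      where
      ids : ∀ a → + (a + (a * m + a * m)) ≡ 0ℤ ⟨mod + p ⟩
      ids a = subst (λ z → + z ≡ 0ℤ ⟨mod + p ⟩) (trans (cong (a *_) p≡) (lem a m)) (multiple-mod p a)
        where lem : ∀ a m → a * suc (m * 2) ≡ a + (a * m + a * m)
              lem = ℕSolver.solve-∀

    -- The row at x is the row at 0 with all colours turned by -x, and turning the colours is an
    -- even permutation.
    row-extend : ∀ γ a x → sgnL σC (row (extend γ) (a , x)) ≡ rowSign (inner γ a) (cross-at γ a)
    row-extend γ a x = trans (cong (sgnL σC) (trans (List.map-cong (χ-extend γ a x) Os) (List.map-∘ {g = spin (back x)} {f = slotColour (inner γ a) (cross-at γ a)} Os)))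
      (sgnL-map-even σC (finEnum k) (spin-injective (back x)) (spin-even (back x)) {map (slotColour (inner γ a) (cross-at γ a)) Os}
        (ℕ.≤-reflexive (trans (List.length-tabulate id) (sym (trans (List.length-map _ Os) length-Os)))))

    sign-power : ∀ γ ζ → rowSign γ ζ ↑ p ≡ rowSign γ ζ
    sign-power γ ζ = by-cases (unique? σC Fin._≟_ (map (slotColour γ ζ) Os))
      where
      by-cases : Dec (Unique (map (slotColour γ ζ) Os)) → rowSign γ ζ ↑ p ≡ rowSign γ ζ
      by-cases (yes u) = odd-power (sgnL-sq σC u)
      by-cases (no ¬u) = trans (cong (_↑ p) z) (trans (trans (cong (0ℤ ↑_) p≡) (·-zeroˡ _)) (sym z))
        where z = sgnL-nonunique σC Fin._≟_ (map (slotColour γ ζ) Os) ¬u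

    -- The p rows of a half have equal signs, and an odd power of 0, 1 or -1 is the number itself.
    D′-extend : ∀ γ → D′ (extend γ) ≡ rowSign (inner γ zero) (cross γ) · rowSign (inner γ (suc zero)) (spun (cross γ))
    D′-extend γ = trans (∏-× (allFin 2) ps _) (cong₂ _·_ (half zero) (trans (·-identityʳ _) (half (suc zero))))
      where
      half : ∀ a → ∏ ps (λ x → sgnL σC (row (extend γ) (a , x))) ≡ rowSign (inner γ a) (cross-at γ a)
      half a = trans (∏-cong ps (λ x → row-extend γ a x)) (trans (∏-const ps _) (trans (cong (rowSign (inner γ a) (cross-at γ a) ↑_) (List.length-tabulate {n = p} id)) (sign-power (inner γ a) (cross-at γ a))))

    cs = allFin k

  halfSum : Vec C p → ℤ
  halfSum ζ = ∑ (allVecs cs m) (λ γ → rowSign γ ζ)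

  -- The inner colours of the two halves interact only through the crossing colours ζ, so for given
  -- ζ the sums over them factor.
  fixedCount≡∑ζ : fixedCount g₁ ≡ ∑ (allVecs cs p) (λ ζ → halfSum ζ · halfSum (spun ζ))
  fixedCount≡∑ζ = trans fixedCount≡∑Γ (trans (∑-cong (Enumeration.list Γ-enum) D′-extend) (trans (∑-× (allVecs cs m) _ _)
    (trans (∑-cong (allVecs cs m) (λ γ₀ → trans (∑-× (allVecs cs m) (allVecs cs p) _) (trans (∑-swap (allVecs cs m) (allVecs cs p) _)
        (∑-cong (allVecs cs p) (λ ζ → ∑-*ˡ (allVecs cs m) (rowSign γ₀ ζ) (λ γ₁ → rowSign γ₁ (spun ζ)))))))
      (trans (∑-swap (allVecs cs m) (allVecs cs p) _) (∑-cong (allVecs cs p) (λ ζ → ∑-*ʳ (allVecs cs m) (halfSum (spun ζ)) (λ γ₀ → rowSign γ₀ ζ)))))))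

-- The signed number of equivariant colourings in terms of starters

Vec-map-injective : ∀ {X Y : Set} {f : X → Y} → (∀ {x y} → f x ≡ f y → x ≡ y) → ∀ {n} {v w : Vec X n} → Vec.map f v ≡ Vec.map f w → v ≡ w
Vec-map-injective inj {v = []}    {[]}    _  = refl
Vec-map-injective inj {v = _ ∷ _} {_ ∷ _} eq = cong₂ _∷_ (inj (Vec.∷-injectiveˡ eq)) (Vec-map-injective inj (Vec.∷-injectiveʳ eq))

module FixedCount (p m : ℕ) .{{_ : NonZero p}} (prime : Prime p) (p≡ : p ≡ suc (m * 2)) (m>0 : 0 < m) where
  open Equivariant p m prime p≡ m>0 public
  open Starters p m prime p≡ using (Position; positions; block; place; starters)
  open OneSpecial cyc fixedC

  private
    ps = allFin p
    cs = allFin k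
    s = Sign.s σC
    amounts : Fin m → ℕ
    amounts = suc ∘ toℕ

    W : ℤ
    W = starters amounts (0′ p)

    twin : Vec C m → Fin m → List C
    twin γ d = Vec.lookup γ d ∷ spin (suc (toℕ d)) (Vec.lookup γ d) ∷ []

    twins : Vec C m → List C
    twins γ = concatMap (twin γ) (allFin m)

    slots≡ : ∀ γ ζ → map (slotColour γ ζ) Os ≡ twins γ ++ Vec.toList ζ
    slots≡ γ ζ = trans (List.map-++ (slotColour γ ζ) (concatMap slotBlock (allFin m)) (map inj₂ ps))
      (cong₂ _++_ (List.map-concatMap (slotColour γ ζ) slotBlock (allFin m)) (trans (sym (List.map-∘ {g = slotColour γ ζ} {f = inj₂} ps)) (sym (toList≡map-lookup ζ))))

    -- In a row, the two ends of a rotated edge get cyclic colours.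
    onlyCyclic : ∀ γ ζ → Unique (map (slotColour γ ζ) Os) → ∃ λ γ′ → Vec.map cyc γ′ ≡ γ
    onlyCyclic γ ζ u = Vec.tabulate (proj₁ ∘ z) , vec-ext (λ d → trans (Vec.lookup-map d cyc (Vec.tabulate (proj₁ ∘ z))) (trans (cong cyc (Vec.lookup∘tabulate (proj₁ ∘ z) d)) (proj₂ (z d))))
      where
      z : ∀ d → ∃ λ z → cyc z ≡ Vec.lookup γ d
      z d = go (colour (Vec.lookup γ d)) refl
        where
        go : ∀ {c} → Colour c → c ≡ Vec.lookup γ d → ∃ λ z → cyc z ≡ Vec.lookup γ d
        go (isCyc z)   eq = z , eq
        go (isFixed φ) eq = contradiction (unique-map⇒injective (slotColour γ ζ) u (∈Os (inj₁ (d , false))) (∈Os (inj₁ (d , true)))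
            (trans (sym eq) (trans (sym (onColours-fixed (rot p (suc (toℕ d))) φ)) (cong (spin (suc (toℕ d))) eq)))) λ ()

    halfSum≡ : ∀ ζ → halfSum ζ ≡ ∑ (allVecs ps m) (λ γ → rowSign (Vec.map cyc γ) ζ)
    halfSum≡ ζ = ∑-inj (Vec.≡-dec Fin._≟_) (allVecs-unique m (Unique.allFin⁺ p)) (Enumeration.complete (vecEnum (finEnum p) m)) (allVecs-unique m (Unique.allFin⁺ k))
      (λ eq → Vec-map-injective cyc-injective eq) (λ γ _ → Enumeration.complete (vecEnum (finEnum k) m) (Vec.map cyc γ))
      (λ {γ} _ nz → onlyCyclic γ ζ (sgnL≢0⇒unique σC Fin._≟_ nz))

    IsCyc : C → Set
    IsCyc c = ∃ λ z → c ≡ cyc z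

    cyc? : ∀ c → Dec (IsCyc c)
    cyc? c = go (colour c)
      where
      go : ∀ {c} → Colour c → Dec (IsCyc c)
      go (isCyc z)   = yes (z , refl)
      go (isFixed φ) = no (λ (z , eq) → fixed≢cyc eq)

    not-cyc : ∀ c → ¬ IsCyc c → ∃ λ φ → c ≡ fixedC φ
    not-cyc c = go (colour c)
      where
      go : ∀ {c} → Colour c → ¬ IsCyc c → ∃ λ φ → c ≡ fixedC φ
      go (isFixed φ) _  = φ , refl
      go (isCyc z)   nc = contradiction (z , refl) nc

    length-twins : ∀ γ → length (twins γ) ≡ m * 2
    length-twins γ = trans (length-concatMap (twin γ) 2 (allFin m) (λ _ → refl)) (cong (_* 2) (List.length-tabulate {n = m} id))

    twins-cyc : ∀ γ → All IsCyc (twins (Vec.map cyc γ))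
    twins-cyc γ = go (allFin m)
      where
      go : ∀ ds → All IsCyc (concatMap (twin (Vec.map cyc γ)) ds)
      go []       = []
      go (d ∷ ds) = (Vec.lookup γ d , Vec.lookup-map d cyc γ) ∷
        (rot p (suc (toℕ d)) (Vec.lookup γ d) , trans (cong (spin (suc (toℕ d))) (Vec.lookup-map d cyc γ)) (onColours-cyc _ _)) ∷ go ds

    length-filter-map : ∀ {X Y : Set} {P : Y → Set} (P? : ∀ y → Dec (P y)) (h : X → Y) xs → length (filter P? (map h xs)) ≡ length (filter (P? ∘ h) xs)
    length-filter-map P? h []       = refl
    length-filter-map P? h (x ∷ xs) with P? (h x)
    ... | yes _ = cong suc (length-filter-map P? h xs)
    ... | no _  = length-filter-map P? h xs

    -- A row contains every colour once. The inner slots use 2m of the 2m + 1 cyclic colours, which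
    -- leaves a single one for the crossing slots.
    one-cyclic : ∀ γ ζ → Unique (map (slotColour (Vec.map cyc γ) ζ) Os) → ∃ λ y → filter (cyc? ∘ Vec.lookup ζ) ps ≡ [ y ]
    one-cyclic γ ζ u = single (filter (cyc? ∘ Vec.lookup ζ) ps) (ℕ.+-cancelˡ-≡ (m * 2) _ _ (begin
      m * 2 + length (filter (cyc? ∘ Vec.lookup ζ) ps)
        ≡⟨ cong₂ _+_ (sym (trans (cong length (List.filter-all cyc? (twins-cyc γ))) (length-twins (Vec.map cyc γ))))
             (trans (sym (length-filter-map cyc? (Vec.lookup ζ) ps)) (cong (length ∘ filter cyc?) (sym (toList≡map-lookup ζ)))) ⟩
      length (filter cyc? (twins (Vec.map cyc γ))) + length (filter cyc? (Vec.toList ζ))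
        ≡⟨ trans (sym (List.length-++ (filter cyc? (twins (Vec.map cyc γ))))) (cong length (sym (List.filter-++ cyc? (twins (Vec.map cyc γ)) (Vec.toList ζ)))) ⟩
      length (filter cyc? (twins (Vec.map cyc γ) ++ Vec.toList ζ))
        ≡⟨ cong (length ∘ filter cyc?) (sym (slots≡ (Vec.map cyc γ) ζ)) ⟩
      length (filter cyc? (map (slotColour (Vec.map cyc γ) ζ) Os))
        ≡⟨ ↭.↭-length (↭.filter-↭ cyc? (full⇒↭ (finEnum k) u (ℕ.≤-reflexive (trans (List.length-tabulate id) (sym (trans (List.length-map _ Os) length-Os)))))) ⟩
      length (filter cyc? cs)
        ≡⟨ ↭.↭-length (unique-set⇒↭ (Unique.filter⁺ cyc? (Unique.allFin⁺ k)) (Unique.map⁺ cyc-injective (Unique.allFin⁺ p)) into onto) ⟩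
      length (map cyc ps)
        ≡⟨ trans (List.length-map cyc ps) (trans (List.length-tabulate {n = p} id) (trans p≡ (ℕ.+-comm 1 (m * 2)))) ⟩
      m * 2 + 1 ∎))
      where
      open ≡-Reasoning
      into : ∀ {c} → c ∈ filter cyc? cs → c ∈ map cyc ps
      into c∈ = let z , eq = proj₂ (∈.∈-filter⁻ cyc? {xs = cs} c∈) in subst (_∈ map cyc ps) (sym eq) (∈.∈-map⁺ cyc (∈.∈-allFin z))
      onto : ∀ {c} → c ∈ map cyc ps → c ∈ filter cyc? cs
      onto c∈ = let z , _ , eq = ∈.∈-map⁻ cyc c∈ in ∈.∈-filter⁺ cyc? (∈.∈-allFin _) (z , eq)
      single : ∀ {X : Set} (l : List X) → length l ≡ 1 → ∃ λ y → l ≡ [ y ]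
      single (y ∷ []) _ = y , refl

    Φs : ℕ
    Φs = m * 2

    placed : Fin p × Fin p × Vec (Fin Φs) Φs → Vec C p
    placed (y , z , β) = place-at p≡ y z β

    support : ∀ ζ → halfSum ζ · halfSum (spun ζ) ≢ 0ℤ → ∃ λ yzβ → placed yzβ ≡ ζ
    support ζ nz =
      let γ , _ , γ≢0 = ∑-≢0 (allVecs ps m) (λ e → nz (trans (cong (_· halfSum (spun ζ)) (trans (halfSum≡ ζ) e)) (·-zeroˡ _)))
          y , eq = one-cyclic γ ζ (sgnL≢0⇒unique σC Fin._≟_ γ≢0)
          z , at = proj₂ (∈.∈-filter⁻ (cyc? ∘ Vec.lookup ζ) {xs = ps} (subst (y ∈_) (sym eq) (here refl)))
          off : ∀ y′ → y ≢ y′ → ∃ λ φ → Vec.lookup ζ y′ ≡ fixedC φ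
          off y′ ne = not-cyc (Vec.lookup ζ y′) (λ isc → ne (sym (Any.singleton⁻ (subst (y′ ∈_) eq (∈.∈-filter⁺ (cyc? ∘ Vec.lookup ζ) (∈.∈-allFin y′) isc)))))
          β , β≡ = from-lookup p≡ y z ζ at off
      in (y , z , β) , β≡

    -- Fixed colours do not turn, so the second half has the same slot y and the same arrangement β;
    -- only the residue of the cyclic entry moves.
    spun-placed : ∀ y z β → spun (place-at p≡ y z β) ≡ place-at p≡ y (rot p (toℕ y) z) β
    spun-placed y z β = vec-ext (λ y′ → trans (Vec.lookup∘tabulate _ y′) (by-cases y′ (y Fin.≟ y′)))
      where
      by-cases : ∀ y′ → Dec (y ≡ y′) → spin (toℕ y′) (Vec.lookup (place-at p≡ y z β) y′) ≡ Vec.lookup (place-at p≡ y (rot p (toℕ y) z) β) y′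
      by-cases y′ (yes refl) = trans (cong (spin (toℕ y)) (lookup-here p≡ y z β)) (trans (onColours-cyc (rot p (toℕ y)) z) (sym (lookup-here p≡ y (rot p (toℕ y) z) β)))
      by-cases y′ (no ne)    = let φ , eq = lookup-there p≡ y β ne in
        trans (cong (spin (toℕ y′)) (eq z)) (trans (onColours-fixed (rot p (toℕ y′)) φ) (sym (eq (rot p (toℕ y) z))))

    above : ∀ φ z → s (cyc z) (fixedC φ) ≡ ⊝ 1ℤ
    above φ z = trans (sg-> lt) (sym ⊝1≡-1)
      where
      lt : toℕ (fixedC φ) < toℕ (cyc z)
      lt rewrite Fin.toℕ-↑ˡ φ p | Fin.toℕ-↑ʳ (m * 2) z = ℕ.<-≤-trans (Fin.toℕ<n φ) (ℕ.m≤m+n (m * 2) (toℕ z))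

    below : ∀ φ z → s (fixedC φ) (cyc z) ≡ 1ℤ
    below φ z = trans (Sign.anti σC (cyc z) (fixedC φ)) (trans (cong ⊝_ (above φ z)) (solve 0 (:- (:- con 1ℤ) := con 1ℤ) refl))

    s-cyc : ∀ a b → s (cyc a) (cyc b) ≡ Sign.s (finSign p) a b
    s-cyc a b rewrite Fin.toℕ-↑ʳ (m * 2) a | Fin.toℕ-↑ʳ (m * 2) b = sg-+ (m * 2) (toℕ a) (toℕ b)
      where
      sg-+ : ∀ c a b → sg (c + a) (c + b) ≡ sg a b
      sg-+ zero    a b = refl
      sg-+ (suc c) a b = sg-+ c a b

    -- Every cyclic colour is larger than every fixed one.
    insertion : ∀ {G} z as bs → All IsCyc G → length as + length bs ≡ m * 2 →
                sgnL σC (G ++ (map fixedC as ++ cyc z ∷ map fixedC bs)) ≡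
                sgnL σC (G ++ [ cyc z ]) · (sgnL σC (map fixedC (as ++ bs)) · (⊝ 1ℤ) ↑ length bs)
    insertion {G} z as bs cycs len = begin
      sgnL σC (G ++ R)
        ≡⟨ pp-++ s G R ⟩
      sgnL σC G · sgnL σC R · ∏ G (λ g → ∏ R (s g))
        ≡⟨ cong₂ (λ a b → sgnL σC G · a · b) inner-sign outer ⟩
      sgnL σC G · (sgnL σC (A′ ++ B′) · (⊝ 1ℤ) ↑ length bs) · ∏ G (λ g → s g cz · 1ℤ)
        ≡⟨ solve 3 (λ a b c → a :* b :* c := (a :* con 1ℤ :* c) :* b) refl (sgnL σC G) (sgnL σC (A′ ++ B′) · (⊝ 1ℤ) ↑ length bs) (∏ G (λ g → s g cz · 1ℤ)) ⟩
      (sgnL σC G · 1ℤ · ∏ G (λ g → s g cz · 1ℤ)) · (sgnL σC (A′ ++ B′) · (⊝ 1ℤ) ↑ length bs)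
        ≡⟨ cong₂ (λ a b → a · (b · (⊝ 1ℤ) ↑ length bs)) (sym (pp-++ s G [ cz ])) (cong (sgnL σC) (sym (List.map-++ fixedC as bs))) ⟩
      sgnL σC (G ++ [ cz ]) · (sgnL σC (map fixedC (as ++ bs)) · (⊝ 1ℤ) ↑ length bs) ∎
      where
      open ≡-Reasoning
      cz = cyc z
      A′ = map fixedC as
      B′ = map fixedC bs
      R = A′ ++ cz ∷ B′
      after : ∀ w l → ∏ (map fixedC l) (s (cyc w)) ≡ (⊝ 1ℤ) ↑ length l
      after w l = trans (∏-map fixedC l (s (cyc w))) (trans (∏-cong l (λ φ → above φ w)) (∏-const l (⊝ 1ℤ)))
      before : ∏ A′ (λ a → s a cz) ≡ 1ℤ
      before = trans (∏-map fixedC as _) (∏-one as (λ {φ} _ → below φ z))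
      inner-sign : sgnL σC R ≡ sgnL σC (A′ ++ B′) · (⊝ 1ℤ) ↑ length bs
      inner-sign = begin
        sgnL σC R
          ≡⟨ pp-++ s A′ (cz ∷ B′) ⟩
        sgnL σC A′ · sgnL σC (cz ∷ B′) · ∏ A′ (λ a → s a cz · ∏ B′ (s a))
          ≡⟨ cong₂ (λ a b → sgnL σC A′ · a · b) (trans (pp-∷ s cz B′) (cong (_· sgnL σC B′) (after z bs))) (trans (∏-* A′ _ _) (trans (cong (_· ∏ A′ (λ a → ∏ B′ (s a))) before) (·-identityˡ _))) ⟩
        sgnL σC A′ · ((⊝ 1ℤ) ↑ length bs · sgnL σC B′) · ∏ A′ (λ a → ∏ B′ (s a))
          ≡⟨ solve 4 (λ a e b c → a :* (e :* b) :* c := (a :* b :* c) :* e) refl (sgnL σC A′) ((⊝ 1ℤ) ↑ length bs) (sgnL σC B′) (∏ A′ (λ a → ∏ B′ (s a))) ⟩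
        (sgnL σC A′ · sgnL σC B′ · ∏ A′ (λ a → ∏ B′ (s a))) · (⊝ 1ℤ) ↑ length bs
          ≡⟨ cong (_· (⊝ 1ℤ) ↑ length bs) (sym (pp-++ s A′ B′)) ⟩
        sgnL σC (A′ ++ B′) · (⊝ 1ℤ) ↑ length bs ∎
      outer : ∏ G (λ g → ∏ R (s g)) ≡ ∏ G (λ g → s g cz · 1ℤ)
      outer = ∏-cong∈ G (λ g∈ → at (All.lookup cycs g∈))
        where
        at : ∀ {g} → IsCyc g → ∏ R (s g) ≡ s g cz · 1ℤ
        at (w , refl) = trans (∏-++ A′ (cz ∷ B′) (s (cyc w))) (trans (cong₂ (λ a b → a · (s (cyc w) cz · b)) (after w as) (after w bs))
          (trans (solve 3 (λ a b c → a :* (b :* c) := b :* (a :* c)) refl ((⊝ 1ℤ) ↑ length as) (s (cyc w) cz) ((⊝ 1ℤ) ↑ length bs))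
            (cong (s (cyc w) cz ·_) (trans (sym (↑-+ (⊝ 1ℤ) (length as) (length bs))) (trans (cong ((⊝ 1ℤ) ↑_) len) (↑-even ⊝1-sq m))))))

    places≡ : ∀ γ z → map cyc (map (place amounts γ z) positions) ≡ twins (Vec.map cyc γ) ++ [ cyc z ]
    places≡ γ z = trans (sym (List.map-∘ positions)) (trans (List.map-++ (cyc ∘ place amounts γ z) (concatMap block (allFin m)) [ nothing ])
      (cong (_++ [ cyc z ]) (trans (List.map-concatMap (cyc ∘ place amounts γ z) block (allFin m)) (List.concatMap-cong (λ d → cong₂ (λ a b → a ∷ b ∷ [])
        (sym (Vec.lookup-map d cyc γ)) (sym (trans (cong (spin (suc (toℕ d))) (Vec.lookup-map d cyc γ)) (onColours-cyc (rot p (suc (toℕ d))) (Vec.lookup γ d))))) (allFin m)))))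

    -- The sign of the fixed colours among themselves, times -1 for each of them that comes after
    -- the larger cyclic colour.
    fixedPart : Fin p → Vec (Fin Φs) Φs → ℤ
    fixedPart y β = sgnL σC (map fixedC (Vec.toList β)) · (⊝ 1ℤ) ↑ length (post p≡ y β)

    length-pre-post : ∀ y β → length (pre p≡ y β) + length (post p≡ y β) ≡ m * 2
    length-pre-post y β = trans (sym (List.length-++ (pre p≡ y β))) (trans (cong length (pre++post p≡ y β)) (Vec.length-toList β))

    rowSign-placed : ∀ γ y z β → rowSign (Vec.map cyc γ) (place-at p≡ y z β) ≡ sgnL (finSign p) (map (place amounts γ z) positions) · fixedPart y β
    rowSign-placed γ y z β = begin
      sgnL σC (map (slotColour (Vec.map cyc γ) (place-at p≡ y z β)) Os)
        ≡⟨ cong (sgnL σC) (trans (slots≡ (Vec.map cyc γ) (place-at p≡ y z β)) (cong (twins (Vec.map cyc γ) ++_) (toList-place p≡ y z β))) ⟩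
      sgnL σC (twins (Vec.map cyc γ) ++ (map fixedC (pre p≡ y β) ++ cyc z ∷ map fixedC (post p≡ y β)))
        ≡⟨ insertion z (pre p≡ y β) (post p≡ y β) (twins-cyc γ) (length-pre-post y β) ⟩
      sgnL σC (twins (Vec.map cyc γ) ++ [ cyc z ]) · (sgnL σC (map fixedC (pre p≡ y β ++ post p≡ y β)) · (⊝ 1ℤ) ↑ length (post p≡ y β))
        ≡⟨ cong₂ (λ a b → a · (sgnL σC (map fixedC b) · (⊝ 1ℤ) ↑ length (post p≡ y β)))
             (trans (cong (sgnL σC) (sym (places≡ γ z))) (trans (pp-map s cyc (map (place amounts γ z) positions)) (pp-cong (map (place amounts γ z) positions) s-cyc)))
             (pre++post p≡ y β) ⟩
      sgnL (finSign p) (map (place amounts γ z) positions) · fixedPart y β ∎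
      where open ≡-Reasoning

    halfSum-placed : ∀ y z β → halfSum (place-at p≡ y z β) ≡ starters amounts z · fixedPart y β
    halfSum-placed y z β = trans (halfSum≡ (place-at p≡ y z β)) (trans (∑-cong (allVecs ps m) (λ γ → rowSign-placed γ y z β)) (∑-*ʳ (allVecs ps m) (fixedPart y β) _))

    length-positions′ : length positions ≡ p
    length-positions′ = Starters.length-positions p m prime p≡

    -- Translating all pairs together with the left over residue is an even permutation of ℤ/p.
    starters-rot : ∀ a z → starters amounts (rot p a z) ≡ starters amounts z
    starters-rot a z = trans (∑-↭ _ (↭-sym (map-injective-↭ (vecEnum (finEnum p) m) (Vec-map-injective (rot-injective p a)))))
      (trans (∑-map (Vec.map (rot p a)) (allVecs ps m) _) (∑-cong (allVecs ps m) (λ γ → trans (cong (sgnL (finSign p)) (trans (List.map-cong (moved γ) positions) (List.map-∘ {g = rot p a} {f = place amounts γ z} positions)))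
        (sgnL-map-even (finSign p) (finEnum p) (rot-injective p a) (rot-even a) {map (place amounts γ z) positions}
          (ℕ.≤-reflexive (trans (List.length-tabulate id) (sym (trans (List.length-map _ positions) length-positions′))))))))
      where
      moved : ∀ γ o → place amounts (Vec.map (rot p a) γ) (rot p a z) o ≡ rot p a (place amounts γ z o)
      moved γ (just (d , false)) = Vec.lookup-map d (rot p a) γ
      moved γ (just (d , true))  = trans (cong (rot p (suc (toℕ d))) (Vec.lookup-map d (rot p a) γ)) (trans (sym (rot-+ p (suc (toℕ d)) a _))
                                     (trans (cong (λ t → rot p t (Vec.lookup γ d)) (ℕ.+-comm (suc (toℕ d)) a)) (rot-+ p a (suc (toℕ d)) _)))
      moved γ nothing            = refl

    starters-const : ∀ z → starters amounts z ≡ W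
    starters-const z = trans (cong (starters amounts) (sym (rot-toℕ-0′ p z))) (starters-rot (toℕ z) (0′ p))

    fixedSq : List (Fin Φs) → ℤ
    fixedSq l = sgnL σC (map fixedC l) · sgnL σC (map fixedC l)

    fixedSq-alternating : Alternating fixedSq
    fixedSq-alternating .Alternating.symmetric {l} {l′} perm = trans (sym (pp-* s s (map fixedC l))) (trans
      (pp-↭ (λ x y → sym (trans (cong₂ _·_ (Sign.anti σC x y) (Sign.anti σC x y)) (⊝·⊝ _ _))) (↭.map⁺ fixedC perm)) (pp-* s s (map fixedC l′)))
    fixedSq-alternating .Alternating.repeated x l = trans (cong (_· sgnL σC (map fixedC (x ∷ x ∷ l))) (sgnL-repeated σC {map fixedC (x ∷ x ∷ l)} (here refl))) (·-zeroˡ _)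

    -- A squared sign is the indicator of a list without repetitions, so the sum counts the
    -- arrangements of the 2m fixed colours.
    ∑-fixedSq : ∑ (allVecs (allFin Φs) Φs) (fixedSq ∘ Vec.toList) ≡ + (Φs !)
    ∑-fixedSq = trans (sym (tuples≡∑ (allFin Φs) Φs fixedSq)) (trans (tuples≡!·sublists fixedSq-alternating (allFin Φs) Φs)
      (trans (cong (+ (Φs !) ·_) (trans (∑-full-sublist (allFin Φs) Φs fixedSq (List.length-tabulate id))
        (sgnL-sq σC (Unique.map⁺ fixedC-injective (Unique.allFin⁺ Φs))))) (·-identityʳ _)))

    fixedPart-sq : ∀ y β → fixedPart y β · fixedPart y β ≡ fixedSq (Vec.toList β)
    fixedPart-sq y β = trans (·-interchange _ _ _ _) (trans (cong (fixedSq (Vec.toList β) ·_) (trans (sym (↑-+ (⊝ 1ℤ) l l)) (trans (cong ((⊝ 1ℤ) ↑_) (lem l)) (↑-even ⊝1-sq l)))) (·-identityʳ _))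
      where
      l = length (post p≡ y β)
      lem : ∀ l → l + l ≡ l * 2
      lem = ℕSolver.solve-∀

    Ψ-enum : Enumeration (Fin p × Fin p × Vec (Fin Φs) Φs)
    Ψ-enum = finEnum p ×-enum (finEnum p ×-enum vecEnum (finEnum Φs) Φs)

  -- The crossing colours that matter are given by the slot y and the residue z of the one cyclic
  -- entry, p choices for each, and by an arrangement of the fixed colours. Each half contributes
  -- one signed starter count, and the sign `fixedPart`, common to both halves, is squared.
  fixedCount≡ : fixedCount g₁ ≡ + p · (+ p · (+ ((m * 2) !) · (starters (suc ∘ toℕ) (0′ p) · starters (suc ∘ toℕ) (0′ p))))
  fixedCount≡ = begin
    fixedCount g₁
      ≡⟨ fixedCount≡∑ζ ⟩
    ∑ (allVecs cs p) (λ ζ → halfSum ζ · halfSum (spun ζ))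
      ≡⟨ ∑-inj (Vec.≡-dec Fin._≟_) (Enumeration.unique Ψ-enum) (Enumeration.complete Ψ-enum) (allVecs-unique p (Unique.allFin⁺ k)) placed-injective
           (λ yzβ _ → Enumeration.complete (vecEnum (finEnum k) p) (placed yzβ)) (λ {ζ} _ → support ζ) ⟩
    ∑ (Enumeration.list Ψ-enum) (λ yzβ → halfSum (placed yzβ) · halfSum (spun (placed yzβ)))
      ≡⟨ ∑-cong (Enumeration.list Ψ-enum) (λ (y , z , β) → trans (cong₂ _·_ (half y z β) (trans (cong halfSum (spun-placed y z β)) (half y (rot p (toℕ y) z) β)))
           (trans (·-interchange W (fixedPart y β) W (fixedPart y β)) (cong (W · W ·_) (fixedPart-sq y β)))) ⟩
    ∑ (Enumeration.list Ψ-enum) (λ (y , z , β) → W · W · fixedSq (Vec.toList β))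
      ≡⟨ trans (∑-× ps _ _) (∑-cong ps (λ y → trans (∑-× ps (allVecs (allFin Φs) Φs) _) (∑-cong ps (λ z → trans (∑-*ˡ (allVecs (allFin Φs) Φs) (W · W) _) (cong (W · W ·_) ∑-fixedSq))))) ⟩
    ∑ ps (λ _ → ∑ ps (λ _ → W · W · + (Φs !)))
      ≡⟨ trans (∑-const ps _) (cong₂ (λ a b → + a · b) len (trans (∑-const ps _) (cong (λ a → + a · (W · W · + (Φs !))) len))) ⟩
    + p · (+ p · (W · W · + (Φs !)))
      ≡⟨ cong (λ a → + p · (+ p · a)) (·-comm (W · W) (+ (Φs !))) ⟩
    + p · (+ p · (+ (Φs !) · (W · W))) ∎
    where
    open ≡-Reasoning
    len : length ps ≡ p
    len = List.length-tabulate id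
    half : ∀ y z β → halfSum (place-at p≡ y z β) ≡ W · fixedPart y β
    half y z β = trans (halfSum-placed y z β) (cong (_· fixedPart y β) (starters-const z))
    placed-injective : ∀ {a b} → placed a ≡ placed b → a ≡ b
    placed-injective {y , z , β} {y′ , z′ , β′} eq =
      let a , b , c = place-injective cyc-injective fixedC-injective fixed≢cyc p≡ {y} {z} {β} {y′} {z′} {β′} eq in cong₂ _,_ a (cong₂ _,_ b c)

-- Counting by indicators, and weights that do not vanish

∈-pairs : ∀ {X : Set} {x y : X} {xs} → x ∈ xs → y ∈ xs → x ≢ y → (x , y) ∈ pairs xs ⊎ (y , x) ∈ pairs xs
∈-pairs (here refl) (here refl) ne = contradiction refl ne
∈-pairs (here refl) (there y∈)  ne = inj₁ (∈.∈-++⁺ˡ (∈.∈-map⁺ (_ ,_) y∈))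
∈-pairs (there x∈)  (here refl) ne = inj₂ (∈.∈-++⁺ˡ (∈.∈-map⁺ (_ ,_) x∈))
∈-pairs {xs = z ∷ zs} (there x∈) (there y∈) ne = Sum.map (∈.∈-++⁺ʳ (map (z ,_) zs)) (∈.∈-++⁺ʳ (map (z ,_) zs)) (∈-pairs x∈ y∈ ne)

module _ {X : Set} {P : X → Set} (P? : ∀ x → Dec (P x)) where

  ∑-⟦⟧ : ∀ xs → ∑ xs (λ x → ⟦ P? x ⟧) ≡ + length (filter P? xs)
  ∑-⟦⟧ []       = refl
  ∑-⟦⟧ (x ∷ xs) with P? x
  ... | yes _ = trans (cong (1ℤ ⊕_) (∑-⟦⟧ xs)) (sym (pos-⊕ 1 (length (filter P? xs))))
  ... | no _  = trans (cong (0ℤ ⊕_) (∑-⟦⟧ xs)) (sym (pos-⊕ 0 (length (filter P? xs))))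

  ∏-if : ∀ a xs → ∏ xs (λ x → if does (P? x) then a else 1ℤ) ≡ a ↑ length (filter P? xs)
  ∏-if a []       = refl
  ∏-if a (x ∷ xs) with P? x
  ... | yes _ = cong (a ·_) (∏-if a xs)
  ... | no _  = trans (·-identityˡ _) (∏-if a xs)

↑-≢0 : ∀ {a} n → a ≢ 0ℤ → a ↑ n ≢ 0ℤ
↑-≢0 zero    nz = 1≢0
↑-≢0 (suc n) nz eq = Sum.[ nz , ↑-≢0 n nz ]′ (·-≡0 eq)

weight≢0 : ∀ {k c} → c ≤ k → weight k c ≢ 0ℤ
weight≢0 {k} {c} le eq = Sum.[ ↑-≢0 c (square-one⇒≢0 ⊝1-sq) , (λ z → ℕ.<⇒≢ (binom-pos k c le) (sym (ℤ.+-injective z))) ]′ (·-≡0 (trans (sym (weight≡binom k c)) eq))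

-- The coefficient of the graph polynomial of K 2p, from the signed count of colourings

module Paintable (p m : ℕ) .{{_ : NonZero p}} (p≡ : p ≡ suc (m * 2)) (m>0 : 0 < m) where
  open Colouring p m p≡ m>0 public

  private
    k′ : ℕ
    k′ = pred k

    k≡ : k ≡ suc k′
    k≡ = trans (cong (λ z → m * 2 + z) p≡) (trans (ℕ.+-suc (m * 2) (m * 2)) (cong suc (sym (trans (cong pred (cong (λ z → m * 2 + z) p≡)) (cong pred (ℕ.+-suc (m * 2) (m * 2)))))))

  slotForm : VP → Slot × Slot → Form {length (edgeList (K n))}
  slotForm v (o , o′) = difference (de v o′) (de v o)

  -- In the line graph the edges at each vertex form a clique, so the graph polynomial is, up to
  -- sign, a product over the vertices of Vandermonde products, taken in slot order.
  forms : List (Form {length (edgeList (K n))})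
  forms = concatMap (λ v → map (slotForm v) (pairs Os)) VPs

  private
    slotForm∈ : ∀ {v vs oo′} → v ∈ vs → oo′ ∈ pairs Os → slotForm v oo′ ∈ concatMap (λ v → map (slotForm v) (pairs Os)) vs
    slotForm∈ (here refl) q = ∈.∈-++⁺ˡ (∈.∈-map⁺ (slotForm _) q)
    slotForm∈ {vs = v ∷ _} (there v∈) q = ∈.∈-++⁺ʳ (map (slotForm v) (pairs Os)) (slotForm∈ v∈ q)

    homogeneous : All (λ ℓ → proj₂ ℓ ≡ 0ℤ) forms
    homogeneous = go VPs
      where
      go : ∀ vs → All (λ ℓ → proj₂ ℓ ≡ 0ℤ) (concatMap (λ v → map (slotForm v) (pairs Os)) vs)
      go []       = []
      go (v ∷ vs) = All.++⁺ (All.map⁺ (All.tabulate (λ _ → refl))) (go vs)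

    complete : ∀ e f → AdjacentEdges (K n) e f → difference e f ∈ forms ⊎ difference f e ∈ forms
    complete e f (e≢f , w , we , wf) =
      let v , v≡w = vtx-surjective w
          o , o≡ = incident-slot v {e} (subst (λ w → Incident (K n) w e) (sym v≡w) we)
          o′ , o′≡ = incident-slot v {f} (subst (λ w → Incident (K n) w f) (sym v≡w) wf)
      in Sum.map (form∈ v o′≡ o≡) (form∈ v o≡ o′≡)
           (∈-pairs (∈Os o′) (∈Os o) (λ eq → e≢f (trans (sym o≡) (trans (cong (de v) (sym eq)) o′≡))))
      where
      form∈ : ∀ v {o o′ e f} → de v o ≡ e → de v o′ ≡ f → (o , o′) ∈ pairs Os → difference f e ∈ forms
      form∈ v refl refl q = slotForm∈ (Enumeration.complete VP-enum v) q

    -- There are p · k edges and every edge is adjacent to 2(k - 1) others, which makes k - 1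
    -- factors per edge: just enough for all exponents to equal k - 1.
    length-forms : length forms ≡ p * k * k′
    length-forms = begin
      length forms                   ≡⟨ length-concatMap _ (length (pairs Os)) VPs (λ v → List.length-map (slotForm v) (pairs Os)) ⟩
      length VPs * length (pairs Os) ≡⟨ cong (_* length (pairs Os)) length-VPs ⟩
      p * 2 * length (pairs Os)      ≡⟨ lem₁ p (length (pairs Os)) ⟩
      p * (length (pairs Os) * 2)    ≡⟨ cong (p *_) (ℕ.+-cancelʳ-≡ k _ _ half) ⟩
      p * (k * k′)                   ≡⟨ ℕ.*-assoc p k k′ ⟨
      p * k * k′                     ∎
      where
      open ≡-Reasoning
      lem₁ : ∀ p l → p * 2 * l ≡ p * (l * 2)
      lem₁ = ℕSolver.solve-∀
      lem₂ : ∀ k k′ → k * suc k′ ≡ k * k′ + k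
      lem₂ = ℕSolver.solve-∀
      half : length (pairs Os) * 2 + k ≡ k * k′ + k
      half = begin
        length (pairs Os) * 2 + k         ≡⟨ cong (λ z → length (pairs Os) * 2 + z) length-Os ⟨
        length (pairs Os) * 2 + length Os ≡⟨ length-pairs Os ⟩
        length Os * length Os             ≡⟨ cong₂ _*_ length-Os (trans length-Os k≡) ⟩
        k * suc k′                        ≡⟨ lem₂ k k′ ⟩
        k * k′ + k                        ∎

    eval-difference : ∀ e f (x : E → ℤ) → evalForm (difference e f) x ≡ x e ⊕ ⊝ x f
    eval-difference e f x = solve 2 (λ a b → (con 1ℤ :* a :+ (con -1ℤ :* b :+ con 0ℤ)) :+ con 0ℤ := a :+ :- b) refl (x e) (x f)

    value : C → ℤ
    value i = + toℕ i

    factors : ∀ c → ∏ forms (λ ℓ → evalForm ℓ (value ∘ Vec.lookup c)) ≡ D′ c · V k ↑ (p * 2)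
    factors c = begin
      ∏ forms (λ ℓ → evalForm ℓ x)
        ≡⟨ ∏-concatMap (λ v → map (slotForm v) (pairs Os)) VPs _ ⟩
      ∏ VPs (λ v → ∏ (map (slotForm v) (pairs Os)) (λ ℓ → evalForm ℓ x))
        ≡⟨ ∏-cong VPs (λ v → trans (∏-map (slotForm v) (pairs Os) _) (trans (∏-cong (pairs Os) (λ (o , o′) → eval-difference (de v o′) (de v o) x)) (sym (pp-map (dif k) (χ c v) Os)))) ⟩
      ∏ VPs (λ v → pp (dif k) (row c v))
        ≡⟨ ∏-cong VPs (λ v → pp-dif k (row c v) (ℕ.≤-reflexive (sym (length-row c v)))) ⟩
      ∏ VPs (λ v → sgnL σC (row c v) · V k)
        ≡⟨ ∏-* VPs _ _ ⟩
      D′ c · ∏ VPs (λ _ → V k)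
        ≡⟨ cong (D′ c ·_) (trans (∏-const VPs (V k)) (cong (V k ↑_) length-VPs)) ⟩
      D′ c · V k ↑ (p * 2) ∎
      where
      open ≡-Reasoning
      x : E → ℤ
      x = value ∘ Vec.lookup c

    ∑-darts : ∀ (g : E → ℤ) → ∑ XV (λ (v , o) → g (de v o)) ≡ ∑ allE g ⊕ ∑ allE g
    ∑-darts g = begin
      ∑ XV (g ∘ uncurry de)                                     ≡⟨ ∑-↭ (g ∘ uncurry de) X₅-↭ ⟩
      ∑ X₅ (g ∘ uncurry de)                                     ≡⟨ ∑-concatMap blockDarts Bs _ ⟩
      ∑ Bs (λ b → ∑ (blockDarts b) (g ∘ uncurry de))            ≡⟨ ∑-cong Bs (λ b → cong (g (eb b) ⊕_) (trans (cong (λ e → g e ⊕ 0ℤ) (de-d₂ b)) (solve 1 (λ a → a :+ con 0ℤ := a) refl (g (eb b))))) ⟩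
      ∑ Bs (λ b → g (eb b) ⊕ g (eb b))                          ≡⟨ ∑-+ Bs _ _ ⟩
      ∑ Bs (g ∘ eb) ⊕ ∑ Bs (g ∘ eb)                             ≡⟨ cong₂ _⊕_ total total ⟩
      ∑ allE g ⊕ ∑ allE g                                       ∎
      where
      open ≡-Reasoning
      total : ∑ Bs (g ∘ eb) ≡ ∑ allE g
      total = trans (sym (∑-map eb Bs g)) (∑-↭ g eb-↭)

    module _ (c : ColVec) (pr : ProperVec c) where
      class : C → List E
      class i = filter (λ e → Vec.lookup c e Fin.≟ i) allE

      row-↭ : ∀ v → row c v ↭ allFin k
      row-↭ v = full⇒↭ (finEnum k) (proper⇒unique c pr v) (ℕ.≤-reflexive (trans (List.length-tabulate id) (sym (length-row c v))))

      -- Double counting of the darts of colour i: one at each of the 2p vertices, and two on each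
      -- edge.
      length-class : ∀ i → length (class i) ≡ p
      length-class i = ℕ.*-cancelʳ-≡ _ _ 2 (trans (double (length (class i))) (ℤ.+-injective (begin
        + (length (class i) + length (class i))
          ≡⟨ trans (pos-⊕ _ _) (sym (cong₂ _⊕_ (∑-⟦⟧ _ allE) (∑-⟦⟧ _ allE))) ⟩
        ∑ allE ind ⊕ ∑ allE ind
          ≡⟨ ∑-darts ind ⟨
        ∑ XV (λ (v , o) → ind (de v o))
          ≡⟨ ∑-× VPs Os _ ⟩
        ∑ VPs (λ v → ∑ Os (λ o → ⟦ χ c v o Fin.≟ i ⟧))
          ≡⟨ ∑-cong VPs (λ v → trans (sym (∑-map (χ c v) Os _)) (trans (∑-↭ _ (row-↭ v))
               (trans (∑-single (Unique.allFin⁺ k) (∈.∈-allFin i) (λ {j} ne → ⟦⟧-no (j Fin.≟ i) ne)) (⟦⟧-yes (i Fin.≟ i) refl)))) ⟩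
        ∑ VPs (λ _ → 1ℤ)
          ≡⟨ trans (∑-const VPs 1ℤ) (trans (·-identityʳ _) (cong +_ length-VPs)) ⟩
        + (p * 2) ∎)))
        where
        open ≡-Reasoning
        ind : E → ℤ
        ind e = ⟦ Vec.lookup c e Fin.≟ i ⟧
        double : ∀ a → a * 2 ≡ a + a
        double = ℕSolver.solve-∀

      ∏-classes : ∀ (f : C → ℤ) → ∏ allE (f ∘ Vec.lookup c) ≡ ∏ (allFin k) (λ i → f i ↑ p)
      ∏-classes f = begin
        ∏ allE (f ∘ Vec.lookup c)
          ≡⟨ ∏-cong allE (λ e → sym (trans (∏-single {f = λ i → only e i} (Unique.allFin⁺ k) (∈.∈-allFin (Vec.lookup c e)) (λ {i} ne → if-no (Vec.lookup c e Fin.≟ i) (ne ∘ sym)))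
                                      (if-yes (Vec.lookup c e Fin.≟ Vec.lookup c e) refl))) ⟩
        ∏ allE (λ e → ∏ (allFin k) (only e))
          ≡⟨ ∏-swap allE (allFin k) _ ⟩
        ∏ (allFin k) (λ i → ∏ allE (λ e → only e i))
          ≡⟨ ∏-cong (allFin k) (λ i → trans (∏-if (λ e → Vec.lookup c e Fin.≟ i) (f i) allE) (cong (f i ↑_) (length-class i))) ⟩
        ∏ (allFin k) (λ i → f i ↑ p) ∎
        where
        open ≡-Reasoning
        only : E → C → ℤ
        only e i = if does (Vec.lookup c e Fin.≟ i) then f i else 1ℤ

    w : C → ℤ
    w i = weight k′ (toℕ i)

    w≢0 : ∀ i → w i ≢ 0ℤ
    w≢0 i = weight≢0 (ℕ.s≤s⁻¹ (subst (toℕ i <_) k≡ (Fin.toℕ<n i)))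

    Ω : ℤ
    Ω = ∏ (allFin k) (λ i → w i ↑ p)

    φ : E → ℕ → ℤ
    φ e j = ∑ (allFin k) (λ i → w i · value i ↑ j)

    -- All colour classes have p edges, so the weights multiply to the same `Ω` for every proper
    -- colouring. Improper colourings vanish on both sides through `D′`.
    Φ≡ : Φ forms φ ≡ Ω · (∑ (allVecs (allFin k) (length (edgeList (K n)))) D′ · V k ↑ (p * 2))
    Φ≡ = trans (Φ-eval (allFin k) value forms (λ _ → w)) (trans (∑-cong vs at) (trans (∑-*ˡ vs Ω _) (cong (Ω ·_) (∑-*ʳ vs _ _))))
      where
      vs = allVecs (allFin k) (length (edgeList (K n)))
      at : ∀ c → ∏ allE (w ∘ Vec.lookup c) · ∏ forms (λ ℓ → evalForm ℓ (value ∘ Vec.lookup c)) ≡ Ω · (D′ c · V k ↑ (p * 2))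
      at c = trans (cong (∏ allE (w ∘ Vec.lookup c) ·_) (factors c)) (by-value (D′ c ℤ.≟ 0ℤ))
        where
        by-value : Dec (D′ c ≡ 0ℤ) → ∏ allE (w ∘ Vec.lookup c) · (D′ c · V k ↑ (p * 2)) ≡ Ω · (D′ c · V k ↑ (p * 2))
        by-value (no nz) = cong (_· (D′ c · V k ↑ (p * 2))) (∏-classes c (D′≢0⇒proper c nz) w)
        by-value (yes z) = trans (vanish _) (sym (vanish _))
          where vanish : ∀ a → a · (D′ c · V k ↑ (p * 2)) ≡ 0ℤ
                vanish a = trans (cong (λ z → a · (z · V k ↑ (p * 2))) z) (solve 2 (λ a b → a :* (con 0ℤ :* b) := con 0ℤ) refl a (V k ↑ (p * 2)))

  paintable : ∑ (allVecs (allFin k) (length (edgeList (K n)))) D′ ≢ 0ℤ → EdgePaintable (K n) k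
  paintable nz =
    let β , coefficient , supported = monomial forms φ (λ z → Sum.[ ∏-≢0 (allFin k) (λ {i} _ → ↑-≢0 p (w≢0 i)) , Sum.[ nz , ↑-≢0 (p * 2) (V≢0 k) ]′ ∘ ·-≡0 ]′ (·-≡0 (trans (sym Φ≡) z)))
    in alonTarsi k β coefficient (λ e → subst (β e <_) (sym k≡) (s≤s (bounded β coefficient (large β supported) e)))
    where
    open AlonTarsi (K n) forms homogeneous complete
    large : ∀ β → (∀ e → φ e (β e) ≢ 0ℤ) → ∀ e → k′ ≤ β e
    large β supported e = ℕ.≮⇒≥ (λ lt → supported e (trans (∑-weight k≡ (β e)) (fd-power-low k′ (β e) 0 lt)))
    bounded : ∀ β → Φ forms (δ β) ≢ 0ℤ → (∀ e → k′ ≤ β e) → ∀ e → β e ≤ k′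
    bounded β nz′ large e = ℕ.≮⇒≥ (λ lt → nz′ (Φ-low forms (λ e j lt → ⟦⟧-no (j ℕ.≟ β e) (ℕ.<⇒≢ lt))
      (subst (_< Nsum β) (trans (Nsum-const {length (edgeList (K n))} k′) (trans (cong (_* k′) length-allE) (sym length-forms))) (Nsum-strict e large lt))))

-- One-factorizations and proper colourings

AllPairs-resp-↭ : ∀ {X : Set} {R : X → X → Set} → (∀ {x y} → R x y → R y x) → ∀ {xs ys : List X} → xs ↭ ys → AllPairs R xs → AllPairs R ys
AllPairs-resp-↭ sy ↭.refl         r                        = r
AllPairs-resp-↭ sy (↭.prep x p)   (rx ∷ r)                 = ↭.All-resp-↭ p rx ∷ AllPairs-resp-↭ sy p r
AllPairs-resp-↭ sy (↭.swap x y p) ((rxy ∷ rx) ∷ (ry ∷ r)) = (sy rxy ∷ ↭.All-resp-↭ p ry) ∷ (↭.All-resp-↭ p rx ∷ AllPairs-resp-↭ sy p r)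
AllPairs-resp-↭ sy (↭.trans p q)  r                        = AllPairs-resp-↭ sy q (AllPairs-resp-↭ sy p r)

toList-tabulate : ∀ {X : Set} {k} (f : Fin k → X) → Vec.toList (Vec.tabulate f) ≡ map f (allFin k)
toList-tabulate f = trans (toList≡map-lookup (Vec.tabulate f)) (List.map-cong (Vec.lookup∘tabulate f) (allFin _))

sumℤ≡∑ : ∀ {X : Set} (f : X → ℤ) xs → sumℤ (map f xs) ≡ ∑ xs f
sumℤ≡∑ f []       = refl
sumℤ≡∑ f (x ∷ xs) = trans (+≡⊕ (f x) _) (cong (f x ⊕_) (sumℤ≡∑ f xs))

productℤ≡∏ : ∀ {X : Set} (f : X → ℤ) xs → productℤ (map f xs) ≡ ∏ xs f
productℤ≡∏ f []       = refl
productℤ≡∏ f (x ∷ xs) = trans (*≡· (f x) _) (cong (f x ·_) (productℤ≡∏ f xs))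

^≡↑ : ∀ a n → a ℤ.^ n ≡ a ↑ n
^≡↑ a zero    = refl
^≡↑ a (suc n) = trans (*≡· a _) (cong (a ·_) (^≡↑ a n))

∑-filter-⟦⟧ : ∀ {X : Set} {P : X → Set} (P? : ∀ x → Dec (P x)) (f : X → ℤ) xs → ∑ (filter P? xs) f ≡ ∑ xs (λ x → ⟦ P? x ⟧ · f x)
∑-filter-⟦⟧ P? f []       = refl
∑-filter-⟦⟧ P? f (x ∷ xs) with P? x
... | yes _ = cong₂ _⊕_ (sym (·-identityˡ (f x))) (∑-filter-⟦⟧ P? f xs)
... | no _  = trans (∑-filter-⟦⟧ P? f xs) (sym (trans (cong (_⊕ rest) (·-zeroˡ (f x))) (⊕-identityˡ rest)))
  where rest = ∑ xs (λ x → ⟦ P? x ⟧ · f x)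

∈-allSubsets : ∀ {N} (M : Subset N) → M ∈ allSubsets N
∈-allSubsets []                    = here refl
∈-allSubsets {suc N} (inside ∷ M)  = ∈.∈-++⁺ˡ (∈.∈-map⁺ (inside ∷_) (∈-allSubsets M))
∈-allSubsets {suc N} (outside ∷ M) = ∈.∈-++⁺ʳ (map (inside ∷_) (allSubsets N)) (∈.∈-map⁺ (outside ∷_) (∈-allSubsets M))

allSubsets-unique : ∀ N → Unique (allSubsets N)
allSubsets-unique zero    = [] ∷ []
allSubsets-unique (suc N) = Unique.++⁺ (Unique.map⁺ Vec.∷-injectiveʳ (allSubsets-unique N)) (Unique.map⁺ Vec.∷-injectiveʳ (allSubsets-unique N))
  λ (M∈ , M∈′) → distinct (∈.∈-map⁻ (inside ∷_) M∈) (∈.∈-map⁻ (outside ∷_) M∈′)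
  where
  distinct : ∀ {M : Subset (suc N)} → (∃ λ A → A ∈ allSubsets N × M ≡ inside ∷ A) → (∃ λ A → A ∈ allSubsets N × M ≡ outside ∷ A) → ⊥
  distinct (_ , _ , refl) (_ , _ , ())

-- Two edges cross in one of two orders, recorded by the two decisions. The six ways in which a < b
-- and x < y can interleave are checked in turn.
cross-sign : ∀ {a b x y} {P P′ : Set} (d : Dec P) (d′ : Dec P′) → a < b → x < y → a ≢ x → a ≢ y → b ≢ x → b ≢ y →
             (P → a < x × x < b × b < y) → (a < x × x < b × b < y → P) → (P′ → x < a × a < y × y < b) → (x < a × a < y × y < b → P′) →
             (if does d then -1ℤ else 1ℤ) · (if does d′ then -1ℤ else 1ℤ) ≡ sg a x · sg a y · sg b x · sg b y
cross-sign {a} {b} {x} {y} d d′ a<b x<y a≢x a≢y b≢x b≢y from to from′ to′ with ℕ.<-cmp a x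
... | tri≈ _ eq _ = contradiction eq a≢x
... | tri< a<x _ _ with ℕ.<-cmp b x
...   | tri≈ _ eq _ = contradiction eq b≢x
...   | tri< b<x _ _ = trans (cong₂ _·_ (if-no d (λ pf → ℕ.<-asym b<x (proj₁ (proj₂ (from pf))))) (if-no d′ (λ pf → ℕ.<-asym a<x (proj₁ (from′ pf)))))
  (trans (solve 0 (con 1ℤ :* con 1ℤ := con 1ℤ :* con 1ℤ :* con 1ℤ :* con 1ℤ) refl)
    (sym (cong₂ _·_ (cong₂ _·_ (cong₂ _·_ (sg-< a<x) (sg-< (ℕ.<-trans a<x x<y))) (sg-< b<x)) (sg-< (ℕ.<-trans b<x x<y)))))
...   | tri> _ _ x<b with ℕ.<-cmp b y
...     | tri≈ _ eq _ = contradiction eq b≢y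
...     | tri< b<y _ _ = trans (cong₂ _·_ (if-yes d (to (a<x , x<b , b<y))) (if-no d′ (λ pf → ℕ.<-asym a<x (proj₁ (from′ pf)))))
  (trans (solve 0 (con -1ℤ :* con 1ℤ := con 1ℤ :* con 1ℤ :* con -1ℤ :* con 1ℤ) refl)
    (sym (cong₂ _·_ (cong₂ _·_ (cong₂ _·_ (sg-< a<x) (sg-< (ℕ.<-trans a<x x<y))) (sg-> x<b)) (sg-< b<y))))
...     | tri> _ _ y<b = trans (cong₂ _·_ (if-no d (λ pf → ℕ.<-asym y<b (proj₂ (proj₂ (from pf))))) (if-no d′ (λ pf → ℕ.<-asym a<x (proj₁ (from′ pf)))))
  (trans (solve 0 (con 1ℤ :* con 1ℤ := con 1ℤ :* con 1ℤ :* con -1ℤ :* con -1ℤ) refl)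
    (sym (cong₂ _·_ (cong₂ _·_ (cong₂ _·_ (sg-< a<x) (sg-< (ℕ.<-trans a<x x<y))) (sg-> x<b)) (sg-> y<b))))
cross-sign {a} {b} {x} {y} d d′ a<b x<y a≢x a≢y b≢x b≢y from to from′ to′ | tri> _ _ x<a with ℕ.<-cmp a y
...   | tri≈ _ eq _ = contradiction eq a≢y
...   | tri> _ _ y<a = trans (cong₂ _·_ (if-no d (λ pf → ℕ.<-asym x<a (proj₁ (from pf)))) (if-no d′ (λ pf → ℕ.<-asym y<a (proj₁ (proj₂ (from′ pf))))))
  (trans (solve 0 (con 1ℤ :* con 1ℤ := con -1ℤ :* con -1ℤ :* con -1ℤ :* con -1ℤ) refl)
    (sym (cong₂ _·_ (cong₂ _·_ (cong₂ _·_ (sg-> x<a) (sg-> y<a)) (sg-> (ℕ.<-trans x<a a<b))) (sg-> (ℕ.<-trans y<a a<b)))))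
...   | tri< a<y _ _ with ℕ.<-cmp b y
...     | tri≈ _ eq _ = contradiction eq b≢y
...     | tri< b<y _ _ = trans (cong₂ _·_ (if-no d (λ pf → ℕ.<-asym x<a (proj₁ (from pf)))) (if-no d′ (λ pf → ℕ.<-asym b<y (proj₂ (proj₂ (from′ pf))))))
  (trans (solve 0 (con 1ℤ :* con 1ℤ := con -1ℤ :* con 1ℤ :* con -1ℤ :* con 1ℤ) refl)
    (sym (cong₂ _·_ (cong₂ _·_ (cong₂ _·_ (sg-> x<a) (sg-< a<y)) (sg-> (ℕ.<-trans x<a a<b))) (sg-< b<y))))
...     | tri> _ _ y<b = trans (cong₂ _·_ (if-no d (λ pf → ℕ.<-asym x<a (proj₁ (from pf)))) (if-yes d′ (to′ (x<a , a<y , y<b))))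
  (trans (solve 0 (con 1ℤ :* con -1ℤ := con -1ℤ :* con 1ℤ :* con -1ℤ :* con -1ℤ) refl)
    (sym (cong₂ _·_ (cong₂ _·_ (cong₂ _·_ (sg-> x<a) (sg-< a<y)) (sg-> (ℕ.<-trans x<a a<b))) (sg-> y<b))))

module Factorizations (p m : ℕ) .{{_ : NonZero p}} (p≡ : p ≡ suc (m * 2)) (m>0 : 0 < m) where
  open Signs p m p≡ m>0 public

  private
    G : Graph
    G = K n

    ES : Set
    ES = EdgeSet G

    OF : List ES → Set
    OF = OneFactorization G

    OF? : ∀ l → Dec (OF l)
    OF? = oneFactorization? G

    signed : List ES → ℤ
    signed l = ⟦ OF? l ⟧ · εF G l

    disjoint-sym : ∀ {M N : ES} → Subset.Empty (M Subset.∩ N) → Subset.Empty (N Subset.∩ M)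
    disjoint-sym {M} {N} empty (x , x∈) = empty (x , subst (x Subset.∈_) (Subset.∩-comm N M) x∈)

    OF-↭ : ∀ {l l′} → l ↭ l′ → OF l → OF l′
    OF-↭ perm (pms , ne , dis , cov) =
      ↭.All-resp-↭ perm pms , ↭.All-resp-↭ perm ne , AllPairs-resp-↭ (λ {M} {N} → disjoint-sym {M} {N}) perm dis , λ e → ↭.Any-resp-↭ perm (cov e)

    εF≡∏ : ∀ l → εF G l ≡ ∏ l (ε G)
    εF≡∏ = productℤ≡∏ (ε G)

    signed-alternating : Alternating signed
    signed-alternating .Alternating.symmetric {l} {l′} perm = cong₂ _·_ (⟦⟧-cong (OF? l) (OF? l′) (OF-↭ perm) (OF-↭ (↭-sym perm)))
      (trans (εF≡∏ l) (trans (∏-↭ (ε G) perm) (sym (εF≡∏ l′))))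
    signed-alternating .Alternating.repeated M l = trans (cong (_· εF G (M ∷ M ∷ l)) (⟦⟧-no (OF? (M ∷ M ∷ l)) impossible)) (·-zeroˡ _)
      where
      impossible : ¬ OF (M ∷ M ∷ l)
      impossible (_ , (x , x∈) ∷ _ , (empty ∷ _) ∷ _ , _) = empty (x , Subset.x∈p∩q⁺ (x∈ , x∈))

    cover-once : ∀ {l : List ES} {e} → AllPairs (λ M N → Subset.Empty (M Subset.∩ N)) l → Any (e Subset.∈_) l → ∑ l (λ M → ⟦ e Subset.∈? M ⟧) ≡ 1ℤ
    cover-once {M ∷ l} {e} (dis ∷ _) (here e∈) = trans (cong₂ _⊕_ (⟦⟧-yes (e Subset.∈? M) e∈)
      (∑-zero l (λ {N} N∈ → ⟦⟧-no (e Subset.∈? N) (λ e∈′ → All.lookup dis N∈ (e , Subset.x∈p∩q⁺ (e∈ , e∈′)))))) (⊕-identityʳ 1ℤ)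
    cover-once {M ∷ l} {e} (dis ∷ ds) (there any) = trans (cong₂ _⊕_ (⟦⟧-no (e Subset.∈? M) (λ e∈ →
      let N , N∈ , e∈′ = find any in All.lookup dis N∈ (e , Subset.x∈p∩q⁺ (e∈ , e∈′)))) (cover-once ds any)) (⊕-identityˡ 1ℤ)

    v₀ : VP
    v₀ = zero , 0′ p

    -- Double counting at one vertex: every factor contains one of its k edges, and every one of
    -- these edges lies in one factor.
    OF-length : ∀ {l} → OF l → length l ≡ k
    OF-length {l} (pms , _ , dis , cov) = ℤ.+-injective (begin
      + length l
        ≡⟨ trans (sym (·-identityʳ _)) (sym (∑-const l 1ℤ)) ⟩
      ∑ l (λ _ → 1ℤ)
        ≡⟨ ∑-cong∈ l (λ M∈ → sym (once (All.lookup pms M∈))) ⟩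
      ∑ l (λ M → ∑ Os (λ o → ⟦ de v₀ o Subset.∈? M ⟧))
        ≡⟨ ∑-swap l Os _ ⟩
      ∑ Os (λ o → ∑ l (λ M → ⟦ de v₀ o Subset.∈? M ⟧))
        ≡⟨ ∑-cong Os (λ o → cover-once dis (cov (de v₀ o))) ⟩
      ∑ Os (λ _ → 1ℤ)
        ≡⟨ trans (∑-const Os 1ℤ) (trans (·-identityʳ _) (cong +_ length-Os)) ⟩
      + k ∎)
      where
      open ≡-Reasoning
      once : ∀ {M} → PerfectMatching G M → ∑ Os (λ o → ⟦ de v₀ o Subset.∈? M ⟧) ≡ 1ℤ
      once {M} (matching , covers) =
        let e , e∈ , inc = covers (vtx v₀)
            o , o≡ = incident-slot v₀ {e} inc
            o∈ = subst (Subset._∈ M) (sym o≡) e∈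
        in trans (∑-single Os-unique (∈Os o) (λ {o′} ne → ⟦⟧-no (de v₀ o′ Subset.∈? M) (λ o′∈ → matching _ _ o′∈ o∈ (de-adjacent v₀ ne))))
             (⟦⟧-yes (de v₀ o Subset.∈? M) o∈)

    -- Besides ordering the factors, this lets the entries range over all edge sets: the weight
    -- vanishes unless they form a one-factorization. The tuples can then be compared with the lists
    -- of colour classes.
    S≡tuples : + (k !) · S n ≡ tuples (allSubsets (length (edgeList G))) k signed
    S≡tuples = begin
      + (k !) · sumℤ (map (εF G) (filter OF? (sublists PM)))
        ≡⟨ cong (+ (k !) ·_) (trans (sumℤ≡∑ (εF G) (filter OF? (sublists PM))) (∑-filter-⟦⟧ OF? (εF G) (sublists PM))) ⟩
      + (k !) · ∑ (sublists PM) signed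
        ≡⟨ cong (+ (k !) ·_) (∑-cong (sublists PM) (λ l → sized l (length l ℕ.≟ k))) ⟩
      + (k !) · ∑ (sublists PM) (λ l → ⟦ length l ℕ.≟ k ⟧ · signed l)
        ≡⟨ tuples≡!·sublists signed-alternating PM k ⟨
      tuples PM k signed
        ≡⟨ tuples-filter (perfectMatching? G) (allSubsets (length (edgeList G))) k signed (λ l _ any → not-OF l (λ (pms , _) →
             let M , M∈ , ¬pm = find any in ¬pm (All.lookup pms M∈))) ⟨
      tuples (allSubsets (length (edgeList G))) k signed ∎
      where
      open ≡-Reasoning
      PM = perfectMatchings G
      not-OF : ∀ l → ¬ OF l → signed l ≡ 0ℤ
      not-OF l ¬of = trans (cong (_· εF G l) (⟦⟧-no (OF? l) ¬of)) (·-zeroˡ _)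
      sized : ∀ l (d : Dec (length l ≡ k)) → signed l ≡ ⟦ d ⟧ · signed l
      sized l (yes _) = sym (·-identityˡ _)
      sized l (no ne) = trans (not-OF l (ne ∘ OF-length)) (sym (·-zeroˡ _))

  class : ColVec → C → ES
  class c i = Vec.tabulate (λ e → does (Vec.lookup c e Fin.≟ i))

  classes : ColVec → Vec ES k
  classes c = Vec.tabulate (class c)

  private
    ∈-class : ∀ c {e i} → Vec.lookup c e ≡ i → e Subset.∈ class c i
    ∈-class c {e} {i} eq = Vec.lookup⇒[]= e (class c i) (trans (Vec.lookup∘tabulate _ e) (dec-true (Vec.lookup c e Fin.≟ i) eq))

    class-∈ : ∀ c {e i} → e Subset.∈ class c i → Vec.lookup c e ≡ i
    class-∈ c {e} {i} e∈ = does-true (Vec.lookup c e Fin.≟ i) (trans (sym (Vec.lookup∘tabulate _ e)) (Vec.[]=⇒lookup e∈))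

    classes-injective : ∀ {c c′} → classes c ≡ classes c′ → c ≡ c′
    classes-injective {c} {c′} eq = vec-ext (λ e → sym (class-∈ c′ (subst (e Subset.∈_)
      (trans (sym (Vec.lookup∘tabulate (class c) (Vec.lookup c e))) (trans (cong (λ v → Vec.lookup v (Vec.lookup c e)) eq) (Vec.lookup∘tabulate (class c′) (Vec.lookup c e))))
      (∈-class c refl))))

    proper⇒OF : ∀ c → ProperVec c → OF (map (class c) (allFin k))
    proper⇒OF c pr =
      All.map⁺ (All.tabulate (λ {i} _ → (λ e f e∈ f∈ adj → pr e f adj (trans (class-∈ c e∈) (sym (class-∈ c f∈)))) , covers i)) ,
      All.map⁺ (All.tabulate (λ {i} _ → let e , e∈ , _ = covers i (vtx v₀) in e , e∈)) ,
      AllPairs.map⁺ (AllPairs.map (λ {i} {j} i≢j (e , e∈) → let e∈i , e∈j = Subset.x∈p∩q⁻ (class c i) (class c j) e∈ in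
        i≢j (trans (sym (class-∈ c e∈i)) (class-∈ c e∈j))) (Unique.allFin⁺ k)) ,
      λ e → Any.map⁺ (lose (∈.∈-allFin (Vec.lookup c e)) (∈-class c refl))
      where
      covers : ∀ i v → ∃ λ e → e Subset.∈ class c i × Incident G v e
      covers i w =
        let v , v≡w = vtx-surjective w
            perm = full⇒↭ (finEnum k) (proper⇒unique c pr v) (ℕ.≤-reflexive (trans (List.length-tabulate id) (sym (length-row c v))))
            o , _ , eq = ∈.∈-map⁻ (χ c v) (↭.∈-resp-↭ (↭-sym perm) (∈.∈-allFin i))
        in de v o , ∈-class c (sym eq) , subst (λ w → Incident G w (de v o)) v≡w (incident-view n (de-view v o))

    OF⇒proper : ∀ c → OF (map (class c) (allFin k)) → ProperVec c
    OF⇒proper c (pms , _) e f adj eq = proj₁ (All.lookup (All.map⁻ pms) (∈.∈-allFin (Vec.lookup c e))) e f (∈-class c refl) (∈-class c (sym eq)) adj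

    crossing? : ∀ M (ef : E × E) → Dec (proj₁ ef Subset.∈ M × proj₂ ef Subset.∈ M × Crosses G (proj₁ ef) (proj₂ ef))
    crossing? M (e , f) = (e Subset.∈? M) ×-dec ((f Subset.∈? M) ×-dec crosses? G e f)

    crossing : ES → E → E → ℤ
    crossing M e f = if does (crossing? M (e , f)) then -1ℤ else 1ℤ

    ε≡∏ : ∀ M → ε G M ≡ ∏ allE (λ e → ∏ allE (crossing M e))
    ε≡∏ M = trans (^≡↑ -1ℤ (cr G M)) (trans (sym (∏-if (crossing? M) -1ℤ (cartesianProduct allE allE))) (∏-× allE allE _))

    module _ (c : ColVec) (pr : ProperVec c) where
      own : E → E → ℤ
      own e f = crossing (class c (Vec.lookup c e)) e f

      own-one : ∀ e f → ¬ (f Subset.∈ class c (Vec.lookup c e) × Crosses G e f) → own e f ≡ 1ℤ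
      own-one e f none = if-no (crossing? (class c (Vec.lookup c e)) (e , f)) (none ∘ proj₂)

      distinct-ends : ∀ {e f} → e ≢ f → Vec.lookup c e ≡ Vec.lookup c f → ∀ {u v} → Incident G u e → Incident G v f → toℕ u ≢ toℕ v
      distinct-ends {e} {f} e≢f same {u} ue vf eq = pr e f (e≢f , u , ue , subst (λ v → Incident G v f) (sym (Fin.toℕ-injective eq)) vf) same

      own² : ∀ {e f} → e ≢ f → own e f · own f e ≡ q c e f
      own² {e} {f} e≢f = by-cases (Vec.lookup c e Fin.≟ Vec.lookup c f)
        where
        by-cases : Dec (Vec.lookup c e ≡ Vec.lookup c f) → own e f · own f e ≡ q c e f
        by-cases (no ne) = trans (cong₂ _·_ (own-one e f (λ (f∈ , _) → ne (sym (class-∈ c f∈)))) (own-one f e (λ (e∈ , _) → ne (class-∈ c e∈))))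
          (trans (·-identityʳ 1ℤ) (sym (if-no (Vec.lookup c e Fin.≟ Vec.lookup c f) ne)))
        by-cases (yes eq) = trans
          (cross-sign (crossing? (class c (Vec.lookup c e)) (e , f)) (crossing? (class c (Vec.lookup c f)) (f , e)) (lo<hi n e) (lo<hi n f)
            (distinct-ends e≢f eq (inj₁ refl) (inj₁ refl)) (distinct-ends e≢f eq (inj₁ refl) (inj₂ refl))
            (distinct-ends e≢f eq (inj₂ refl) (inj₁ refl)) (distinct-ends e≢f eq (inj₂ refl) (inj₂ refl))
            (proj₂ ∘ proj₂) (λ cross → ∈-class c refl , ∈-class c (sym eq) , cross)
            (proj₂ ∘ proj₂) (λ cross → ∈-class c refl , ∈-class c eq , cross))
          (sym (if-yes (Vec.lookup c e Fin.≟ Vec.lookup c f) eq))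

      -- An edge lies only in the class of its own colour, so the product over classes collapses.
      -- The two orders of each pair of edges then combine to one factor of `Q`.
      εF≡Q : εF G (map (class c) (allFin k)) ≡ Q c
      εF≡Q = begin
        εF G (map (class c) (allFin k))
          ≡⟨ trans (εF≡∏ (map (class c) (allFin k))) (trans (∏-map (class c) (allFin k) (ε G)) (∏-cong (allFin k) (λ i → ε≡∏ (class c i)))) ⟩
        ∏ (allFin k) (λ i → ∏ allE (λ e → ∏ allE (crossing (class c i) e)))
          ≡⟨ trans (∏-swap (allFin k) allE _) (∏-cong allE (λ e → ∏-single (Unique.allFin⁺ k) (∈.∈-allFin (Vec.lookup c e)) (λ {i} ne →
               ∏-one allE (λ {f} _ → if-no (crossing? (class c i) (e , f)) (λ (e∈ , _) → ne (sym (class-∈ c e∈))))))) ⟩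
        ∏ allE (λ e → ∏ allE (own e))
          ≡⟨ ∏∏≡pp own allE ⟩
        ∏ allE (λ e → own e e) · pp (λ e f → own e f · own f e) allE
          ≡⟨ cong₂ _·_ (∏-one allE (λ {e} _ → own-one e e (λ (_ , cross) → ℕ.<-irrefl refl (proj₁ cross)))) (pp-cong-unique (Unique.allFin⁺ _) own²) ⟩
        1ℤ · Q c
          ≡⟨ ·-identityˡ _ ⟩
        Q c ∎
        where open ≡-Reasoning

    signed-classes : ∀ c → signed (Vec.toList (classes c)) ≡ D′ c
    signed-classes c = trans (cong signed (toList-tabulate (class c))) (by-cases (D′ c ℤ.≟ 0ℤ))
      where
      by-cases : Dec (D′ c ≡ 0ℤ) → signed (map (class c) (allFin k)) ≡ D′ c
      by-cases (no nz) = let pr = D′≢0⇒proper c nz in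
        trans (cong₂ _·_ (⟦⟧-yes (OF? (map (class c) (allFin k))) (proper⇒OF c pr)) (trans (εF≡Q c pr) (sym (D′≡Q c pr)))) (·-identityˡ _)
      by-cases (yes z) = trans (cong (_· εF G (map (class c) (allFin k))) (⟦⟧-no (OF? (map (class c) (allFin k))) (λ of →
        square-one⇒≢0 (D′-sq c (OF⇒proper c of)) z))) (trans (·-zeroˡ _) (sym z))

    ∈-vec : ∀ {k} (l : Vec ES k) {e} → Any (e Subset.∈_) (Vec.toList l) → ∃ λ i → e Subset.∈ Vec.lookup l i
    ∈-vec (M ∷ l) (here e∈)   = zero , e∈
    ∈-vec (M ∷ l) (there any) = let i , e∈ = ∈-vec l any in suc i , e∈

    vec-∈ : ∀ {k} (l : Vec ES k) i → Vec.lookup l i ∈ Vec.toList l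
    vec-∈ (M ∷ l) zero    = here refl
    vec-∈ (M ∷ l) (suc i) = there (vec-∈ l i)

    disjoint-vec : ∀ {k} (l : Vec ES k) {e} → AllPairs (λ M N → Subset.Empty (M Subset.∩ N)) (Vec.toList l) →
                   ∀ i j → e Subset.∈ Vec.lookup l i → e Subset.∈ Vec.lookup l j → i ≡ j
    disjoint-vec (M ∷ l) (dis ∷ _)  zero    zero    _   _   = refl
    disjoint-vec (M ∷ l) (dis ∷ _)  zero    (suc j) e∈  e∈′ = contradiction (_ , Subset.x∈p∩q⁺ (e∈ , e∈′)) (All.lookup dis (vec-∈ l j))
    disjoint-vec (M ∷ l) (dis ∷ _)  (suc i) zero    e∈  e∈′ = contradiction (_ , Subset.x∈p∩q⁺ (e∈′ , e∈)) (All.lookup dis (vec-∈ l i))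
    disjoint-vec (M ∷ l) (_ ∷ ds)   (suc i) (suc j) e∈  e∈′ = cong suc (disjoint-vec l ds i j e∈ e∈′)

    OF⇒classes : ∀ l → OF (Vec.toList l) → ∃ λ c → classes c ≡ l
    OF⇒classes l (_ , _ , dis , cov) = c , vec-ext (λ i → trans (Vec.lookup∘tabulate (class c) i)
        (Subset.⊆-antisym (λ {e} e∈ → subst (λ i → e Subset.∈ Vec.lookup l i) (trans (sym (lookup-c e)) (class-∈ c e∈)) (proj₂ (colour-of e)))
                          (λ {e} e∈ → ∈-class c (trans (lookup-c e) (disjoint-vec l dis _ i (proj₂ (colour-of e)) e∈)))))
      where
      colour-of : ∀ e → ∃ λ i → e Subset.∈ Vec.lookup l i
      colour-of e = ∈-vec l (cov e)
      c : ColVec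
      c = Vec.tabulate (proj₁ ∘ colour-of)
      lookup-c : ∀ e → Vec.lookup c e ≡ proj₁ (colour-of e)
      lookup-c = Vec.lookup∘tabulate (proj₁ ∘ colour-of)

  k!·S≡ : + (k !) · S n ≡ ∑ (allVecs (allFin k) (length (edgeList (K n)))) D′
  k!·S≡ = begin
    + (k !) · S n
      ≡⟨ S≡tuples ⟩
    tuples subsets k signed
      ≡⟨ tuples≡∑ subsets k signed ⟩
    ∑ (allVecs subsets k) (signed ∘ Vec.toList)
      ≡⟨ ∑-inj (Vec.≡-dec (Vec.≡-dec Bool._≟_)) (allVecs-unique _ (Unique.allFin⁺ k)) (λ c → ∈-allVecs c (λ _ → ∈.∈-allFin _)) (allVecs-unique k (allSubsets-unique _))
           classes-injective (λ c _ → ∈-allVecs (classes c) (λ _ → ∈-allSubsets _)) (λ {l} _ nz → OF⇒classes l (by-cases l nz (OF? (Vec.toList l)) refl)) ⟩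
    ∑ (allVecs (allFin k) (length (edgeList (K n)))) (signed ∘ Vec.toList ∘ classes)
      ≡⟨ ∑-cong (allVecs (allFin k) (length (edgeList (K n)))) signed-classes ⟩
    ∑ (allVecs (allFin k) (length (edgeList (K n)))) D′ ∎
    where
    open ≡-Reasoning
    subsets = allSubsets (length (edgeList G))
    by-cases : ∀ (l : Vec ES k) → signed (Vec.toList l) ≢ 0ℤ → (d : Dec (OF (Vec.toList l))) → OF? (Vec.toList l) ≡ d → OF (Vec.toList l)
    by-cases l nz (yes of) _  = of
    by-cases l nz (no ¬of) eq = contradiction (trans (cong (λ d → ⟦ d ⟧ · εF G (Vec.toList l)) eq) (·-zeroˡ _)) nz

-- From the number of fixed colourings to the residue of S

module _ {p : ℕ} .{{_ : NonZero p}} (prime : Prime p) where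
  ⊝1≢0 : ¬ (⊝ 1ℤ ≡ 0ℤ ⟨mod + p ⟩)
  ⊝1≢0 eq = small-mod (s≤s z≤n) (ℕ.nonTrivial⇒n>1 p {{Prime.prime⇒nonTrivial prime}}) (mod-trans (≡⇒mod (solve 0 (con 1ℤ := :- (:- con 1ℤ)) refl)) (mod-trans (mod-⊝ eq) (≡⇒mod (solve 0 (:- con 0ℤ := con 0ℤ) refl))))

  private
    x = + p

    divide : ∀ {a} → a ≡ 0ℤ ⟨mod x ⟩ → ∃ λ q → a ≡ q · x
    divide (by q eq) = q , trans eq (⊕-identityˡ _)

    multiple : ∀ {a q} → a ≡ q · x → a ≡ 0ℤ ⟨mod x ⟩
    multiple {q = q} eq = by q (trans eq (sym (⊕-identityˡ _)))

    cancel : ∀ {a b} → x · a ≡ x · b → a ≡ b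
    cancel {a} {b} eq = Sum.[ (λ z → contradiction (ℤ.+-injective z) (ℕ.≢-nonZero⁻¹ p)) , (λ d → trans (solve 2 (λ a b → a := (a :+ :- b) :+ b) refl a b) (trans (cong (_⊕ b) d) (⊕-identityˡ b))) ]′
      (·-≡0 (trans (solve 3 (λ x a b → x :* (a :+ :- b) := x :* a :+ :- (x :* b)) refl x a b) (trans (cong (_⊕ ⊝ (x · b)) eq) (solve 1 (λ a → a :+ :- a := con 0ℤ) refl (x · b)))))

    factor : ∀ {a b} → a ≡ ⊝ 1ℤ ⟨mod x ⟩ → a · b ≡ 0ℤ ⟨mod x ⟩ → ∃ λ q → b ≡ q · x
    factor unit eq = Sum.[ (λ z → contradiction (mod-trans (mod-sym unit) z) ⊝1≢0) , divide ]′ (mod-euclid prime eq)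

  -- With x = p, R · (x · F) plays the part of (2p-1)! and W that of the squared starter count.
  -- After one x and the unit F are removed, T = R · S ⊕ c · x · W is divisible by x². This first
  -- gives S = s · x, and then R · s ≡ - c · W modulo x, where R and c are -1 and W is 1.
  residue-of-count : ∀ {R F S W} → R ≡ ⊝ 1ℤ ⟨mod x ⟩ → F ≡ ⊝ 1ℤ ⟨mod x ⟩ → W ≡ 1ℤ ⟨mod x ⟩ →
    R · (x · F) · S ⊕ (x ⊕ ⊝ 1ℤ) · ((x ⊕ ⊝ 1ℤ) · (x ⊕ ⊝ 1ℤ)) · (x · (x · (F · W))) ≡ 0ℤ ⟨mod + (p * (p * p)) ⟩ →
    ∃ λ s → (S ≡ s · x) × (s ≡ ⊝ 1ℤ ⟨mod x ⟩)
  residue-of-count {R} {F} {S} {W} R≡ F≡ W≡ (by q eq) =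
    let t , T≡ = factor {F} {T} F≡ (multiple {q = q · x} (trans FT (sym (·-assoc q x x))))
        t′ , t≡ = factor {F} {t} F≡ (multiple {q = q} (cancel (trans (trans (lem₁ x F t) (cong (F ·_) (sym T≡))) (trans FT (lem₂ q x)))))
        RS : R · S ≡ (t′ · x ⊕ ⊝ (c · W)) · x
        RS = trans (lem₃ (R · S) c x W) (trans (cong (_⊕ ⊝ (c · x · W)) (trans T≡ (cong (_· x) t≡))) (lem₄ t′ x c W))
        s , S≡ = factor {R} {S} R≡ (multiple RS)
        Rs : R · s ≡ t′ · x ⊕ ⊝ (c · W)
        Rs = cancel (trans (lem₁ x R s) (trans (cong (R ·_) (sym S≡)) (trans RS (·-comm _ x))))
    in s , S≡ , mod-trans (≡⇒mod (solve 1 (λ s → s := :- (:- con 1ℤ :* s)) refl s)) (mod-trans (mod-⊝ (mod-trans (mod-· (mod-sym R≡) mod-refl) (≡⇒mod Rs)))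
         (mod-trans (by (⊝ t′) (solve 4 (λ t x c w → :- (t :* x :+ :- (c :* w)) := c :* w :+ :- t :* x) refl t′ x c W))
           (mod-trans (mod-· (mod-· x-1 (mod-· x-1 x-1)) W≡) (≡⇒mod (solve 0 (:- con 1ℤ :* (:- con 1ℤ :* :- con 1ℤ) :* con 1ℤ := :- con 1ℤ) refl)))))
    where
    c T : ℤ
    c = (x ⊕ ⊝ 1ℤ) · ((x ⊕ ⊝ 1ℤ) · (x ⊕ ⊝ 1ℤ))
    T = R · S ⊕ c · x · W
    x-1 : x ⊕ ⊝ 1ℤ ≡ ⊝ 1ℤ ⟨mod x ⟩
    x-1 = by 1ℤ (solve 1 (λ x → x :+ :- con 1ℤ := :- con 1ℤ :+ con 1ℤ :* x) refl x)
    FT : F · T ≡ q · (x · x)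
    FT = cancel (trans (solve 6 (λ x R F S c W → x :* (F :* (R :* S :+ c :* x :* W)) := R :* (x :* F) :* S :+ c :* (x :* (x :* (F :* W)))) refl x R F S c W)
      (trans eq (trans (cong (λ z → 0ℤ ⊕ q · z) (trans (pos-· p (p * p)) (cong (x ·_) (pos-· p p)))) (solve 2 (λ q x → con 0ℤ :+ q :* (x :* (x :* x)) := x :* (q :* (x :* x))) refl q x))))
    lem₁ : ∀ x a b → x · (a · b) ≡ a · (b · x)
    lem₁ = solve 3 (λ x a b → x :* (a :* b) := a :* (b :* x)) refl
    lem₂ : ∀ q x → q · (x · x) ≡ x · (q · x)
    lem₂ = solve 2 (λ q x → q :* (x :* x) := x :* (q :* x)) refl
    lem₃ : ∀ r c x w → r ≡ (r ⊕ c · x · w) ⊕ ⊝ (c · x · w)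
    lem₃ = solve 4 (λ r c x w → r := (r :+ c :* x :* w) :+ :- (c :* x :* w)) refl
    lem₄ : ∀ t x c w → t · x · x ⊕ ⊝ (c · x · w) ≡ (t · x ⊕ ⊝ (c · w)) · x
    lem₄ = solve 4 (λ t x c w → t :* x :* x :+ :- (c :* x :* w) := (t :* x :+ :- (c :* w)) :* x) refl

factorial≢0 : ∀ k → + (k !) ≢ 0ℤ
factorial≢0 k eq = ℕ.≢-nonZero⁻¹ (k !) {{k ℕ.!≢0}} (ℤ.+-injective eq)

divisible : ∀ p {a s} → a ≡ s · + p → s ≡ ⊝ 1ℤ ⟨mod + p ⟩ → + (p ^ 2) ℤ.∣ a ℤ.- (ℤ.- + p)
divisible p {a} {s} a≡ (by u s≡) = mod⇒∣ {p ^ 2} {a ℤ.- (ℤ.- + p)} (by u (trans (+≡⊕ a (ℤ.- (ℤ.- + p))) (trans (cong (a ⊕_) (trans (-≡⊝ _) (cong ⊝_ (-≡⊝ (+ p)))))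
  (trans (cong (_⊕ ⊝ (⊝ (+ p))) (trans a≡ (cong (_· + p) s≡)))
    (trans (solve 2 (λ u x → (:- con 1ℤ :+ u :* x) :* x :+ :- (:- x) := con 0ℤ :+ u :* (x :* (x :* con 1ℤ))) refl u (+ p)) (cong (λ z → 0ℤ ⊕ u · z) (sym (pos-^ p 2))))))))

-- The residue of S from factorials modulo p, and the three indices

module Main (p m : ℕ) .{{_ : NonZero p}} (prime : Prime p) (p≡ : p ≡ suc (m * 2)) (m>0 : 0 < m) where
  open FixedCount p m prime p≡ m>0 using (n; k; Os; de; vtx; Os-unique; length-Os; de-adjacent; fixedCount≡; A-mod; A; D′)
  open Factorizations p m p≡ m>0 using (k!·S≡)
  open UnitStarters p m prime p≡ using (starters-sq)
  open Paintable p m p≡ m>0 using (paintable)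

  private
    -- The factors of (2p-1)! above p and those below p. The former are 1, ..., p-1 shifted by p, so
    -- Wilson's theorem gives -1 for both.
    R F : ℤ
    R = ∏ (allFin (m * 2)) (λ d → + suc (p + toℕ d))
    F = + ((m * 2) !)

    k!≡ : + (k !) ≡ R · (+ p · F)
    k!≡ = trans (sym (∏-rising (m * 2) p)) (cong (R ·_) (trans (cong (λ j → + (j !)) p≡) (trans (pos-· (suc (m * 2)) ((m * 2) !)) (cong (λ j → + j · F) (sym p≡)))))

    F≡ : F ≡ ⊝ 1ℤ ⟨mod + p ⟩
    F≡ = wilson {m = m} prime p≡

    R≡ : R ≡ ⊝ 1ℤ ⟨mod + p ⟩
    R≡ = mod-trans (mod-∏ (allFin (m * 2)) (λ {d} _ → by 1ℤ (trans (cong +_ (trans (cong suc (ℕ.+-comm p (toℕ d))) refl)) (trans (pos-⊕ (suc (toℕ d)) p) (cong (+ suc (toℕ d) ⊕_) (sym (·-identityˡ (+ p))))))))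
      (mod-trans (≡⇒mod (∏-factorial (m * 2))) F≡)

  S-residue : ∃ λ s → (S n ≡ s · + p) × (s ≡ ⊝ 1ℤ ⟨mod + p ⟩)
  S-residue = residue-of-count prime {R} {F} R≡ F≡ starters-sq
    (mod-trans (≡⇒mod (cong₂ (λ a b → a ⊕ (+ p ⊕ ⊝ 1ℤ) · ((+ p ⊕ ⊝ 1ℤ) · (+ p ⊕ ⊝ 1ℤ)) · b) (trans (cong (_· S n) (sym k!≡)) k!·S≡) (sym fixedCount≡))) A-mod)

  S≢0 : S n ≢ 0ℤ
  S≢0 z = let s , S≡ , s≡ = S-residue in
    Sum.[ (λ s≡0 → ⊝1≢0 prime (mod-trans (mod-sym s≡) (≡⇒mod s≡0))) , (λ p≡0 → contradiction (ℤ.+-injective p≡0) (ℕ.≢-nonZero⁻¹ p)) ]′ (·-≡0 (trans (sym S≡) z))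

  S-divisible : + (p ^ 2) ℤ.∣ S n ℤ.- (ℤ.- + p)
  S-divisible = let s , S≡ , s≡ = S-residue in divisible p S≡ s≡

  K-paintable : EdgePaintable (K n) k
  K-paintable = paintable (λ A≡0 → Sum.[ factorial≢0 k , S≢0 ]′ (·-≡0 (trans k!·S≡ A≡0)))

  -- The k edges at one vertex need different colours.
  k≤colours : ∀ j → EdgeColourable (K n) j → k ≤ j
  k≤colours j (c , proper) = subst₂ _≤_ (trans (List.length-map _ Os) length-Os) (List.length-tabulate {n = j} id)
    (unique-⊆⇒length≤ (AllPairs.map⁺ {f = λ o → c (de v o)} (AllPairs.map (λ ne → proper _ _ (de-adjacent v ne)) Os-unique)) (λ _ → ∈.∈-allFin _))
    where
    v = zero , 0′ p

  indices : ChromaticIndex (K n) k × ListChromaticIndex (K n) k × PaintabilityIndex (K n) k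
  indices = (colourable , k≤colours) , (choosable , λ j → k≤colours j ∘ choosable⇒colourable (K n) j)
          , (K-paintable , λ j → k≤colours j ∘ choosable⇒colourable (K n) j ∘ paintable⇒choosable (K n) j)
    where
    choosable = paintable⇒choosable (K n) k K-paintable
    colourable = choosable⇒colourable (K n) k choosable

odd-prime : ∀ {p} → Prime p → 2 ∤ p → ∃ λ m → p ≡ suc (m * 2) × 0 < m
odd-prime {p} pr odd = p / 2 , p≡ , ℕ.n≢0⇒n>0 (λ z → ℕ.<⇒≢ (ℕ.nonTrivial⇒n>1 p {{Prime.prime⇒nonTrivial pr}}) (sym (trans p≡ (cong (λ h → suc (h * 2)) z))))
  where
  one : ∀ r → r ≢ 0 → r < 2 → r ≡ 1
  one zero          nz _               = contradiction refl nz
  one (suc zero)    _  _               = refl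
  one (suc (suc _)) _  (s≤s (s≤s ()))
  p≡ : p ≡ suc (p / 2 * 2)
  p≡ = trans (ℕ%.m≡m%n+[m/n]*n p 2) (cong (_+ p / 2 * 2) (one (p % 2) (odd ∘ ℕ∣.m%n≡0⇒n∣m p 2) (ℕ%.m%n<n p 2)))

theorem1p2 : (p : ℕ) → Prime p → 2 ∤ p →
    + (p ^ 2) ℤ.∣ S (2 * p) ℤ.- (ℤ.- + p)
    × ChromaticIndex (K (2 * p)) (2 * p ∸ 1)
    × ListChromaticIndex (K (2 * p)) (2 * p ∸ 1)
    × PaintabilityIndex (K (2 * p)) (2 * p ∸ 1)
theorem1p2 p pr odd = conclude (odd-prime pr odd)
  where
  instance
    p≢0 : NonZero p
    p≢0 = Prime.prime⇒nonZero pr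
  Indices : ℕ → Set
  Indices k = ChromaticIndex (K (2 * p)) k × ListChromaticIndex (K (2 * p)) k × PaintabilityIndex (K (2 * p)) k
  conclude : (∃ λ m → p ≡ suc (m * 2) × 0 < m) → + (p ^ 2) ℤ.∣ S (2 * p) ℤ.- (ℤ.- + p) × Indices (2 * p ∸ 1)
  conclude (m , p≡ , m>0) = Main.S-divisible p m pr p≡ m>0 , subst Indices k≡ (Main.indices p m pr p≡ m>0)
    where
    k≡ : m * 2 + p ≡ 2 * p ∸ 1
    k≡ = cong (_∸ 1) (trans (cong (_+ p) (sym p≡)) (cong (λ z → p + z) (sym (ℕ.+-identityʳ p))))
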